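{- Let $E$ be the elliptic curve $y^2=x^3+1$ over $\mathbb{Q}$, and for a prime $p>3$ and $k\in\mathbb{N}$ let $N_p(k)$ be the number of $\mathbb{F}_{p^k}$-rational points of the reduction of $E$ modulo $p$ (including the point at infinity). Then for every prime $p\equiv 1\pmod 6$, $$r_{1,3}(p)=\tfrac13 N_p(1).$$ Moreover, the three-term relation $$3r_{1,3}(p^k)=\begin{cases}N_p(k)+3p\, r_{1,3}(p^{k-2}), & k\ge 3,\\ N_p(k), & k=1,2,\end{cases}$$ holds for every $k\ge1$ when $p\equiv1\pmod6$, and for every even $k\ge 2$ when $p>3$ is any prime. Consequently, for every integer $k\ge 0$, $$r_{1,3}(p^{2k+1})=\tfrac13\big[N_p(2k+1)+pN_p(2k-1)+\cdots+p^kN_p(1)\big]\quad\text{for primes } p\equiv 1\pmod 6,$$ and $$r_{1,3}(p^{2k+2})=\tfrac13\big[N_p(2k+2)+pN_p(2k)+\cdots+p^kN_p(2)\big]\quad\text{for primes } p>3.$$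
   Context: For a nonnegative integer $n$, $r_{1,3}(n)$ denotes the number of vectors $\vec{x}\in\mathbb{Z}^4$ with $x_1^2+x_2^2+x_3^2+x_4^2=n$ and $x_i\equiv 1\pmod 3$ for all $i$. -}

module Defs where

open import Level using (0ℓ)
open import Algebra.Bundles using (CommutativeRing)
open import Data.Nat as ℕ using (ℕ; suc)
open import Data.Integer as ℤ using (ℤ; +_)
open import Data.Integer.DivMod using (_%ℕ_)
open import Data.List using (List; []; _∷_; length; filter; map; upTo; concatMap; cartesianProduct)
open import Data.Nat.ListAction using (sum)
open import Data.List.Relation.Unary.Any using (Any)
open import Data.List.Relation.Unary.AllPairs using (AllPairs)
open import Data.Product using (_×_; _,_; ∃)
open import Relation.Nullary using (¬_; Dec)
open import Relation.Nullary.Decidable using (_×-dec_)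
open import Relation.Binary using (Decidable)
open import Relation.Binary.PropositionalEquality using (_≡_)

record FiniteField : Set₁ where
  field
    commRing : CommutativeRing 0ℓ 0ℓ
  open CommutativeRing commRing public
  field
    _≟_      : Decidable _≈_
    1≉0      : ¬ (1# ≈ 0#)
    inverse  : ∀ x → ¬ (x ≈ 0#) → ∃ λ y → (x * y) ≈ 1#
    elements : List Carrier
    complete : ∀ x → Any (x ≈_) elements
    distinct : AllPairs (λ a b → ¬ (a ≈ b)) elements

card : FiniteField → ℕ
card F = length (FiniteField.elements F)

-- Number of F-rational points of the projective curve  y² = x³ + 1
-- (affine solutions (x , y) ∈ F × F, plus the single point at infinity).
#E : FiniteField → ℕ
#E F = suc (length (filter onCurve? (cartesianProduct elements elements)))
  where
    open FiniteField F
    onCurve? : (p : Carrier × Carrier) → Dec _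
    onCurve? (x , y) = (y * y) ≟ ((x * x * x) + 1#)

-- r_{1,3}(n): number of (x₁,x₂,x₃,x₄) ∈ ℤ⁴ with Σ xᵢ² = n and
-- xᵢ ≡ 1 (mod 3) for all i.  Every solution satisfies |xᵢ| ≤ n, so it
-- suffices to count over the box [-n, n]⁴.

box : ℕ → List ℤ
box n = map (λ i → (+ i) ℤ.- (+ n)) (upTo (suc (2 ℕ.* n)))

quads : ℕ → List (ℤ × ℤ × ℤ × ℤ)
quads n = concatMap (λ a → concatMap (λ b → concatMap (λ c → map (λ d → (a , b , c , d)) (box n)) (box n)) (box n)) (box n)

≡1mod3? : (x : ℤ) → Dec (x %ℕ 3 ≡ 1)
≡1mod3? x = (x %ℕ 3) ℕ.≟ 1

r13 : ℕ → ℕ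
r13 n = length (filter ok? (quads n))
  where
    ok? : (v : ℤ × ℤ × ℤ × ℤ) → Dec _
    ok? (a , b , c , d) =
      (((a ℤ.* a) ℤ.+ (b ℤ.* b) ℤ.+ (c ℤ.* c) ℤ.+ (d ℤ.* d)) ℤ.≟ (+ n))
        ×-dec (≡1mod3? a ×-dec (≡1mod3? b ×-dec (≡1mod3? c ×-dec ≡1mod3? d)))

sumTo : ℕ → (ℕ → ℕ) → ℕ
sumTo k f = sum (map f (upTo (suc k)))

{-# OPTIONS --safe #-}
module Submission where

-- Let θ = Σ q^(x²) and θ_χ = Σ χ(x) q^(x²), both over x ≡ 1 (mod 4), with χ the quadratic character modulo 3.
-- A Hadamard transform followed by a sum over signs shows that 3 r₁₃(n) is the coefficient of q^(4n) in θ⁴ - θ_χ⁴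
-- when n ≡ 1 (mod 6).  Since q d/dq is a derivation, powers of θ are determined by a linear recursion on their
-- coefficients.  The windmill involution on x² + 4yz = N verifies it for σ, so θ⁴ has coefficients σ(n); rotation by
-- the units of ℤ[ω] verifies it for Jacobi's θ_χ³ = Σ v q^(3v²), so θ_χ⁴ is a theta series over u² + 3v² = 4n.
-- At n = pᵏ the latter is read off from a single solution of T² + 3W² = pᵏ.
--
-- Over a field with q ≡ 1 (mod 6) elements, the first two moments of the character sums of y² = gⁱx³ + 1 over the
-- three cubic twists show that the curve has q + 1 - 2T points, where T² + 3W² = q and T ≡ 1 (mod 3).
-- If p ≡ 1 (mod 6), then -2T ≡ -C((q-1)/2, (q-1)/3) is prime to p, which makes (T, W) the primitive solution;
-- if p ≡ 5 (mod 6), then T = ± √q because -3 is not a square modulo p.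

-- The fields `F k` are known only by their cardinalities, without embeddings between them, so the
-- point counts cannot be tied together as powers of one Frobenius eigenvalue. Each count is
-- computed on its own as p^k + 1 - 2T, and the uniqueness of the suitable solution of T² + 3W² =
-- p^k identifies this T with the one seen by the theta series. Everything meets in 6 r₁₃(n) = 2σ(n)
-- - α(n) at n = p^k, where α is twice the coefficient of θ_χ⁴. The divisor sums satisfy σ(p^(k+2))
-- = pσ(p^k) + 1 + p^(k+2), and α(p^(k+2)) = pα(p^k) + 4T; subtraction leaves 2(1 + p^(k+2) - 2T) +
-- 6p r₁₃(p^k), twice the three-term relation. For p ≡ 1 (mod 6), pα(p^k) collects the solutions
-- divisible by p, and 4T the sign variants of the primitive one. Coefficients are finite sums over
-- a box `Z B`, with B chosen only at the end. The windmill needs N ≡ 5 (mod 8), so that N is no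
-- square; hence the identity for θ⁴ is propagated only along exponents ≡ 4 (mod 8).

-- Finite sums and their reindexing.

module Sums where

  open import Algebra.Bundles using (CommutativeMonoid; CommutativeRing)
  open import Data.List using (List; []; _∷_; _++_; map; filter; cartesianProduct)
  open import Data.List.Membership.Propositional using (_∈_)
  open import Data.List.Membership.Propositional.Properties using (∈-map⁺; ∈-map⁻; ∈-filter⁺; ∈-filter⁻)
  open import Data.List.Membership.Propositional.Properties.WithK using (unique∧set⇒bag)
  open import Data.List.Relation.Binary.BagAndSetEquality using (∼bag⇒↭)
  open import Data.List.Relation.Binary.Permutation.Propositional as Perm using (_↭_)
  open import Data.List.Relation.Unary.All as All using (All)
  import Data.List.Relation.Unary.All.Properties as AllP
  open import Data.List.Relation.Unary.AllPairs using ([]; _∷_)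
  open import Data.List.Relation.Unary.Any using (here; there)
  open import Data.List.Relation.Unary.Unique.Propositional using (Unique)
  import Data.List.Relation.Unary.Unique.Propositional.Properties as Unique
  open import Data.Product using (_×_; _,_; ∃)
  open import Function using (_∘_; mk⇔)
  open import Level using (0ℓ)
  open import Relation.Nullary using (¬_; Dec; yes; no)
  open import Relation.Nullary.Decidable using (¬?)
  open import Relation.Binary.PropositionalEquality as ≡ using (_≡_; _≢_; refl)

  module _ {A B : Set} where

    map-unique : (f : A → B) {xs : List A} → Unique xs →
      (∀ {x y} → x ∈ xs → y ∈ xs → f x ≡ f y → x ≡ y) → Unique (map f xs)
    map-unique f [] inj = []
    map-unique f (x∉ ∷ u) inj =
      AllP.map⁺ (All.tabulate (λ y∈ eq → All.lookup x∉ y∈ (inj (here refl) (there y∈) eq)))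
      ∷ map-unique f u (λ x∈ y∈ → inj (there x∈) (there y∈))

    -- Duplicate-free lists with the same elements are equal as bags, hence permutations of each
    -- other.
    map-↭ : (f : A → B) {xs : List A} {ys : List B} → Unique xs → Unique ys →
      (∀ {x} → x ∈ xs → f x ∈ ys) →
      (∀ {x y} → x ∈ xs → y ∈ xs → f x ≡ f y → x ≡ y) →
      (∀ {y} → y ∈ ys → ∃ λ x → x ∈ xs × f x ≡ y) → map f xs ↭ ys
    map-↭ f {xs} {ys} uxs uys into inj surj =
      ∼bag⇒↭ (unique∧set⇒bag (map-unique f uxs inj) uys (mk⇔ to from))
      where
        to : ∀ {y} → y ∈ map f xs → y ∈ ys
        to y∈ with x , x∈ , refl ← ∈-map⁻ f y∈ = into x∈
        from : ∀ {y} → y ∈ ys → y ∈ map f xs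
        from y∈ with x , x∈ , refl ← surj y∈ = ∈-map⁺ f x∈

  module Sum (M : CommutativeMonoid 0ℓ 0ℓ) where
    open CommutativeMonoid M renaming (refl to ≈-refl; sym to ≈-sym; trans to ≈-trans)
    open import Relation.Binary.Reasoning.Setoid setoid

    ∑ : {A : Set} → List A → (A → Carrier) → Carrier
    ∑ []       f = ε
    ∑ (x ∷ xs) f = f x ∙ ∑ xs f

    private variable A B : Set

    medial : ∀ a b c d → (a ∙ b) ∙ (c ∙ d) ≈ (a ∙ c) ∙ (b ∙ d)
    medial a b c d = begin
      (a ∙ b) ∙ (c ∙ d) ≈⟨ assoc a b (c ∙ d) ⟩
      a ∙ (b ∙ (c ∙ d)) ≈⟨ ∙-congˡ (assoc b c d) ⟨
      a ∙ ((b ∙ c) ∙ d) ≈⟨ ∙-congˡ (∙-congʳ (comm b c)) ⟩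
      a ∙ ((c ∙ b) ∙ d) ≈⟨ ∙-congˡ (assoc c b d) ⟩
      a ∙ (c ∙ (b ∙ d)) ≈⟨ assoc a c (b ∙ d) ⟨
      (a ∙ c) ∙ (b ∙ d) ∎

    ∑-cong∈ : (xs : List A) {f g : A → Carrier} →
      (∀ {x} → x ∈ xs → f x ≈ g x) → ∑ xs f ≈ ∑ xs g
    ∑-cong∈ []       eq = ≈-refl
    ∑-cong∈ (x ∷ xs) eq = ∙-cong (eq (here refl)) (∑-cong∈ xs (eq ∘ there))

    ∑-cong : (xs : List A) {f g : A → Carrier} → (∀ x → f x ≈ g x) → ∑ xs f ≈ ∑ xs g
    ∑-cong xs eq = ∑-cong∈ xs (λ {x} _ → eq x)

    ∑-ε : (xs : List A) {f : A → Carrier} → (∀ x → f x ≈ ε) → ∑ xs f ≈ ε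
    ∑-ε []       eq = ≈-refl
    ∑-ε (x ∷ xs) eq = ≈-trans (∙-cong (eq x) (∑-ε xs eq)) (identityˡ ε)

    ∑-∙ : (xs : List A) (f g : A → Carrier) → ∑ xs (λ x → f x ∙ g x) ≈ ∑ xs f ∙ ∑ xs g
    ∑-∙ []       f g = ≈-sym (identityˡ ε)
    ∑-∙ (x ∷ xs) f g = ≈-trans (∙-congˡ (∑-∙ xs f g)) (medial (f x) (g x) (∑ xs f) (∑ xs g))

    ∑-map : (h : A → B) (xs : List A) (f : B → Carrier) → ∑ (map h xs) f ≡ ∑ xs (f ∘ h)
    ∑-map h []       f = refl
    ∑-map h (x ∷ xs) f = ≡.cong (f (h x) ∙_) (∑-map h xs f)

    ∑-++ : (xs ys : List A) (f : A → Carrier) → ∑ (xs ++ ys) f ≈ ∑ xs f ∙ ∑ ys f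
    ∑-++ []       ys f = ≈-sym (identityˡ _)
    ∑-++ (x ∷ xs) ys f = ≈-trans (∙-congˡ (∑-++ xs ys f)) (≈-sym (assoc (f x) (∑ xs f) (∑ ys f)))

    ∑-swap : (xs : List A) (ys : List B) (f : A → B → Carrier) →
      ∑ xs (λ x → ∑ ys (f x)) ≈ ∑ ys (λ y → ∑ xs (λ x → f x y))
    ∑-swap []       ys f = ≈-sym (∑-ε ys (λ _ → ≈-refl))
    ∑-swap (x ∷ xs) ys f = ≈-trans (∙-congˡ (∑-swap xs ys f)) (≈-sym (∑-∙ ys (f x) _))

    ∑-× : (xs : List A) (ys : List B) (f : A × B → Carrier) →
      ∑ (cartesianProduct xs ys) f ≈ ∑ xs (λ x → ∑ ys (λ y → f (x , y)))
    ∑-× []       ys f = ≈-refl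
    ∑-× (x ∷ xs) ys f = begin
      ∑ (map (x ,_) ys ++ cartesianProduct xs ys) f             ≈⟨ ∑-++ (map (x ,_) ys) _ f ⟩
      ∑ (map (x ,_) ys) f ∙ ∑ (cartesianProduct xs ys) f        ≈⟨ ∙-cong (reflexive (∑-map (x ,_) ys f)) (∑-× xs ys f) ⟩
      ∑ ys (λ y → f (x , y)) ∙ ∑ xs (λ x → ∑ ys (λ y → f (x , y))) ∎

    ∑-↭ : {xs ys : List A} (f : A → Carrier) → xs ↭ ys → ∑ xs f ≈ ∑ ys f
    ∑-↭ f Perm.refl         = ≈-refl
    ∑-↭ f (Perm.prep x p)   = ∙-congˡ (∑-↭ f p)
    ∑-↭ f (Perm.trans p q)  = ≈-trans (∑-↭ f p) (∑-↭ f q)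
    ∑-↭ {xs = x ∷ y ∷ xs} {ys = _ ∷ _ ∷ ys} f (Perm.swap x y p) = begin
      f x ∙ (f y ∙ ∑ xs f) ≈⟨ assoc (f x) (f y) _ ⟨
      (f x ∙ f y) ∙ ∑ xs f ≈⟨ ∙-cong (comm (f x) (f y)) (∑-↭ f p) ⟩
      (f y ∙ f x) ∙ ∑ ys f ≈⟨ assoc (f y) (f x) _ ⟩
      f y ∙ (f x ∙ ∑ ys f) ∎

    ∑-single∈ : {xs : List A} (f : A → Carrier) {a : A} → Unique xs → a ∈ xs →
      (∀ {x} → x ∈ xs → x ≢ a → f x ≈ ε) → ∑ xs f ≈ f a
    ∑-single∈ {xs = _ ∷ xs} f {a} (n ∷ u) (here refl) z =
      ≈-trans (∙-congˡ (≈-trans (∑-cong∈ xs {g = λ _ → ε} (λ x∈ → z (there x∈) (λ eq → All.lookup n x∈ (≡.sym eq)))) (∑-ε xs (λ _ → ≈-refl)))) (identityʳ (f a))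
    ∑-single∈ f {a} (n ∷ u) (there a∈) z =
      ≈-trans (∙-cong (z (here refl) (All.lookup n a∈)) (∑-single∈ f u a∈ (z ∘ there))) (identityˡ (f a))

    ∑-single : {xs : List A} (f : A → Carrier) {a : A} → Unique xs → a ∈ xs →
      (∀ x → x ≢ a → f x ≈ ε) → ∑ xs f ≈ f a
    ∑-single f u a∈ z = ∑-single∈ f u a∈ (λ {x} _ → z x)

    ∑-bijection : (f : A → B) {xs : List A} {ys : List B} → Unique xs → Unique ys →
      (∀ {x} → x ∈ xs → f x ∈ ys) →
      (∀ {x y} → x ∈ xs → y ∈ xs → f x ≡ f y → x ≡ y) →
      (∀ {y} → y ∈ ys → ∃ λ x → x ∈ xs × f x ≡ y) →
      (w : B → Carrier) → ∑ xs (w ∘ f) ≈ ∑ ys w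
    ∑-bijection f {xs} uxs uys into inj surj w =
      ≈-trans (reflexive (≡.sym (∑-map f xs w))) (∑-↭ w (map-↭ f uxs uys into inj surj))

    module _ (≈ε? : ∀ a → Dec (a ≈ ε)) where

      support : (A → Carrier) → List A → List A
      support w = filter (λ x → ¬? (≈ε? (w x)))

      ∑-support : (w : A → Carrier) (xs : List A) → ∑ (support w xs) w ≈ ∑ xs w
      ∑-support w []       = ≈-refl
      ∑-support w (x ∷ xs) with ≈ε? (w x)
      ... | yes eq = ≈-trans (∑-support w xs) (≈-trans (≈-sym (identityˡ _)) (∙-congʳ (≈-sym eq)))
      ... | no  _  = ∙-congˡ (∑-support w xs)

      -- Only nonzero terms have to be matched: restricted to the support of the weight on both
      -- sides, `f` becomes a bijection. A substitution between boxes can thus be used although it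
      -- does not map one box onto the other.
      ∑-reindex : (f : A → B) {xs : List A} {ys : List B} → Unique xs → Unique ys →
        (w : B → Carrier) →
        (∀ {x} → x ∈ xs → ¬ (w (f x) ≈ ε) → f x ∈ ys) →
        (∀ {x y} → f x ≡ f y → x ≡ y) →
        (∀ {y} → y ∈ ys → ¬ (w y ≈ ε) → ∃ λ x → x ∈ xs × f x ≡ y) →
        ∑ xs (w ∘ f) ≈ ∑ ys w
      ∑-reindex f {xs} {ys} uxs uys w into inj surj = begin
        ∑ xs (w ∘ f)                   ≈⟨ ∑-support (w ∘ f) xs ⟨
        ∑ (support (w ∘ f) xs) (w ∘ f) ≈⟨ ∑-bijection f (Unique.filter⁺ _ uxs) (Unique.filter⁺ _ uys) into′ (λ _ _ → inj) surj′ w ⟩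
        ∑ (support w ys) w             ≈⟨ ∑-support w ys ⟩
        ∑ ys w                         ∎
        where
          into′ : ∀ {x} → x ∈ support (w ∘ f) xs → f x ∈ support w ys
          into′ x∈ with x∈xs , nz ← ∈-filter⁻ (λ x → ¬? (≈ε? (w (f x)))) x∈ =
            ∈-filter⁺ (λ y → ¬? (≈ε? (w y))) (into x∈xs nz) nz
          surj′ : ∀ {y} → y ∈ support w ys → ∃ λ x → x ∈ support (w ∘ f) xs × f x ≡ y
          surj′ y∈ with y∈ys , nz ← ∈-filter⁻ (λ y → ¬? (≈ε? (w y))) {xs = ys} y∈
            with x , x∈ , refl ← surj y∈ys nz = x , ∈-filter⁺ (λ x → ¬? (≈ε? (w (f x)))) x∈ nz , refl

  module RingSum (R : CommutativeRing 0ℓ 0ℓ) where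
    open CommutativeRing R
    open Sum +-commutativeMonoid public renaming (∑-ε to ∑-0; ∑-∙ to ∑-+)

    ∑-*ˡ : {A : Set} (c : Carrier) (xs : List A) (f : A → Carrier) → ∑ xs (λ x → c * f x) ≈ c * ∑ xs f
    ∑-*ˡ c []       f = sym (zeroʳ c)
    ∑-*ˡ c (x ∷ xs) f = trans (+-congˡ (∑-*ˡ c xs f)) (sym (distribˡ c (f x) (∑ xs f)))

    ∑-*ʳ : {A : Set} (c : Carrier) (xs : List A) (f : A → Carrier) → ∑ xs (λ x → f x * c) ≈ ∑ xs f * c
    ∑-*ʳ c xs f = trans (∑-cong xs (λ x → *-comm (f x) c)) (trans (∑-*ˡ c xs f) (*-comm c _))

-- Indicator functions and sums over boxes of integers.

module LatticeSums where

  open Sums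
  open import Defs using (box; quads; r13)
  open import Data.Fin as Fin using (Fin; toℕ)
  open import Data.Fin.Properties using (all?; toℕ-fromℕ<)
  open import Data.Nat as ℕ using (ℕ; zero; suc; z≤n; s≤s)
  import Data.Nat.Properties as ℕ
  open import Data.Integer using (ℤ; +_; -[1+_]; _+_; _*_; _-_; _⊖_; -_; ∣_∣; _≤_; _<_; _≟_; _<?_; _≤?_; 0ℤ; 1ℤ; +≤+; -≤+; +<+)
  open import Data.Integer.DivMod using (_%ℕ_; _/ℕ_; n%ℕd<d; a≡a%ℕn+[a/ℕn]*n)
  open import Data.Integer.Properties hiding (_≟_; _<?_; _≤?_)
  open import Data.Integer.Divisibility.Signed using (_∣_; divides; _∣?_; ∣-refl; ∣m∣n⇒∣m+n; ∣m∣n⇒∣m-n; ∣m⇒∣-m; ∣n⇒∣m*n; ∣m⇒∣m*n)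
  open import Data.Integer.Tactic.RingSolver using (solve-∀)
  open import Data.List using (List; []; _∷_; map; cartesianProduct; concatMap; length; filter)
  open import Data.List.Membership.Propositional using (_∈_)
  open import Data.List.Membership.Propositional.Properties using (∈-map⁺; ∈-map⁻; ∈-upTo⁺; ∈-upTo⁻; ∈-cartesianProduct⁺)
  open import Data.List.Relation.Unary.Unique.Propositional using (Unique)
  import Data.List.Relation.Unary.Unique.Propositional.Properties as Unique
  open import Data.Product using (_×_; _,_; proj₁; proj₂; ∃)
  open import Data.Sum using (_⊎_; inj₁; inj₂)
  open import Function using (_∘_)
  open import Relation.Nullary using (¬_; Dec; yes; no; contradiction)
  open import Relation.Nullary.Decidable using (_×-dec_; from-no; toWitness)
  open import Relation.Unary using (Decidable)
  open import Relation.Binary.Definitions using (Tri; tri<; tri≈; tri>)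
  open import Relation.Binary.PropositionalEquality using (_≡_; _≢_; refl; sym; trans; cong; cong₂; subst; subst₂; module ≡-Reasoning)

  open RingSum +-*-commutativeRing public

  -- Integer-valued, so that counts can be weighted with signs, subtracted and factored inside the
  -- ring ℤ.
  𝟙 : {P : Set} → Dec P → ℤ
  𝟙 (yes _) = 1ℤ
  𝟙 (no _)  = 0ℤ

  module _ {P Q : Set} where

    𝟙-cong : (P → Q) → (Q → P) → (p? : Dec P) (q? : Dec Q) → 𝟙 p? ≡ 𝟙 q?
    𝟙-cong f g (yes p) (yes q) = refl
    𝟙-cong f g (yes p) (no ¬q) = contradiction (f p) ¬q
    𝟙-cong f g (no ¬p) (yes q) = contradiction (g q) ¬p
    𝟙-cong f g (no ¬p) (no ¬q) = refl

    𝟙-× : (p? : Dec P) (q? : Dec Q) → 𝟙 (p? ×-dec q?) ≡ 𝟙 p? * 𝟙 q?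
    𝟙-× (yes p) (yes q) = refl
    𝟙-× (yes p) (no ¬q) = refl
    𝟙-× (no ¬p) q?      = refl

  module _ {P : Set} where

    𝟙-yes : (p? : Dec P) → P → 𝟙 p? ≡ 1ℤ
    𝟙-yes (yes _) p = refl
    𝟙-yes (no ¬p) p = contradiction p ¬p

    𝟙-no : (p? : Dec P) → ¬ P → 𝟙 p? ≡ 0ℤ
    𝟙-no (yes p) ¬p = contradiction p ¬p
    𝟙-no (no _)  ¬p = refl

    𝟙≢0 : (p? : Dec P) → 𝟙 p? ≢ 0ℤ → P
    𝟙≢0 (yes p) _  = p
    𝟙≢0 (no _)  nz = contradiction refl nz

    𝟙-guard : (p? : Dec P) {a b : ℤ} → (P → a ≡ b) → 𝟙 p? * a ≡ 𝟙 p? * b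
    𝟙-guard (yes p) eq = cong (1ℤ *_) (eq p)
    𝟙-guard (no _)  eq = refl

  *≢0ˡ : ∀ a b → a * b ≢ 0ℤ → a ≢ 0ℤ
  *≢0ˡ a b nz refl = nz refl

  *≢0ʳ : ∀ a b → a * b ≢ 0ℤ → b ≢ 0ℤ
  *≢0ʳ a b nz refl = nz (*-zeroʳ a)

  ∑-neg : {A : Set} (xs : List A) (f : A → ℤ) → ∑ xs (λ x → - f x) ≡ - ∑ xs f
  ∑-neg []       f = refl
  ∑-neg (x ∷ xs) f = trans (cong (λ z → - f x + z) (∑-neg xs f)) (sym (neg-distrib-+ (f x) (∑ xs f)))

  ∑-- : {A : Set} (xs : List A) (f g : A → ℤ) → ∑ xs (λ x → f x - g x) ≡ ∑ xs f - ∑ xs g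
  ∑-- xs f g = trans (∑-+ xs f (λ x → - g x)) (cong (λ z → ∑ xs f + z) (∑-neg xs g))

  ∑-concatMap : {A C : Set} (g : A → List C) (xs : List A) (f : C → ℤ) → ∑ (concatMap g xs) f ≡ ∑ xs (λ x → ∑ (g x) f)
  ∑-concatMap g []       f = refl
  ∑-concatMap g (x ∷ xs) f = trans (∑-++ (g x) (concatMap g xs) f) (cong (λ z → ∑ (g x) f + z) (∑-concatMap g xs f))

  length-filter : {A : Set} {P : A → Set} (P? : Decidable P) (xs : List A) → + length (filter P? xs) ≡ ∑ xs (λ x → 𝟙 (P? x))
  length-filter P? [] = refl
  length-filter P? (x ∷ xs) with P? x
  ... | yes _ = trans (pos-+ 1 _) (cong (λ z → 1ℤ + z) (length-filter P? xs))
  ... | no  _ = trans (length-filter P? xs) (sym (+-identityˡ _))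

  x≡-x⇒x≡0 : ∀ x → x ≡ - x → x ≡ 0ℤ
  x≡-x⇒x≡0 (+ zero) eq = refl

  minus-cancelʳ : ∀ {a b} c → a - c ≡ b - c → a ≡ b
  minus-cancelʳ {a} {b} c eq = trans (lem a c) (trans (cong (_+ c) eq) (sym (lem b c)))
    where
    lem : ∀ a c → a ≡ a - c + c
    lem = solve-∀

  abstract

    -- Sealed, so that sums over a box stay symbolic; from here on membership is nothing but a bound
    -- on the absolute value.
    Z : ℕ → List ℤ
    Z = box

    Z≡box : ∀ n → Z n ≡ box n
    Z≡box n = refl

    Z⁺ : ∀ {n x} → ∣ x ∣ ℕ.≤ n → x ∈ Z n
    Z⁺ {n} {x} ∣x∣≤n = subst (_∈ Z n) eq (∈-map⁺ _ (∈-upTo⁺ (s≤s bound)))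
      where
      y : ℤ
      y = x + + n
      y≥0 : 0ℤ ≤ y
      y≥0 = lem x ∣x∣≤n
        where
        lem : ∀ x → ∣ x ∣ ℕ.≤ n → 0ℤ ≤ x + + n
        lem (+ m) _ = +≤+ z≤n
        lem -[1+ m ] m<n = subst (0ℤ ≤_) (sym (⊖-≥ m<n)) (+≤+ z≤n)
      i : ℕ
      i = ∣ y ∣
      eq : + i - + n ≡ x
      eq = trans (cong (_- + n) (0≤i⇒+∣i∣≡i y≥0)) (lem x (+ n))
        where
        lem : ∀ x n → x + n - n ≡ x
        lem = solve-∀
      bound : i ℕ.≤ 2 ℕ.* n
      bound = ℕ.≤-trans (∣i+j∣≤∣i∣+∣j∣ x (+ n))
        (subst (∣ x ∣ ℕ.+ n ℕ.≤_) (cong (n ℕ.+_) (sym (ℕ.+-identityʳ n))) (ℕ.+-monoˡ-≤ n ∣x∣≤n))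

    Z⁻ : ∀ {n x} → x ∈ Z n → ∣ x ∣ ℕ.≤ n
    Z⁻ {n} x∈ with i , i∈ , refl ← ∈-map⁻ _ x∈ = subst (ℕ._≤ n) (cong ∣_∣ (sym (m-n≡m⊖n i n))) (≤-lem i (ℕ.≤-pred (∈-upTo⁻ i∈)))
      where
      ≤-lem : ∀ i → i ℕ.≤ 2 ℕ.* n → ∣ i ⊖ n ∣ ℕ.≤ n
      ≤-lem i i≤ with ℕ.≤-total n i
      ... | inj₁ n≤i = subst (ℕ._≤ n) (cong ∣_∣ (sym (⊖-≥ n≤i))) (subst (i ℕ.∸ n ℕ.≤_) (trans (cong (ℕ._∸ n) (cong (n ℕ.+_) (ℕ.+-identityʳ n))) (ℕ.m+n∸n≡m n n)) (ℕ.∸-monoˡ-≤ n i≤))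
      ... | inj₂ i≤n = subst (ℕ._≤ n) (sym (∣⊖∣-≤ i≤n)) (ℕ.m∸n≤m n i)

    Z-unique : ∀ n → Unique (Z n)
    Z-unique n = Unique.map⁺ (λ eq → +-injective (minus-cancelʳ (+ n) eq)) (Unique.upTo⁺ _)

  ∑-Z-neg : ∀ n (f : ℤ → ℤ) → ∑ (Z n) (f ∘ -_) ≡ ∑ (Z n) f
  ∑-Z-neg n f = ∑-bijection -_ (Z-unique n) (Z-unique n) neg∈ (λ _ _ → neg-injective)
    (λ {y} y∈ → - y , neg∈ y∈ , neg-involutive y) f
    where
    neg∈ : ∀ {x} → x ∈ Z n → - x ∈ Z n
    neg∈ {x} x∈ = Z⁺ (subst (ℕ._≤ n) (sym (∣-i∣≡∣i∣ x)) (Z⁻ x∈))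

  -- The involution permutes the support of `w` and turns the sum into its negative, and an integer
  -- equal to its negative is zero. That `xs` contains the whole support takes the place of
  -- invariance of `xs` under `r`.
  ∑-anti : {A : Set} {xs : List A} → Unique xs → (r : A → A) → (∀ x → r (r x) ≡ x) → (w : A → ℤ) →
    (∀ {x} → w x ≢ 0ℤ → x ∈ xs) → (∀ x → w (r x) ≡ - w x) → ∑ xs w ≡ 0ℤ
  ∑-anti {xs = xs} u r rr w supp anti = x≡-x⇒x≡0 _ (begin
    ∑ xs w              ≡⟨ ∑-reindex (_≟ 0ℤ) r u u w (λ _ → supp)
                            (λ {x} {y} eq → trans (sym (rr x)) (trans (cong r eq) (rr y)))
                            (λ {y} y∈ nz → r y , supp (λ z → nz (lem y z)) , rr y) ⟨
    ∑ xs (w ∘ r)        ≡⟨ ∑-cong xs anti ⟩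
    ∑ xs (λ x → - w x)  ≡⟨ ∑-neg xs w ⟩
    - ∑ xs w            ∎)
    where
    open ≡-Reasoning
    lem : ∀ y → w (r y) ≡ 0ℤ → w y ≡ 0ℤ
    lem y z = neg-injective (trans (sym (anti y)) z)

  -- Powers of a theta series and the recursion that determines their coefficients.

  module Theta (B : ℕ) (w : ℤ → ℤ) where

    R : ℕ → ℤ → ℤ
    R zero    N = 𝟙 (N ≟ 0ℤ)
    R (suc k) N = ∑ (Z B) (λ x → w x * R k (N - x * x))

    private
      -- Coefficients of θ^k · q dθ/dq, where θ = Σ w(x) q^(x²).
      D : ℕ → ℤ → ℤ
      D k N = ∑ (Z B) (λ x → w x * (x * x * R k (N - x * x)))

    -- R k is the coefficient sequence of the k-th power of Σ w(x) q^(x²); this is Leibniz' rule for q d/dq.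
    derivation : ∀ k N → N * R (suc k) N ≡ + suc k * D k N
    derivation k N = begin
      N * ∑ (Z B) (λ x → w x * R k (N - x * x))      ≡⟨ ∑-*ˡ N (Z B) _ ⟨
      ∑ (Z B) (λ x → N * (w x * R k (N - x * x)))    ≡⟨ ∑-cong (Z B) (λ x → split N (w x) (x * x) (R k (N - x * x))) ⟩
      ∑ (Z B) (λ x → w x * (x * x * R k (N - x * x)) + w x * ((N - x * x) * R k (N - x * x)))
                                                        ≡⟨ ∑-+ (Z B) _ _ ⟩
      D k N + ∑ (Z B) (λ x → w x * ((N - x * x) * R k (N - x * x)))
                                                        ≡⟨ cong (λ z → D k N + z) (rest k) ⟩
      D k N + + k * D k N                               ≡⟨ count k (D k N) ⟩
      + suc k * D k N                                   ∎
      where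
      open ≡-Reasoning
      split : ∀ N w s r → N * (w * r) ≡ w * (s * r) + w * ((N - s) * r)
      split = solve-∀
      count : ∀ k d → d + + k * d ≡ + suc k * d
      count k d = sym (suc-* (+ k) d)
      vanish : ∀ M → M * 𝟙 (M ≟ 0ℤ) ≡ 0ℤ
      vanish M with M ≟ 0ℤ
      ... | yes refl = refl
      ... | no  _    = *-zeroʳ M
      -- The derivative falls on one of the k remaining factors. By induction this is k times a sum
      -- in which the weight `y * y` sits on an inner variable; exchanging x and y moves it to the
      -- outer one.
      rest : ∀ k → ∑ (Z B) (λ x → w x * ((N - x * x) * R k (N - x * x))) ≡ + k * D k N
      rest zero    = ∑-0 (Z B) (λ x → trans (cong (w x *_) (vanish (N - x * x))) (*-zeroʳ (w x)))
      rest (suc j) = begin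
        ∑ (Z B) (λ x → w x * ((N - x * x) * R (suc j) (N - x * x)))
          ≡⟨ ∑-cong (Z B) (λ x → trans (cong (w x *_) (derivation j (N - x * x))) (pull (w x) (+ suc j) _)) ⟩
        ∑ (Z B) (λ x → + suc j * (w x * D j (N - x * x)))
          ≡⟨ ∑-*ˡ (+ suc j) (Z B) _ ⟩
        + suc j * ∑ (Z B) (λ x → w x * D j (N - x * x))
          ≡⟨ cong (+ suc j *_) (begin
            ∑ (Z B) (λ x → w x * D j (N - x * x))
              ≡⟨ ∑-cong (Z B) (λ x → sym (∑-*ˡ (w x) (Z B) _)) ⟩
            ∑ (Z B) (λ x → ∑ (Z B) (λ y → w x * (w y * (y * y * R j (N - x * x - y * y)))))
              ≡⟨ ∑-swap (Z B) (Z B) _ ⟩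
            ∑ (Z B) (λ y → ∑ (Z B) (λ x → w x * (w y * (y * y * R j (N - x * x - y * y)))))
              ≡⟨ ∑-cong (Z B) (λ y → trans (∑-cong (Z B) (λ x → trans
                   (exch (w x) (w y) (y * y) _)
                   (cong (λ z → w y * (y * y) * (w x * R j z)) (comm₂ N (x * x) (y * y)))))
                   (trans (∑-*ˡ (w y * (y * y)) (Z B) _) (*-assoc (w y) (y * y) _))) ⟩
            D (suc j) N ∎) ⟩
        + suc j * D (suc j) N ∎
        where
        pull : ∀ a b c → a * (b * c) ≡ b * (a * c)
        pull = solve-∀
        exch : ∀ a b s r → a * (b * (s * r)) ≡ b * s * (a * r)
        exch = solve-∀
        comm₂ : ∀ N a b → N - a - b ≡ N - b - a
        comm₂ = solve-∀

    -- Both sides of `derivation` are sums against the coefficients of θ^k, so their difference is a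
    -- linear relation among those alone; θ^(k+1) has been eliminated.
    R-recursion : ∀ k N → ∑ (Z B) (λ x → w x * ((N - + suc k * (x * x)) * R k (N - x * x))) ≡ 0ℤ
    R-recursion k N = begin
      ∑ (Z B) (λ x → w x * ((N - + suc k * (x * x)) * R k (N - x * x)))
        ≡⟨ ∑-cong (Z B) (λ x → split N (+ suc k) (w x) (x * x) (R k (N - x * x))) ⟩
      ∑ (Z B) (λ x → N * (w x * R k (N - x * x)) - + suc k * (w x * (x * x * R k (N - x * x))))
        ≡⟨ ∑-- (Z B) _ _ ⟩
      ∑ (Z B) (λ x → N * (w x * R k (N - x * x))) - ∑ (Z B) (λ x → + suc k * (w x * (x * x * R k (N - x * x))))
        ≡⟨ cong₂ _-_ (∑-*ˡ N (Z B) _) (∑-*ˡ (+ suc k) (Z B) _) ⟩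
      N * R (suc k) N - + suc k * D k N
        ≡⟨ i≡j⇒i-j≡0 (derivation k N) ⟩
      0ℤ ∎
      where
      open ≡-Reasoning
      split : ∀ N k w s r → w * ((N - k * s) * r) ≡ N * (w * r) - k * (w * (s * r))
      split = solve-∀

  1<x*x : ∀ x → x ≢ 0ℤ → x ≢ 1ℤ → x ≢ - 1ℤ → 1ℤ < x * x
  1<x*x (+ 0)             a b c = contradiction refl a
  1<x*x (+ 1)             a b c = contradiction refl b
  1<x*x (+ suc (suc n))   a b c = +<+ (s≤s (s≤s z≤n))
  1<x*x (-[1+ 0 ])        a b c = contradiction refl c
  1<x*x (-[1+ suc n ])    a b c = +<+ (s≤s (s≤s z≤n))

  4∤-1 : ¬ (+ 4 ∣ 0ℤ - 1ℤ)
  4∤-1 = from-no (+ 4 ∣? (0ℤ - 1ℤ))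

  4∤-2 : ¬ (+ 4 ∣ - 1ℤ - 1ℤ)
  4∤-2 = from-no (+ 4 ∣? (- 1ℤ - 1ℤ))

  1mod4⇒1<x*x : ∀ x → + 4 ∣ x - 1ℤ → x ≢ 1ℤ → 1ℤ < x * x
  1mod4⇒1<x*x x d x≢1 = 1<x*x x (λ { refl → 4∤-1 d }) x≢1 (λ { refl → 4∤-2 d })

  module Uniqueness (B : ℕ) (1≤B : 1 ℕ.≤ B) (w : ℤ → ℤ) (w1 : w 1ℤ ≡ 1ℤ) (w-supp : ∀ x → w x ≢ 0ℤ → + 4 ∣ x - 1ℤ) where
    open Theta B w

    -- Among x ≡ 1 (mod 4) only x = 1 has x² ≤ 1. The k-th power therefore starts at q^k, and by
    -- `R-diagonal` with coefficient 1.
    R-small : ∀ k M → M < + k → R k M ≡ 0ℤ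
    R-small zero    M M<0 with M ≟ 0ℤ
    ... | yes refl = contradiction M<0 (<-irrefl refl)
    ... | no  _    = refl
    R-small (suc k) M M<k+1 = ∑-0 (Z B) term
      where
      term : ∀ x → w x * R k (M - x * x) ≡ 0ℤ
      term x with w x ≟ 0ℤ
      ... | yes eq = cong (_* R k (M - x * x)) eq
      ... | no  nz = trans (cong (w x *_) (R-small k (M - x * x) bound)) (*-zeroʳ (w x))
        where
        1≤xx : 1ℤ ≤ x * x
        1≤xx with x ≟ 1ℤ
        ... | yes refl = ≤-refl
        ... | no  x≢1  = <⇒≤ (1mod4⇒1<x*x x (w-supp x nz) x≢1)
        bound : M - x * x < + k
        bound = <-≤-trans (+-monoˡ-< (- (x * x)) M<k+1) (≤-trans (+-monoʳ-≤ (+ suc k) (neg-mono-≤ 1≤xx)) (≤-reflexive (suc-1 (+ k))))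
          where
          suc-1 : ∀ k → (1ℤ + k) + - 1ℤ ≡ k
          suc-1 = solve-∀

    R-diagonal : ∀ k → R k (+ k) ≡ 1ℤ
    R-diagonal zero    = refl
    R-diagonal (suc k) = begin
      ∑ (Z B) (λ x → w x * R k (+ suc k - x * x)) ≡⟨ ∑-single _ (Z-unique B) (Z⁺ 1≤B) others ⟩
      w 1ℤ * R k (+ suc k - 1ℤ)                     ≡⟨ cong₂ _*_ w1 (trans (cong (R k) (suc-1 (+ k))) (R-diagonal k)) ⟩
      1ℤ                                            ∎
      where
      open ≡-Reasoning
      suc-1 : ∀ k → (1ℤ + k) - 1ℤ ≡ k
      suc-1 = solve-∀
      others : ∀ x → x ≢ 1ℤ → w x * R k (+ suc k - x * x) ≡ 0ℤ
      others x x≢1 with w x ≟ 0ℤ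
      ... | yes eq = cong (_* R k (+ suc k - x * x)) eq
      ... | no  nz = trans (cong (w x *_) (R-small k _ (<-≤-trans (+-monoʳ-< (+ suc k) (neg-mono-< (1mod4⇒1<x*x x (w-supp x nz) x≢1))) (≤-reflexive (suc-1 (+ k)))))) (*-zeroʳ (w x))

    -- In the recursion at M + 1 the term x = 1 involves the value at M, all others involve smaller arguments.
    unique : (k : ℕ) (E : ℤ → ℤ) (good : ℤ → Set) →
      (∀ M → M ≤ + k → E M ≡ 0ℤ) →
      (∀ M → good M → ∑ (Z B) (λ x → w x * ((M + 1ℤ - + suc k * (x * x)) * E (M + 1ℤ - x * x))) ≡ 0ℤ) →
      (∀ M x → good M → + 4 ∣ x - 1ℤ → x ≢ 1ℤ → good (M + 1ℤ - x * x)) →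
      ∀ M → good M → E M ≡ 0ℤ
    unique k E good low rec next M gM = go ∣ M ∣ M (i≤+∣i∣ M) gM
      where
      i≤+∣i∣ : ∀ M → M ≤ + ∣ M ∣
      i≤+∣i∣ (+ n)    = ≤-refl
      i≤+∣i∣ -[1+ n ] = -≤+
      go : ∀ n M → M ≤ + n → good M → E M ≡ 0ℤ
      go zero    M M≤0 gM = low M (≤-trans M≤0 (+≤+ z≤n))
      go (suc n) M M≤n gM with M ≤? + k
      ... | yes M≤k = low M M≤k
      ... | no  M≰k with i*j≡0⇒i≡0∨j≡0 (M - + k) prod
        where
        open ≡-Reasoning
        term : ℤ → ℤ
        term x = w x * ((M + 1ℤ - + suc k * (x * x)) * E (M + 1ℤ - x * x))
        others : ∀ x → x ≢ 1ℤ → term x ≡ 0ℤ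
        others x x≢1 with w x ≟ 0ℤ
        ... | yes eq = cong (_* ((M + 1ℤ - + suc k * (x * x)) * E (M + 1ℤ - x * x))) eq
        ... | no  nz = trans (cong (λ z → w x * ((M + 1ℤ - + suc k * (x * x)) * z)) (go n _ smaller (next M x gM (w-supp x nz) x≢1)))
                         (trans (cong (w x *_) (*-zeroʳ (M + 1ℤ - + suc k * (x * x)))) (*-zeroʳ (w x)))
          where
          smaller : M + 1ℤ - x * x ≤ + n
          smaller = ≤-trans (+-mono-≤ (+-monoˡ-≤ 1ℤ M≤n) (neg-mono-≤ (i<j⇒suc[i]≤j (1mod4⇒1<x*x x (w-supp x nz) x≢1)))) (≤-reflexive (lem (+ n)))
            where
            lem : ∀ n → 1ℤ + n + 1ℤ + - (+ 2) ≡ n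
            lem = solve-∀
        -- At x = 1 the factor (M + 1) - (k + 1)x² equals M - k, which is nonzero above the starting
        -- exponent k.
        prod : (M - + k) * E M ≡ 0ℤ
        prod = begin
          (M - + k) * E M                                      ≡⟨ cong₂ (λ a b → a * E b) (lem₁ M (+ k)) (lem₂ M) ⟩
          (M + 1ℤ - + suc k * (1ℤ * 1ℤ)) * E (M + 1ℤ - 1ℤ * 1ℤ) ≡⟨ *-identityˡ _ ⟨
          1ℤ * ((M + 1ℤ - + suc k * (1ℤ * 1ℤ)) * E (M + 1ℤ - 1ℤ * 1ℤ)) ≡⟨ cong (_* ((M + 1ℤ - + suc k * (1ℤ * 1ℤ)) * E (M + 1ℤ - 1ℤ * 1ℤ))) w1 ⟨
          term 1ℤ                                              ≡⟨ ∑-single term (Z-unique B) (Z⁺ 1≤B) others ⟨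
          ∑ (Z B) term                                       ≡⟨ rec M gM ⟩
          0ℤ                                                   ∎
          where
          lem₁ : ∀ M k → M - k ≡ M + 1ℤ - (1ℤ + k) * (1ℤ * 1ℤ)
          lem₁ = solve-∀
          lem₂ : ∀ M → M ≡ M + 1ℤ - 1ℤ * 1ℤ
          lem₂ = solve-∀
      ... | inj₁ eq = contradiction (≤-reflexive (i-j≡0⇒i≡j M (+ k) eq)) M≰k
      ... | inj₂ eq = eq

  -- Congruences and characters modulo 2, 3 and 4.

  𝟙-∣-shift : ∀ m {a b} → m ∣ a - b → 𝟙 (m ∣? a) ≡ 𝟙 (m ∣? b)
  𝟙-∣-shift m {a} {b} d = 𝟙-cong (λ e → subst (m ∣_) (lem₁ a b) (∣m∣n⇒∣m-n e d))
                                (λ e → subst (m ∣_) (lem₂ a b) (∣m∣n⇒∣m+n d e)) (m ∣? a) (m ∣? b)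
    where
    lem₁ : ∀ a b → a - (a - b) ≡ b
    lem₁ = solve-∀
    lem₂ : ∀ a b → a - b + b ≡ a
    lem₂ = solve-∀

  -- The gateway to the tables: identities between periodic functions are moved to residues and
  -- there settled by evaluation.
  residue : ∀ n .{{_ : ℕ.NonZero n}} x → ∃ λ (r : Fin n) → + n ∣ x - + toℕ r
  residue n x = r , divides (x /ℕ n) (begin
      x - + toℕ r                          ≡⟨ cong₂ (λ a b → a - + b) (a≡a%ℕn+[a/ℕn]*n x n) r≡ ⟩
      + (x %ℕ n) + (x /ℕ n) * + n - + (x %ℕ n) ≡⟨ lem (+ (x %ℕ n)) _ ⟩
      (x /ℕ n) * + n                       ∎)
    where
    open ≡-Reasoning
    r = Fin.fromℕ< (n%ℕd<d x n)
    r≡ : toℕ r ≡ x %ℕ n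
    r≡ = toℕ-fromℕ< (n%ℕd<d x n)
    lem : ∀ a b → a + b - a ≡ b
    lem = solve-∀

  opaque

    -- `ψ` selects one number from each pair x, -x of odd numbers; `χ` is the quadratic character
    -- modulo 3. Opaque, so that they are computed only in the tables.
    ψ odd χ : ℤ → ℤ
    ψ x   = 𝟙 (+ 4 ∣? x - 1ℤ)
    odd x = 𝟙 (+ 2 ∣? x - 1ℤ)
    χ x   = 𝟙 (+ 3 ∣? x - 1ℤ) - 𝟙 (+ 3 ∣? x + 1ℤ)

    δ : ℤ → ℤ → ℤ
    δ m x = 𝟙 (m ∣? x)

  -- The quadratic character modulo 12 of real quadratic type, restricted to x ≡ 1 (mod 4). The
  -- corresponding theta series is η(24z).
  H : ℤ → ℤ
  H x = ψ x * χ x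

  opaque
    unfolding ψ odd χ δ

    δ-shift : ∀ m {a b} → m ∣ a - b → δ m a ≡ δ m b
    δ-shift = 𝟙-∣-shift

    δ-yes : ∀ {m a} → m ∣ a → δ m a ≡ 1ℤ
    δ-yes = 𝟙-yes _

    δ≢0 : ∀ {m a} → δ m a ≢ 0ℤ → m ∣ a
    δ≢0 = 𝟙≢0 _

    ψ≢0 : ∀ {x} → ψ x ≢ 0ℤ → + 4 ∣ x - 1ℤ
    ψ≢0 = 𝟙≢0 _

    ψ-yes : ∀ {x} → + 4 ∣ x - 1ℤ → ψ x ≡ 1ℤ
    ψ-yes = 𝟙-yes _

    odd-yes : ∀ {x} → + 2 ∣ x - 1ℤ → odd x ≡ 1ℤ
    odd-yes = 𝟙-yes _

    ψ-shift : ∀ {x y} → + 4 ∣ x - y → ψ x ≡ ψ y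
    ψ-shift {x} {y} d = 𝟙-∣-shift (+ 4) (subst (+ 4 ∣_) (lem x y) d)
      where
      lem : ∀ x y → x - y ≡ (x - 1ℤ) - (y - 1ℤ)
      lem = solve-∀

    odd-shift : ∀ {x y} → + 2 ∣ x - y → odd x ≡ odd y
    odd-shift {x} {y} d = 𝟙-∣-shift (+ 2) (subst (+ 2 ∣_) (lem x y) d)
      where
      lem : ∀ x y → x - y ≡ (x - 1ℤ) - (y - 1ℤ)
      lem = solve-∀

    χ-shift : ∀ {x y} → + 3 ∣ x - y → χ x ≡ χ y
    χ-shift {x} {y} d = cong₂ _-_ (𝟙-∣-shift (+ 3) {x - 1ℤ} {y - 1ℤ} (subst (+ 3 ∣_) (lem x y) d))
                                 (𝟙-∣-shift (+ 3) {x + 1ℤ} {y + 1ℤ} (subst (+ 3 ∣_) (lem′ x y) d))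
      where
      lem : ∀ x y → x - y ≡ (x - 1ℤ) - (y - 1ℤ)
      lem = solve-∀
      lem′ : ∀ x y → x - y ≡ (x + 1ℤ) - (y + 1ℤ)
      lem′ = solve-∀

    χ-neg-table : ∀ (r : Fin 3) → χ (- (+ toℕ r)) ≡ - χ (+ toℕ r)
    χ-neg-table = toWitness {a? = all? (λ r → χ (- (+ toℕ r)) ≟ - χ (+ toℕ r))} _

    ψ-neg-table : ∀ (r : Fin 4) → ψ (+ toℕ r) + ψ (- (+ toℕ r)) ≡ odd (+ toℕ r)
    ψ-neg-table = toWitness {a? = all? (λ r → ψ (+ toℕ r) + ψ (- (+ toℕ r)) ≟ odd (+ toℕ r))} _

    ψψ-table : ∀ (r s : Fin 4) → ψ (+ toℕ r) * ψ (+ toℕ s) + ψ (- (+ toℕ r)) * ψ (- (+ toℕ s)) ≡ δ (+ 4) (+ toℕ r - + toℕ s) * odd (+ toℕ s)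
    ψψ-table = toWitness {a? = all? (λ r → all? (λ s → ψ (+ toℕ r) * ψ (+ toℕ s) + ψ (- (+ toℕ r)) * ψ (- (+ toℕ s)) ≟ δ (+ 4) (+ toℕ r - + toℕ s) * odd (+ toℕ s)))} _

    χ1 : χ 1ℤ ≡ 1ℤ
    χ1 = refl

  ∣-neg : ∀ m {x y} → m ∣ x - y → m ∣ - x - - y
  ∣-neg m {x} {y} d = subst (m ∣_) (lem x y) (∣m⇒∣-m d)
    where
    lem : ∀ x y → - (x - y) ≡ - x - - y
    lem = solve-∀

  χ-neg : ∀ x → χ (- x) ≡ - χ x
  χ-neg x with r , d ← residue 3 x = trans (χ-shift (∣-neg (+ 3) {x} {+ toℕ r} d))
      (trans (χ-neg-table r) (cong -_ (sym (χ-shift d))))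

  4∣⇒2∣ : ∀ {x} → + 4 ∣ x → + 2 ∣ x
  4∣⇒2∣ (divides q eq) = divides (q * + 2) (trans eq (lem q))
    where
    lem : ∀ q → q * + 4 ≡ q * + 2 * + 2
    lem = solve-∀

  ψ-neg : ∀ x → ψ x + ψ (- x) ≡ odd x
  ψ-neg x with r , d ← residue 4 x = trans (cong₂ _+_ (ψ-shift d) (ψ-shift (∣-neg (+ 4) {x} {+ toℕ r} d)))
      (trans (ψ-neg-table r) (sym (odd-shift (4∣⇒2∣ d))))

  -- Adding the pair (-u, -v) trades the condition u ≡ v ≡ 1 (mod 4) for u ≡ v (mod 4) with v odd.
  -- The latter can be parametrised linearly, since u - v is then an arbitrary multiple of 4.
  ψψ : ∀ u v → ψ u * ψ v + ψ (- u) * ψ (- v) ≡ δ (+ 4) (u - v) * odd v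
  ψψ u v with r , d ← residue 4 u | s , e ← residue 4 v = begin
      ψ u * ψ v + ψ (- u) * ψ (- v)
        ≡⟨ cong₂ _+_ (cong₂ _*_ (ψ-shift d) (ψ-shift e)) (cong₂ _*_ (ψ-shift (∣-neg (+ 4) {u} d)) (ψ-shift (∣-neg (+ 4) {v} e))) ⟩
      ψ (+ toℕ r) * ψ (+ toℕ s) + ψ (- (+ toℕ r)) * ψ (- (+ toℕ s))
        ≡⟨ ψψ-table r s ⟩
      δ (+ 4) (+ toℕ r - + toℕ s) * odd (+ toℕ s)
        ≡⟨ cong₂ _*_ (δ-shift (+ 4) (subst (+ 4 ∣_) (lem u v (+ toℕ r) (+ toℕ s)) (∣m∣n⇒∣m-n d e))) (odd-shift (4∣⇒2∣ e)) ⟨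
      δ (+ 4) (u - v) * odd v ∎
    where
    open ≡-Reasoning
    lem : ∀ u v r s → (u - r) - (v - s) ≡ (u - v) - (r - s)
    lem = solve-∀

  odd⇒¬even : ∀ {a b} → + 2 ∣ a → a ≢ 1ℤ + + 2 * b
  odd⇒¬even {a} {b} (divides q eq) a≡ = from-no (+ 2 ∣? 1ℤ) (divides (q - b) (trans (sym (lem b)) (trans (cong (_- + 2 * b) (trans (sym a≡) eq)) (lem′ q b))))
    where
    lem : ∀ b → 1ℤ + + 2 * b - + 2 * b ≡ 1ℤ
    lem = solve-∀
    lem′ : ∀ q b → q * + 2 - + 2 * b ≡ (q - b) * + 2
    lem′ = solve-∀

  parity : ∀ x → (+ 2 ∣ x) ⊎ (+ 2 ∣ x - 1ℤ)
  parity x with residue 2 x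
  ... | Fin.zero , d = inj₁ (subst (+ 2 ∣_) (+-identityʳ x) d)
  ... | Fin.suc Fin.zero , d = inj₂ d

  2∣x[x+1] : ∀ x → + 2 ∣ x * (x + 1ℤ)
  2∣x[x+1] x with parity x
  ... | inj₁ d = ∣m⇒∣m*n (x + 1ℤ) d
  ... | inj₂ d = ∣n⇒∣m*n x (subst (+ 2 ∣_) (lem x) (∣m∣n⇒∣m+n d (∣-refl {+ 2})))
    where
    lem : ∀ x → x - 1ℤ + + 2 ≡ x + 1ℤ
    lem = solve-∀

  -- Odd squares are 1 modulo 8: for m = 2i + 1, m² - 1 = 4i(i + 1), and i(i + 1) is even.
  5mod8-nonsquare : ∀ m j → m * m ≢ + 5 + + 8 * j
  5mod8-nonsquare m j eq with parity m
  ... | inj₁ d = odd⇒¬even {b = + 2 + + 4 * j} (∣m⇒∣m*n m d) (trans eq (lem j))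
    where
    lem : ∀ j → + 5 + + 8 * j ≡ 1ℤ + + 2 * (+ 2 + + 4 * j)
    lem = solve-∀
  ... | inj₂ (divides i e) = odd⇒¬even {b = j} (2∣x[x+1] i) (*-cancelˡ-≡ (+ 4) _ _ (begin
      + 4 * (i * (i + 1ℤ))                          ≡⟨ lem₁ i ⟩
      (i * + 2 + 1ℤ) * (i * + 2 + 1ℤ) - 1ℤ          ≡⟨ cong (λ z → (z + 1ℤ) * (z + 1ℤ) - 1ℤ) (sym e) ⟩
      (m - 1ℤ + 1ℤ) * (m - 1ℤ + 1ℤ) - 1ℤ            ≡⟨ cong (_- 1ℤ) (trans (lem₂ m) eq) ⟩
      + 5 + + 8 * j - 1ℤ                            ≡⟨ lem₃ j ⟩
      + 4 * (1ℤ + + 2 * j)                          ∎))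
    where
    open ≡-Reasoning
    lem₁ : ∀ i → + 4 * (i * (i + 1ℤ)) ≡ (i * + 2 + 1ℤ) * (i * + 2 + 1ℤ) - 1ℤ
    lem₁ = solve-∀
    lem₂ : ∀ m → (m - 1ℤ + 1ℤ) * (m - 1ℤ + 1ℤ) ≡ m * m
    lem₂ = solve-∀
    lem₃ : ∀ j → + 5 + + 8 * j - 1ℤ ≡ + 4 * (1ℤ + + 2 * j)
    lem₃ = solve-∀

  -- Divisor sums and the windmill involutions.

  x+x≡0⇒x≡0 : ∀ x → x + x ≡ 0ℤ → x ≡ 0ℤ
  x+x≡0⇒x≡0 x eq = x≡-x⇒x≡0 x (trans (lem x) (trans (cong (_- x) eq) (+-identityˡ (- x))))
    where
    lem : ∀ x → x ≡ x + x - x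
    lem = solve-∀

  0≤x*x : ∀ x → 0ℤ ≤ x * x
  0≤x*x (+ n)    = subst (0ℤ ≤_) (pos-* n n) (+≤+ z≤n)
  0≤x*x -[1+ n ] = +≤+ z≤n

  ∣x∣≤ : ∀ {B} x → x * x ≤ + B → ∣ x ∣ ℕ.≤ B
  ∣x∣≤ {B} x le = ℕ.≤-trans (sq ∣ x ∣) (drop‿+≤+ (subst (_≤ + B) (trans (lem x) (sym (pos-* ∣ x ∣ ∣ x ∣))) le))
    where
    sq : ∀ n → n ℕ.≤ n ℕ.* n
    sq zero    = z≤n
    sq (suc n) = ℕ.m≤m*n (suc n) (suc n)
    lem : ∀ x → x * x ≡ + ∣ x ∣ * + ∣ x ∣
    lem (+ n)    = refl
    lem -[1+ n ] = refl

  ∣x∣≤* : ∀ {B x y} → 0ℤ < x → 0ℤ < y → x * y ≤ + B → ∣ x ∣ ℕ.≤ B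
  ∣x∣≤* {B} {+ suc m} {+ suc n} _ _ le = ℕ.≤-trans (ℕ.m≤m*n (suc m) (suc n)) (drop‿+≤+ le)
  ∣x∣≤* {x = + zero} (+<+ ()) _ _
  ∣x∣≤* {x = + suc m} {+ zero} _ (+<+ ()) _

  ≤-drop : ∀ {a b c} → 0ℤ ≤ b → a + b ≤ c → a ≤ c
  ≤-drop {a} {b} 0≤b le = ≤-trans (subst (_≤ a + b) (+-identityʳ a) (+-monoʳ-≤ a 0≤b)) le

  0<x*y : ∀ {x y} → 0ℤ < x → 0ℤ < y → 0ℤ < x * y
  0<x*y {+ suc m} {+ suc n} _ _ = +<+ (s≤s z≤n)
  0<x*y {+ zero} (+<+ ()) _
  0<x*y {+ suc m} {+ zero} _ (+<+ ())

  0≤*₊ : ∀ n {x} → 0ℤ ≤ x → 0ℤ ≤ + n * x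
  0≤*₊ n {+ m} _ = subst (0ℤ ≤_) (pos-* n m) (+≤+ z≤n)

  x≤4*x : ∀ {x} → 0ℤ ≤ x → x ≤ + 4 * x
  x≤4*x {x} 0≤x = subst (_≤ + 4 * x) (+-identityʳ x) (subst (x + 0ℤ ≤_) (lem x) (+-monoʳ-≤ x (0≤*₊ 3 0≤x)))
    where
    lem : ∀ x → x + + 3 * x ≡ + 4 * x
    lem = solve-∀

  -- The divisor sum of M / 4, written over factorisations 4yz = M. With M = N - x² the condition
  -- becomes the windmill equation x² + 4yz = N.
  σ : ℕ → ℤ → ℤ
  σ B M = ∑ (Z B) (λ y → ∑ (Z B) (λ z → 𝟙 (0ℤ <? y ×-dec 0ℤ <? z ×-dec + 4 * (y * z) ≟ M) * y))

  module Windmill (B : ℕ) (j : ℤ) where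

    N : ℤ
    N = + 5 + + 8 * j

    P : ℤ × ℤ × ℤ → Set
    P (x , y , z) = 0ℤ < y × 0ℤ < z × x * x + + 4 * (y * z) ≡ N

    P? : ∀ t → Dec (P t)
    P? (x , y , z) = 0ℤ <? y ×-dec 0ℤ <? z ×-dec (x * x + + 4 * (y * z)) ≟ N

    Z³ : List (ℤ × ℤ × ℤ)
    Z³ = cartesianProduct (Z B) (cartesianProduct (Z B) (Z B))

    Z³-unique : Unique Z³
    Z³-unique = Unique.cartesianProduct⁺ (Z-unique B) (Unique.cartesianProduct⁺ (Z-unique B) (Z-unique B))

    -- `τ` is the branch of Zagier's windmill map for x + z < y, namely (x + 2z, z, y - x - z),
    -- followed by `ρ`. In this form it preserves the region x + z < y.
    neg swap ρ τ : ℤ × ℤ × ℤ → ℤ × ℤ × ℤ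
    neg (x , y , z) = - x , y , z
    swap (x , y , z) = x , z , y
    ρ (x , y , z) = - x , z , y
    τ (x , y , z) = - x - + 2 * z , y - x - z , z

    neg-P : ∀ t → P t → P (neg t)
    neg-P (x , y , z) (y>0 , z>0 , eq) = y>0 , z>0 , trans (lem x (+ 4 * (y * z))) eq
      where
      lem : ∀ x c → - x * - x + c ≡ x * x + c
      lem = solve-∀

    swap-P : ∀ t → P t → P (swap t)
    swap-P (x , y , z) (y>0 , z>0 , eq) = z>0 , y>0 , trans (lem x y z) eq
      where
      lem : ∀ x y z → x * x + + 4 * (z * y) ≡ x * x + + 4 * (y * z)
      lem = solve-∀

    τ-P : ∀ x y z → x + z < y → P (x , y , z) → P (τ (x , y , z)) × (- x - + 2 * z) + z < y - x - z
    τ-P x y z lt (y>0 , z>0 , eq) =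
      (subst (0ℤ <_) (lem₀ x y z) (m<n⇒0<n-m lt) , z>0 , trans (lem x y z) eq) ,
      subst₂ _<_ (lem₁ x z) (lem₂ x y z) (+-monoʳ-< (- x - z) y>0)
      where
      m<n⇒0<n-m : ∀ {m n} → m < n → 0ℤ < n - m
      m<n⇒0<n-m {m} {n} m<n = subst (_< n - m) (+-inverseʳ m) (+-monoˡ-< (- m) m<n)
      lem₀ : ∀ x y z → y - (x + z) ≡ y - x - z
      lem₀ = solve-∀
      lem : ∀ x y z → (- x - + 2 * z) * (- x - + 2 * z) + + 4 * ((y - x - z) * z) ≡ x * x + + 4 * (y * z)
      lem = solve-∀
      lem₁ : ∀ x z → - x - z + 0ℤ ≡ (- x - + 2 * z) + z
      lem₁ = solve-∀
      lem₂ : ∀ x y z → - x - z + y ≡ y - x - z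
      lem₂ = solve-∀

    neg-neg : ∀ t → neg (neg t) ≡ t
    neg-neg (x , y , z) = cong (_, (y , z)) (neg-involutive x)

    ρρ : ∀ t → ρ (ρ t) ≡ t
    ρρ (x , y , z) = cong (_, (y , z)) (neg-involutive x)

    ττ : ∀ t → τ (τ t) ≡ t
    ττ (x , y , z) = cong₂ (λ a b → a , b , z) (lem₁ x z) (lem₂ x y z)
      where
      lem₁ : ∀ x z → - (- x - + 2 * z) - + 2 * z ≡ x
      lem₁ = solve-∀
      lem₂ : ∀ x y z → y - x - z - (- x - + 2 * z) - z ≡ y
      lem₂ = solve-∀

    module _ (N≤B : N ≤ + B) where

      P-bounded : ∀ {t} → P t → t ∈ Z³
      P-bounded {x , y , z} (y>0 , z>0 , eq) =
        ∈-cartesianProduct⁺ (Z⁺ (∣x∣≤ x (≤-drop 0≤4yz total)))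
          (∈-cartesianProduct⁺ (Z⁺ (∣x∣≤* y>0 z>0 yz≤B)) (Z⁺ (∣x∣≤* z>0 y>0 (subst (_≤ + B) (*-comm y z) yz≤B))))
        where
        total : x * x + + 4 * (y * z) ≤ + B
        total = subst (_≤ + B) (sym eq) N≤B
        0≤yz : 0ℤ ≤ y * z
        0≤yz = <⇒≤ (0<x*y y>0 z>0)
        0≤4yz : 0ℤ ≤ + 4 * (y * z)
        0≤4yz = 0≤*₊ 4 0≤yz
        yz≤B : y * z ≤ + B
        yz≤B = ≤-trans (x≤4*x 0≤yz) (≤-drop (0≤x*x x) (subst (_≤ + B) (+-comm (x * x) _) total))

      sum-involution : ∀ (r : ℤ × ℤ × ℤ → ℤ × ℤ × ℤ) → (∀ t → r (r t) ≡ t) →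
        (f : ℤ × ℤ × ℤ → ℤ) → (∀ t → f t ≢ 0ℤ → P t) → (∀ t → f (r t) ≢ 0ℤ → P t) → ∑ Z³ (f ∘ r) ≡ ∑ Z³ f
      sum-involution r rr f supp supp′ = ∑-reindex (_≟ 0ℤ) r Z³-unique Z³-unique f
        (λ {t} _ nz → P-bounded (supp (r t) nz))
        (λ {s} {t} eq → trans (sym (rr s)) (trans (cong r eq) (rr t)))
        (λ {t} _ nz → r t , P-bounded (supp′ (r t) (subst (λ s → f s ≢ 0ℤ) (sym (rr t)) nz)) , rr t)

      -- τ maps the region y > x + z onto itself and negates G, while ρ exchanges the two regions and fixes G.
      G : ℤ × ℤ × ℤ → ℤ
      G (x , y , z) = (y + z) * ((x + z) * (y - x))

      upper? : ∀ ((x , y , z) : ℤ × ℤ × ℤ) → Dec (x + z < y × P (x , y , z))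
      upper? t@(x , y , z) = x + z <? y ×-dec P? t

      lower? : ∀ ((x , y , z) : ℤ × ℤ × ℤ) → Dec (y < x + z × P (x , y , z))
      lower? t@(x , y , z) = y <? x + z ×-dec P? t

      lower upper : ℤ × ℤ × ℤ → ℤ
      upper t@(x , y , z) = 𝟙 (upper? t) * G t
      lower t@(x , y , z) = 𝟙 (lower? t) * G t

      upper-vanishes : ∑ Z³ upper ≡ 0ℤ
      upper-vanishes = ∑-anti Z³-unique τ ττ upper
        (λ {t} nz → P-bounded (proj₂ (𝟙≢0 (upper? t) (*≢0ˡ _ (G t) nz))))
        (λ t@(x , y , z) → trans (cong₂ _*_ (𝟙-cong (back t) (forth t) (upper? (τ t)) (upper? t)) (lem x y z)) (sym (neg-distribʳ-* (𝟙 (upper? t)) (G t))))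
        where
        Up : ℤ × ℤ × ℤ → Set
        Up t@(x , y , z) = x + z < y × P t
        forth : ∀ t → Up t → Up (τ t)
        forth (x , y , z) (lt , p) with p′ , lt′ ← τ-P x y z lt p = lt′ , p′
        back : ∀ t → Up (τ t) → Up t
        back t u = subst Up (ττ t) (forth (τ t) u)
        lem : ∀ x y z → (y - x - z + z) * ((- x - + 2 * z + z) * (y - x - z - (- x - + 2 * z))) ≡ - ((y + z) * ((x + z) * (y - x)))
        lem = solve-∀

      lower-vanishes : ∑ Z³ lower ≡ 0ℤ
      lower-vanishes = begin
        ∑ Z³ lower       ≡⟨ ∑-cong Z³ (λ t@(x , y , z) → cong₂ _*_
                              (𝟙-cong (λ { (lt , p) → subst₂ _<_ (lem₁ x z y) (lem₂ x z) (+-monoˡ-< (- x) lt) , swap-P (neg t) (neg-P t p) })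
                                      (λ { (lt , p) → subst₂ _<_ (lem₃ x y) (lem₄ x z) (+-monoˡ-< x lt) , subst P (ρρ t) (swap-P (neg (ρ t)) (neg-P (ρ t) p)) })
                                      (lower? t) (upper? (ρ t)))
                              (lem x y z)) ⟩
        ∑ Z³ (upper ∘ ρ) ≡⟨ sum-involution ρ ρρ upper
                              (λ t nz → proj₂ (𝟙≢0 (upper? t) (*≢0ˡ _ (G t) nz)))
                              (λ t nz → subst P (ρρ t) (swap-P (neg (ρ t)) (neg-P (ρ t) (proj₂ (𝟙≢0 (upper? (ρ t)) (*≢0ˡ _ (G (ρ t)) nz)))))) ⟩
        ∑ Z³ upper       ≡⟨ upper-vanishes ⟩
        0ℤ               ∎
        where
        open ≡-Reasoning
        lem : ∀ x y z → (y + z) * ((x + z) * (y - x)) ≡ (z + y) * ((- x + y) * (z - - x))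
        lem = solve-∀
        lem₁ : ∀ x z y → y - x ≡ - x + y
        lem₁ = solve-∀
        lem₂ : ∀ x z → x + z - x ≡ z
        lem₂ = solve-∀
        lem₃ : ∀ x y → - x + y + x ≡ y
        lem₃ = solve-∀
        lem₄ : ∀ x z → z + x ≡ x + z
        lem₄ = solve-∀

      p : ℤ × ℤ × ℤ → ℤ
      p t = 𝟙 (P? t)

      -- y = x + z would make N = (x + 2z)² a square.
      split : ∀ t → p t * G t ≡ upper t + lower t
      split t@(x , y , z) = go (P? t) (<-cmp (x + z) y)
        where
        go : Dec (P t) → Tri (x + z < y) (x + z ≡ y) (y < x + z) → p t * G t ≡ upper t + lower t
        go (no ¬p) _ = begin
          p t * G t                   ≡⟨ cong (_* G t) (𝟙-no (P? t) ¬p) ⟩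
          0ℤ * G t + 0ℤ * G t         ≡⟨ cong₂ (λ a b → a * G t + b * G t) (𝟙-no (upper? t) (¬p ∘ proj₂)) (𝟙-no (lower? t) (¬p ∘ proj₂)) ⟨
          upper t + lower t           ∎
          where open ≡-Reasoning
        go (yes q) (tri< a _ b) = begin
          p t * G t                   ≡⟨ cong (_* G t) (𝟙-yes (P? t) q) ⟩
          1ℤ * G t                    ≡⟨ +-identityʳ (1ℤ * G t) ⟨
          1ℤ * G t + 0ℤ * G t         ≡⟨ cong₂ (λ a b → a * G t + b * G t) (𝟙-yes (upper? t) (a , q)) (𝟙-no (lower? t) (b ∘ proj₁)) ⟨
          upper t + lower t           ∎
          where open ≡-Reasoning
        go (yes q) (tri> b _ a) = begin
          p t * G t                   ≡⟨ cong (_* G t) (𝟙-yes (P? t) q) ⟩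
          1ℤ * G t                    ≡⟨ +-identityˡ (1ℤ * G t) ⟨
          0ℤ * G t + 1ℤ * G t         ≡⟨ cong₂ (λ a b → a * G t + b * G t) (𝟙-no (upper? t) (b ∘ proj₁)) (𝟙-yes (lower? t) (a , q)) ⟨
          upper t + lower t           ∎
          where open ≡-Reasoning
        go (yes q) (tri≈ _ y≡x+z _) = contradiction (trans (lem x z) (trans (cong (λ y → x * x + + 4 * (y * z)) y≡x+z) (proj₂ (proj₂ q)))) (5mod8-nonsquare (x + + 2 * z) j)
          where
          lem : ∀ x z → (x + + 2 * z) * (x + + 2 * z) ≡ x * x + + 4 * ((x + z) * z)
          lem = solve-∀

      G-vanishes : ∑ Z³ (λ t → p t * G t) ≡ 0ℤ
      G-vanishes = trans (∑-cong Z³ split) (trans (∑-+ Z³ upper lower) (cong₂ _+_ upper-vanishes lower-vanishes))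

      odd-part-vanishes : ∑ Z³ (λ t@(x , y , z) → p t * (x * (y * y - z * z))) ≡ 0ℤ
      odd-part-vanishes = ∑-anti Z³-unique neg neg-neg _ (λ {t} nz → P-bounded (𝟙≢0 (P? t) (*≢0ˡ _ _ nz)))
        (λ t@(x , y , z) → trans (cong (_* (- x * (y * y - z * z))) (𝟙-cong (λ q → subst P (neg-neg t) (neg-P (neg t) q)) (neg-P t) (P? (neg t)) (P? t)))
                             (lem (p t) x (y * y - z * z)))
        where
        lem : ∀ p x c → p * (- x * c) ≡ - (p * (x * c))
        lem = solve-∀

      -- (x + z)(y - x) = yz - x² + x(y - z), so this weight differs from `G` only by a term odd in
      -- x.
      sym-vanishes : ∑ Z³ (λ t@(x , y , z) → p t * ((y * z - x * x) * (y + z))) ≡ 0ℤ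
      sym-vanishes = begin
        ∑ Z³ (λ t@(x , y , z) → p t * ((y * z - x * x) * (y + z)))
          ≡⟨ ∑-cong Z³ (λ t@(x , y , z) → lem (p t) x y z) ⟩
        ∑ Z³ (λ t@(x , y , z) → p t * G t - p t * (x * (y * y - z * z)))
          ≡⟨ ∑-- Z³ _ _ ⟩
        ∑ Z³ (λ t → p t * G t) - ∑ Z³ (λ t@(x , y , z) → p t * (x * (y * y - z * z)))
          ≡⟨ cong₂ _-_ G-vanishes odd-part-vanishes ⟩
        0ℤ ∎
        where
        open ≡-Reasoning
        lem : ∀ p x y z → p * ((y * z - x * x) * (y + z)) ≡ p * ((y + z) * ((x + z) * (y - x))) - p * (x * (y * y - z * z))
        lem = solve-∀

      -- The equation is symmetric in y and z, so the last factor y may be replaced by the mean of y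
      -- and z.
      S₂ : ∑ Z³ (λ t@(x , y , z) → p t * ((y * z - x * x) * y)) ≡ 0ℤ
      S₂ = x+x≡0⇒x≡0 _ (begin
        ∑ Z³ f + ∑ Z³ f          ≡⟨ cong (λ s → ∑ Z³ f + s) (sum-involution swap (λ _ → refl) f
                                      (λ t nz → 𝟙≢0 (P? t) (*≢0ˡ _ _ nz))
                                      (λ t nz → swap-P (swap t) (𝟙≢0 (P? (swap t)) (*≢0ˡ _ _ nz)))) ⟨
        ∑ Z³ f + ∑ Z³ (f ∘ swap) ≡⟨ ∑-+ Z³ f (f ∘ swap) ⟨
        ∑ Z³ (λ t → f t + f (swap t)) ≡⟨ ∑-cong Z³ (λ t@(x , y , z) →
                                         trans (cong (λ c → f t + c * ((z * y - x * x) * z)) (𝟙-cong (swap-P (swap t)) (swap-P t) (P? (swap t)) (P? t)))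
                                               (lem (p t) x y z)) ⟩
        ∑ Z³ (λ t@(x , y , z) → p t * ((y * z - x * x) * (y + z))) ≡⟨ sym-vanishes ⟩
        0ℤ                       ∎)
        where
        open ≡-Reasoning
        f : ℤ × ℤ × ℤ → ℤ
        f t@(x , y , z) = p t * ((y * z - x * x) * y)
        lem : ∀ p x y z → p * ((y * z - x * x) * y) + p * ((z * y - x * x) * z) ≡ p * ((y * z - x * x) * (y + z))
        lem = solve-∀

      P-odd : ∀ t → P t → odd (proj₁ t) ≡ 1ℤ
      P-odd (x , y , z) (_ , _ , eq) with parity x
      ... | inj₂ d = odd-yes d
      ... | inj₁ (divides q e) = contradiction (trans eq (lem₂ j))
              (odd⇒¬even {x * x + + 4 * (y * z)} {+ 2 + + 4 * j} (divides (q * x + + 2 * (y * z)) (trans (cong (λ a → a * x + + 4 * (y * z)) e) (lem q x (y * z)))))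
        where
        lem : ∀ q x c → q * + 2 * x + + 4 * c ≡ (q * x + + 2 * c) * + 2
        lem = solve-∀
        lem₂ : ∀ j → + 5 + + 8 * j ≡ 1ℤ + + 2 * (+ 2 + + 4 * j)
        lem₂ = solve-∀

      -- On solutions x is odd, so `ψ` keeps exactly one of x and -x. The other factors are even in
      -- x, and the sum is half of the one in `S₂`.
      S₁ : ∑ Z³ (λ t@(x , y , z) → ψ x * (p t * ((y * z - x * x) * y))) ≡ 0ℤ
      S₁ = x+x≡0⇒x≡0 _ (begin
        ∑ Z³ f + ∑ Z³ f          ≡⟨ cong (λ s → ∑ Z³ f + s) (sum-involution neg neg-neg f
                                      (λ t nz → 𝟙≢0 (P? t) (*≢0ˡ _ _ (*≢0ʳ (ψ (proj₁ t)) _ nz)))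
                                      (λ t nz → subst P (neg-neg t) (neg-P (neg t) (𝟙≢0 (P? (neg t)) (*≢0ˡ _ _ (*≢0ʳ (ψ (- proj₁ t)) _ nz)))))) ⟨
        ∑ Z³ f + ∑ Z³ (f ∘ neg) ≡⟨ ∑-+ Z³ f (f ∘ neg) ⟨
        ∑ Z³ (λ t → f t + f (neg t)) ≡⟨ ∑-cong Z³ (λ t@(x , y , z) →
                                         trans (cong (λ c → f t + ψ (- x) * (c * ((y * z - - x * - x) * y))) (𝟙-cong (λ q → subst P (neg-neg t) (neg-P (neg t) q)) (neg-P t) (P? (neg t)) (P? t)))
                                               (trans (lem (ψ x) (ψ (- x)) (p t) x y z) (𝟙-guard (P? t) (λ q → trans (cong (_* ((y * z - x * x) * y)) (trans (ψ-neg x) (P-odd t q))) (*-identityˡ _))))) ⟩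
        ∑ Z³ (λ t@(x , y , z) → p t * ((y * z - x * x) * y)) ≡⟨ S₂ ⟩
        0ℤ                       ∎)
        where
        open ≡-Reasoning
        f : ℤ × ℤ × ℤ → ℤ
        f t@(x , y , z) = ψ x * (p t * ((y * z - x * x) * y))
        lem : ∀ a b p x y z → a * (p * ((y * z - x * x) * y)) + b * (p * ((y * z - - x * - x) * y)) ≡ p * ((a + b) * ((y * z - x * x) * y))
        lem = solve-∀

      -- On solutions N - 5x² = 4(yz - x²), where 5 = k + 1 comes from the recursion for the power k
      -- = 4; the sum is four times the one in `S₁`.
      σ-recursion : ∑ (Z B) (λ x → ψ x * ((N - + 5 * (x * x)) * σ B (N - x * x))) ≡ 0ℤ
      σ-recursion = begin
        ∑ (Z B) (λ x → ψ x * ((N - + 5 * (x * x)) * σ B (N - x * x)))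
          ≡⟨ ∑-cong (Z B) (λ x → trans (sym (*-assoc (ψ x) (N - + 5 * (x * x)) _))
               (trans (sym (∑-*ˡ (ψ x * (N - + 5 * (x * x))) (Z B) _))
                 (∑-cong (Z B) (λ y → trans (sym (∑-*ˡ (ψ x * (N - + 5 * (x * x))) (Z B) _)) (∑-cong (Z B) (term x y)))))) ⟩
        ∑ (Z B) (λ x → ∑ (Z B) (λ y → ∑ (Z B) (λ z → f (x , y , z))))
          ≡⟨ ∑-cong (Z B) (λ x → ∑-× (Z B) (Z B) (λ t → f (x , t))) ⟨
        ∑ (Z B) (λ x → ∑ (cartesianProduct (Z B) (Z B)) (λ t → f (x , t)))
          ≡⟨ ∑-× (Z B) (cartesianProduct (Z B) (Z B)) f ⟨
        ∑ Z³ f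
          ≡⟨ ∑-*ˡ (+ 4) Z³ _ ⟩
        + 4 * ∑ Z³ (λ t@(x , y , z) → ψ x * (p t * ((y * z - x * x) * y)))
          ≡⟨ cong (+ 4 *_) S₁ ⟩
        0ℤ ∎
        where
        open ≡-Reasoning
        f : ℤ × ℤ × ℤ → ℤ
        f t@(x , y , z) = + 4 * (ψ x * (p t * ((y * z - x * x) * y)))
        term : ∀ x y z → ψ x * (N - + 5 * (x * x)) * (𝟙 (0ℤ <? y ×-dec 0ℤ <? z ×-dec + 4 * (y * z) ≟ N - x * x) * y) ≡ f (x , y , z)
        term x y z = begin
          ψ x * (N - + 5 * (x * x)) * (𝟙 (0ℤ <? y ×-dec 0ℤ <? z ×-dec + 4 * (y * z) ≟ N - x * x) * y)
            ≡⟨ cong (λ c → ψ x * (N - + 5 * (x * x)) * (c * y)) (𝟙-cong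
                 (λ { (a , b , e) → a , b , trans (cong (λ s → x * x + s) e) (lem₁ N (x * x)) })
                 (λ { (a , b , e) → a , b , trans (lem₂ (x * x) (+ 4 * (y * z))) (cong (_- x * x) e) }) (0ℤ <? y ×-dec 0ℤ <? z ×-dec + 4 * (y * z) ≟ N - x * x) (P? (x , y , z))) ⟩
          ψ x * (N - + 5 * (x * x)) * (p (x , y , z) * y)
            ≡⟨ lem₃ (ψ x) (p (x , y , z)) (N - + 5 * (x * x)) y ⟩
          p (x , y , z) * (ψ x * ((N - + 5 * (x * x)) * y))
            ≡⟨ 𝟙-guard (P? (x , y , z)) (λ { (_ , _ , e) → cong (λ n → ψ x * ((n - + 5 * (x * x)) * y)) (sym e) }) ⟩
          p (x , y , z) * (ψ x * ((x * x + + 4 * (y * z) - + 5 * (x * x)) * y))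
            ≡⟨ lem₄ (ψ x) (p (x , y , z)) x y z ⟩
          f (x , y , z) ∎
          where
          lem₁ : ∀ N s → s + (N - s) ≡ N
          lem₁ = solve-∀
          lem₂ : ∀ s c → c ≡ s + c - s
          lem₂ = solve-∀
          lem₃ : ∀ a p n y → a * n * (p * y) ≡ p * (a * (n * y))
          lem₃ = solve-∀
          lem₄ : ∀ a p x y z → p * (a * ((x * x + + 4 * (y * z) - + 5 * (x * x)) * y)) ≡ + 4 * (a * (p * ((y * z - x * x) * y)))
          lem₄ = solve-∀

  -- The form u² + 3v², Jacobi's identity, and the two fourth powers.

  Z² : ℕ → List (ℤ × ℤ)
  Z² B = cartesianProduct (Z B) (Z B)

  Z²-unique : ∀ B → Unique (Z² B)
  Z²-unique B = Unique.cartesianProduct⁺ (Z-unique B) (Z-unique B)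

  Z²⁺ : ∀ {B u v} → u * u + + 3 * (v * v) ≤ + B → (u , v) ∈ Z² B
  Z²⁺ {B} {u} {v} le = ∈-cartesianProduct⁺ (Z⁺ (∣x∣≤ u (≤-drop (0≤*₊ 3 (0≤x*x v)) le)))
    (Z⁺ (∣x∣≤ v (≤-drop {v * v} {u * u + + 2 * (v * v)} (≤-trans (0≤x*x u) (subst (_≤ u * u + + 2 * (v * v)) (+-identityʳ (u * u)) (+-monoʳ-≤ (u * u) (0≤*₊ 2 (0≤x*x v)))))
       (subst (_≤ + B) (lem (u * u) (v * v)) le))))
    where
    lem : ∀ a b → a + + 3 * b ≡ b + (a + + 2 * b)
    lem = solve-∀

  -- u + v√-3 = (1 + √-3)(T - W√-3) turns u² + 3v² = 4n into T² + 3W² = n.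
  module Eisenstein (B : ℕ) (N : ℤ) (N≤B : N ≤ + B) (F : ℤ → ℤ → ℤ) (F-even : ∀ u v → F (- u) (- v) ≡ F u v) where

    norm? : ∀ ((u , v) : ℤ × ℤ) → Dec (u * u + + 3 * (v * v) ≡ N)
    norm? (u , v) = u * u + + 3 * (v * v) ≟ N

    φ : ℤ × ℤ → ℤ × ℤ
    φ (t , w) = t + + 3 * w , t - w

    norm-φ : ∀ t w → (t + + 3 * w) * (t + + 3 * w) + + 3 * ((t - w) * (t - w)) ≡ + 4 * (t * t + + 3 * (w * w))
    norm-φ = solve-∀

    normφ? : ∀ ((t , w) : ℤ × ℤ) → Dec (+ 4 * (t * t + + 3 * (w * w)) ≡ N)
    normφ? (t , w) = + 4 * (t * t + + 3 * (w * w)) ≟ N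

    f g : ℤ × ℤ → ℤ
    f (u , v) = 𝟙 (norm? (u , v)) * (ψ u * (ψ v * F u v))
    g (u , v) = 𝟙 (norm? (u , v)) * (δ (+ 4) (u - v) * odd v * F u v)

    norm∈ : ∀ {t} → f t ≢ 0ℤ → t ∈ Z² B
    norm∈ {t} nz = Z²⁺ (subst (_≤ + B) (sym (𝟙≢0 (norm? t) (*≢0ˡ _ _ nz))) N≤B)

    neg : ℤ × ℤ → ℤ × ℤ
    neg (u , v) = - u , - v

    neg-neg : ∀ t → neg (neg t) ≡ t
    neg-neg (u , v) = cong₂ _,_ (neg-involutive u) (neg-involutive v)

    neg-norm : ∀ t → 𝟙 (norm? (neg t)) ≡ 𝟙 (norm? t)
    neg-norm t@(u , v) = 𝟙-cong (trans (sym (lem u v))) (trans (lem u v)) (norm? (neg t)) (norm? t)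
      where
      lem : ∀ u v → - u * - u + + 3 * (- v * - v) ≡ u * u + + 3 * (v * v)
      lem = solve-∀

    double : ∑ (Z² B) f + ∑ (Z² B) f ≡ ∑ (Z² B) g
    double = begin
      ∑ (Z² B) f + ∑ (Z² B) f          ≡⟨ cong (λ s → ∑ (Z² B) f + s) (∑-reindex (_≟ 0ℤ) neg (Z²-unique B) (Z²-unique B) f
                                            (λ _ → norm∈) (λ {s} {t} eq → trans (sym (neg-neg s)) (trans (cong neg eq) (neg-neg t)))
                                            (λ {t} _ nz → neg t , Z²⁺ (subst (_≤ + B) (sym (lem₀ t nz)) N≤B) , neg-neg t)) ⟨
      ∑ (Z² B) f + ∑ (Z² B) (f ∘ neg)  ≡⟨ ∑-+ (Z² B) f (f ∘ neg) ⟨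
      ∑ (Z² B) (λ t → f t + f (neg t)) ≡⟨ ∑-cong (Z² B) (λ t@(u , v) → trans
                                            (cong₂ (λ a b → f t + a * (ψ (- u) * (ψ (- v) * b))) (neg-norm t) (F-even u v))
                                            (trans (lem₁ (𝟙 (norm? t)) (ψ u) (ψ v) (ψ (- u)) (ψ (- v)) (F u v))
                                                   (cong (λ c → 𝟙 (norm? t) * (c * F u v)) (ψψ u v)))) ⟩
      ∑ (Z² B) g                       ∎
      where
      open ≡-Reasoning
      lem₁ : ∀ p a b c d e → p * (a * (b * e)) + p * (c * (d * e)) ≡ p * ((a * b + c * d) * e)
      lem₁ = solve-∀
      lem₀ : ∀ ((u , v) : ℤ × ℤ) → f (u , v) ≢ 0ℤ → - u * - u + + 3 * (- v * - v) ≡ N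
      lem₀ (u , v) nz = trans (lem u v) (𝟙≢0 (norm? (u , v)) (*≢0ˡ _ _ nz))
        where
        lem : ∀ u v → - u * - u + + 3 * (- v * - v) ≡ u * u + + 3 * (v * v)
        lem = solve-∀

    φ-surj : ∀ {u v} → + 4 ∣ u - v → ∃ λ w → φ (v + w , w) ≡ (u , v)
    φ-surj {u} {v} (divides w eq) = w , cong₂ _,_ (trans (lem₁ v w) (trans (cong (λ z → v + z) (sym eq)) (lem₂ u v))) (lem₃ v w)
      where
      lem₁ : ∀ v w → v + w + + 3 * w ≡ v + w * + 4
      lem₁ = solve-∀
      lem₂ : ∀ u v → v + (u - v) ≡ u
      lem₂ = solve-∀
      lem₃ : ∀ v w → v + w - w ≡ v
      lem₃ = solve-∀

    φ-inj : ∀ {s t} → φ s ≡ φ t → s ≡ t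
    φ-inj {t₁ , w₁} {t₂ , w₂} eq = cong₂ _,_ (trans (lem t₁ w₁) (trans (cong₂ _+_ (cong proj₂ eq) w≡) (sym (lem t₂ w₂)))) w≡
      where
      lem : ∀ t w → t ≡ t - w + w
      lem = solve-∀
      lem′ : ∀ t w → + 4 * w ≡ t + + 3 * w - (t - w)
      lem′ = solve-∀
      w≡ : w₁ ≡ w₂
      w≡ = *-cancelˡ-≡ (+ 4) _ _ (trans (lem′ t₁ w₁) (trans (cong₂ _-_ (cong proj₁ eq) (cong proj₂ eq)) (sym (lem′ t₂ w₂))))

    h : ℤ × ℤ → ℤ
    h (t , w) = 𝟙 (normφ? (t , w)) * (odd (t - w) * F (t + + 3 * w) (t - w))

    -- Since u - v = 4w, the substitution `φ` maps ℤ² bijectively onto the pairs with u ≡ v (mod 4),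
    -- and the congruence disappears from the sum.
    reindexed : ∑ (Z² B) f + ∑ (Z² B) f ≡ ∑ (Z² B) h
    reindexed = trans double (trans (sym (∑-reindex (_≟ 0ℤ) φ (Z²-unique B) (Z²-unique B) g
        (λ {t} _ nz → Z²⁺ (subst (_≤ + B) (sym (𝟙≢0 (norm? (φ t)) (*≢0ˡ _ _ nz))) N≤B)) φ-inj surj))
      (∑-cong (Z² B) same))
      where
      same : ∀ t → g (φ t) ≡ h t
      same (t , w) = cong₂ _*_ (𝟙-cong (trans (sym (norm-φ t w))) (trans (norm-φ t w)) (norm? (φ (t , w))) (normφ? (t , w)))
        (cong (_* F (t + + 3 * w) (t - w)) (trans (cong (_* odd (t - w)) (δ-yes (divides w (lem t w)))) (*-identityˡ _)))
        where
        lem : ∀ t w → t + + 3 * w - (t - w) ≡ w * + 4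
        lem = solve-∀
      surj : ∀ {uv} → uv ∈ Z² B → g uv ≢ 0ℤ → ∃ λ tw → tw ∈ Z² B × φ tw ≡ uv
      surj {u , v} _ nz with w , eq ← φ-surj {u} {v} (δ≢0 (*≢0ˡ _ (odd v) (*≢0ˡ _ (F u v) (*≢0ʳ (𝟙 (norm? (u , v))) _ nz)))) =
        (v + w , w) , Z²⁺ (≤-trans (x≤4*x n≥0) (subst (_≤ + B) (sym 4n≡N) N≤B)) , eq
        where
        n≥0 : 0ℤ ≤ (v + w) * (v + w) + + 3 * (w * w)
        n≥0 = +-mono-≤ (0≤x*x (v + w)) (0≤*₊ 3 (0≤x*x w))
        4n≡N : + 4 * ((v + w) * (v + w) + + 3 * (w * w)) ≡ N
        4n≡N = trans (sym (norm-φ (v + w) w)) (trans (cong (λ (u , v) → u * u + + 3 * (v * v)) eq) (𝟙≢0 (norm? (u , v)) (*≢0ˡ _ _ nz)))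

  χ-+3 : ∀ t w → χ (t + + 3 * w) ≡ χ t
  χ-+3 t w = χ-shift (divides w (lem t w))
    where
    lem : ∀ t w → t + + 3 * w - t ≡ w * + 3
    lem = solve-∀

  module Jacobi (B : ℕ) (1≤B : 1 ℕ.≤ B) where

    T : ℤ → ℤ
    T M = ∑ (Z B) (λ v → 𝟙 (+ 3 * (v * v) ≟ M) * (ψ v * v))

    neg-w : ℤ × ℤ → ℤ × ℤ
    neg-w (t , w) = t , - w

    module _ (N : ℤ) (N≤B : N ≤ + B) where

      -- On u² + 3v² = N the factor N - 4u² is 3(v² - u²). In the coordinates t, w the weight
      -- becomes -24 χ(t) w (t² - w²), which is odd in w, and w → -w preserves both the norm and the
      -- parity of t - w.
      T-recursion : ∑ (Z B) (λ u → H u * ((N - + 4 * (u * u)) * T (N - u * u))) ≡ 0ℤ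
      T-recursion = begin
        ∑ (Z B) (λ u → H u * ((N - + 4 * (u * u)) * T (N - u * u)))
          ≡⟨ ∑-cong (Z B) (λ u → trans (sym (*-assoc (H u) (N - + 4 * (u * u)) _)) (trans (sym (∑-*ˡ (H u * (N - + 4 * (u * u))) (Z B) _)) (∑-cong (Z B) (term u)))) ⟩
        ∑ (Z B) (λ u → ∑ (Z B) (λ v → f (u , v)))
          ≡⟨ ∑-× (Z B) (Z B) f ⟨
        ∑ (Z² B) f
          ≡⟨ x+x≡0⇒x≡0 _ (trans reindexed anti) ⟩
        0ℤ ∎
        where
        open ≡-Reasoning
        F : ℤ → ℤ → ℤ
        F u v = χ u * (v * (+ 3 * (v * v - u * u)))
        F-even : ∀ u v → F (- u) (- v) ≡ F u v
        F-even u v = trans (cong (_* (- v * (+ 3 * (- v * - v - - u * - u)))) (χ-neg u)) (lem (χ u) u v)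
          where
          lem : ∀ c u v → - c * (- v * (+ 3 * (- v * - v - - u * - u))) ≡ c * (v * (+ 3 * (v * v - u * u)))
          lem = solve-∀
        open Eisenstein B N N≤B F F-even
        term : ∀ u v → H u * (N - + 4 * (u * u)) * (𝟙 (+ 3 * (v * v) ≟ N - u * u) * (ψ v * v)) ≡ f (u , v)
        term u v = begin
          H u * (N - + 4 * (u * u)) * (𝟙 (+ 3 * (v * v) ≟ N - u * u) * (ψ v * v))
            ≡⟨ cong (λ c → H u * (N - + 4 * (u * u)) * (c * (ψ v * v))) (𝟙-cong
                 (λ e → trans (cong (λ s → u * u + s) e) (lem₁ N (u * u)))
                 (λ e → trans (lem₂ (u * u) (+ 3 * (v * v))) (cong (_- u * u) e)) (+ 3 * (v * v) ≟ N - u * u) (norm? (u , v))) ⟩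
          H u * (N - + 4 * (u * u)) * (𝟙 (norm? (u , v)) * (ψ v * v))
            ≡⟨ lem₃ (ψ u) (χ u) (N - + 4 * (u * u)) (𝟙 (norm? (u , v))) (ψ v) v ⟩
          𝟙 (norm? (u , v)) * (ψ u * (ψ v * (χ u * (v * (N - + 4 * (u * u))))))
            ≡⟨ 𝟙-guard (norm? (u , v)) (λ e → cong (λ n → ψ u * (ψ v * (χ u * (v * n)))) (trans (cong (_- + 4 * (u * u)) (sym e)) (lem₄ (u * u) (v * v)))) ⟩
          f (u , v) ∎
          where
          lem₁ : ∀ N s → s + (N - s) ≡ N
          lem₁ = solve-∀
          lem₂ : ∀ s c → c ≡ s + c - s
          lem₂ = solve-∀
          lem₃ : ∀ a c n p b v → a * c * n * (p * (b * v)) ≡ p * (a * (b * (c * (v * n))))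
          lem₃ = solve-∀
          lem₄ : ∀ s t → s + + 3 * t - + 4 * s ≡ + 3 * (t - s)
          lem₄ = solve-∀
        anti : ∑ (Z² B) h ≡ 0ℤ
        anti = ∑-anti (Z²-unique B) neg-w (λ (t , w) → cong (t ,_) (neg-involutive w)) h supp anti-h
          where
          supp : ∀ {tw} → h tw ≢ 0ℤ → tw ∈ Z² B
          supp {t , w} nz = Z²⁺ (≤-trans (x≤4*x (+-mono-≤ (0≤x*x t) (0≤*₊ 3 (0≤x*x w)))) (subst (_≤ + B) (sym (𝟙≢0 (normφ? (t , w)) (*≢0ˡ _ _ nz))) N≤B))
          anti-h : ∀ tw → h (neg-w tw) ≡ - h tw
          anti-h (t , w) = begin
            h (t , - w)
              ≡⟨ cong₂ (λ p o → p * (o * F (t + + 3 * - w) (t - - w)))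
                   (𝟙-cong (trans (sym (lem₁ t w))) (trans (lem₁ t w)) (normφ? (t , - w)) (normφ? (t , w)))
                   (odd-shift (divides w (lem₂ t w))) ⟩
            p * (o * F (t + + 3 * - w) (t - - w))
              ≡⟨ cong (λ c → p * (o * (c * ((t - - w) * (+ 3 * ((t - - w) * (t - - w) - (t + + 3 * - w) * (t + + 3 * - w))))))) (χ-+3 t (- w)) ⟩
            p * (o * (χ t * ((t - - w) * (+ 3 * ((t - - w) * (t - - w) - (t + + 3 * - w) * (t + + 3 * - w))))))
              ≡⟨ lem₃ p o (χ t) t w ⟩
            - (p * (o * (χ t * ((t - w) * (+ 3 * ((t - w) * (t - w) - (t + + 3 * w) * (t + + 3 * w)))))))
              ≡⟨ cong (λ c → - (p * (o * (c * ((t - w) * (+ 3 * ((t - w) * (t - w) - (t + + 3 * w) * (t + + 3 * w)))))))) (χ-+3 t w) ⟨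
            - h (t , w) ∎
            where
            p o : ℤ
            p = 𝟙 (normφ? (t , w))
            o = odd (t - w)
            lem₁ : ∀ t w → + 4 * (t * t + + 3 * (- w * - w)) ≡ + 4 * (t * t + + 3 * (w * w))
            lem₁ = solve-∀
            lem₂ : ∀ t w → t - - w - (t - w) ≡ w * + 2
            lem₂ = solve-∀
            lem₃ : ∀ p o c t w → p * (o * (c * ((t - - w) * (+ 3 * ((t - - w) * (t - - w) - (t + + 3 * - w) * (t + + 3 * - w))))))
                 ≡ - (p * (o * (c * ((t - w) * (+ 3 * ((t - w) * (t - w) - (t + + 3 * w) * (t + + 3 * w)))))))
            lem₃ = solve-∀

    H1 : H 1ℤ ≡ 1ℤ
    H1 = cong₂ _*_ (ψ-yes (divides 0ℤ refl)) χ1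

    H-supp : ∀ x → H x ≢ 0ℤ → + 4 ∣ x - 1ℤ
    H-supp x nz = ψ≢0 (*≢0ˡ (ψ x) (χ x) nz)

    open Theta B H using (R; R-recursion)
    open Uniqueness B 1≤B H H1 H-supp using (R-small; R-diagonal; unique)

    T-term : ∀ v M → M < + 3 → 𝟙 (+ 3 * (v * v) ≟ M) * (ψ v * v) ≡ 0ℤ
    T-term v M M<3 with ψ v ≟ 0ℤ
    ... | yes eq = trans (cong (λ c → 𝟙 (+ 3 * (v * v) ≟ M) * (c * v)) eq) (*-zeroʳ (𝟙 (+ 3 * (v * v) ≟ M)))
    ... | no  nz = cong (_* (ψ v * v)) (𝟙-no (+ 3 * (v * v) ≟ M) (λ e → <-irrefl refl (<-≤-trans M<3 (subst (+ 3 ≤_) e (*-monoˡ-≤-nonNeg (+ 3) 1≤vv)))))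
      where
      1≤vv : 1ℤ ≤ v * v
      1≤vv with v ≟ 1ℤ
      ... | yes refl = ≤-refl
      ... | no  v≢1  = <⇒≤ (1mod4⇒1<x*x v (ψ≢0 nz) v≢1)

    T3 : T (+ 3) ≡ 1ℤ
    T3 = trans (∑-single _ (Z-unique B) (Z⁺ 1≤B) others) (cong (λ c → 1ℤ * (c * 1ℤ)) (ψ-yes {1ℤ} (divides 0ℤ refl)))
      where
      others : ∀ v → v ≢ 1ℤ → 𝟙 (+ 3 * (v * v) ≟ + 3) * (ψ v * v) ≡ 0ℤ
      others v v≢1 with ψ v ≟ 0ℤ
      ... | yes eq = trans (cong (λ c → 𝟙 (+ 3 * (v * v) ≟ + 3) * (c * v)) eq) (*-zeroʳ (𝟙 (+ 3 * (v * v) ≟ + 3)))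
      ... | no  nz = cong (_* (ψ v * v)) (𝟙-no (+ 3 * (v * v) ≟ + 3) (λ e → <-irrefl (sym (*-cancelˡ-≡ (+ 3) (v * v) 1ℤ e)) (1mod4⇒1<x*x v (ψ≢0 nz) v≢1)))

    -- Jacobi's identity for the cube of Euler's pentagonal series.
    R₃≡T : ∀ M → M + 1ℤ ≤ + B → R 3 M ≡ T M
    R₃≡T M M<B = i-j≡0⇒i≡j (R 3 M) (T M) (unique 3 (λ M → R 3 M - T M) (λ M → M + 1ℤ ≤ + B) low rec next M M<B)
      where
      low : ∀ M → M ≤ + 3 → R 3 M - T M ≡ 0ℤ
      low M M≤3 with M ≟ + 3
      ... | yes refl = cong₂ _-_ (R-diagonal 3) T3
      ... | no  M≢3  = cong₂ _-_ (R-small 3 M M<3) (∑-0 (Z B) (λ v → T-term v M M<3))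
        where
        M<3 : M < + 3
        M<3 = ≤∧≢⇒< M≤3 M≢3
      rec : ∀ M → M + 1ℤ ≤ + B → ∑ (Z B) (λ x → H x * ((M + 1ℤ - + 4 * (x * x)) * (R 3 (M + 1ℤ - x * x) - T (M + 1ℤ - x * x)))) ≡ 0ℤ
      rec M le = trans (∑-cong (Z B) (λ x → lem (H x) (M + 1ℤ - + 4 * (x * x)) (R 3 (M + 1ℤ - x * x)) (T (M + 1ℤ - x * x))))
        (trans (∑-- (Z B) _ _) (cong₂ _-_ (R-recursion 3 (M + 1ℤ)) (T-recursion (M + 1ℤ) le)))
        where
        lem : ∀ h n a b → h * (n * (a - b)) ≡ h * (n * a) - h * (n * b)
        lem = solve-∀
      next : ∀ M x → M + 1ℤ ≤ + B → + 4 ∣ x - 1ℤ → x ≢ 1ℤ → M + 1ℤ - x * x + 1ℤ ≤ + B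
      next M x le d x≢1 = ≤-trans (subst (_≤ M + 1ℤ) (lem M (x * x)) (+-monoʳ-≤ (M + 1ℤ) {1ℤ - x * x} {0ℤ} (i≤j⇒i-j≤0 (<⇒≤ (1mod4⇒1<x*x x d x≢1))) ⟨≡⟩ +-identityʳ (M + 1ℤ))) le
        where
        _⟨≡⟩_ : ∀ {a b c} → a ≤ b → b ≡ c → a ≤ c
        p ⟨≡⟩ refl = p
        lem : ∀ M s → M + 1ℤ + (1ℤ - s) ≡ M + 1ℤ - s + 1ℤ
        lem = solve-∀

  module FourSquares (B : ℕ) (1≤B : 1 ℕ.≤ B) where

    ψ1 : ψ 1ℤ ≡ 1ℤ
    ψ1 = ψ-yes (divides 0ℤ refl)

    open Theta B ψ using (R; R-recursion)
    open Uniqueness B 1≤B ψ ψ1 (λ x → ψ≢0) using (R-small; R-diagonal; unique)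

    σ? : ∀ M y z → Dec (0ℤ < y × 0ℤ < z × + 4 * (y * z) ≡ M)
    σ? M y z = 0ℤ <? y ×-dec 0ℤ <? z ×-dec + 4 * (y * z) ≟ M

    σ-small : ∀ M → M < + 4 → σ B M ≡ 0ℤ
    σ-small M M<4 = ∑-0 (Z B) (λ y → ∑-0 (Z B) (λ z → cong (_* y) (𝟙-no (σ? M y z) (λ { (y>0 , z>0 , e) →
      <-irrefl refl (<-≤-trans M<4 (subst (+ 4 ≤_) e (*-monoˡ-≤-nonNeg (+ 4) (i<j⇒suc[i]≤j (0<x*y y>0 z>0))))) }))))

    y*z≡1 : ∀ {y z} → 0ℤ < y → 0ℤ < z → y * z ≡ 1ℤ → y ≡ 1ℤ
    y*z≡1 {+ suc m} {+ suc n} _ _ eq = cong +_ (ℕ.m*n≡1⇒m≡1 (suc m) (suc n) (+-injective eq))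
    y*z≡1 {+ zero} (+<+ ()) _ _
    y*z≡1 {+ suc m} {+ zero} _ (+<+ ()) _

    σ4 : σ B (+ 4) ≡ 1ℤ
    σ4 = trans (∑-single _ (Z-unique B) (Z⁺ 1≤B) (λ y y≢1 → ∑-0 (Z B) (λ z → cong (_* y) (𝟙-no (σ? (+ 4) y z) (λ { (y>0 , z>0 , e) → y≢1 (y*z≡1 y>0 z>0 (*-cancelˡ-≡ (+ 4) (y * z) 1ℤ e)) })))))
       (trans (∑-single _ (Z-unique B) (Z⁺ 1≤B) (λ z z≢1 → cong (_* 1ℤ) (𝟙-no (σ? (+ 4) 1ℤ z) (λ { (y>0 , z>0 , e) → z≢1 (trans (sym (*-identityˡ z)) (*-cancelˡ-≡ (+ 4) (1ℤ * z) 1ℤ e)) }))))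
         (cong (_* 1ℤ) (𝟙-yes (σ? (+ 4) 1ℤ 1ℤ) (+<+ (s≤s z≤n) , +<+ (s≤s z≤n) , refl))))

    -- The recursion for `σ` is available only at N ≡ 5 (mod 8). Odd squares being 1 modulo 8, the
    -- step from M to M + 1 - x² stays in the class of 4. The bound keeps all solutions inside the
    -- box.
    Good : ℤ → Set
    Good M = M + 1ℤ ≤ + B × ∃ λ i → M ≡ + 4 + + 8 * i

    R₄≡σ : ∀ i → + 5 + + 8 * i ≤ + B → R 4 (+ 4 + + 8 * i) ≡ σ B (+ 4 + + 8 * i)
    R₄≡σ i le = i-j≡0⇒i≡j (R 4 M₀) (σ B M₀) (unique 4 (λ M → R 4 M - σ B M) Good low rec next M₀ (subst (_≤ + B) (lem₀ i) le , i , refl))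
      where
      M₀ : ℤ
      M₀ = + 4 + + 8 * i
      lem₀ : ∀ i → + 5 + + 8 * i ≡ + 4 + + 8 * i + 1ℤ
      lem₀ = solve-∀
      low : ∀ M → M ≤ + 4 → R 4 M - σ B M ≡ 0ℤ
      low M M≤4 with M ≟ + 4
      ... | yes refl = cong₂ _-_ (R-diagonal 4) σ4
      ... | no  M≢4  = cong₂ _-_ (R-small 4 M M<4) (σ-small M M<4)
        where
        M<4 : M < + 4
        M<4 = ≤∧≢⇒< M≤4 M≢4
      rec : ∀ M → Good M → ∑ (Z B) (λ x → ψ x * ((M + 1ℤ - + 5 * (x * x)) * (R 4 (M + 1ℤ - x * x) - σ B (M + 1ℤ - x * x)))) ≡ 0ℤ
      rec M (le , i , M≡) = trans (∑-cong (Z B) (λ x → lem (ψ x) (M + 1ℤ - + 5 * (x * x)) (R 4 (M + 1ℤ - x * x)) (σ B (M + 1ℤ - x * x))))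
        (trans (∑-- (Z B) _ _) (cong₂ _-_ (R-recursion 4 (M + 1ℤ))
          (subst (λ N → ∑ (Z B) (λ x → ψ x * ((N - + 5 * (x * x)) * σ B (N - x * x))) ≡ 0ℤ) N≡ (Windmill.σ-recursion B i (subst (_≤ + B) (sym N≡) le)))))
        where
        N≡ : + 5 + + 8 * i ≡ M + 1ℤ
        N≡ = trans (lem₀ i) (cong (_+ 1ℤ) (sym M≡))
        lem : ∀ h n a b → h * (n * (a - b)) ≡ h * (n * a) - h * (n * b)
        lem = solve-∀
      next : ∀ M x → Good M → + 4 ∣ x - 1ℤ → x ≢ 1ℤ → Good (M + 1ℤ - x * x)
      next M x (le , i , M≡) d@(divides q e) x≢1 =
        ≤-trans (subst₂ _≤_ (lem M (x * x)) (+-identityʳ (M + 1ℤ)) (+-monoʳ-≤ (M + 1ℤ) (i≤j⇒i-j≤0 (<⇒≤ (1mod4⇒1<x*x x d x≢1))))) le ,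
        -- For x = 4q + 1, x² = 1 + 8(q + 2q²).
        i - q - + 2 * (q * q) ,
        trans (cong₂ (λ a b → a + 1ℤ - b * b) M≡ (trans (lem₁ x) (cong (_+ 1ℤ) e))) (lem₂ i q)
        where
        lem : ∀ M s → M + 1ℤ + (1ℤ - s) ≡ M + 1ℤ - s + 1ℤ
        lem = solve-∀
        lem₁ : ∀ x → x ≡ x - 1ℤ + 1ℤ
        lem₁ = solve-∀
        lem₂ : ∀ i q → + 4 + + 8 * i + 1ℤ - (q * + 4 + 1ℤ) * (q * + 4 + 1ℤ) ≡ + 4 + + 8 * (i - q - + 2 * (q * q))
        lem₂ = solve-∀

  eis? : ∀ n ((t , w) : ℤ × ℤ) → Dec (t * t + + 3 * (w * w) ≡ n)
  eis? n (t , w) = t * t + + 3 * (w * w) ≟ n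

  -- For odd n this is twice the n-th coefficient of η(6z)⁴, written as a theta series with complex multiplication.
  α : ℕ → ℤ → ℤ
  α B n = ∑ (Z² B) (λ tw@(t , w) → 𝟙 (eis? n tw) * (χ t * t))

  -- Modulo 2 the form t² + 3w² agrees with t - w.
  odd-difference : ∀ t w n → + 2 ∣ n - 1ℤ → t * t + + 3 * (w * w) ≡ n → + 2 ∣ t - w - 1ℤ
  odd-difference t w n d refl = subst (+ 2 ∣_) (lem t w)
    (∣m∣n⇒∣m+n (∣m∣n⇒∣m-n (∣m∣n⇒∣m-n d (2∣x[x+1] t)) (∣n⇒∣m*n (+ 3) (2∣x[x+1] w))) (∣m⇒∣m*n (t + w) (∣-refl {+ 2})))
    where
    lem : ∀ t w → t * t + + 3 * (w * w) - 1ℤ - t * (t + 1ℤ) - + 3 * (w * (w + 1ℤ)) + + 2 * (t + w) ≡ t - w - 1ℤ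
    lem = solve-∀

  module CuspForm (B : ℕ) (1≤B : 1 ℕ.≤ B) (n : ℤ) (n-odd : + 2 ∣ n - 1ℤ) (bound : + 4 * n + 1ℤ ≤ + B) where

    open Jacobi B 1≤B
    open Theta B H using (R)

    4n≤B : + 4 * n ≤ + B
    4n≤B = ≤-trans (subst (_≤ + 4 * n + 1ℤ) (+-identityʳ (+ 4 * n)) (+-monoʳ-≤ (+ 4 * n) {0ℤ} {1ℤ} (+≤+ z≤n))) bound

    F : ℤ → ℤ → ℤ
    F u v = χ u * v

    F-even : ∀ u v → F (- u) (- v) ≡ F u v
    F-even u v = trans (cong (_* (- v)) (χ-neg u)) (lem (χ u) v)
      where
      lem : ∀ c v → - c * - v ≡ c * v
      lem = solve-∀

    open Eisenstein B (+ 4 * n) 4n≤B F F-even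

    -- One of the four factors is kept and the other three are replaced by Jacobi's series, which
    -- leaves a sum over a binary form.
    R₄-as-double-sum : R 4 (+ 4 * n) ≡ ∑ (Z² B) f
    R₄-as-double-sum = begin
      ∑ (Z B) (λ u → H u * R 3 (+ 4 * n - u * u))
        ≡⟨ ∑-cong (Z B) (λ u → cong (H u *_) (R₃≡T (+ 4 * n - u * u) (≤-trans (subst₂ _≤_ (lem (+ 4 * n) (u * u)) (+-identityʳ _) (+-monoʳ-≤ (+ 4 * n + 1ℤ) (neg-mono-≤ (0≤x*x u)))) bound))) ⟩
      ∑ (Z B) (λ u → H u * T (+ 4 * n - u * u))
        ≡⟨ ∑-cong (Z B) (λ u → trans (sym (∑-*ˡ (H u) (Z B) _)) (∑-cong (Z B) (term u))) ⟩
      ∑ (Z B) (λ u → ∑ (Z B) (λ v → f (u , v)))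
        ≡⟨ ∑-× (Z B) (Z B) f ⟨
      ∑ (Z² B) f ∎
      where
      open ≡-Reasoning
      lem : ∀ n s → n + 1ℤ + - s ≡ n - s + 1ℤ
      lem = solve-∀
      term : ∀ u v → H u * (𝟙 (+ 3 * (v * v) ≟ + 4 * n - u * u) * (ψ v * v)) ≡ f (u , v)
      term u v = trans (cong (λ c → H u * (c * (ψ v * v))) (𝟙-cong
                 (λ e → trans (cong (λ s → u * u + s) e) (lem₁ (+ 4 * n) (u * u)))
                 (λ e → trans (lem₂ (u * u) (+ 3 * (v * v))) (cong (_- u * u) e)) (+ 3 * (v * v) ≟ + 4 * n - u * u) (norm? (u , v))))
                 (lem₃ (ψ u) (χ u) (𝟙 (norm? (u , v))) (ψ v) v)
        where
        lem₁ : ∀ N s → s + (N - s) ≡ N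
        lem₁ = solve-∀
        lem₂ : ∀ s c → c ≡ s + c - s
        lem₂ = solve-∀
        lem₃ : ∀ a c p b v → a * c * (p * (b * v)) ≡ p * (a * (b * (c * v)))
        lem₃ = solve-∀

    odd-part : ∑ (Z² B) (λ tw@(t , w) → 𝟙 (eis? n tw) * (χ t * w)) ≡ 0ℤ
    odd-part = ∑-anti (Z²-unique B) neg-w (λ (t , w) → cong (t ,_) (neg-involutive w)) _ supp anti
      where
      supp : ∀ {tw} → 𝟙 (eis? n tw) * (χ (proj₁ tw) * proj₂ tw) ≢ 0ℤ → tw ∈ Z² B
      supp {t , w} nz = Z²⁺ (≤-trans (x≤4*x (+-mono-≤ (0≤x*x t) (0≤*₊ 3 (0≤x*x w)))) (subst (_≤ + B) (cong (+ 4 *_) (sym (𝟙≢0 (eis? n (t , w)) (*≢0ˡ _ _ nz)))) 4n≤B))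
      anti : ∀ ((t , w) : ℤ × ℤ) → 𝟙 (eis? n (t , - w)) * (χ t * - w) ≡ - (𝟙 (eis? n (t , w)) * (χ t * w))
      anti (t , w) = trans (cong (_* (χ t * - w)) (𝟙-cong (trans (sym (lem₁ t w))) (trans (lem₁ t w)) (eis? n (t , - w)) (eis? n (t , w))))
        (lem₂ (𝟙 (eis? n (t , w))) (χ t) w)
        where
        lem₁ : ∀ t w → t * t + + 3 * (- w * - w) ≡ t * t + + 3 * (w * w)
        lem₁ = solve-∀
        lem₂ : ∀ p c w → p * (c * - w) ≡ - (p * (c * w))
        lem₂ = solve-∀

    -- In the new coordinates the weight is χ(t)(t - w), and the part with w cancels under w → -w.
    -- The condition that t - w be odd is automatic for odd n.
    2R₄≡α : R 4 (+ 4 * n) + R 4 (+ 4 * n) ≡ α B n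
    2R₄≡α = begin
      R 4 (+ 4 * n) + R 4 (+ 4 * n)  ≡⟨ cong (λ s → s + s) R₄-as-double-sum ⟩
      ∑ (Z² B) f + ∑ (Z² B) f        ≡⟨ reindexed ⟩
      ∑ (Z² B) h                     ≡⟨ ∑-cong (Z² B) term ⟩
      ∑ (Z² B) (λ tw@(t , w) → 𝟙 (eis? n tw) * (χ t * t) - 𝟙 (eis? n tw) * (χ t * w)) ≡⟨ ∑-- (Z² B) _ _ ⟩
      α B n - ∑ (Z² B) (λ tw@(t , w) → 𝟙 (eis? n tw) * (χ t * w)) ≡⟨ cong (λ s → α B n - s) odd-part ⟩
      α B n - 0ℤ                     ≡⟨ +-identityʳ (α B n) ⟩
      α B n                          ∎
      where
      open ≡-Reasoning
      term : ∀ ((t , w) : ℤ × ℤ) → h (t , w) ≡ 𝟙 (eis? n (t , w)) * (χ t * t) - 𝟙 (eis? n (t , w)) * (χ t * w)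
      term (t , w) = begin
        𝟙 (normφ? (t , w)) * (odd (t - w) * (χ (t + + 3 * w) * (t - w)))
          ≡⟨ cong₂ (λ p c → p * (odd (t - w) * (c * (t - w)))) (𝟙-cong (*-cancelˡ-≡ (+ 4) _ n) (cong (+ 4 *_)) (normφ? (t , w)) (eis? n (t , w))) (χ-+3 t w) ⟩
        𝟙 (eis? n (t , w)) * (odd (t - w) * (χ t * (t - w)))
          ≡⟨ 𝟙-guard (eis? n (t , w)) (λ e → trans (cong (_* (χ t * (t - w))) (odd-yes (odd-difference t w n n-odd e))) (*-identityˡ _)) ⟩
        𝟙 (eis? n (t , w)) * (χ t * (t - w))
          ≡⟨ lem (𝟙 (eis? n (t , w))) (χ t) t w ⟩
        𝟙 (eis? n (t , w)) * (χ t * t) - 𝟙 (eis? n (t , w)) * (χ t * w) ∎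
        where
        lem : ∀ p c t w → p * (c * (t - w)) ≡ p * (c * t) - p * (c * w)
        lem = solve-∀

  -- From r₁₃ to theta coefficients: the Hadamard transform and sums over signs.

  opaque
    unfolding ψ χ δ

    -- 1 - χχχχ and ψψψψ in the coordinates of the Hadamard transform.
    ω : ℤ → ℤ → ℤ → ℤ → ℤ
    ω a b c d = 1ℤ - χ (a + b + c + d) * (χ (a + b - c - d) * (χ (a - b + c - d) * χ (a - b - c + d)))

    Ψ : ℤ → ℤ → ℤ → ℤ → ℤ
    Ψ a b c d = ψ (a + b + c + d) * (ψ (a + b - c - d) * (ψ (a - b + c - d) * ψ (a - b - c + d)))

    t : ℤ → ℤ
    t x = δ (+ 3) (x - 1ℤ)

    N₄ : ℤ → ℤ → ℤ → ℤ → ℤ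
    N₄ a b c d = a * a + b * b + c * c + d * d

  ± : (ℤ → ℤ) → ℤ
  ± f = f 1ℤ + f (- 1ℤ)

  -- The indicator of 3 ∤ x, split according to which of x and -x is 1 modulo 3.
  τ : ℤ → ℤ
  τ x = ± (λ s → t (s * x))

  -- If a, b, c, d ≡ 1 (mod 3), then ω (s₁ a) (s₂ b) (s₃ c) (s₄ d) = ω s₁ s₂ s₃ s₄, so this is the sum of Ψ ω over all changes of sign.
  K : ℤ → ℤ → ℤ → ℤ → ℤ
  K a b c d = ± (λ s₄ → ± (λ s₃ → ± (λ s₂ → ± (λ s₁ → Ψ (s₁ * a) (s₂ * b) (s₃ * c) (s₄ * d) * ω s₁ s₂ s₃ s₄))))

  -- `Ψ` can be nonzero only if the first coordinate differs in parity from the other three. Letting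
  -- each coordinate take the first place restores the symmetry.
  K-sym : ℤ → ℤ → ℤ → ℤ → ℤ
  K-sym a b c d = K a b c d + K b a c d + (K c b a d + K d b c a)

  opaque
    unfolding ω Ψ t N₄ ψ χ δ

    ω≡ : ∀ a b c d → ω a b c d ≡ 1ℤ - χ (a + b + c + d) * (χ (a + b - c - d) * (χ (a - b + c - d) * χ (a - b - c + d)))
    ω≡ a b c d = refl

    Ψ≡ : ∀ a b c d → Ψ a b c d ≡ ψ (a + b + c + d) * (ψ (a + b - c - d) * (ψ (a - b + c - d) * ψ (a - b - c + d)))
    Ψ≡ a b c d = refl

    N₄≡ : ∀ a b c d → N₄ a b c d ≡ a * a + b * b + c * c + d * d
    N₄≡ a b c d = refl

    t≡ : ∀ x → t x ≡ δ (+ 3) (x - 1ℤ)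
    t≡ x = refl

    t-𝟙 : ∀ x → t x ≡ 𝟙 (+ 3 ∣? x - 1ℤ)
    t-𝟙 x = refl

    δ-guard : ∀ m a {x y} → (m ∣ a → x ≡ y) → δ m a * x ≡ δ m a * y
    δ-guard m a eq = 𝟙-guard (m ∣? a) eq

    -- If the norm is 1 modulo 3, one or four coordinates are prime to 3. With one, the Hadamard
    -- coordinates are plus or minus that one with an even number of minus signs, so the product of
    -- characters is 1 and `ω` is zero; with four, every `τ` is 1.
    ω-table : ∀ (a b c d : Fin 3) → let a = + toℕ a ; b = + toℕ b ; c = + toℕ c ; d = + toℕ d in
      δ (+ 3) (N₄ a b c d - 1ℤ) * ω a b c d ≡ δ (+ 3) (N₄ a b c d - 1ℤ) * (τ a * (τ b * (τ c * (τ d * ω a b c d))))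
    ω-table = toWitness {a? = all? λ a → all? λ b → all? λ c → all? λ d → let a = + toℕ a ; b = + toℕ b ; c = + toℕ c ; d = + toℕ d in
      δ (+ 3) (N₄ a b c d - 1ℤ) * ω a b c d ≟ δ (+ 3) (N₄ a b c d - 1ℤ) * (τ a * (τ b * (τ c * (τ d * ω a b c d))))} _

    K-table : ∀ (a b c d : Fin 4) → let a = + toℕ a ; b = + toℕ b ; c = + toℕ c ; d = + toℕ d in
      δ (+ 2) (N₄ a b c d - 1ℤ) * K-sym a b c d ≡ δ (+ 2) (N₄ a b c d - 1ℤ) * + 12
    K-table = toWitness {a? = all? λ a → all? λ b → all? λ c → all? λ d → let a = + toℕ a ; b = + toℕ b ; c = + toℕ c ; d = + toℕ d in
      δ (+ 2) (N₄ a b c d - 1ℤ) * K-sym a b c d ≟ δ (+ 2) (N₄ a b c d - 1ℤ) * + 12} _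

  ±-cong : ∀ {f g : ℤ → ℤ} → (∀ s → f s ≡ g s) → ± f ≡ ± g
  ±-cong eq = cong₂ _+_ (eq 1ℤ) (eq (- 1ℤ))

  ±-*ˡ : ∀ c (f : ℤ → ℤ) → ± (λ s → c * f s) ≡ c * ± f
  ±-*ˡ c f = sym (*-distribˡ-+ c (f 1ℤ) (f (- 1ℤ)))

  cong₄ : ∀ (f : ℤ → ℤ → ℤ → ℤ → ℤ) {a a′ b b′ c c′ d d′} → a ≡ a′ → b ≡ b′ → c ≡ c′ → d ≡ d′ → f a b c d ≡ f a′ b′ c′ d′
  cong₄ f refl refl refl refl = refl

  module Congruences {m a b c d a′ b′ c′ d′ : ℤ} (da : m ∣ a - a′) (db : m ∣ b - b′) (dc : m ∣ c - c′) (dd : m ∣ d - d′) where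

    s₁ : m ∣ (a + b + c + d) - (a′ + b′ + c′ + d′)
    s₁ = subst (m ∣_) (lem a a′ b b′ c c′ d d′) (∣m∣n⇒∣m+n (∣m∣n⇒∣m+n (∣m∣n⇒∣m+n da db) dc) dd)
      where
      lem : ∀ a a′ b b′ c c′ d d′ → (a - a′) + (b - b′) + (c - c′) + (d - d′) ≡ (a + b + c + d) - (a′ + b′ + c′ + d′)
      lem = solve-∀

    s₂ : m ∣ (a + b - c - d) - (a′ + b′ - c′ - d′)
    s₂ = subst (m ∣_) (lem a a′ b b′ c c′ d d′) (∣m∣n⇒∣m-n (∣m∣n⇒∣m-n (∣m∣n⇒∣m+n da db) dc) dd)
      where
      lem : ∀ a a′ b b′ c c′ d d′ → (a - a′) + (b - b′) - (c - c′) - (d - d′) ≡ (a + b - c - d) - (a′ + b′ - c′ - d′)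
      lem = solve-∀

    s₃ : m ∣ (a - b + c - d) - (a′ - b′ + c′ - d′)
    s₃ = subst (m ∣_) (lem a a′ b b′ c c′ d d′) (∣m∣n⇒∣m-n (∣m∣n⇒∣m+n (∣m∣n⇒∣m-n da db) dc) dd)
      where
      lem : ∀ a a′ b b′ c c′ d d′ → (a - a′) - (b - b′) + (c - c′) - (d - d′) ≡ (a - b + c - d) - (a′ - b′ + c′ - d′)
      lem = solve-∀

    s₄ : m ∣ (a - b - c + d) - (a′ - b′ - c′ + d′)
    s₄ = subst (m ∣_) (lem a a′ b b′ c c′ d d′) (∣m∣n⇒∣m+n (∣m∣n⇒∣m-n (∣m∣n⇒∣m-n da db) dc) dd)
      where
      lem : ∀ a a′ b b′ c c′ d d′ → (a - a′) - (b - b′) - (c - c′) + (d - d′) ≡ (a - b - c + d) - (a′ - b′ - c′ + d′)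
      lem = solve-∀

    norm : m ∣ (N₄ a b c d - 1ℤ) - (N₄ a′ b′ c′ d′ - 1ℤ)
    norm = subst₂ (λ x y → m ∣ (x - 1ℤ) - (y - 1ℤ)) (sym (N₄≡ a b c d)) (sym (N₄≡ a′ b′ c′ d′))
        (subst (m ∣_) (lem a a′ b b′ c c′ d d′) (∣m∣n⇒∣m+n (∣m∣n⇒∣m+n (∣m∣n⇒∣m+n (∣m⇒∣m*n (a + a′) da) (∣m⇒∣m*n (b + b′) db)) (∣m⇒∣m*n (c + c′) dc)) (∣m⇒∣m*n (d + d′) dd)))
      where
      lem : ∀ a a′ b b′ c c′ d d′ → (a - a′) * (a + a′) + (b - b′) * (b + b′) + (c - c′) * (c + c′) + (d - d′) * (d + d′) ≡ (a * a + b * b + c * c + d * d - 1ℤ) - (a′ * a′ + b′ * b′ + c′ * c′ + d′ * d′ - 1ℤ)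
      lem = solve-∀

  ∣-scale : ∀ m s {x y} → m ∣ x - y → m ∣ s * x - s * y
  ∣-scale m s {x} {y} d = subst (m ∣_) (lem s x y) (∣n⇒∣m*n s d)
    where
    lem : ∀ s x y → s * (x - y) ≡ s * x - s * y
    lem = solve-∀

  t-shift : ∀ {x y} → + 3 ∣ x - y → t x ≡ t y
  t-shift {x} {y} d = trans (t≡ x) (trans (δ-shift (+ 3) (subst (+ 3 ∣_) (lem x y) d)) (sym (t≡ y)))
    where
    lem : ∀ x y → x - y ≡ (x - 1ℤ) - (y - 1ℤ)
    lem = solve-∀

  τ-shift : ∀ {x y} → + 3 ∣ x - y → τ x ≡ τ y
  τ-shift {x} {y} d = ±-cong (λ s → t-shift {s * x} {s * y} (∣-scale (+ 3) s {x} {y} d))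

  module _ {a b c d a′ b′ c′ d′ : ℤ} where

    ω-shift : + 3 ∣ a - a′ → + 3 ∣ b - b′ → + 3 ∣ c - c′ → + 3 ∣ d - d′ → ω a b c d ≡ ω a′ b′ c′ d′
    ω-shift da db dc dd = trans (ω≡ a b c d) (trans (cong (λ x → 1ℤ - x)
        (cong₂ _*_ (χ-shift s₁) (cong₂ _*_ (χ-shift s₂) (cong₂ _*_ (χ-shift s₃) (χ-shift s₄))))) (sym (ω≡ a′ b′ c′ d′)))
      where open Congruences {+ 3} {a} {b} {c} {d} {a′} {b′} {c′} {d′} da db dc dd

    K-shift : + 4 ∣ a - a′ → + 4 ∣ b - b′ → + 4 ∣ c - c′ → + 4 ∣ d - d′ → K a b c d ≡ K a′ b′ c′ d′
    K-shift da db dc dd = ±-cong (λ s₄ → ±-cong (λ s₃ → ±-cong (λ s₂ → ±-cong (λ s₁ → cong (_* ω s₁ s₂ s₃ s₄)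
      (scaled s₁ s₂ s₃ s₄)))))
      where
      scaled : ∀ s₁ s₂ s₃ s₄ → Ψ (s₁ * a) (s₂ * b) (s₃ * c) (s₄ * d) ≡ Ψ (s₁ * a′) (s₂ * b′) (s₃ * c′) (s₄ * d′)
      scaled s₁ s₂ s₃ s₄ = trans (Ψ≡ _ _ _ _) (trans
        (cong₂ _*_ (ψ-shift C.s₁) (cong₂ _*_ (ψ-shift C.s₂) (cong₂ _*_ (ψ-shift C.s₃) (ψ-shift C.s₄)))) (sym (Ψ≡ _ _ _ _)))
        where module C = Congruences {+ 4} {s₁ * a} {s₂ * b} {s₃ * c} {s₄ * d} {s₁ * a′} {s₂ * b′} {s₃ * c′} {s₄ * d′} (∣-scale (+ 4) s₁ {a} {a′} da) (∣-scale (+ 4) s₂ {b} {b′} db) (∣-scale (+ 4) s₃ {c} {c′} dc) (∣-scale (+ 4) s₄ {d} {d′} dd)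

  ω-nonzero : ∀ a b c d → + 3 ∣ N₄ a b c d - 1ℤ → ω a b c d ≡ τ a * (τ b * (τ c * (τ d * ω a b c d)))
  ω-nonzero a b c d N≡1 with i , da ← residue 3 a | j , db ← residue 3 b | k , dc ← residue 3 c | l , dd ← residue 3 d = begin
      ω a b c d       ≡⟨ *-identityˡ _ ⟨
      1ℤ * ω a b c d  ≡⟨ cong₂ _*_ (sym δ≡1) (ω-shift da db dc dd) ⟩
      δ (+ 3) (N₄ (+ toℕ i) (+ toℕ j) (+ toℕ k) (+ toℕ l) - 1ℤ) * ω (+ toℕ i) (+ toℕ j) (+ toℕ k) (+ toℕ l)
        ≡⟨ ω-table i j k l ⟩
      δ (+ 3) (N₄ (+ toℕ i) (+ toℕ j) (+ toℕ k) (+ toℕ l) - 1ℤ) * (τ (+ toℕ i) * (τ (+ toℕ j) * (τ (+ toℕ k) * (τ (+ toℕ l) * ω (+ toℕ i) (+ toℕ j) (+ toℕ k) (+ toℕ l)))))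
        ≡⟨ cong₂ _*_ (sym δ≡1) (cong₂ _*_ (τ-shift da) (cong₂ _*_ (τ-shift db) (cong₂ _*_ (τ-shift dc) (cong₂ _*_ (τ-shift dd) (ω-shift da db dc dd))))) ⟨
      1ℤ * (τ a * (τ b * (τ c * (τ d * ω a b c d)))) ≡⟨ *-identityˡ _ ⟩
      τ a * (τ b * (τ c * (τ d * ω a b c d)))        ∎
    where
    open ≡-Reasoning
    δ≡1 : δ (+ 3) (N₄ (+ toℕ i) (+ toℕ j) (+ toℕ k) (+ toℕ l) - 1ℤ) ≡ 1ℤ
    δ≡1 = trans (sym (δ-shift (+ 3) (Congruences.norm {+ 3} da db dc dd))) (δ-yes N≡1)

  K-sym≡12 : ∀ a b c d → + 2 ∣ N₄ a b c d - 1ℤ → K-sym a b c d ≡ + 12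
  K-sym≡12 a b c d odd with i , da ← residue 4 a | j , db ← residue 4 b | k , dc ← residue 4 c | l , dd ← residue 4 d = begin
      K-sym a b c d        ≡⟨ cong₂ _+_ (cong₂ _+_ (K-shift da db dc dd) (K-shift db da dc dd)) (cong₂ _+_ (K-shift dc db da dd) (K-shift dd db dc da)) ⟩
      K-sym (+ toℕ i) (+ toℕ j) (+ toℕ k) (+ toℕ l)       ≡⟨ *-identityˡ _ ⟨
      1ℤ * K-sym (+ toℕ i) (+ toℕ j) (+ toℕ k) (+ toℕ l)  ≡⟨ cong (_* K-sym (+ toℕ i) (+ toℕ j) (+ toℕ k) (+ toℕ l)) δ≡1 ⟨
      δ (+ 2) (N₄ (+ toℕ i) (+ toℕ j) (+ toℕ k) (+ toℕ l) - 1ℤ) * K-sym (+ toℕ i) (+ toℕ j) (+ toℕ k) (+ toℕ l)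
        ≡⟨ K-table i j k l ⟩
      δ (+ 2) (N₄ (+ toℕ i) (+ toℕ j) (+ toℕ k) (+ toℕ l) - 1ℤ) * + 12
        ≡⟨ cong (_* + 12) δ≡1 ⟩
      + 12 ∎
    where
    open ≡-Reasoning
    δ≡1 : δ (+ 2) (N₄ (+ toℕ i) (+ toℕ j) (+ toℕ k) (+ toℕ l) - 1ℤ) ≡ 1ℤ
    δ≡1 = trans (sym (δ-shift (+ 2) (Congruences.norm {+ 2} (4∣⇒2∣ da) (4∣⇒2∣ db) (4∣⇒2∣ dc) (4∣⇒2∣ dd)))) (δ-yes odd)

  module Quadruples (n : ℕ) where

    ∑⁴ : (ℤ → ℤ → ℤ → ℤ → ℤ) → ℤ
    ∑⁴ f = ∑ (Z n) (λ a → ∑ (Z n) (λ b → ∑ (Z n) (λ c → ∑ (Z n) (λ d → f a b c d))))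

    ∑⁴-cong : ∀ {f g : ℤ → ℤ → ℤ → ℤ → ℤ} → (∀ a b c d → f a b c d ≡ g a b c d) → ∑⁴ f ≡ ∑⁴ g
    ∑⁴-cong eq = ∑-cong (Z n) (λ a → ∑-cong (Z n) (λ b → ∑-cong (Z n) (λ c → ∑-cong (Z n) (eq a b c))))

    ∑⁴-+ : ∀ (f g : ℤ → ℤ → ℤ → ℤ → ℤ) → ∑⁴ (λ a b c d → f a b c d + g a b c d) ≡ ∑⁴ f + ∑⁴ g
    ∑⁴-+ f g = trans (∑-cong (Z n) (λ a → trans (∑-cong (Z n) (λ b → trans (∑-cong (Z n) (λ c → ∑-+ (Z n) (f a b c) (g a b c)))
      (∑-+ (Z n) _ _))) (∑-+ (Z n) _ _))) (∑-+ (Z n) _ _)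

    ∑⁴-*ˡ : ∀ k (f : ℤ → ℤ → ℤ → ℤ → ℤ) → ∑⁴ (λ a b c d → k * f a b c d) ≡ k * ∑⁴ f
    ∑⁴-*ˡ k f = trans (∑-cong (Z n) (λ a → trans (∑-cong (Z n) (λ b → trans (∑-cong (Z n) (λ c → ∑-*ˡ k (Z n) (f a b c)))
      (∑-*ˡ k (Z n) _))) (∑-*ˡ k (Z n) _))) (∑-*ˡ k (Z n) _)

    swap₁₂ : ∀ (f : ℤ → ℤ → ℤ → ℤ → ℤ) → ∑⁴ (λ a b c d → f b a c d) ≡ ∑⁴ f
    swap₁₂ f = ∑-swap (Z n) (Z n) _

    swap₂₃ : ∀ (f : ℤ → ℤ → ℤ → ℤ → ℤ) → ∑⁴ (λ a b c d → f a c b d) ≡ ∑⁴ f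
    swap₂₃ f = ∑-cong (Z n) (λ a → ∑-swap (Z n) (Z n) _)

    swap₃₄ : ∀ (f : ℤ → ℤ → ℤ → ℤ → ℤ) → ∑⁴ (λ a b c d → f a b d c) ≡ ∑⁴ f
    swap₃₄ f = ∑-cong (Z n) (λ a → ∑-cong (Z n) (λ b → ∑-swap (Z n) (Z n) _))

    swap₁₃ : ∀ (f : ℤ → ℤ → ℤ → ℤ → ℤ) → ∑⁴ (λ a b c d → f c b a d) ≡ ∑⁴ f
    swap₁₃ f = trans (swap₂₃ (λ a b c d → f b c a d)) (trans (swap₁₂ (λ a b c d → f a c b d)) (swap₂₃ f))

    swap₁₄ : ∀ (f : ℤ → ℤ → ℤ → ℤ → ℤ) → ∑⁴ (λ a b c d → f d b c a) ≡ ∑⁴ f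
    swap₁₄ f = trans (swap₃₄ (λ a b c d → f c b d a)) (trans (swap₁₃ (λ a b c d → f a b d c)) (swap₃₄ f))

    -- Reflecting the half with -x ≡ 1 (mod 3) turns a sum over x prime to 3 into a sum over x ≡ 1
    -- (mod 3) of the values at x and -x.
    flip : ∀ (f : ℤ → ℤ) → ∑ (Z n) (λ x → τ x * f x) ≡ ∑ (Z n) (λ x → t x * ± (λ s → f (s * x)))
    flip f = begin
      ∑ (Z n) (λ x → τ x * f x)
        ≡⟨ ∑-cong (Z n) (λ x → cong₂ (λ y z → (t y + t z) * f x) (*-identityˡ x) (-1*i≡-i x)) ⟩
      ∑ (Z n) (λ x → (t x + t (- x)) * f x)
        ≡⟨ ∑-cong (Z n) (λ x → *-distribʳ-+ (f x) (t x) (t (- x))) ⟩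
      ∑ (Z n) (λ x → t x * f x + t (- x) * f x)
        ≡⟨ ∑-+ (Z n) _ _ ⟩
      ∑ (Z n) (λ x → t x * f x) + ∑ (Z n) (λ x → t (- x) * f x)
        ≡⟨ cong (λ z → ∑ (Z n) (λ x → t x * f x) + z) (∑-Z-neg n (λ x → t (- x) * f x)) ⟨
      ∑ (Z n) (λ x → t x * f x) + ∑ (Z n) (λ x → t (- - x) * f (- x))
        ≡⟨ ∑-+ (Z n) _ _ ⟨
      ∑ (Z n) (λ x → t x * f x + t (- - x) * f (- x))
        ≡⟨ ∑-cong (Z n) (λ x → trans (cong (λ z → t x * f x + t z * f (- x)) (neg-involutive x)) (trans (sym (*-distribˡ-+ (t x) (f x) (f (- x))))
             (cong₂ (λ y z → t x * (f y + f z)) (sym (*-identityˡ x)) (sym (-1*i≡-i x))))) ⟩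
      ∑ (Z n) (λ x → t x * ± (λ s → f (s * x))) ∎
      where open ≡-Reasoning

    flip-× : {Y : Set} (ys : List Y) (f : ℤ → Y → ℤ) → ∑ (Z n) (λ x → ∑ ys (λ y → τ x * f x y)) ≡ ∑ (Z n) (λ x → ∑ ys (λ y → t x * ± (λ s → f (s * x) y)))
    flip-× ys f = trans (∑-swap (Z n) ys _) (trans (∑-cong ys (λ y → flip (λ x → f x y))) (∑-swap ys (Z n) _))

    pack : ∀ (f : ℤ → ℤ → ℤ → ℤ) → ∑ (cartesianProduct (Z n) (cartesianProduct (Z n) (Z n))) (λ (b , c , d) → f b c d) ≡ ∑ (Z n) (λ b → ∑ (Z n) (λ c → ∑ (Z n) (λ d → f b c d)))
    pack f = trans (∑-× (Z n) (cartesianProduct (Z n) (Z n)) _) (∑-cong (Z n) (λ b → ∑-× (Z n) (Z n) _))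

    flip₁ : ∀ (f : ℤ → ℤ → ℤ → ℤ → ℤ) → ∑⁴ (λ a b c d → τ a * f a b c d) ≡ ∑⁴ (λ a b c d → t a * ± (λ s → f (s * a) b c d))
    flip₁ f = trans (∑-cong (Z n) (λ a → sym (pack (λ b c d → τ a * f a b c d)))) (trans (flip-× (cartesianProduct (Z n) (cartesianProduct (Z n) (Z n))) (λ a (b , c , d) → f a b c d)) (∑-cong (Z n) (λ a → pack (λ b c d → t a * ± (λ s → f (s * a) b c d)))))

    flip₂ : ∀ (f : ℤ → ℤ → ℤ → ℤ → ℤ) → ∑⁴ (λ a b c d → τ b * f a b c d) ≡ ∑⁴ (λ a b c d → t b * ± (λ s → f a (s * b) c d))
    flip₂ f = trans (sym (swap₁₂ (λ a b c d → τ b * f a b c d))) (trans (flip₁ (λ a b c d → f b a c d)) (swap₁₂ (λ a b c d → t b * ± (λ s → f a (s * b) c d))))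

    flip₃ : ∀ (f : ℤ → ℤ → ℤ → ℤ → ℤ) → ∑⁴ (λ a b c d → τ c * f a b c d) ≡ ∑⁴ (λ a b c d → t c * ± (λ s → f a b (s * c) d))
    flip₃ f = trans (sym (swap₁₃ (λ a b c d → τ c * f a b c d))) (trans (flip₁ (λ a b c d → f c b a d)) (swap₁₃ (λ a b c d → t c * ± (λ s → f a b (s * c) d))))

    flip₄ : ∀ (f : ℤ → ℤ → ℤ → ℤ → ℤ) → ∑⁴ (λ a b c d → τ d * f a b c d) ≡ ∑⁴ (λ a b c d → t d * ± (λ s → f a b c (s * d)))
    flip₄ f = trans (sym (swap₁₄ (λ a b c d → τ d * f a b c d))) (trans (flip₁ (λ a b c d → f d b c a)) (swap₁₄ (λ a b c d → t d * ± (λ s → f a b c (s * d)))))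

    signs : (ℤ → ℤ → ℤ → ℤ → ℤ) → ℤ → ℤ → ℤ → ℤ → ℤ
    signs f a b c d = ± (λ s₄ → ± (λ s₃ → ± (λ s₂ → ± (λ s₁ → f (s₁ * a) (s₂ * b) (s₃ * c) (s₄ * d)))))

    t⁴ : ℤ → ℤ → ℤ → ℤ → ℤ → ℤ
    t⁴ a b c d x = t a * (t b * (t c * (t d * x)))

    flip-all : ∀ (f : ℤ → ℤ → ℤ → ℤ → ℤ) → ∑⁴ (λ a b c d → τ a * (τ b * (τ c * (τ d * f a b c d)))) ≡ ∑⁴ (λ a b c d → t⁴ a b c d (signs f a b c d))
    flip-all f = begin
      ∑⁴ (λ a b c d → τ a * (τ b * (τ c * (τ d * f a b c d))))
        ≡⟨ flip₁ (λ a b c d → τ b * (τ c * (τ d * f a b c d))) ⟩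
      ∑⁴ (λ a b c d → t a * ± (λ s → τ b * (τ c * (τ d * f (s * a) b c d))))
        ≡⟨ ∑⁴-cong (λ a b c d → lem₁ (t a) (τ b) (τ c) (τ d) (f (1ℤ * a) b c d) (f (- 1ℤ * a) b c d)) ⟩
      ∑⁴ (λ a b c d → τ b * (τ c * (τ d * (t a * ± (λ s → f (s * a) b c d)))))
        ≡⟨ flip₂ (λ a b c d → τ c * (τ d * (t a * ± (λ s → f (s * a) b c d)))) ⟩
      ∑⁴ (λ a b c d → t b * ± (λ s₂ → τ c * (τ d * (t a * ± (λ s → f (s * a) (s₂ * b) c d)))))
        ≡⟨ ∑⁴-cong (λ a b c d → lem₂ (t b) (τ c) (τ d) (t a) (± (λ s → f (s * a) (1ℤ * b) c d)) (± (λ s → f (s * a) (- 1ℤ * b) c d))) ⟩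
      ∑⁴ (λ a b c d → τ c * (τ d * (t a * (t b * ± (λ s₂ → ± (λ s → f (s * a) (s₂ * b) c d))))))
        ≡⟨ flip₃ (λ a b c d → τ d * (t a * (t b * ± (λ s₂ → ± (λ s → f (s * a) (s₂ * b) c d))))) ⟩
      ∑⁴ (λ a b c d → t c * ± (λ s₃ → τ d * (t a * (t b * ± (λ s₂ → ± (λ s → f (s * a) (s₂ * b) (s₃ * c) d))))))
        ≡⟨ ∑⁴-cong (λ a b c d → lem₃ (t c) (τ d) (t a) (t b) (± (λ s₂ → ± (λ s → f (s * a) (s₂ * b) (1ℤ * c) d))) (± (λ s₂ → ± (λ s → f (s * a) (s₂ * b) (- 1ℤ * c) d)))) ⟩
      ∑⁴ (λ a b c d → τ d * (t a * (t b * (t c * ± (λ s₃ → ± (λ s₂ → ± (λ s → f (s * a) (s₂ * b) (s₃ * c) d)))))))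
        ≡⟨ flip₄ (λ a b c d → t a * (t b * (t c * ± (λ s₃ → ± (λ s₂ → ± (λ s → f (s * a) (s₂ * b) (s₃ * c) d)))))) ⟩
      ∑⁴ (λ a b c d → t d * ± (λ s₄ → t a * (t b * (t c * ± (λ s₃ → ± (λ s₂ → ± (λ s → f (s * a) (s₂ * b) (s₃ * c) (s₄ * d))))))))
        ≡⟨ ∑⁴-cong (λ a b c d → lem₄ (t d) (t a) (t b) (t c) (± (λ s₃ → ± (λ s₂ → ± (λ s → f (s * a) (s₂ * b) (s₃ * c) (1ℤ * d))))) (± (λ s₃ → ± (λ s₂ → ± (λ s → f (s * a) (s₂ * b) (s₃ * c) (- 1ℤ * d)))))) ⟩
      ∑⁴ (λ a b c d → t⁴ a b c d (signs f a b c d)) ∎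
      where
      open ≡-Reasoning
      lem₁ : ∀ t b c d x y → t * (b * (c * (d * x)) + b * (c * (d * y))) ≡ b * (c * (d * (t * (x + y))))
      lem₁ = solve-∀
      lem₂ : ∀ t c d a x y → t * (c * (d * (a * x)) + c * (d * (a * y))) ≡ c * (d * (a * (t * (x + y))))
      lem₂ = solve-∀
      lem₃ : ∀ t d a b x y → t * (d * (a * (b * x)) + d * (a * (b * y))) ≡ d * (a * (b * (t * (x + y))))
      lem₃ = solve-∀
      lem₄ : ∀ t a b c x y → t * (a * (b * (c * x)) + a * (b * (c * y))) ≡ a * (b * (c * (t * (x + y))))
      lem₄ = solve-∀

  ±-cong₁ : ∀ {f g : ℤ → ℤ} → (∀ s → s * s ≡ 1ℤ → f s ≡ g s) → ± f ≡ ± g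
  ±-cong₁ eq = cong₂ _+_ (eq 1ℤ refl) (eq (- 1ℤ) refl)

  ∑-quadruples : (xs : List ℤ) (f : ℤ × ℤ × ℤ × ℤ → ℤ) →
    ∑ (concatMap (λ a → concatMap (λ b → concatMap (λ c → map (λ d → (a , b , c , d)) xs) xs) xs) xs) f
    ≡ ∑ xs (λ a → ∑ xs (λ b → ∑ xs (λ c → ∑ xs (λ d → f (a , b , c , d)))))
  ∑-quadruples xs f =
    trans (∑-concatMap (λ a → concatMap (λ b → concatMap (λ c → map (λ d → (a , b , c , d)) xs) xs) xs) xs f) (∑-cong xs (λ a →
    trans (∑-concatMap (λ b → concatMap (λ c → map (λ d → (a , b , c , d)) xs) xs) xs f) (∑-cong xs (λ b →
    trans (∑-concatMap (λ c → map (λ d → (a , b , c , d)) xs) xs f) (∑-cong xs (λ c → ∑-map (λ d → (a , b , c , d)) xs f))))))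

  ≡1mod3⇒∣ : ∀ x → x %ℕ 3 ≡ 1 → + 3 ∣ x - 1ℤ
  ≡1mod3⇒∣ x eq = divides (x /ℕ 3) (trans (cong (_- 1ℤ) (trans (a≡a%ℕn+[a/ℕn]*n x 3) (cong (λ r → + r + (x /ℕ 3) * + 3) eq))) (lem (x /ℕ 3)))
    where
    lem : ∀ q → 1ℤ + q * + 3 - 1ℤ ≡ q * + 3
    lem = solve-∀

  ∣⇒≡1mod3 : ∀ x → + 3 ∣ x - 1ℤ → x %ℕ 3 ≡ 1
  ∣⇒≡1mod3 x d = go (x %ℕ 3) (n%ℕd<d x 3) (subst (+ 3 ∣_) (trans (cong (λ y → y - 1ℤ - (x /ℕ 3) * + 3) (a≡a%ℕn+[a/ℕn]*n x 3)) (lem (+ (x %ℕ 3)) (x /ℕ 3)))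
      (∣m∣n⇒∣m-n d (∣n⇒∣m*n (x /ℕ 3) (∣-refl {+ 3}))))
    where
    lem : ∀ r q → r + q * + 3 - 1ℤ - q * + 3 ≡ r - 1ℤ
    lem = solve-∀
    go : ∀ r → r ℕ.< 3 → + 3 ∣ + r - 1ℤ → r ≡ 1
    go 0 _ d = contradiction d (from-no (+ 3 ∣? (0ℤ - 1ℤ)))
    go 1 _ _ = refl
    go 2 _ d = contradiction d (from-no (+ 3 ∣? (+ 2 - 1ℤ)))
    go (suc (suc (suc _))) (s≤s (s≤s (s≤s ()))) _

  module Lattice (n : ℕ) where

    open Quadruples n

    norm? : ∀ a b c d → Dec (N₄ a b c d ≡ + n)
    norm? a b c d = N₄ a b c d ≟ + n

    p : ℤ → ℤ → ℤ → ℤ → ℤ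
    p a b c d = 𝟙 (norm? a b c d)

    mod3? : (x : ℤ) → Dec (x %ℕ 3 ≡ 1)
    mod3? x = (x %ℕ 3) ℕ.≟ 1

    Counted : ℤ × ℤ × ℤ × ℤ → Set
    Counted (a , b , c , d) = (a * a) + (b * b) + (c * c) + (d * d) ≡ + n × a %ℕ 3 ≡ 1 × b %ℕ 3 ≡ 1 × c %ℕ 3 ≡ 1 × d %ℕ 3 ≡ 1

    counted? : Decidable Counted
    counted? (a , b , c , d) = (((a * a) + (b * b) + (c * c) + (d * d)) ≟ (+ n)) ×-dec (mod3? a ×-dec (mod3? b ×-dec (mod3? c ×-dec mod3? d)))

    r13≡length : r13 n ≡ length (filter counted? (quads n))
    r13≡length = refl

    r13-as-sum : + r13 n ≡ ∑⁴ (λ a b c d → t⁴ a b c d (p a b c d))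
    r13-as-sum = begin
      + r13 n                                       ≡⟨ cong +_ r13≡length ⟩
      + length (filter counted? (quads n))          ≡⟨ length-filter counted? (quads n) ⟩
      ∑ (quads n) (λ q → 𝟙 (counted? q))            ≡⟨ ∑-quadruples (box n) (λ q → 𝟙 (counted? q)) ⟩
      ∑ (box n) (λ a → ∑ (box n) (λ b → ∑ (box n) (λ c → ∑ (box n) (λ d → 𝟙 (counted? (a , b , c , d))))))
        ≡⟨ cong (λ xs → ∑ xs (λ a → ∑ xs (λ b → ∑ xs (λ c → ∑ xs (λ d → 𝟙 (counted? (a , b , c , d))))))) (Z≡box n) ⟨
      ∑⁴ (λ a b c d → 𝟙 (counted? (a , b , c , d))) ≡⟨ ∑⁴-cong term ⟩
      ∑⁴ (λ a b c d → t⁴ a b c d (p a b c d))       ∎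
      where
      open ≡-Reasoning
      term : ∀ a b c d → 𝟙 (counted? (a , b , c , d)) ≡ t⁴ a b c d (p a b c d)
      term a b c d = trans (𝟙-× (((a * a) + (b * b) + (c * c) + (d * d)) ≟ (+ n)) (mod3? a ×-dec (mod3? b ×-dec (mod3? c ×-dec mod3? d)))) (trans (cong₂ _*_ (𝟙-cong (trans (N₄≡ a b c d)) (trans (sym (N₄≡ a b c d))) (((a * a) + (b * b) + (c * c) + (d * d)) ≟ (+ n)) (norm? a b c d))
          (trans (𝟙-× (mod3? a) (mod3? b ×-dec (mod3? c ×-dec mod3? d))) (cong₂ _*_ (mod3 a) (trans (𝟙-× (mod3? b) (mod3? c ×-dec mod3? d)) (cong₂ _*_ (mod3 b) (trans (𝟙-× (mod3? c) (mod3? d)) (cong₂ _*_ (mod3 c) (mod3 d))))))))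
          (lem (p a b c d) (t a) (t b) (t c) (t d)))
        where
        mod3 : ∀ x → 𝟙 (mod3? x) ≡ t x
        mod3 x = trans (𝟙-cong (≡1mod3⇒∣ x) (∣⇒≡1mod3 x) (mod3? x) (+ 3 ∣? x - 1ℤ)) (sym (t-𝟙 x))
        lem : ∀ p a b c d → p * (a * (b * (c * d))) ≡ a * (b * (c * (d * p)))
        lem = solve-∀

    module _ (n-odd : + 2 ∣ + n - 1ℤ) (n≡1 : + 3 ∣ + n - 1ℤ) where

      G : ℤ → ℤ → ℤ → ℤ → ℤ
      G a b c d = p a b c d * (Ψ a b c d * ω a b c d)

      p-sign : ∀ a b c d s₁ s₂ s₃ s₄ → s₁ * s₁ ≡ 1ℤ → s₂ * s₂ ≡ 1ℤ → s₃ * s₃ ≡ 1ℤ → s₄ * s₄ ≡ 1ℤ → p (s₁ * a) (s₂ * b) (s₃ * c) (s₄ * d) ≡ p a b c d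
      p-sign a b c d s₁ s₂ s₃ s₄ e₁ e₂ e₃ e₄ = cong (λ N → 𝟙 (N ≟ + n)) (begin
        N₄ (s₁ * a) (s₂ * b) (s₃ * c) (s₄ * d)
          ≡⟨ N₄≡ (s₁ * a) (s₂ * b) (s₃ * c) (s₄ * d) ⟩
        s₁ * a * (s₁ * a) + s₂ * b * (s₂ * b) + s₃ * c * (s₃ * c) + s₄ * d * (s₄ * d)
          ≡⟨ cong₄ (λ x y z w → x + y + z + w) (sq s₁ a e₁) (sq s₂ b e₂) (sq s₃ c e₃) (sq s₄ d e₄) ⟩
        a * a + b * b + c * c + d * d
          ≡⟨ N₄≡ a b c d ⟨
        N₄ a b c d ∎)
        where
        open ≡-Reasoning
        lem : ∀ s x → s * x * (s * x) ≡ s * s * (x * x)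
        lem = solve-∀
        sq : ∀ s x → s * s ≡ 1ℤ → s * x * (s * x) ≡ x * x
        sq s x e = trans (lem s x) (trans (cong (_* (x * x)) e) (*-identityˡ (x * x)))

      p-symm : ∀ {a b c d a′ b′ c′ d′} → N₄ a b c d ≡ N₄ a′ b′ c′ d′ → p a b c d ≡ p a′ b′ c′ d′
      p-symm = cong (λ N → 𝟙 (N ≟ + n))

      signs-G : ∀ a b c d → + 3 ∣ a - 1ℤ → + 3 ∣ b - 1ℤ → + 3 ∣ c - 1ℤ → + 3 ∣ d - 1ℤ → signs G a b c d ≡ p a b c d * K a b c d
      signs-G a b c d da db dc dd = begin
        signs G a b c d
          ≡⟨ ±-cong₁ (λ s₄ e₄ → ±-cong₁ (λ s₃ e₃ → ±-cong₁ (λ s₂ e₂ → ±-cong₁ (λ s₁ e₁ → cong₂ _*_ (p-sign a b c d s₁ s₂ s₃ s₄ e₁ e₂ e₃ e₄)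
               (cong (λ z → Ψ (s₁ * a) (s₂ * b) (s₃ * c) (s₄ * d) * z) (ω-shift {s₁ * a} {s₂ * b} {s₃ * c} {s₄ * d} {s₁} {s₂} {s₃} {s₄} (sc s₁ da) (sc s₂ db) (sc s₃ dc) (sc s₄ dd))))))) ⟩
        ± (λ s₄ → ± (λ s₃ → ± (λ s₂ → ± (λ s₁ → p a b c d * k s₁ s₂ s₃ s₄))))
          ≡⟨ ±-cong₁ (λ s₄ _ → trans (±-cong₁ (λ s₃ _ → trans (±-cong₁ (λ s₂ _ → ±-*ˡ (p a b c d) (λ s₁ → k s₁ s₂ s₃ s₄))) (±-*ˡ (p a b c d) (λ s₂ → ± (λ s₁ → k s₁ s₂ s₃ s₄))))) (±-*ˡ (p a b c d) (λ s₃ → ± (λ s₂ → ± (λ s₁ → k s₁ s₂ s₃ s₄))))) ⟩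
        ± (λ s₄ → p a b c d * ± (λ s₃ → ± (λ s₂ → ± (λ s₁ → k s₁ s₂ s₃ s₄))))
          ≡⟨ ±-*ˡ (p a b c d) (λ s₄ → ± (λ s₃ → ± (λ s₂ → ± (λ s₁ → k s₁ s₂ s₃ s₄)))) ⟩
        p a b c d * K a b c d ∎
        where
        open ≡-Reasoning
        k : ℤ → ℤ → ℤ → ℤ → ℤ
        k s₁ s₂ s₃ s₄ = Ψ (s₁ * a) (s₂ * b) (s₃ * c) (s₄ * d) * ω s₁ s₂ s₃ s₄
        sc : ∀ s {x} → + 3 ∣ x - 1ℤ → + 3 ∣ s * x - s
        sc s {x} d = subst (λ y → + 3 ∣ s * x - y) (*-identityʳ s) (∣-scale (+ 3) s {x} {1ℤ} d)

      t-guard : ∀ a {x y} → (+ 3 ∣ a - 1ℤ → x ≡ y) → t a * x ≡ t a * y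
      t-guard a {x} {y} eq = trans (cong (_* x) (t≡ a)) (trans (δ-guard (+ 3) (a - 1ℤ) eq) (cong (_* y) (sym (t≡ a))))

      sum-G : ∑⁴ G ≡ ∑⁴ (λ a b c d → t⁴ a b c d (p a b c d * K a b c d))
      sum-G = begin
        ∑⁴ G
          ≡⟨ ∑⁴-cong (λ a b c d → trans (𝟙-guard (norm? a b c d) (λ e → cong (λ z → Ψ a b c d * z) (ω-nonzero a b c d (subst (λ z → + 3 ∣ z - 1ℤ) (sym e) n≡1))))
               (lem (p a b c d) (Ψ a b c d) (ω a b c d) (τ a) (τ b) (τ c) (τ d))) ⟩
        ∑⁴ (λ a b c d → τ a * (τ b * (τ c * (τ d * G a b c d))))
          ≡⟨ flip-all G ⟩
        ∑⁴ (λ a b c d → t⁴ a b c d (signs G a b c d))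
          ≡⟨ ∑⁴-cong (λ a b c d → t-guard a (λ da → t-guard b (λ db → t-guard c (λ dc → t-guard d (λ dd → signs-G a b c d da db dc dd))))) ⟩
        ∑⁴ (λ a b c d → t⁴ a b c d (p a b c d * K a b c d)) ∎
        where
        open ≡-Reasoning
        lem : ∀ p Ψ ω a b c d → p * (Ψ * (a * (b * (c * (d * ω))))) ≡ a * (b * (c * (d * (p * (Ψ * ω)))))
        lem = solve-∀

      -- The norm and the weights `t` are symmetric in the coordinates, so four copies of the sum
      -- combine into one over `K-sym`. Its constant value 12 leaves 12 / 4 = 3.
      sum-G≡3r13 : ∑⁴ G ≡ + 3 * + r13 n
      sum-G≡3r13 = *-cancelˡ-≡ (+ 4) (∑⁴ G) (+ 3 * + r13 n) (begin
        + 4 * ∑⁴ G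
          ≡⟨ cong (+ 4 *_) sum-G ⟩
        + 4 * ∑⁴ g
          ≡⟨ quad (∑⁴ g) ⟩
        ∑⁴ g + ∑⁴ g + (∑⁴ g + ∑⁴ g)
          ≡⟨ cong₂ _+_ (cong (λ z → ∑⁴ g + z) (swap₁₂ g)) (cong₂ _+_ (swap₁₃ g) (swap₁₄ g)) ⟨
        ∑⁴ g + ∑⁴ (λ a b c d → g b a c d) + (∑⁴ (λ a b c d → g c b a d) + ∑⁴ (λ a b c d → g d b c a))
          ≡⟨ trans (∑⁴-+ _ _) (cong₂ _+_ (∑⁴-+ g (λ a b c d → g b a c d)) (∑⁴-+ (λ a b c d → g c b a d) (λ a b c d → g d b c a))) ⟨
        ∑⁴ (λ a b c d → g a b c d + g b a c d + (g c b a d + g d b c a))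
          ≡⟨ ∑⁴-cong (λ a b c d → trans
               (cong₂ _+_ (cong (λ z → g a b c d + t b * (t a * (t c * (t d * (z * K b a c d))))) (p-symm (n₁ a b c d)))
                          (cong₂ (λ y z → t c * (t b * (t a * (t d * (y * K c b a d)))) + t d * (t b * (t c * (t a * (z * K d b c a))))) (p-symm (n₂ a b c d)) (p-symm (n₃ a b c d))))
               (trans (collect (t a) (t b) (t c) (t d) (p a b c d) (K a b c d) (K b a c d) (K c b a d) (K d b c a))
               (cong (λ z → t a * (t b * (t c * (t d * z)))) (𝟙-guard (norm? a b c d) (λ e → K-sym≡12 a b c d (subst (λ z → + 2 ∣ z - 1ℤ) (sym e) n-odd)))))) ⟩
        ∑⁴ (λ a b c d → t⁴ a b c d (p a b c d * + 12))
          ≡⟨ ∑⁴-cong (λ a b c d → factor (t a) (t b) (t c) (t d) (p a b c d)) ⟩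
        ∑⁴ (λ a b c d → + 12 * t⁴ a b c d (p a b c d))
          ≡⟨ ∑⁴-*ˡ (+ 12) (λ a b c d → t⁴ a b c d (p a b c d)) ⟩
        + 12 * ∑⁴ (λ a b c d → t⁴ a b c d (p a b c d))
          ≡⟨ cong (+ 12 *_) r13-as-sum ⟨
        + 12 * + r13 n
          ≡⟨ twelve (+ r13 n) ⟩
        + 4 * (+ 3 * + r13 n) ∎)
        where
        open ≡-Reasoning
        g : ℤ → ℤ → ℤ → ℤ → ℤ
        g a b c d = t⁴ a b c d (p a b c d * K a b c d)
        quad : ∀ x → + 4 * x ≡ x + x + (x + x)
        quad = solve-∀
        twelve : ∀ x → + 12 * x ≡ + 4 * (+ 3 * x)
        twelve = solve-∀
        n₁ : ∀ a b c d → N₄ b a c d ≡ N₄ a b c d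
        n₁ a b c d = trans (N₄≡ b a c d) (trans (lem a b c d) (sym (N₄≡ a b c d)))
          where
          lem : ∀ a b c d → b * b + a * a + c * c + d * d ≡ a * a + b * b + c * c + d * d
          lem = solve-∀
        n₂ : ∀ a b c d → N₄ c b a d ≡ N₄ a b c d
        n₂ a b c d = trans (N₄≡ c b a d) (trans (lem a b c d) (sym (N₄≡ a b c d)))
          where
          lem : ∀ a b c d → c * c + b * b + a * a + d * d ≡ a * a + b * b + c * c + d * d
          lem = solve-∀
        n₃ : ∀ a b c d → N₄ d b c a ≡ N₄ a b c d
        n₃ a b c d = trans (N₄≡ d b c a) (trans (lem a b c d) (sym (N₄≡ a b c d)))
          where
          lem : ∀ a b c d → d * d + b * b + c * c + a * a ≡ a * a + b * b + c * c + d * d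
          lem = solve-∀
        collect : ∀ a b c d p k₁ k₂ k₃ k₄ → a * (b * (c * (d * (p * k₁)))) + b * (a * (c * (d * (p * k₂)))) + (c * (b * (a * (d * (p * k₃)))) + d * (b * (c * (a * (p * k₄)))))
                ≡ a * (b * (c * (d * (p * (k₁ + k₂ + (k₃ + k₄))))))
        collect = solve-∀
        factor : ∀ a b c d p → a * (b * (c * (d * (p * + 12)))) ≡ + 12 * (a * (b * (c * (d * p))))
        factor = solve-∀

  module Hadamard (B : ℕ) (1≤B : 1 ℕ.≤ B) (n : ℕ) (n-odd : + 2 ∣ + n - 1ℤ) (n≡1 : + 3 ∣ + n - 1ℤ) (bound : + 4 * + n + 1ℤ ≤ + B) where

    Quad : Set
    Quad = ℤ × ℤ × ℤ × ℤ

    Z⁴ : ℕ → List Quad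
    Z⁴ m = cartesianProduct (Z m) (cartesianProduct (Z m) (cartesianProduct (Z m) (Z m)))

    Z⁴-unique : ∀ m → Unique (Z⁴ m)
    Z⁴-unique m = Unique.cartesianProduct⁺ (Z-unique m) (Unique.cartesianProduct⁺ (Z-unique m) (Unique.cartesianProduct⁺ (Z-unique m) (Z-unique m)))

    Z⁴-sum : ∀ m (f : ℤ → ℤ → ℤ → ℤ → ℤ) → ∑ (Z⁴ m) (λ (a , b , c , d) → f a b c d) ≡ Quadruples.∑⁴ m f
    Z⁴-sum m f = trans (∑-× (Z m) (cartesianProduct (Z m) (cartesianProduct (Z m) (Z m))) (λ (a , b , c , d) → f a b c d)) (∑-cong (Z m) (λ a → Quadruples.pack m (f a)))

    Z⁴⁺ : ∀ {m a b c d} → N₄ a b c d ≤ + m → (a , b , c , d) ∈ Z⁴ m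
    Z⁴⁺ {m} {a} {b} {c} {d} le = ∈-cartesianProduct⁺ (Z⁺ (∣x∣≤ a (below (b * b + c * c + d * d) (nn b c d) (lem₁ (a * a) (b * b) (c * c) (d * d)))))
      (∈-cartesianProduct⁺ (Z⁺ (∣x∣≤ b (below (a * a + c * c + d * d) (nn a c d) (lem₂ (a * a) (b * b) (c * c) (d * d)))))
      (∈-cartesianProduct⁺ (Z⁺ (∣x∣≤ c (below (a * a + b * b + d * d) (nn a b d) (lem₃ (a * a) (b * b) (c * c) (d * d)))))
        (Z⁺ (∣x∣≤ d (below (a * a + b * b + c * c) (nn a b c) (lem₄ (a * a) (b * b) (c * c) (d * d)))))))
      where
      below : ∀ {x} y → 0ℤ ≤ y → a * a + b * b + c * c + d * d ≡ x + y → x ≤ + m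
      below y y≥0 eq = ≤-drop y≥0 (subst (_≤ + m) (trans (N₄≡ a b c d) eq) le)
      nn : ∀ x y z → 0ℤ ≤ x * x + y * y + z * z
      nn x y z = +-mono-≤ (+-mono-≤ (0≤x*x x) (0≤x*x y)) (0≤x*x z)
      lem₁ : ∀ a b c d → a + b + c + d ≡ a + (b + c + d)
      lem₁ = solve-∀
      lem₂ : ∀ a b c d → a + b + c + d ≡ b + (a + c + d)
      lem₂ = solve-∀
      lem₃ : ∀ a b c d → a + b + c + d ≡ c + (a + b + d)
      lem₃ = solve-∀
      lem₄ : ∀ a b c d → a + b + c + d ≡ d + (a + b + c)
      lem₄ = solve-∀

    -- Twice an orthogonal involution: the norm is multiplied by 4, and the square of the map is
    -- multiplication by 4, which yields injectivity.
    had : Quad → Quad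
    had (a , b , c , d) = a + b + c + d , a + b - c - d , a - b + c - d , a - b - c + d

    had-inj : ∀ {x y} → had x ≡ had y → x ≡ y
    had-inj {a , b , c , d} {a′ , b′ , c′ , d′} eq = cong₂ _,_
        (via (lem₁ a b c d) (lem₁ a′ b′ c′ d′) (cong (λ (x , y , z , w) → x + y + z + w) eq))
      (cong₂ _,_ (via (lem₂ a b c d) (lem₂ a′ b′ c′ d′) (cong (λ (x , y , z , w) → x + y - z - w) eq))
      (cong₂ _,_ (via (lem₃ a b c d) (lem₃ a′ b′ c′ d′) (cong (λ (x , y , z , w) → x - y + z - w) eq))
        (via (lem₄ a b c d) (lem₄ a′ b′ c′ d′) (cong (λ (x , y , z , w) → x - y - z + w) eq))))
      where
      via : ∀ {x y x′ y′} → + 4 * x ≡ y → + 4 * x′ ≡ y′ → y ≡ y′ → x ≡ x′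
      via e e′ eq = *-cancelˡ-≡ (+ 4) _ _ (trans e (trans eq (sym e′)))
      lem₁ : ∀ a b c d → + 4 * a ≡ (a + b + c + d) + (a + b - c - d) + (a - b + c - d) + (a - b - c + d)
      lem₁ = solve-∀
      lem₂ : ∀ a b c d → + 4 * b ≡ (a + b + c + d) + (a + b - c - d) - (a - b + c - d) - (a - b - c + d)
      lem₂ = solve-∀
      lem₃ : ∀ a b c d → + 4 * c ≡ (a + b + c + d) - (a + b - c - d) + (a - b + c - d) - (a - b - c + d)
      lem₃ = solve-∀
      lem₄ : ∀ a b c d → + 4 * d ≡ (a + b + c + d) - (a + b - c - d) - (a - b + c - d) + (a - b - c + d)
      lem₄ = solve-∀

    had-norm : ∀ a b c d → N₄ (a + b + c + d) (a + b - c - d) (a - b + c - d) (a - b - c + d) ≡ + 4 * N₄ a b c d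
    had-norm a b c d = trans (N₄≡ (a + b + c + d) (a + b - c - d) (a - b + c - d) (a - b - c + d)) (trans (lem a b c d) (cong (+ 4 *_) (sym (N₄≡ a b c d))))
      where
      lem : ∀ a b c d → (a + b + c + d) * (a + b + c + d) + (a + b - c - d) * (a + b - c - d) + (a - b + c - d) * (a - b + c - d) + (a - b - c + d) * (a - b - c + d)
          ≡ + 4 * (a * a + b * b + c * c + d * d)
      lem = solve-∀

    had-surj : ∀ a b c d → + 4 ∣ a - 1ℤ → + 4 ∣ b - 1ℤ → + 4 ∣ c - 1ℤ → + 4 ∣ d - 1ℤ → ∃ λ q → had q ≡ (a , b , c , d)
    had-surj a b c d (divides i ea) (divides j eb) (divides k ec) (divides l ed) =
      -- The inverse is a quarter of the transform. On (1,1,1,1) + 4(i,j,k,l) it gives (1,0,0,0)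
      -- plus the transform of (i,j,k,l).
      (1ℤ + (i + j + k + l) , i + j - k - l , i - j + k - l , i - j - k + l) ,
      cong₂ _,_ (trans (lem₁ i j k l) (back a i ea)) (cong₂ _,_ (trans (lem₂ i j k l) (back b j eb)) (cong₂ _,_ (trans (lem₃ i j k l) (back c k ec)) (trans (lem₄ i j k l) (back d l ed))))
      where
      back : ∀ x q → x - 1ℤ ≡ q * + 4 → q * + 4 + 1ℤ ≡ x
      back x q e = trans (cong (_+ 1ℤ) (sym e)) (lem x)
        where
        lem : ∀ x → x - 1ℤ + 1ℤ ≡ x
        lem = solve-∀
      lem₁ : ∀ i j k l → 1ℤ + (i + j + k + l) + (i + j - k - l) + (i - j + k - l) + (i - j - k + l) ≡ i * + 4 + 1ℤ
      lem₁ = solve-∀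
      lem₂ : ∀ i j k l → 1ℤ + (i + j + k + l) + (i + j - k - l) - (i - j + k - l) - (i - j - k + l) ≡ j * + 4 + 1ℤ
      lem₂ = solve-∀
      lem₃ : ∀ i j k l → 1ℤ + (i + j + k + l) - (i + j - k - l) + (i - j + k - l) - (i - j - k + l) ≡ k * + 4 + 1ℤ
      lem₃ = solve-∀
      lem₄ : ∀ i j k l → 1ℤ + (i + j + k + l) - (i + j - k - l) - (i - j + k - l) + (i - j - k + l) ≡ l * + 4 + 1ℤ
      lem₄ = solve-∀

    4n : ℤ
    4n = + 4 * + n

    4n≤B : 4n ≤ + B
    4n≤B = ≤-trans (subst (_≤ 4n + 1ℤ) (+-identityʳ 4n) (+-monoʳ-≤ 4n {0ℤ} {1ℤ} (+≤+ z≤n))) bound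

    w : ℤ → ℤ → ℤ → ℤ → ℤ
    w a b c d = 𝟙 (N₄ a b c d ≟ 4n) * (ψ a * (ψ b * (ψ c * ψ d)) * (1ℤ - χ a * (χ b * (χ c * χ d))))

    W : Quad → ℤ
    W (a , b , c , d) = w a b c d

    open Lattice n using (G; sum-G≡3r13)

    W-had : ∀ ((a , b , c , d) : Quad) → G n-odd n≡1 a b c d ≡ W (had (a , b , c , d))
    W-had (a , b , c , d) = cong₂ _*_
      (𝟙-cong (λ e → trans (had-norm a b c d) (cong (+ 4 *_) e)) (λ e → *-cancelˡ-≡ (+ 4) _ (+ n) (trans (sym (had-norm a b c d)) e))
        (N₄ a b c d ≟ + n) (N₄ (a + b + c + d) (a + b - c - d) (a - b + c - d) (a - b - c + d) ≟ 4n))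
      (cong₂ _*_ (Ψ≡ a b c d) (ω≡ a b c d))

    W-norm : ∀ ((a , b , c , d) : Quad) → W (a , b , c , d) ≢ 0ℤ → N₄ a b c d ≡ 4n
    W-norm (a , b , c , d) nz = 𝟙≢0 (N₄ a b c d ≟ 4n) (*≢0ˡ _ _ nz)

    reindexed : ∑ (Z⁴ n) (W ∘ had) ≡ ∑ (Z⁴ B) W
    reindexed = ∑-reindex (_≟ 0ℤ) had (Z⁴-unique n) (Z⁴-unique B) W into had-inj surj
      where
      into : ∀ {q} → q ∈ Z⁴ n → W (had q) ≢ 0ℤ → had q ∈ Z⁴ B
      into {q} _ nz = Z⁴⁺ (subst (_≤ + B) (sym (W-norm (had q) nz)) 4n≤B)
      surj : ∀ {r} → r ∈ Z⁴ B → W r ≢ 0ℤ → ∃ λ q → q ∈ Z⁴ n × had q ≡ r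
      surj {r@(a , b , c , d)} _ nz = q , Z⁴⁺ (≤-reflexive (*-cancelˡ-≡ (+ 4) _ (+ n) (trans (sym (had-norm (proj₁ q) (proj₁ (proj₂ q)) (proj₁ (proj₂ (proj₂ q))) (proj₂ (proj₂ (proj₂ q)))))
          (trans (cong (λ (a , b , c , d) → N₄ a b c d) eq) (W-norm r nz))))) , eq
        where
        nz′ : ψ a * (ψ b * (ψ c * ψ d)) ≢ 0ℤ
        nz′ = *≢0ˡ (ψ a * (ψ b * (ψ c * ψ d))) (1ℤ - χ a * (χ b * (χ c * χ d))) (*≢0ʳ (𝟙 (N₄ a b c d ≟ 4n)) _ nz)
        nz″ : ψ b * (ψ c * ψ d) ≢ 0ℤ
        nz″ = *≢0ʳ (ψ a) (ψ b * (ψ c * ψ d)) nz′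
        nz‴ : ψ c * ψ d ≢ 0ℤ
        nz‴ = *≢0ʳ (ψ b) (ψ c * ψ d) nz″
        preimage : ∃ λ q → had q ≡ r
        preimage = had-surj a b c d (ψ≢0 (*≢0ˡ (ψ a) (ψ b * (ψ c * ψ d)) nz′)) (ψ≢0 (*≢0ˡ (ψ b) (ψ c * ψ d) nz″)) (ψ≢0 (*≢0ˡ (ψ c) (ψ d) nz‴)) (ψ≢0 (*≢0ʳ (ψ c) (ψ d) nz‴))
        q : Quad
        q = proj₁ preimage
        eq : had q ≡ r
        eq = proj₂ preimage

    open Quadruples B using (∑⁴; ∑⁴-cong; ∑⁴-*ˡ)

    R₄-as-sum : ∀ (v : ℤ → ℤ) N → Theta.R B v 4 N ≡ ∑⁴ (λ a b c d → 𝟙 (N₄ a b c d ≟ N) * (v a * (v b * (v c * v d))))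
    R₄-as-sum v N = ∑-cong (Z B) (λ a → trans (sym (∑-*ˡ (v a) (Z B) _)) (∑-cong (Z B) (λ b → trans (pull₂ a b) (∑-cong (Z B) (λ c → trans (pull₃ a b c) (∑-cong (Z B) (term a b c)))))))
      where
      D : ℤ → ℤ → ℤ → ℤ → ℤ
      D a b c d = v d * 𝟙 (N - a * a - b * b - c * c - d * d ≟ 0ℤ)
      C : ℤ → ℤ → ℤ → ℤ
      C a b c = v c * ∑ (Z B) (D a b c)
      pull₂ : ∀ a b → v a * (v b * ∑ (Z B) (C a b)) ≡ ∑ (Z B) (λ c → v a * v b * C a b c)
      pull₂ a b = trans (sym (*-assoc (v a) (v b) (∑ (Z B) (C a b)))) (sym (∑-*ˡ (v a * v b) (Z B) (C a b)))
      pull₃ : ∀ a b c → v a * v b * C a b c ≡ ∑ (Z B) (λ d → v a * v b * v c * D a b c d)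
      pull₃ a b c = trans (sym (*-assoc (v a * v b) (v c) (∑ (Z B) (D a b c)))) (sym (∑-*ˡ (v a * v b * v c) (Z B) (D a b c)))
      term : ∀ a b c d → v a * v b * v c * D a b c d ≡ 𝟙 (N₄ a b c d ≟ N) * (v a * (v b * (v c * v d)))
      term a b c d = trans (cong (λ z → v a * v b * v c * (v d * z)) (𝟙-cong
          (λ e → trans (N₄≡ a b c d) (trans (sym (+-identityʳ _)) (trans (cong (λ z → a * a + b * b + c * c + d * d + z) (sym e)) (lem₁ N (a * a) (b * b) (c * c) (d * d)))))
          (λ e → trans (cong (λ z → z - a * a - b * b - c * c - d * d) (trans (sym e) (N₄≡ a b c d))) (lem₂ (a * a) (b * b) (c * c) (d * d)))
          (N - a * a - b * b - c * c - d * d ≟ 0ℤ) (N₄ a b c d ≟ N)))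
        (lem₃ (v a) (v b) (v c) (v d) (𝟙 (N₄ a b c d ≟ N)))
        where
        lem₁ : ∀ N a b c d → a + b + c + d + (N - a - b - c - d) ≡ N
        lem₁ = solve-∀
        lem₂ : ∀ a b c d → a + b + c + d - a - b - c - d ≡ 0ℤ
        lem₂ = solve-∀
        lem₃ : ∀ a b c d p → a * b * c * (d * p) ≡ p * (a * (b * (c * d)))
        lem₃ = solve-∀

    ∑⁴-- : ∀ (f g : ℤ → ℤ → ℤ → ℤ → ℤ) → ∑⁴ (λ a b c d → f a b c d - g a b c d) ≡ ∑⁴ f - ∑⁴ g
    ∑⁴-- f g = trans (∑-cong (Z B) (λ a → trans (∑-cong (Z B) (λ b → trans (∑-cong (Z B) (λ c → ∑-- (Z B) (f a b c) (g a b c))) (∑-- (Z B) _ _))) (∑-- (Z B) _ _))) (∑-- (Z B) _ _)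

    3r13 : + 3 * + r13 n ≡ Theta.R B ψ 4 4n - Theta.R B H 4 4n
    3r13 = begin
      + 3 * + r13 n                            ≡⟨ sum-G≡3r13 n-odd n≡1 ⟨
      Quadruples.∑⁴ n (G n-odd n≡1)            ≡⟨ Z⁴-sum n (G n-odd n≡1) ⟨
      ∑ (Z⁴ n) (λ (a , b , c , d) → G n-odd n≡1 a b c d) ≡⟨ ∑-cong (Z⁴ n) W-had ⟩
      ∑ (Z⁴ n) (W ∘ had)                       ≡⟨ reindexed ⟩
      ∑ (Z⁴ B) W                               ≡⟨ Z⁴-sum B w ⟩
      ∑⁴ w                                     ≡⟨ ∑⁴-cong (λ a b c d → lem (𝟙 (N₄ a b c d ≟ 4n)) (ψ a) (ψ b) (ψ c) (ψ d) (χ a) (χ b) (χ c) (χ d)) ⟩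
      ∑⁴ (λ a b c d → f ψ a b c d - f H a b c d) ≡⟨ ∑⁴-- (f ψ) (f H) ⟩
      ∑⁴ (f ψ) - ∑⁴ (f H)                      ≡⟨ cong₂ _-_ (R₄-as-sum ψ 4n) (R₄-as-sum H 4n) ⟨
      Theta.R B ψ 4 4n - Theta.R B H 4 4n      ∎
      where
      open ≡-Reasoning
      f : (ℤ → ℤ) → ℤ → ℤ → ℤ → ℤ → ℤ
      f v a b c d = 𝟙 (N₄ a b c d ≟ 4n) * (v a * (v b * (v c * v d)))
      lem : ∀ p a b c d x y z w → p * (a * (b * (c * d)) * (1ℤ - x * (y * (z * w)))) ≡ p * (a * (b * (c * d))) - p * (a * x * (b * y * (c * z * (d * w))))
      lem = solve-∀

    -- Doubled, because the passage to pairs u ≡ v (mod 4) yields twice the coefficient of θ_χ⁴.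
    6r13 : + 6 * + r13 n ≡ + 2 * σ B 4n - α B (+ n)
    6r13 = begin
      + 6 * + r13 n                                    ≡⟨ lem₁ (+ r13 n) ⟩
      + 2 * (+ 3 * + r13 n)                            ≡⟨ cong (+ 2 *_) 3r13 ⟩
      + 2 * (Theta.R B ψ 4 4n - Theta.R B H 4 4n)      ≡⟨ lem₂ (Theta.R B ψ 4 4n) (Theta.R B H 4 4n) ⟩
      + 2 * Theta.R B ψ 4 4n - (Theta.R B H 4 4n + Theta.R B H 4 4n)
        ≡⟨ cong₂ (λ x y → + 2 * x - y) ψ-part (CuspForm.2R₄≡α B 1≤B (+ n) n-odd bound) ⟩
      + 2 * σ B 4n - α B (+ n)                         ∎
      where
      open ≡-Reasoning
      lem₁ : ∀ r → + 6 * r ≡ + 2 * (+ 3 * r)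
      lem₁ = solve-∀
      lem₂ : ∀ x y → + 2 * (x - y) ≡ + 2 * x - (y + y)
      lem₂ = solve-∀
      ψ-part : Theta.R B ψ 4 4n ≡ σ B 4n
      ψ-part = go n-odd
        where
        go : + 2 ∣ + n - 1ℤ → Theta.R B ψ 4 4n ≡ σ B 4n
        go (divides i e) = subst (λ N → Theta.R B ψ 4 N ≡ σ B N) (sym 4n≡) (FourSquares.R₄≡σ B 1≤B i (subst (_≤ + B) (trans (cong (_+ 1ℤ) 4n≡) (lem i)) bound))
          where
          4n≡ : 4n ≡ + 4 + + 8 * i
          4n≡ = trans (lem′ (+ n)) (trans (cong (λ z → + 4 * (z + 1ℤ)) e) (lem″ i))
            where
            lem′ : ∀ n → + 4 * n ≡ + 4 * (n - 1ℤ + 1ℤ)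
            lem′ = solve-∀
            lem″ : ∀ i → + 4 * (i * + 2 + 1ℤ) ≡ + 4 + + 8 * i
            lem″ = solve-∀
          lem : ∀ i → + 4 + + 8 * i + 1ℤ ≡ + 5 + + 8 * i
          lem = solve-∀

-- Finite fields as structures on `Fin q`.

module FieldTransport where

  open import Defs
  open import Algebra.Bundles using (CommutativeRing; RawRing)
  open import Algebra.Structures using (IsCommutativeRing)
  import Algebra.Solver.Ring.AlmostCommutativeRing as ACR
  import Algebra.Solver.Ring
  import Algebra.Properties.Ring
  import Algebra.Properties.AbelianGroup
  import Algebra.Properties.Semiring.Mult
  import Algebra.Morphism.RingMonomorphism
  open import Algebra.Morphism.Structures using (module RingMorphisms)
  open import Data.Fin as Fin using (Fin; zero; suc)
  open import Data.Integer as ℤ using (ℤ; +_; -[1+_])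
  import Data.Integer.Properties as ℤ
  open import Data.List using (_∷_; lookup; length)
  open import Data.List.Relation.Unary.All as All using (All)
  open import Data.List.Relation.Unary.AllPairs using (AllPairs; _∷_)
  open import Data.List.Relation.Unary.Any as Any using (index)
  open import Data.List.Relation.Unary.Any.Properties using (lookup-index)
  open import Data.List.Membership.Propositional.Properties using (∈-lookup)
  open import Data.Maybe using (Maybe; just; nothing)
  open import Data.Nat as ℕ using (ℕ; zero; suc)
  open import Data.Product using (_×_; _,_; ∃)
  open import Level using (0ℓ)
  open import Relation.Nullary using (¬_; yes; no; contradiction)
  open import Relation.Binary.PropositionalEquality as ≡ using (_≡_; _≢_)

  module IntegerImage (R : CommutativeRing 0ℓ 0ℓ) where
    open CommutativeRing R
    open Algebra.Properties.Ring ring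
    open Algebra.Properties.AbelianGroup +-abelianGroup using (⁻¹-∙-comm)
    open Algebra.Properties.Semiring.Mult semiring using (×-homo-+; ×1-homo-*) renaming (_×_ to _·_)
    open import Relation.Binary.Reasoning.Setoid setoid

    -- Serves as the coefficient morphism of the ring solver, so that integer constants may occur in
    -- solved identities, and later as reduction modulo the characteristic.
    ι : ℤ → Carrier
    ι (+ n)    = n · 1#
    ι -[1+ n ] = - (suc n · 1#)

    ι-⊖ : ∀ m n → ι (m ℤ.⊖ n) ≈ m · 1# - n · 1#
    ι-⊖ zero    zero    = sym (-‿inverseʳ 0#)
    ι-⊖ zero    (suc n) = sym (+-identityˡ _)
    ι-⊖ (suc m) zero    = sym (trans (+-congˡ -0#≈0#) (+-identityʳ _))
    ι-⊖ (suc m) (suc n) = begin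
      ι (suc m ℤ.⊖ suc n)                 ≈⟨ reflexive (≡.cong ι (ℤ.[1+m]⊖[1+n]≡m⊖n m n)) ⟩
      ι (m ℤ.⊖ n)                         ≈⟨ ι-⊖ m n ⟩
      m · 1# - n · 1#                     ≈⟨ +-congʳ (+-identityˡ _) ⟨
      (0# + m · 1#) - n · 1#              ≈⟨ +-congʳ (+-congʳ (-‿inverseʳ 1#)) ⟨
      ((1# - 1#) + m · 1#) - n · 1#       ≈⟨ +-congʳ (trans (+-assoc _ _ _) (trans (+-congˡ (+-comm _ _)) (sym (+-assoc _ _ _)))) ⟩
      ((1# + m · 1#) - 1#) - n · 1#       ≈⟨ +-assoc _ _ _ ⟩
      (1# + m · 1#) + (- 1# - n · 1#)     ≈⟨ +-congˡ (⁻¹-∙-comm _ _) ⟩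
      (1# + m · 1#) - (1# + n · 1#)       ∎

    ι-+ : ∀ i j → ι (i ℤ.+ j) ≈ ι i + ι j
    ι-+ (+ m)    (+ n)    = ×-homo-+ 1# m n
    ι-+ (+ m)    -[1+ n ] = ι-⊖ m (suc n)
    ι-+ -[1+ m ] (+ n)    = trans (ι-⊖ n (suc m)) (+-comm _ _)
    ι-+ -[1+ m ] -[1+ n ] = begin
      - (suc (suc (m ℕ.+ n)) · 1#)          ≈⟨ -‿cong (+-congˡ (×-homo-+ 1# (suc m) n)) ⟩
      - (1# + (suc m · 1# + n · 1#))        ≈⟨ -‿cong (trans (sym (+-assoc _ _ _)) (trans (+-congʳ (+-comm _ _)) (+-assoc _ _ _))) ⟩
      - (suc m · 1# + suc n · 1#)           ≈⟨ ⁻¹-∙-comm _ _ ⟨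
      - (suc m · 1#) - suc n · 1#           ∎

    ι-neg : ∀ i → ι (ℤ.- i) ≈ - ι i
    ι-neg (+ zero)  = sym -0#≈0#
    ι-neg (+ suc n) = refl
    ι-neg -[1+ n ]  = sym (-‿involutive _)

    ι-* : ∀ i j → ι (i ℤ.* j) ≈ ι i * ι j
    ι-*⁺ : ∀ m j → ι (+ m ℤ.* j) ≈ ι (+ m) * ι j
    ι-*⁺ m (+ n)    = trans (reflexive (≡.cong ι (≡.sym (ℤ.pos-* m n)))) (×1-homo-* m n)
    ι-*⁺ m -[1+ n ] = begin
      ι (+ m ℤ.* -[1+ n ])        ≈⟨ reflexive (≡.cong ι (≡.sym (ℤ.neg-distribʳ-* (+ m) (+ suc n)))) ⟩
      ι (ℤ.- (+ m ℤ.* + suc n))   ≈⟨ ι-neg (+ m ℤ.* + suc n) ⟩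
      - ι (+ m ℤ.* + suc n)       ≈⟨ -‿cong (ι-*⁺ m (+ suc n)) ⟩
      - (ι (+ m) * ι (+ suc n))   ≈⟨ -‿distribʳ-* _ _ ⟩
      ι (+ m) * ι -[1+ n ]        ∎
    ι-* (+ m)    j = ι-*⁺ m j
    ι-* -[1+ m ] j = begin
      ι (-[1+ m ] ℤ.* j)          ≈⟨ reflexive (≡.cong ι (≡.sym (ℤ.neg-distribˡ-* (+ suc m) j))) ⟩
      ι (ℤ.- (+ suc m ℤ.* j))     ≈⟨ ι-neg (+ suc m ℤ.* j) ⟩
      - ι (+ suc m ℤ.* j)         ≈⟨ -‿cong (ι-*⁺ (suc m) j) ⟩
      - (ι (+ suc m) * ι j)       ≈⟨ -‿distribˡ-* _ _ ⟩
      ι -[1+ m ] * ι j            ∎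

    morphism : CommutativeRing.rawRing ℤ.+-*-commutativeRing ACR.-Raw-AlmostCommutative⟶ ACR.fromCommutativeRing R
    morphism = record
      { ⟦_⟧ = ι ; +-homo = ι-+ ; *-homo = ι-* ; -‿homo = ι-neg ; 0-homo = refl ; 1-homo = +-identityʳ 1# }

    coeff≟ : ∀ i j → Maybe (ι i ≈ ι j)
    coeff≟ i j with i ℤ.≟ j
    ... | yes eq = just (reflexive (≡.cong ι eq))
    ... | no  _  = nothing

    open Algebra.Solver.Ring (CommutativeRing.rawRing ℤ.+-*-commutativeRing) (ACR.fromCommutativeRing R) morphism coeff≟ public
      using (solve; con; _:=_; _:+_; _:*_; _:-_; :-_)

  record FieldOn (A : Set) : Set where
    infixl 6 _+_
    infixl 7 _*_
    field
      _+_ _*_ : A → A → A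
      -_      : A → A
      0# 1#   : A
      isCommutativeRing : IsCommutativeRing _≡_ _+_ _*_ -_ 0# 1#
      1≢0     : 1# ≢ 0#
      inverse : ∀ x → x ≢ 0# → ∃ λ y → x * y ≡ 1#

    commutativeRing : CommutativeRing 0ℓ 0ℓ
    commutativeRing = record { isCommutativeRing = isCommutativeRing }

  -- A finite field, carried over to Fin along its enumeration so that its equality is propositional.
  module Transport (F : FiniteField) where
    module F = FiniteField F

    q : ℕ
    q = length F.elements

    e : Fin q → F.Carrier
    e = lookup F.elements

    idx : F.Carrier → Fin q
    idx x = index (F.complete x)

    e-idx : ∀ x → e (idx x) F.≈ x
    e-idx x = F.sym (lookup-index (F.complete x))

    lookup-injective : ∀ {xs} → AllPairs (λ a b → ¬ (a F.≈ b)) xs → ∀ {i j} → lookup xs i F.≈ lookup xs j → i ≡ j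
    lookup-injective (n ∷ ns) {zero}  {zero}  eq = ≡.refl
    lookup-injective (n ∷ ns) {zero}  {suc j} eq = contradiction eq (All.lookup n (∈-lookup j))
    lookup-injective (n ∷ ns) {suc i} {zero}  eq = contradiction (F.sym eq) (All.lookup n (∈-lookup i))
    lookup-injective (n ∷ ns) {suc i} {suc j} eq = ≡.cong suc (lookup-injective ns eq)

    e-injective : ∀ {i j} → e i F.≈ e j → i ≡ j
    e-injective = lookup-injective F.distinct

    rawRing : RawRing 0ℓ 0ℓ
    rawRing = record
      { Carrier = Fin q ; _≈_ = _≡_
      ; _+_ = λ i j → idx (e i F.+ e j)
      ; _*_ = λ i j → idx (e i F.* e j)
      ; -_  = λ i → idx (F.- e i)
      ; 0#  = idx F.0# ; 1# = idx F.1# }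

    open RingMorphisms rawRing (CommutativeRing.rawRing F.commRing) using (IsRingMonomorphism)

    isMonomorphism : IsRingMonomorphism e
    isMonomorphism = record
      { isRingHomomorphism = record
          { isSemiringHomomorphism = record
              { isNearSemiringHomomorphism = record
                  { +-isMonoidHomomorphism = record
                      { isMagmaHomomorphism = record
                          { isRelHomomorphism = record { cong = λ { ≡.refl → F.refl } }
                          ; homo = λ i j → e-idx _ }
                      ; ε-homo = e-idx _ }
                  ; *-homo = λ i j → e-idx _ }
              ; 1#-homo = e-idx _ }
          ; -‿homo = λ i → e-idx _ }
      ; injective = e-injective }

    field-on : FieldOn (Fin q)
    field-on = record
      { _+_ = K._+_ ; _*_ = K._*_ ; -_ = K.-_ ; 0# = K.0# ; 1# = K.1#
      ; isCommutativeRing = Algebra.Morphism.RingMonomorphism.isCommutativeRing isMonomorphism F.isCommutativeRing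
      ; 1≢0 = λ eq → F.1≉0 (F.trans (F.sym (e-idx _)) (F.trans (F.reflexive (≡.cong e eq)) (e-idx _)))
      ; inverse = inverse }
      where
      module K = RawRing rawRing
      inverse : ∀ i → i ≢ K.0# → ∃ λ j → i K.* j ≡ K.1#
      inverse i i≢0 with y , eq ← F.inverse (e i) (λ eq → i≢0 (e-injective (F.trans eq (F.sym (e-idx _))))) =
        idx y , e-injective (F.trans (e-idx _) (F.trans (F.*-congˡ (e-idx y)) (F.trans eq (F.sym (e-idx _)))))

-- Finite fields: roots, power sums and classes of powers.

module CurveOverFiniteField where

  open Sums
  open LatticeSums
  open FieldTransport
  open import Defs using (FiniteField; #E)
  open import Algebra.Bundles using (CommutativeRing)
  import Algebra.Properties.CommutativeSemiring.Exp
  import Algebra.Properties.Ring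
  import Algebra.Properties.Semiring.Exp
  open import Data.Fin using (Fin; zero; suc)
  import Data.Fin.Properties as Fin
  open import Data.Integer as ℤ using (ℤ; +_; 0ℤ; 1ℤ)
  import Data.Integer.Properties as ℤ
  open import Data.Integer.Divisibility.Signed using (_∣_; divides; ∣-refl; ∣m∣n⇒∣m+n; ∣m∣n⇒∣m-n; ∣m⇒∣-m; ∣n⇒∣m*n; ∣m⇒∣m*n; _∣?_)
  open import Data.Integer.Tactic.RingSolver using (solve-∀)
  open import Data.List using (List; []; _∷_; length; allFin; filter; replicate; upTo; cartesianProduct)
  open import Data.List.Properties using (length-tabulate; length-replicate; length-upTo; tabulate-lookup; map-tabulate)
  open import Data.List.Membership.Propositional using (_∈_)
  open import Data.List.Membership.Propositional.Properties using (∈-allFin; ∈-filter⁺; ∈-filter⁻; ∈-upTo⁺; ∈-upTo⁻; ∈-length)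
  open import Data.List.Relation.Unary.All as All using (All; []; _∷_)
  open import Data.List.Relation.Unary.AllPairs using ([]; _∷_)
  open import Data.List.Relation.Unary.Any using (here; there)
  open import Data.List.Relation.Unary.Unique.Propositional using (Unique)
  import Data.List.Relation.Unary.Unique.Propositional.Properties as Unique
  open import Data.Nat as ℕ using (ℕ; zero; suc; z≤n; s≤s)
  open import Data.Nat.Combinatorics using (_C_; nCn≡1; nCk≡nC[n∸k]; nCk+nC[k+1]≡[n+1]C[k+1])
  import Data.Nat.Properties as ℕ
  open import Data.Product using (_×_; _,_; proj₁; proj₂; ∃)
  open import Data.Sum using (_⊎_; inj₁; inj₂)
  open import Function using (_∘_)
  open import Relation.Nullary using (¬_; Dec; yes; no; contradiction)
  open import Relation.Nullary.Decidable using (¬?; _⊎-dec_; from-no)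
  open import Relation.Unary using (Decidable)
  open import Relation.Binary.Definitions using (tri<; tri≈; tri>)
  open import Relation.Binary.PropositionalEquality using (_≡_; _≢_; refl; sym; trans; cong; cong₂; subst; subst₂; module ≡-Reasoning)

  module _ {A : Set} where

    ∑-1 : (xs : List A) → ∑ xs (λ _ → 1ℤ) ≡ + length xs
    ∑-1 []       = refl
    ∑-1 (x ∷ xs) = cong (λ z → 1ℤ ℤ.+ z) (∑-1 xs)

    ∑-≥0 : (xs : List A) {f : A → ℤ} → (∀ x → 0ℤ ℤ.≤ f x) → 0ℤ ℤ.≤ ∑ xs f
    ∑-≥0 []       pos = ℤ.≤-refl
    ∑-≥0 (x ∷ xs) pos = ℤ.+-mono-≤ (pos x) (∑-≥0 xs pos)

    ∑-≥0-vanishes : (xs : List A) {f : A → ℤ} → (∀ x → 0ℤ ℤ.≤ f x) → ∑ xs f ≡ 0ℤ → ∀ {x} → x ∈ xs → f x ≡ 0ℤ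
    ∑-≥0-vanishes (x ∷ xs) {f} pos eq = λ where
        (here refl) → head-zero
        (there x∈)  → ∑-≥0-vanishes xs pos rest x∈
      where
      head-zero : f x ≡ 0ℤ
      head-zero = ℤ.≤-antisym (subst₂ ℤ._≤_ (ℤ.+-identityʳ (f x)) eq (ℤ.+-monoʳ-≤ (f x) (∑-≥0 xs pos))) (pos x)
      rest : ∑ xs f ≡ 0ℤ
      rest = trans (sym (ℤ.+-identityˡ _)) (trans (cong (λ z → z ℤ.+ ∑ xs f) (sym head-zero)) eq)

  module FieldTheory (q : ℕ) (K : FieldOn (Fin q)) where

    open FieldOn K public
    open CommutativeRing commutativeRing public
      using (_-_; +-assoc; +-comm; +-identityˡ; +-identityʳ; -‿inverseˡ; -‿inverseʳ; *-assoc; *-comm; *-identityˡ; *-identityʳ; zeroˡ; zeroʳ; distribˡ; distribʳ; semiring; commutativeSemiring; ring; +-commutativeMonoid; *-commutativeMonoid)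
    open Algebra.Properties.Semiring.Exp semiring public using (_^_; ^-homo-*; ^-assocʳ)
    open Algebra.Properties.CommutativeSemiring.Exp commutativeSemiring public using (^-distrib-*)
    open Algebra.Properties.Ring ring public using (-‿involutive; -‿distribˡ-*; -‿distribʳ-*)
    open IntegerImage commutativeRing public
    open RingSum commutativeRing public using () renaming (∑ to ∑ᴷ; ∑-cong to ∑ᴷ-cong; ∑-+ to ∑ᴷ-+; ∑-*ˡ to ∑ᴷ-*ˡ; ∑-bijection to ∑ᴷ-bijection; ∑-single to ∑ᴷ-single; ∑-swap to ∑ᴷ-swap; ∑-0 to ∑ᴷ-0)
    open Sum *-commutativeMonoid public using () renaming (∑ to ∏; ∑-bijection to ∏-bijection)

    infix 4 _≟_
    _≟_ : (x y : Fin q) → Dec (x ≡ y)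
    _≟_ = Fin._≟_

    fs : List (Fin q)
    fs = allFin q

    fs-unique : Unique fs
    fs-unique = Unique.allFin⁺ q

    length-fs : length fs ≡ q
    length-fs = length-tabulate {n = q} (λ i → i)

    nonzero? : (x : Fin q) → Dec (x ≢ 0#)
    nonzero? x = ¬? (x ≟ 0#)

    nz : List (Fin q)
    nz = filter nonzero? fs

    nz⁺ : ∀ {x} → x ≢ 0# → x ∈ nz
    nz⁺ {x} x≢0 = ∈-filter⁺ nonzero? (∈-allFin x) x≢0

    nz⁻ : ∀ {x} → x ∈ nz → x ≢ 0#
    nz⁻ x∈ = proj₂ (∈-filter⁻ nonzero? {xs = fs} x∈)

    nz-unique : Unique nz
    nz-unique = Unique.filter⁺ nonzero? fs-unique

    -- This is q - 1, obtained as a count rather than by truncated subtraction.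
    m : ℕ
    m = length nz

    count-single : ∀ a → ∑ fs (λ x → 𝟙 (x ≟ a)) ≡ 1ℤ
    count-single a = trans (∑-single _ fs-unique (∈-allFin a) (λ x x≢a → 𝟙-no (x ≟ a) x≢a)) (𝟙-yes (a ≟ a) refl)

    suc-m : suc m ≡ q
    suc-m = ℤ.+-injective (begin
      + suc m                                          ≡⟨ cong (λ z → 1ℤ ℤ.+ z) (length-filter nonzero? fs) ⟩
      1ℤ ℤ.+ ∑ fs (λ x → 𝟙 (nonzero? x))               ≡⟨ cong (λ z → z ℤ.+ ∑ fs (λ x → 𝟙 (nonzero? x))) (count-single 0#) ⟨
      ∑ fs (λ x → 𝟙 (x ≟ 0#)) ℤ.+ ∑ fs (λ x → 𝟙 (nonzero? x)) ≡⟨ ∑-+ fs _ _ ⟨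
      ∑ fs (λ x → 𝟙 (x ≟ 0#) ℤ.+ 𝟙 (nonzero? x))       ≡⟨ ∑-cong fs (λ x → complement (x ≟ 0#)) ⟩
      ∑ fs (λ _ → 1ℤ)                                  ≡⟨ ∑-1 fs ⟩
      + length fs                                      ≡⟨ cong +_ length-fs ⟩
      + q                                              ∎)
      where
      open ≡-Reasoning
      complement : ∀ {P : Set} (p? : Dec P) → 𝟙 p? ℤ.+ 𝟙 (¬? p?) ≡ 1ℤ
      complement (yes _) = refl
      complement (no _)  = refl

    0<m : 0 ℕ.< m
    0<m = ∈-length (nz⁺ 1≢0)

    *-cancelˡ : ∀ {a x y} → a ≢ 0# → a * x ≡ a * y → x ≡ y
    *-cancelˡ {a} {x} {y} a≢0 eq with b , ab ← inverse a a≢0 = begin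
      x            ≡⟨ back x ⟨
      b * (a * x)  ≡⟨ cong (b *_) eq ⟩
      b * (a * y)  ≡⟨ back y ⟩
      y            ∎
      where
      open ≡-Reasoning
      back : ∀ x → b * (a * x) ≡ x
      back x = trans (sym (*-assoc b a x)) (trans (cong (_* x) (trans (*-comm b a) ab)) (*-identityˡ x))

    *-nonzero : ∀ {x y} → x ≢ 0# → y ≢ 0# → x * y ≢ 0#
    *-nonzero {x} {y} x≢0 y≢0 eq = y≢0 (*-cancelˡ x≢0 (trans eq (sym (zeroʳ x))))

    ^-nonzero : ∀ {x} n → x ≢ 0# → x ^ n ≢ 0#
    ^-nonzero zero    x≢0 = 1≢0
    ^-nonzero (suc n) x≢0 = *-nonzero x≢0 (^-nonzero n x≢0)

    x-y≡0⇒x≡y : ∀ {x y} → x - y ≡ 0# → x ≡ y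
    x-y≡0⇒x≡y {x} {y} eq = trans (solve 2 (λ x y → x := (x :- y) :+ y) refl x y) (trans (cong (_+ y) eq) (+-identityˡ y))

    1^n : ∀ n → 1# ^ n ≡ 1#
    1^n zero    = refl
    1^n (suc n) = trans (*-identityˡ (1# ^ n)) (1^n n)

    0^n : ∀ n → 0 ℕ.< n → 0# ^ n ≡ 0#
    0^n (suc n) _ = zeroˡ (0# ^ n)

    bij-* : ∀ {a} → a ≢ 0# → (w : Fin q → Fin q) → ∑ᴷ fs (λ x → w (a * x)) ≡ ∑ᴷ fs w
    bij-* {a} a≢0 w with b , ab ← inverse a a≢0 = ∑ᴷ-bijection (a *_) fs-unique fs-unique (λ {x} _ → ∈-allFin (a * x)) (λ _ _ → *-cancelˡ a≢0)
      (λ {y} _ → b * y , ∈-allFin (b * y) , trans (sym (*-assoc a b y)) (trans (cong (_* y) ab) (*-identityˡ y))) w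

    -- Multiplication by x permutes the nonzero elements, so their product P satisfies P = x^m P.
    fermat : ∀ {x} → x ≢ 0# → x ^ m ≡ 1#
    fermat {x} x≢0 with b , xb ← inverse x x≢0 = *-cancelˡ (∏≢0 nz nz⁻) (begin
      P * x ^ m                  ≡⟨ *-comm P (x ^ m) ⟩
      x ^ length nz * P          ≡⟨ pull nz ⟨
      ∏ nz (x *_)                ≡⟨ ∏-bijection (x *_) nz-unique nz-unique (λ y∈ → nz⁺ (*-nonzero x≢0 (nz⁻ y∈))) (λ _ _ → *-cancelˡ x≢0)
                                      (λ {y} y∈ → b * y , nz⁺ (λ by≡0 → nz⁻ y∈ (trans (sym (xby y)) (trans (cong (x *_) by≡0) (zeroʳ x)))) , xby y) (λ y → y) ⟩
      P                          ≡⟨ *-identityʳ P ⟨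
      P * 1#                     ∎)
      where
      open ≡-Reasoning
      P : Fin q
      P = ∏ nz (λ y → y)
      xby : ∀ y → x * (b * y) ≡ y
      xby y = trans (sym (*-assoc x b y)) (trans (cong (_* y) xb) (*-identityˡ y))
      ∏≢0 : ∀ ys → (∀ {y} → y ∈ ys → y ≢ 0#) → ∏ ys (λ y → y) ≢ 0#
      ∏≢0 []       _  = 1≢0
      ∏≢0 (y ∷ ys) nz = *-nonzero (nz (here refl)) (∏≢0 ys (nz ∘ there))
      pull : ∀ ys → ∏ ys (x *_) ≡ x ^ length ys * ∏ ys (λ y → y)
      pull []       = sym (*-identityˡ 1#)
      pull (y ∷ ys) = trans (cong (x * y *_) (pull ys))
        (solve 4 (λ x y p r → (x :* y) :* (p :* r) := (x :* p) :* (y :* r)) refl x y (x ^ length ys) (∏ ys (λ y → y)))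

    -- Coefficients in increasing order, with an implicit leading coefficient 1.
    monic : List (Fin q) → Fin q → Fin q
    monic []       x = 1#
    monic (c ∷ cs) x = c + x * monic cs x

    -- Horner's scheme: the quotient of `c ∷ cs` by X - a is `quotient cs a`, one coefficient
    -- shorter.
    quotient : List (Fin q) → Fin q → List (Fin q)
    quotient []       a = []
    quotient (c ∷ cs) a = monic (c ∷ cs) a ∷ quotient cs a

    length-quotient : ∀ cs a → length (quotient cs a) ≡ length cs
    length-quotient []       a = refl
    length-quotient (c ∷ cs) a = cong suc (length-quotient cs a)

    division : ∀ c cs a x → monic (c ∷ cs) x ≡ monic (c ∷ cs) a + (x - a) * monic (quotient cs a) x
    division c []       a x = solve 4 (λ c a x o → c :+ x :* o := (c :+ a :* o) :+ (x :- a) :* o) refl c a x 1#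
    division c (d ∷ cs) a x = trans (cong (λ z → c + x * z) (division d cs a x))
      (solve 5 (λ c a x e r → c :+ x :* (e :+ (x :- a) :* r) := (c :+ a :* e) :+ (x :- a) :* (e :+ x :* r)) refl c a x (monic (d ∷ cs) a) (monic (quotient cs a) x))

    roots-bound : ∀ cs xs → Unique xs → All (λ x → monic cs x ≡ 0#) xs → length xs ℕ.≤ length cs
    roots-bound cs       []       _       _        = z≤n
    roots-bound []       (a ∷ xs) _       (r ∷ _)  = contradiction r 1≢0
    roots-bound (c ∷ cs) (a ∷ xs) (n ∷ u) (r ∷ rs) =
      s≤s (subst (length xs ℕ.≤_) (length-quotient cs a) (roots-bound (quotient cs a) xs u (All.zipWith root (n , rs))))
      where
      root : ∀ {x} → a ≢ x × monic (c ∷ cs) x ≡ 0# → monic (quotient cs a) x ≡ 0#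
      root {x} (a≢x , rx) = *-cancelˡ (λ x-a≡0 → a≢x (sym (x-y≡0⇒x≡y x-a≡0))) (begin
        (x - a) * monic (quotient cs a) x                       ≡⟨ +-identityˡ _ ⟨
        0# + (x - a) * monic (quotient cs a) x                  ≡⟨ cong (λ z → z + (x - a) * monic (quotient cs a) x) r ⟨
        monic (c ∷ cs) a + (x - a) * monic (quotient cs a) x    ≡⟨ division c cs a x ⟨
        monic (c ∷ cs) x                                        ≡⟨ rx ⟩
        0#                                                      ≡⟨ zeroʳ (x - a) ⟨
        (x - a) * 0#                                            ∎)
        where open ≡-Reasoning

    power-roots : ∀ k c xs → Unique xs → (∀ {x} → x ∈ xs → x ^ suc k ≡ c) → length xs ℕ.≤ suc k
    power-roots k c xs u roots = subst (length xs ℕ.≤_) (cong suc (length-replicate k)) (roots-bound (- c ∷ replicate k 0#) xs u (All.tabulate root))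
      where
      monic-power : ∀ k x → monic (replicate k 0#) x ≡ x ^ k
      monic-power zero    x = refl
      monic-power (suc k) x = trans (+-identityˡ _) (cong (x *_) (monic-power k x))
      root : ∀ {x} → x ∈ xs → - c + x * monic (replicate k 0#) x ≡ 0#
      root {x} x∈ = trans (cong (λ z → - c + x * z) (monic-power k x)) (trans (cong (λ z → - c + z) (roots x∈)) (-‿inverseˡ c))

    power-count : ∀ k c → ∑ fs (λ x → 𝟙 (x ^ suc k ≟ c)) ℤ.≤ + suc k
    power-count k c = subst (ℤ._≤ + suc k) (length-filter (λ x → x ^ suc k ≟ c) fs)
      (ℤ.+≤+ (power-roots k c (filter (λ x → x ^ suc k ≟ c) fs) (Unique.filter⁺ _ fs-unique) (λ x∈ → proj₂ (∈-filter⁻ (λ x → x ^ suc k ≟ c) {xs = fs} x∈))))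

    -- X^k - 1 has at most k roots, fewer than the m nonzero elements. Elements found in this way
    -- take the place of a generator of the multiplicative group.
    non-root : ∀ k → 0 ℕ.< k → k ℕ.< m → ∃ λ a → a ≢ 0# × a ^ k ≢ 1#
    non-root (suc k) _ k<m with Fin.¬∀⟶∃¬ q (λ a → a ≡ 0# ⊎ a ^ suc k ≡ 1#) (λ a → (a ≟ 0#) ⊎-dec (a ^ suc k ≟ 1#)) all-roots
      where
      all-roots : ¬ (∀ a → a ≡ 0# ⊎ a ^ suc k ≡ 1#)
      all-roots h = ℕ.<-irrefl refl (ℕ.<-≤-trans k<m (power-roots k 1# nz nz-unique (λ {x} x∈ → at x (nz⁻ x∈))))
        where
        at : ∀ x → x ≢ 0# → x ^ suc k ≡ 1#
        at x x≢0 with h x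
        ... | inj₁ x≡0 = contradiction x≡0 x≢0
        ... | inj₂ eq  = eq
    ... | a , ¬root = a , (λ a≡0 → ¬root (inj₁ a≡0)) , (λ eq → ¬root (inj₂ eq))

    ∑ᴷ-1 : ∀ (xs : List (Fin q)) → ∑ᴷ xs (λ _ → 1#) ≡ ι (+ length xs)
    ∑ᴷ-1 []       = refl
    ∑ᴷ-1 (x ∷ xs) = cong (λ z → 1# + z) (∑ᴷ-1 xs)

    -- Translation by 1 permutes the field, so Σ x = Σ (x + 1) = Σ x + q.
    ι-q : ι (+ q) ≡ 0#
    ι-q = begin
      ι (+ q)                                   ≡⟨ cong (λ n → ι (+ n)) length-fs ⟨
      ι (+ length fs)                           ≡⟨ ∑ᴷ-1 fs ⟨
      ∑ᴷ fs (λ _ → 1#)                          ≡⟨ solve 2 (λ s t → t := (s :+ t) :- s) refl s (∑ᴷ fs (λ _ → 1#)) ⟩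
      (s + ∑ᴷ fs (λ _ → 1#)) - s                ≡⟨ cong (_- s) (∑ᴷ-+ fs (λ x → x) (λ _ → 1#)) ⟨
      ∑ᴷ fs (λ x → x + 1#) - s                  ≡⟨ cong (_- s) (∑ᴷ-bijection (_+ 1#) fs-unique fs-unique (λ {x} _ → ∈-allFin (x + 1#))
                                                      (λ {x} {y} _ _ eq → trans (there-and-back x) (trans (cong (_- 1#) eq) (sym (there-and-back y))))
                                                      (λ {y} _ → y - 1# , ∈-allFin (y - 1#) , solve 2 (λ y o → (y :- o) :+ o := y) refl y 1#) (λ x → x)) ⟩
      s - s                                     ≡⟨ -‿inverseʳ s ⟩
      0#                                        ∎
      where
      open ≡-Reasoning
      s : Fin q
      s = ∑ᴷ fs (λ x → x)
      there-and-back : ∀ x → x ≡ (x + 1#) - 1#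
      there-and-back x = solve 2 (λ x o → x := (x :+ o) :- o) refl x 1#

    powerSum : ℕ → Fin q
    powerSum k = ∑ᴷ fs (_^ k)

    -- Here 0^0 = 1, so all q elements contribute.
    powerSum-zero : powerSum 0 ≡ 0#
    powerSum-zero = trans (∑ᴷ-1 fs) (trans (cong (λ n → ι (+ n)) length-fs) ι-q)

    -- Scaling the variable by some `a` with a^k ≠ 1 leaves the sum unchanged and multiplies it by
    -- a^k.
    powerSum-small : ∀ k → 0 ℕ.< k → k ℕ.< m → powerSum k ≡ 0#
    powerSum-small k 0<k k<m with a , a≢0 , aᵏ≢1 ← non-root k 0<k k<m = *-cancelˡ (λ eq → aᵏ≢1 (x-y≡0⇒x≡y eq)) (begin
      (a ^ k - 1#) * powerSum k              ≡⟨ solve 3 (λ a o s → (a :- o) :* s := (a :* s) :- (o :* s)) refl (a ^ k) 1# (powerSum k) ⟩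
      a ^ k * powerSum k - 1# * powerSum k   ≡⟨ cong₂ _-_ scaled (*-identityˡ (powerSum k)) ⟩
      powerSum k - powerSum k                ≡⟨ -‿inverseʳ (powerSum k) ⟩
      0#                                     ≡⟨ zeroʳ (a ^ k - 1#) ⟨
      (a ^ k - 1#) * 0#                      ∎)
      where
      open ≡-Reasoning
      scaled : a ^ k * powerSum k ≡ powerSum k
      scaled = trans (sym (∑ᴷ-*ˡ (a ^ k) fs (_^ k))) (trans (∑ᴷ-cong fs (λ x → sym (^-distrib-* a x k))) (bij-* a≢0 (_^ k)))

    powerSum-periodic : ∀ k → 0 ℕ.< k → powerSum (k ℕ.+ m) ≡ powerSum k
    powerSum-periodic k 0<k = ∑ᴷ-cong fs (λ x → trans (^-homo-* x k m) (at x))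
      where
      at : ∀ x → x ^ k * x ^ m ≡ x ^ k
      at x with x ≟ 0#
      ... | yes refl = trans (cong (_* 0# ^ m) (0^n k 0<k)) (trans (zeroˡ _) (sym (0^n k 0<k)))
      ... | no x≢0   = trans (cong (x ^ k *_) (fermat x≢0)) (*-identityʳ (x ^ k))

    -- x^m is 1 away from zero and 0 at zero, so the sum is q - 1, and q vanishes in the field.
    powerSum-m : powerSum m ≡ - 1#
    powerSum-m = begin
      powerSum m                                 ≡⟨ solve 2 (λ s o → s := (s :+ o) :- o) refl (powerSum m) 1# ⟩
      powerSum m + 1# - 1#                       ≡⟨ cong (λ z → powerSum m + z - 1#) (trans (∑ᴷ-single at-zero fs-unique (∈-allFin 0#) at-nonzero) (at-0 (0# ≟ 0#))) ⟨
      powerSum m + ∑ᴷ fs at-zero - 1#            ≡⟨ cong (_- 1#) (∑ᴷ-+ fs (_^ m) at-zero) ⟨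
      ∑ᴷ fs (λ x → x ^ m + at-zero x) - 1#       ≡⟨ cong (_- 1#) (∑ᴷ-cong fs (λ x → total x (x ≟ 0#))) ⟩
      powerSum 0 - 1#                            ≡⟨ cong (_- 1#) powerSum-zero ⟩
      0# - 1#                                    ≡⟨ +-identityˡ (- 1#) ⟩
      - 1#                                       ∎
      where
      open ≡-Reasoning
      pick : {P : Set} → Dec P → Fin q
      pick (yes _) = 1#
      pick (no _)  = 0#
      at-zero : Fin q → Fin q
      at-zero x = pick (x ≟ 0#)
      at-0 : ∀ (d : Dec (0# ≡ 0#)) → pick d ≡ 1#
      at-0 (yes _) = refl
      at-0 (no n)  = contradiction refl n
      at-nonzero : ∀ x → x ≢ 0# → at-zero x ≡ 0#
      at-nonzero x x≢0 with x ≟ 0#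
      ... | yes eq = contradiction eq x≢0
      ... | no _   = refl
      total : ∀ x (d : Dec (x ≡ 0#)) → x ^ m + pick d ≡ 1#
      total x (yes refl) = trans (cong (_+ 1#) (0^n m 0<m)) (+-identityˡ 1#)
      total x (no x≢0)   = trans (+-identityʳ (x ^ m)) (fermat x≢0)

    affinePoints : ℤ
    affinePoints = ∑ fs (λ x → ∑ fs (λ y → 𝟙 (y * y ≟ x * x * x + 1#)))

  module Cover (q : ℕ) (K : FieldOn (Fin q)) where
    open FieldTheory q K

    module Roots (e′ k : ℕ) (g : Fin q) (ek≡m : suc e′ ℕ.* k ≡ m) (g≢0 : g ≢ 0#)
      (faithful : ∀ d → 0 ℕ.< d → d ℕ.< suc e′ → g ^ (d ℕ.* k) ≢ 1#) where

      e : ℕ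
      e = suc e′

      N : ℕ → Fin q → ℤ
      N i z = ∑ fs (λ x → 𝟙 (g ^ i * x ^ e ≟ z))

      Hits : ℕ → Fin q → Set
      Hits i z = ∃ λ x → g ^ i * x ^ e ≡ z

      hits? : ∀ i z → Dec (Hits i z)
      hits? i z = Fin.any? (λ x → g ^ i * x ^ e ≟ z)

      N-none : ∀ {i z} → ¬ Hits i z → N i z ≡ 0ℤ
      N-none {i} {z} ¬h = ∑-0 fs (λ x → 𝟙-no (g ^ i * x ^ e ≟ z) (λ eq → ¬h (x , eq)))

      N-bound : ∀ i z → N i z ℤ.≤ + e
      N-bound i z with h , gh ← inverse (g ^ i) (^-nonzero i g≢0) =
        subst (ℤ._≤ + e) (∑-cong fs (λ x → 𝟙-cong
            (λ eq → trans (cong (g ^ i *_) eq) (trans (sym (*-assoc (g ^ i) h z)) (trans (cong (_* z) gh) (*-identityˡ z))))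
            (λ eq → trans (sym (*-identityˡ (x ^ e))) (trans (cong (_* x ^ e) (trans (sym gh) (*-comm (g ^ i) h))) (trans (*-assoc h (g ^ i) (x ^ e)) (cong (h *_) eq))))
            (x ^ e ≟ h * z) (g ^ i * x ^ e ≟ z)))
          (power-count e′ (h * z))

      factor-nonzero : ∀ {i x z} → z ≢ 0# → g ^ i * x ^ e ≡ z → x ≢ 0#
      factor-nonzero {i} {x} z≢0 eq refl = z≢0 (trans (sym eq) (trans (cong (g ^ i *_) (zeroˡ (0# ^ e′))) (zeroʳ (g ^ i))))

      power-e-k : ∀ {x} → x ≢ 0# → (x ^ e) ^ k ≡ 1#
      power-e-k {x} x≢0 = trans (^-assocʳ x e k) (trans (cong (x ^_) ek≡m) (fermat x≢0))

      -- If z lay in the classes of both g^i and g^j, then g^(j - i) would be an e-th power and its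
      -- k-th power would be 1, against `faithful`.
      not-less : ∀ {i j z} → z ≢ 0# → j ℕ.< e → Hits i z → Hits j z → ¬ (i ℕ.< j)
      not-less {i} {j} {z} z≢0 j<e (x , ex) (y , ey) i<j = faithful d (ℕ.m<n⇒0<n∸m i<j) (ℕ.≤-<-trans (ℕ.m∸n≤m j i) j<e) (begin
        g ^ (d ℕ.* k)             ≡⟨ ^-assocʳ g d k ⟨
        (g ^ d) ^ k               ≡⟨ *-identityʳ _ ⟨
        (g ^ d) ^ k * 1#          ≡⟨ cong ((g ^ d) ^ k *_) (power-e-k (factor-nonzero {j} {y} {z} z≢0 ey)) ⟨
        (g ^ d) ^ k * (y ^ e) ^ k ≡⟨ ^-distrib-* (g ^ d) (y ^ e) k ⟨
        (g ^ d * y ^ e) ^ k       ≡⟨ cong (_^ k) ratio ⟨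
        (x ^ e) ^ k               ≡⟨ power-e-k (factor-nonzero {i} {x} {z} z≢0 ex) ⟩
        1#                        ∎)
        where
        open ≡-Reasoning
        d : ℕ
        d = j ℕ.∸ i
        ratio : x ^ e ≡ g ^ d * y ^ e
        ratio = *-cancelˡ (^-nonzero i g≢0) (begin
          g ^ i * x ^ e             ≡⟨ trans ex (sym ey) ⟩
          g ^ j * y ^ e             ≡⟨ cong (λ n → g ^ n * y ^ e) (ℕ.m+[n∸m]≡n (ℕ.<⇒≤ i<j)) ⟨
          g ^ (i ℕ.+ d) * y ^ e     ≡⟨ cong (_* y ^ e) (^-homo-* g i d) ⟩
          g ^ i * g ^ d * y ^ e     ≡⟨ *-assoc (g ^ i) (g ^ d) (y ^ e) ⟩
          g ^ i * (g ^ d * y ^ e)   ∎)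

      exclusive : ∀ {i j z} → z ≢ 0# → i ℕ.< e → j ℕ.< e → Hits i z → Hits j z → i ≡ j
      exclusive {i} {j} z≢0 i<e j<e hi hj with ℕ.<-cmp i j
      ... | tri< i<j _ _ = contradiction i<j (not-less z≢0 j<e hi hj)
      ... | tri≈ _ i≡j _ = i≡j
      ... | tri> _ _ j<i = contradiction j<i (not-less z≢0 i<e hj hi)

      -- The number of representations z = g^i x^e with i < e.
      f : Fin q → ℤ
      f z = ∑ (upTo e) (λ i → N i z)

      f-hit : ∀ {i z} → z ≢ 0# → i ℕ.< e → Hits i z → f z ≡ N i z
      f-hit {i} {z} z≢0 i<e hi = ∑-single∈ (λ j → N j z) (Unique.upTo⁺ e) (∈-upTo⁺ i<e)
        (λ {j} j∈ j≢i → N-none {j} {z} (λ hj → j≢i (exclusive z≢0 (∈-upTo⁻ j∈) i<e hj hi)))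

      f-none : ∀ {z} → (∀ {i} → i ℕ.< e → ¬ Hits i z) → f z ≡ 0ℤ
      f-none {z} none = trans (∑-cong∈ (upTo e) {λ i → N i z} {λ _ → 0ℤ} (λ {i} i∈ → N-none {i} {z} (none (∈-upTo⁻ i∈)))) (∑-0 (upTo e) {λ _ → 0ℤ} (λ _ → refl))

      f-bound : ∀ z → z ≢ 0# → f z ℤ.≤ + e
      f-bound z z≢0 with ℕ.anyUpTo? (λ i → hits? i z) e
      ... | yes (i , i<e , hi) = subst (ℤ._≤ + e) (sym (f-hit z≢0 i<e hi)) (N-bound i z)
      ... | no none = subst (ℤ._≤ + e) (sym (f-none (λ {i} i<e hi → none (i , i<e , hi)))) (ℤ.+≤+ z≤n)

      N-zero : ∀ i → N i 0# ≡ 1ℤ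
      N-zero i = trans (∑-cong fs (λ x → 𝟙-cong (λ eq → at x eq (x ≟ 0#)) (λ { refl → trans (cong (g ^ i *_) (zeroˡ (0# ^ e′))) (zeroʳ (g ^ i)) }) (g ^ i * x ^ e ≟ 0#) (x ≟ 0#))) (count-single 0#)
        where
        at : ∀ x → g ^ i * x ^ e ≡ 0# → Dec (x ≡ 0#) → x ≡ 0#
        at x eq (yes x≡0) = x≡0
        at x eq (no x≢0)  = contradiction eq (*-nonzero (^-nonzero i g≢0) (^-nonzero e x≢0))

      ∑-e : (c : ℤ) → ∑ (upTo e) (λ _ → c) ≡ + e ℤ.* c
      ∑-e c = trans (∑-cong (upTo e) (λ _ → sym (ℤ.*-identityʳ c))) (trans (∑-*ˡ c (upTo e) (λ _ → 1ℤ)) (trans (cong (c ℤ.*_) (trans (∑-1 (upTo e)) (cong +_ (length-upTo e)))) (ℤ.*-comm c (+ e))))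

      f-zero : f 0# ≡ + e
      f-zero = trans (∑-cong (upTo e) N-zero) (trans (∑-e 1ℤ) (ℤ.*-identityʳ (+ e)))

      sum-by-value : (φ : Fin q → ℤ) → ∑ (upTo e) (λ i → ∑ fs (λ x → φ (g ^ i * x ^ e))) ≡ ∑ fs (λ z → f z ℤ.* φ z)
      sum-by-value φ = begin
        ∑ (upTo e) (λ i → ∑ fs (λ x → φ (g ^ i * x ^ e)))
          ≡⟨ ∑-cong (upTo e) (λ i → ∑-cong fs (λ x → expand (g ^ i * x ^ e))) ⟩
        ∑ (upTo e) (λ i → ∑ fs (λ x → ∑ fs (λ z → 𝟙 (g ^ i * x ^ e ≟ z) ℤ.* φ z)))
          ≡⟨ ∑-cong (upTo e) (λ i → trans (∑-swap fs fs _) (∑-cong fs (λ z → ∑-*ʳ (φ z) fs (λ x → 𝟙 (g ^ i * x ^ e ≟ z))))) ⟩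
        ∑ (upTo e) (λ i → ∑ fs (λ z → N i z ℤ.* φ z))
          ≡⟨ trans (∑-swap (upTo e) fs _) (∑-cong fs (λ z → ∑-*ʳ (φ z) (upTo e) (λ i → N i z))) ⟩
        ∑ fs (λ z → f z ℤ.* φ z) ∎
        where
        open ≡-Reasoning
        expand : ∀ c → φ c ≡ ∑ fs (λ z → 𝟙 (c ≟ z) ℤ.* φ z)
        expand c = sym (trans (∑-single (λ z → 𝟙 (c ≟ z) ℤ.* φ z) fs-unique (∈-allFin c) (λ z z≢c → cong (ℤ._* φ z) (𝟙-no (c ≟ z) (z≢c ∘ sym))))
          (trans (cong (ℤ._* φ c) (𝟙-yes (c ≟ c) refl)) (ℤ.*-identityˡ (φ c))))

      -- No z is represented more than e times, while the e maps on q elements produce e q values in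
      -- all; so every bound is attained. This is the decomposition into classes modulo e-th powers,
      -- obtained by counting.
      f≡e : ∀ z → f z ≡ + e
      f≡e z = sym (ℤ.i-j≡0⇒i≡j (+ e) (f z) (∑-≥0-vanishes fs {λ z → + e ℤ.- f z} nonneg total (∈-allFin z)))
        where
        nonneg : ∀ z → 0ℤ ℤ.≤ + e ℤ.- f z
        nonneg z with z ≟ 0#
        ... | yes refl = ℤ.≤-reflexive (sym (ℤ.i≡j⇒i-j≡0 (sym f-zero)))
        ... | no z≢0   = ℤ.i≤j⇒0≤j-i (f-bound z z≢0)
        total : ∑ fs (λ z → + e ℤ.- f z) ≡ 0ℤ
        total = begin
          ∑ fs (λ z → + e ℤ.- f z)
            ≡⟨ ∑-- fs (λ _ → + e) f ⟩
          ∑ fs (λ _ → + e) ℤ.- ∑ fs f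
            ≡⟨ cong₂ ℤ._-_ (trans (∑-cong fs (λ _ → sym (ℤ.*-identityʳ (+ e)))) (∑-*ˡ (+ e) fs (λ _ → 1ℤ))) (∑-cong fs (λ z → sym (ℤ.*-identityʳ (f z)))) ⟩
          + e ℤ.* ∑ fs (λ _ → 1ℤ) ℤ.- ∑ fs (λ z → f z ℤ.* 1ℤ)
            ≡⟨ cong (λ s → + e ℤ.* ∑ fs (λ _ → 1ℤ) ℤ.- s) (trans (sym (sum-by-value (λ _ → 1ℤ))) (∑-e (∑ fs (λ _ → 1ℤ)))) ⟩
          + e ℤ.* ∑ fs (λ _ → 1ℤ) ℤ.- + e ℤ.* ∑ fs (λ _ → 1ℤ)
            ≡⟨ ℤ.i≡j⇒i-j≡0 {+ e ℤ.* ∑ fs (λ _ → 1ℤ)} refl ⟩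
          0ℤ ∎
          where open ≡-Reasoning

      cover-sum : (φ : Fin q → ℤ) → ∑ (upTo e) (λ i → ∑ fs (λ x → φ (g ^ i * x ^ e))) ≡ + e ℤ.* ∑ fs φ
      cover-sum φ = trans (sum-by-value φ) (trans (∑-cong fs (λ z → cong (ℤ._* φ z) (f≡e z))) (∑-*ˡ (+ e) fs φ))

      covered : ∀ z → ∃ λ i → i ℕ.< e × Hits i z
      covered z with ℕ.anyUpTo? (λ i → hits? i z) e
      ... | yes h   = h
      ... | no none = contradiction (trans (sym (f≡e z)) (f-none (λ {i} i<e hi → none (i , i<e , hi)))) (λ ())

      N-full : ∀ {i z} → z ≢ 0# → i ℕ.< e → Hits i z → N i z ≡ + e
      N-full {i} {z} z≢0 i<e h = trans (sym (f-hit {i} {z} z≢0 i<e h)) (f≡e z)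

  -- Character sums of the three cubic twists.

  module Moments (q : ℕ) (K : FieldOn (Fin q)) (j : ℕ) (6j≡m : 6 ℕ.* j ≡ FieldTheory.m q K) where
    open FieldTheory q K
    open Cover q K

    -- The exponents (q - 1)/2 and (q - 1)/3 of the quadratic and the cubic residue tests.
    M c : ℕ
    M = 3 ℕ.* j
    c = 2 ℕ.* j

    2M≡m : 2 ℕ.* M ≡ m
    2M≡m = trans (sym (ℕ.*-assoc 2 3 j)) 6j≡m

    3c≡m : 3 ℕ.* c ≡ m
    3c≡m = trans (sym (ℕ.*-assoc 3 2 j)) 6j≡m

    0<j : 0 ℕ.< j
    0<j = ℕ.n≢0⇒n>0 (λ { refl → ℕ.<-irrefl 6j≡m 0<m })

    M-root : ∃ λ a → a ≢ 0# × a ^ M ≢ 1#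
    M-root = non-root M (ℕ.≤-trans 0<j (ℕ.m≤n*m j 3)) (subst (M ℕ.<_) 2M≡m (ℕ.m<m+n M (ℕ.≤-trans (ℕ.≤-trans 0<j (ℕ.m≤n*m j 3)) (ℕ.m≤m+n M 0))))

    c-root : ∃ λ a → a ≢ 0# × a ^ c ≢ 1#
    c-root = non-root c (ℕ.≤-trans 0<j (ℕ.m≤n*m j 2)) (subst (c ℕ.<_) 3c≡m (ℕ.m<m+n c (ℕ.≤-trans (ℕ.≤-trans 0<j (ℕ.m≤n*m j 2)) (ℕ.m≤m+n c (c ℕ.+ 0)))))

    a b : Fin q
    a = proj₁ M-root
    b = proj₁ c-root

    a≢0 : a ≢ 0#
    a≢0 = proj₁ (proj₂ M-root)

    b≢0 : b ≢ 0#
    b≢0 = proj₁ (proj₂ c-root)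

    a-faithful : ∀ d → 0 ℕ.< d → d ℕ.< 2 → a ^ (d ℕ.* M) ≢ 1#
    a-faithful 1 _ _ eq = proj₂ (proj₂ M-root) (trans (cong (a ^_) (sym (ℕ.+-identityʳ M))) eq)
    a-faithful (suc (suc d)) _ (s≤s (s≤s ()))

    b-faithful : ∀ d → 0 ℕ.< d → d ℕ.< 3 → b ^ (d ℕ.* c) ≢ 1#
    b-faithful 1 _ _ eq = proj₂ (proj₂ c-root) (trans (cong (b ^_) (sym (ℕ.+-identityʳ c))) eq)
    b-faithful 2 _ _ eq = proj₂ (proj₂ c-root) (begin
      b ^ c                       ≡⟨ *-identityʳ (b ^ c) ⟨
      b ^ c * 1#                  ≡⟨ cong (b ^ c *_) eq ⟨
      b ^ c * b ^ (2 ℕ.* c)       ≡⟨ ^-homo-* b c (2 ℕ.* c) ⟨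
      b ^ (3 ℕ.* c)               ≡⟨ cong (b ^_) 3c≡m ⟩
      b ^ m                       ≡⟨ fermat b≢0 ⟩
      1#                          ∎)
      where open ≡-Reasoning
    b-faithful (suc (suc (suc d))) _ (s≤s (s≤s (s≤s ())))

    module Sq = Roots 1 M a 2M≡m a≢0 a-faithful
    module Cu = Roots 2 c b 3c≡m b≢0 b-faithful

    -- `χ₂` is the quadratic character, read off from the number of square roots so that it relates
    -- directly to point counts.
    r₂ r₃ χ₂ : Fin q → ℤ
    r₂ z = ∑ fs (λ y → 𝟙 (y * y ≟ z))
    r₃ z = ∑ fs (λ x → 𝟙 (x * x * x ≟ z))
    χ₂ z = r₂ z ℤ.- 1ℤ

    square : ∀ y → a ^ 0 * y ^ 2 ≡ y * y
    square y = trans (*-identityˡ _) (cong (y *_) (*-identityʳ y))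

    cube : ∀ x → b ^ 0 * x ^ 3 ≡ x * x * x
    cube x = trans (*-identityˡ _) (trans (cong (λ z → x * (x * z)) (*-identityʳ x)) (sym (*-assoc x x x)))

    r₂≡ : ∀ z → r₂ z ≡ Sq.N 0 z
    r₂≡ z = ∑-cong fs (λ y → cong (λ s → 𝟙 (s ≟ z)) (sym (square y)))

    r₃≡ : ∀ z → r₃ z ≡ Cu.N 0 z
    r₃≡ z = ∑-cong fs (λ x → cong (λ s → 𝟙 (s ≟ z)) (sym (cube x)))

    data Kind : Fin q → Set where
      is-zero   : Kind 0#
      is-square : ∀ y → y ≢ 0# → Kind (y * y)
      is-other  : ∀ y → y ≢ 0# → Kind (a * (y * y))

    kind : ∀ z → Kind z
    kind z with z ≟ 0#
    ... | yes refl = is-zero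
    ... | no z≢0 with Sq.covered z
    ...   | 0 , _ , y , eq = subst Kind (trans (sym (square y)) eq) (is-square y (Sq.factor-nonzero {0} {y} {z} z≢0 eq))
    ...   | 1 , _ , y , eq = subst Kind (trans (sym (cong₂ _*_ (*-identityʳ a) (cong (y *_) (*-identityʳ y)))) eq) (is-other y (Sq.factor-nonzero {1} {y} {z} z≢0 eq))
    ...   | suc (suc _) , s≤s (s≤s ()) , _

    χ₂-zero : χ₂ 0# ≡ 0ℤ
    χ₂-zero = cong (ℤ._- 1ℤ) (trans (r₂≡ 0#) (Sq.N-zero 0))

    χ₂-square : ∀ {y} → y ≢ 0# → χ₂ (y * y) ≡ 1ℤ
    χ₂-square {y} y≢0 = cong (ℤ._- 1ℤ) (trans (r₂≡ (y * y)) (Sq.N-full {0} {y * y} (*-nonzero y≢0 y≢0) (s≤s z≤n) (y , square y)))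

    χ₂-other : ∀ {y} → y ≢ 0# → χ₂ (a * (y * y)) ≡ ℤ.- 1ℤ
    χ₂-other {y} y≢0 = cong (ℤ._- 1ℤ) (trans (r₂≡ z) (Sq.N-none {0} {z} (λ h → contradiction
        (Sq.exclusive {0} {1} {z} (*-nonzero a≢0 (*-nonzero y≢0 y≢0)) (s≤s z≤n) (s≤s (s≤s z≤n)) h (y , cong₂ _*_ (*-identityʳ a) (cong (y *_) (*-identityʳ y)))) (λ ()))))
      where
      z : Fin q
      z = a * (y * y)

    χ₂-mul : ∀ x y → χ₂ (x * y) ≡ χ₂ x ℤ.* χ₂ y
    χ₂-mul x y with kind x | kind y
    ... | is-zero | _ = trans (cong χ₂ (zeroˡ y)) (trans χ₂-zero (cong (ℤ._* χ₂ y) (sym χ₂-zero)))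
    ... | is-square u u≢0 | is-zero = trans (cong χ₂ (zeroʳ (u * u))) (trans χ₂-zero (sym (trans (cong (χ₂ (u * u) ℤ.*_) χ₂-zero) (ℤ.*-zeroʳ (χ₂ (u * u))))))
    ... | is-other u u≢0 | is-zero = trans (cong χ₂ (zeroʳ (a * (u * u)))) (trans χ₂-zero (sym (trans (cong (χ₂ (a * (u * u)) ℤ.*_) χ₂-zero) (ℤ.*-zeroʳ (χ₂ (a * (u * u)))))))
    ... | is-square u u≢0 | is-square v v≢0 = trans (cong χ₂ (solve 2 (λ u v → (u :* u) :* (v :* v) := (u :* v) :* (u :* v)) refl u v))
          (trans (χ₂-square (*-nonzero u≢0 v≢0)) (sym (cong₂ ℤ._*_ (χ₂-square u≢0) (χ₂-square v≢0))))
    ... | is-square u u≢0 | is-other v v≢0 = trans (cong χ₂ (solve 3 (λ a u v → (u :* u) :* (a :* (v :* v)) := a :* ((u :* v) :* (u :* v))) refl a u v))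
          (trans (χ₂-other (*-nonzero u≢0 v≢0)) (sym (cong₂ ℤ._*_ (χ₂-square u≢0) (χ₂-other v≢0))))
    ... | is-other u u≢0 | is-square v v≢0 = trans (cong χ₂ (solve 3 (λ a u v → (a :* (u :* u)) :* (v :* v) := a :* ((u :* v) :* (u :* v))) refl a u v))
          (trans (χ₂-other (*-nonzero u≢0 v≢0)) (sym (cong₂ ℤ._*_ (χ₂-other u≢0) (χ₂-square v≢0))))
    ... | is-other u u≢0 | is-other v v≢0 = trans (cong χ₂ (solve 3 (λ a u v → (a :* (u :* u)) :* (a :* (v :* v)) := (a :* u :* v) :* (a :* u :* v)) refl a u v))
          (trans (χ₂-square (*-nonzero (*-nonzero a≢0 u≢0) v≢0)) (sym (cong₂ ℤ._*_ (χ₂-other u≢0) (χ₂-other v≢0))))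

    -- It squares to 1 and differs from 1.
    a^M≡-1 : a ^ M ≡ - 1#
    a^M≡-1 = *-cancelˡ {a ^ M - 1#} (λ eq → proj₂ (proj₂ M-root) (x-y≡0⇒x≡y eq)) (begin
      (a ^ M - 1#) * a ^ M     ≡⟨ solve 2 (λ s o → (s :- o) :* s := s :* s :- o :* s) refl (a ^ M) 1# ⟩
      a ^ M * a ^ M - 1# * a ^ M ≡⟨ cong₂ _-_ (trans (sym (^-homo-* a M M)) (trans (cong (a ^_) (trans (cong (M ℕ.+_) (sym (ℕ.+-identityʳ M))) 2M≡m)) (fermat a≢0))) (*-identityˡ (a ^ M)) ⟩
      1# - a ^ M               ≡⟨ cong₂ _-_ (sym (*-identityʳ 1#)) (sym (*-identityʳ (a ^ M))) ⟩
      1# * 1# - a ^ M * 1#     ≡⟨ solve 2 (λ s o → o :* o :- s :* o := (s :- o) :* (:- o)) refl (a ^ M) 1# ⟩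
      (a ^ M - 1#) * - 1#      ∎)
      where open ≡-Reasoning

    -- The bridge from integer character sums to power sums in the field.
    euler : ∀ z → ι (χ₂ z) ≡ z ^ M
    euler z with kind z
    ... | is-zero = trans (cong ι χ₂-zero) (sym (0^n M (ℕ.≤-trans 0<j (ℕ.m≤n*m j 3))))
    ... | is-square y y≢0 = trans (cong ι (χ₂-square y≢0)) (trans (+-identityʳ 1#) (sym (square^M y≢0)))
      where
      square^M : ∀ {y} → y ≢ 0# → (y * y) ^ M ≡ 1#
      square^M {y} y≢0 = trans (cong (_^ M) (cong (y *_) (sym (*-identityʳ y)))) (Sq.power-e-k {y} y≢0)
    ... | is-other y y≢0 = trans (cong ι (χ₂-other y≢0)) (trans (cong -_ (+-identityʳ 1#)) (sym (trans (^-distrib-* a (y * y) M)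
          (trans (cong₂ _*_ a^M≡-1 (trans (cong (_^ M) (cong (y *_) (sym (*-identityʳ y)))) (Sq.power-e-k {y} y≢0))) (*-identityʳ (- 1#))))))

    count-single′ : ∀ c → ∑ fs (λ z → 𝟙 (c ≟ z)) ≡ 1ℤ
    count-single′ c = trans (∑-cong fs (λ z → 𝟙-cong sym sym (c ≟ z) (z ≟ c))) (count-single c)

    ∑-q : ∑ fs (λ _ → 1ℤ) ≡ + q
    ∑-q = trans (∑-1 fs) (cong +_ length-fs)

    ∑χ₂ : ∑ fs χ₂ ≡ 0ℤ
    ∑χ₂ = trans (∑-- fs r₂ (λ _ → 1ℤ)) (ℤ.i≡j⇒i-j≡0 (trans (∑-swap fs fs _) (∑-cong fs (λ y → count-single′ (y * y)))))

    ∑-affine : ∀ d {s} → s ≢ 0# → (w : Fin q → ℤ) → ∑ fs (λ v → w (d + s * v)) ≡ ∑ fs w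
    ∑-affine d {s} s≢0 w with t , st ← inverse s s≢0 = ∑-bijection (λ v → d + s * v) fs-unique fs-unique (λ {v} _ → ∈-allFin (d + s * v))
      (λ {x} {y} _ _ eq → *-cancelˡ s≢0 (trans (drop (s * x)) (trans (cong (_- d) eq) (sym (drop (s * y))))))
      (λ {y} _ → t * (y - d) , ∈-allFin (t * (y - d)) , trans (cong (λ w → d + w) (trans (sym (*-assoc s t (y - d))) (trans (cong (_* (y - d)) st) (*-identityˡ (y - d)))))
         (solve 2 (λ d y → d :+ (y :- d) := y) refl d y)) w
      where
      drop : ∀ x → x ≡ (d + x) - d
      drop x = solve 2 (λ d x → x := (d :+ x) :- d) refl d x

    -- Extended by 0 at 0 to an involution of the whole field, so that it can reindex sums over
    -- `fs`.
    inv : Fin q → Fin q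
    inv x with x ≟ 0#
    ... | yes _  = 0#
    ... | no x≢0 = proj₁ (inverse x x≢0)

    inv-0 : inv 0# ≡ 0#
    inv-0 with 0# ≟ 0#
    ... | yes _ = refl
    ... | no n  = contradiction refl n

    inv-* : ∀ {x} → x ≢ 0# → x * inv x ≡ 1#
    inv-* {x} x≢0 with x ≟ 0#
    ... | yes x≡0 = contradiction x≡0 x≢0
    ... | no n    = proj₂ (inverse x n)

    inv-nonzero : ∀ {x} → x ≢ 0# → inv x ≢ 0#
    inv-nonzero {x} x≢0 eq = 1≢0 (trans (sym (inv-* x≢0)) (trans (cong (x *_) eq) (zeroʳ x)))

    inv-inv : ∀ x → inv (inv x) ≡ x
    inv-inv x = go (x ≟ 0#)
      where
      go : Dec (x ≡ 0#) → inv (inv x) ≡ x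
      go (yes refl) = trans (cong inv inv-0) inv-0
      go (no x≢0)   = *-cancelˡ (inv-nonzero x≢0) (trans (inv-* (inv-nonzero x≢0)) (sym (trans (*-comm (inv x) x) (inv-* x≢0))))

    ∑-inv : (w : Fin q → ℤ) → ∑ fs (w ∘ inv) ≡ ∑ fs w
    ∑-inv w = ∑-bijection inv fs-unique fs-unique (λ {x} _ → ∈-allFin (inv x)) (λ {x} {y} _ _ eq → trans (sym (inv-inv x)) (trans (cong inv eq) (inv-inv y)))
      (λ {y} _ → inv y , ∈-allFin (inv y) , inv-inv y) w

    Q : Fin q → ℤ
    Q k = ∑ fs (λ z → χ₂ (z + 1#) ℤ.* χ₂ (k * z + 1#))

    -- With y = z + 1 nonzero, χ₂(y) χ₂(ky + 1 - k) = χ₂(y² (k + (1 - k)/y)) is the character of an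
    -- affine function of 1/y. This sums to zero unless k = 1; the term at y = 0 is then removed.
    Q-value : ∀ k → Q k ≡ + q ℤ.* 𝟙 (k ≟ 1#) ℤ.- χ₂ k
    Q-value k = begin
      ∑ fs (λ z → χ₂ (z + 1#) ℤ.* χ₂ (k * z + 1#))
        ≡⟨ ∑-affine (- 1#) 1≢0 (λ z → χ₂ (z + 1#) ℤ.* χ₂ (k * z + 1#)) ⟨
      ∑ fs (λ y → χ₂ (- 1# + 1# * y + 1#) ℤ.* χ₂ (k * (- 1# + 1# * y) + 1#))
        ≡⟨ ∑-cong fs (λ y → cong₂ (λ u v → χ₂ u ℤ.* χ₂ v)
             (trans (cong (λ w → - 1# + w + 1#) (*-identityˡ y)) (solve 2 (λ y o → (:- o) :+ y :+ o := y) refl y 1#))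
             (trans (cong (λ w → k * (- 1# + w) + 1#) (*-identityˡ y)) (trans (solve 3 (λ k y o → k :* ((:- o) :+ y) :+ o := k :* y :+ (o :- k :* o)) refl k y 1#) (cong (λ w → k * y + (1# - w)) (*-identityʳ k))))) ⟩
      ∑ fs (λ y → χ₂ y ℤ.* χ₂ (k * y + (1# - k)))
        ≡⟨ ∑-cong fs (λ y → term y (y ≟ 0#)) ⟩
      ∑ fs (λ y → χ₂ (k + (1# - k) * inv y) ℤ.- 𝟙 (y ≟ 0#) ℤ.* χ₂ k)
        ≡⟨ ∑-- fs _ _ ⟩
      ∑ fs (λ y → χ₂ (k + (1# - k) * inv y)) ℤ.- ∑ fs (λ y → 𝟙 (y ≟ 0#) ℤ.* χ₂ k)
        ≡⟨ cong₂ ℤ._-_ (trans (∑-inv (λ v → χ₂ (k + (1# - k) * v))) (line (k ≟ 1#)))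
             (trans (∑-*ʳ (χ₂ k) fs (λ y → 𝟙 (y ≟ 0#))) (trans (cong (ℤ._* χ₂ k) (count-single 0#)) (ℤ.*-identityˡ (χ₂ k)))) ⟩
      + q ℤ.* 𝟙 (k ≟ 1#) ℤ.- χ₂ k ∎
      where
      open ≡-Reasoning
      term : ∀ y (d : Dec (y ≡ 0#)) → χ₂ y ℤ.* χ₂ (k * y + (1# - k)) ≡ χ₂ (k + (1# - k) * inv y) ℤ.- 𝟙 d ℤ.* χ₂ k
      term y (yes refl) = trans (cong (ℤ._* χ₂ (k * 0# + (1# - k))) χ₂-zero) (sym (trans (cong (λ w → χ₂ (k + (1# - k) * w) ℤ.- 1ℤ ℤ.* χ₂ k) inv-0)
        (ℤ.i≡j⇒i-j≡0 (trans (cong χ₂ (trans (cong (λ w → k + w) (zeroʳ (1# - k))) (+-identityʳ k))) (sym (ℤ.*-identityˡ (χ₂ k)))))))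
      term y (no y≢0) = begin
        χ₂ y ℤ.* χ₂ (k * y + (1# - k))             ≡⟨ χ₂-mul y (k * y + (1# - k)) ⟨
        χ₂ (y * (k * y + (1# - k)))                ≡⟨ cong χ₂ (begin
          y * (k * y + (1# - k))                     ≡⟨ cong (λ w → y * (k * y + w)) (trans (sym (*-identityʳ (1# - k))) (cong ((1# - k) *_) (sym (inv-* y≢0)))) ⟩
          y * (k * y + (1# - k) * (y * inv y))       ≡⟨ solve 4 (λ k y o v → y :* (k :* y :+ (o :- k) :* (y :* v)) := (y :* y) :* (k :+ (o :- k) :* v)) refl k y 1# (inv y) ⟩
          y * y * (k + (1# - k) * inv y)             ∎) ⟩
        χ₂ (y * y * (k + (1# - k) * inv y))        ≡⟨ χ₂-mul (y * y) _ ⟩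
        χ₂ (y * y) ℤ.* χ₂ (k + (1# - k) * inv y)   ≡⟨ trans (cong (ℤ._* χ₂ (k + (1# - k) * inv y)) (χ₂-square y≢0)) (ℤ.*-identityˡ _) ⟩
        χ₂ (k + (1# - k) * inv y)                  ≡⟨ ℤ.+-identityʳ _ ⟨
        χ₂ (k + (1# - k) * inv y) ℤ.- 0ℤ ℤ.* χ₂ k  ∎
      line : (d : Dec (k ≡ 1#)) → ∑ fs (λ v → χ₂ (k + (1# - k) * v)) ≡ + q ℤ.* 𝟙 d
      line (yes refl) = trans (∑-cong fs (λ v → trans (cong χ₂ (trans (cong (λ w → 1# + w) (trans (cong (_* v) (-‿inverseʳ 1#)) (zeroˡ v))) (trans (+-identityʳ 1#) (sym (*-identityˡ 1#))))) (χ₂-square 1≢0)))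
        (trans ∑-q (sym (ℤ.*-identityʳ (+ q))))
      line (no k≢1) = trans (∑-affine k (λ eq → k≢1 (sym (x-y≡0⇒x≡y eq))) χ₂) (trans ∑χ₂ (sym (ℤ.*-zeroʳ (+ q))))

    A : ℕ → Fin q → ℤ
    A i x = χ₂ (b ^ i * x ^ 3 + 1#)

    -- Up to sign the trace of Frobenius of the twist y² = b^i x³ + 1.
    s : ℕ → ℤ
    s i = ∑ fs (A i)

    -- Over the three twists, b^i x³ takes every value z three times, and χ₂(z + 1) sums to zero.
    first-moment : ∑ (upTo 3) s ≡ 0ℤ
    first-moment = trans (Cu.cover-sum (λ z → χ₂ (z + 1#))) (cong (+ 3 ℤ.*_)
      (trans (∑-cong fs (λ z → cong χ₂ (trans (+-comm z 1#) (cong (λ w → 1# + w) (sym (*-identityˡ z)))))) (trans (∑-affine 1# 1≢0 χ₂) ∑χ₂)))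

    χ₂-1 : χ₂ 1# ≡ 1ℤ
    χ₂-1 = trans (cong χ₂ (sym (*-identityˡ 1#))) (χ₂-square 1≢0)

    A-0 : ∀ i → A i 0# ≡ 1ℤ
    A-0 i = trans (cong χ₂ (trans (cong (_+ 1#) (trans (cong (b ^ i *_) (zeroˡ (0# ^ 2))) (zeroʳ (b ^ i)))) (+-identityˡ 1#))) χ₂-1

    χ₂-cube : ∀ z → χ₂ (z ^ 3) ≡ χ₂ z
    χ₂-cube z = go (z ≟ 0#)
      where
      go : Dec (z ≡ 0#) → χ₂ (z ^ 3) ≡ χ₂ z
      go (yes refl) = cong χ₂ (zeroˡ (0# ^ 2))
      go (no z≢0)   = trans (cong χ₂ (cong (z *_) (cong (z *_) (*-identityʳ z)))) (trans (χ₂-mul z (z * z)) (trans (cong (χ₂ z ℤ.*_) (χ₂-square z≢0)) (ℤ.*-identityʳ (χ₂ z))))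

    r₃-full : ∀ {x} → x ≢ 0# → Cu.N 0 (x * x * x) ≡ + 3
    r₃-full {x} x≢0 = Cu.N-full {0} {x * x * x} (*-nonzero (*-nonzero x≢0 x≢0) x≢0) (s≤s z≤n) (x , cube x)

    cubes-of-1 : ∑ fs (λ z → 𝟙 (z ^ 3 ≟ 1#)) ≡ + 3
    cubes-of-1 = trans (∑-cong fs (λ z → cong (λ w → 𝟙 (w ≟ 1#)) (sym (*-identityˡ (z ^ 3)))))
      (trans (cong (Cu.N 0) (sym (trans (cong (_* 1#) (*-identityˡ 1#)) (*-identityˡ 1#)))) (r₃-full 1≢0))

    -- The three cube roots of unity contribute 3q, and Σ χ₂(z³) = Σ χ₂(z) vanishes.
    sum-Q : ∑ fs (λ z → Q (z ^ 3)) ≡ + 3 ℤ.* + q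
    sum-Q = begin
      ∑ fs (λ z → Q (z ^ 3))
        ≡⟨ ∑-cong fs (λ z → trans (Q-value (z ^ 3)) (cong (λ w → + q ℤ.* 𝟙 (z ^ 3 ≟ 1#) ℤ.- w) (χ₂-cube z))) ⟩
      ∑ fs (λ z → + q ℤ.* 𝟙 (z ^ 3 ≟ 1#) ℤ.- χ₂ z)
        ≡⟨ ∑-- fs _ _ ⟩
      ∑ fs (λ z → + q ℤ.* 𝟙 (z ^ 3 ≟ 1#)) ℤ.- ∑ fs χ₂
        ≡⟨ cong₂ ℤ._-_ (trans (∑-*ˡ (+ q) fs (λ z → 𝟙 (z ^ 3 ≟ 1#))) (cong (+ q ℤ.*_) cubes-of-1)) ∑χ₂ ⟩
      + q ℤ.* + 3 ℤ.- 0ℤ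
        ≡⟨ lem (+ q) ⟩
      + 3 ℤ.* + q ∎
      where
      open ≡-Reasoning
      lem : ∀ q → q ℤ.* + 3 ℤ.- 0ℤ ≡ + 3 ℤ.* q
      lem = solve-∀

    -- Substituting x′ = zx for x ≠ 0.
    s-square : ∀ i → s i ℤ.* s i ≡ ∑ fs (λ z → ∑ fs (λ x → χ₂ (b ^ i * x ^ 3 + 1#) ℤ.* χ₂ (z ^ 3 * (b ^ i * x ^ 3) + 1#))) ℤ.+ (s i ℤ.- + q)
    s-square i = begin
      s i ℤ.* s i
        ≡⟨ ∑-*ʳ (s i) fs (A i) ⟨
      ∑ fs (λ x → A i x ℤ.* s i)
        ≡⟨ ∑-cong fs (λ x → term x (x ≟ 0#)) ⟩
      ∑ fs (λ x → ∑ fs (λ z → A i x ℤ.* A i (z * x)) ℤ.+ 𝟙 (x ≟ 0#) ℤ.* (s i ℤ.- + q))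
        ≡⟨ ∑-+ fs _ _ ⟩
      ∑ fs (λ x → ∑ fs (λ z → A i x ℤ.* A i (z * x))) ℤ.+ ∑ fs (λ x → 𝟙 (x ≟ 0#) ℤ.* (s i ℤ.- + q))
        ≡⟨ cong₂ ℤ._+_ (trans (∑-swap fs fs _) (∑-cong fs (λ z → ∑-cong fs (λ x → cong (λ w → A i x ℤ.* χ₂ (w + 1#)) (rearrange z x)))))
             (trans (∑-*ʳ (s i ℤ.- + q) fs (λ x → 𝟙 (x ≟ 0#))) (trans (cong (ℤ._* (s i ℤ.- + q)) (count-single 0#)) (ℤ.*-identityˡ (s i ℤ.- + q)))) ⟩
      ∑ fs (λ z → ∑ fs (λ x → χ₂ (b ^ i * x ^ 3 + 1#) ℤ.* χ₂ (z ^ 3 * (b ^ i * x ^ 3) + 1#))) ℤ.+ (s i ℤ.- + q) ∎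
      where
      open ≡-Reasoning
      rearrange : ∀ z x → b ^ i * (z * x) ^ 3 ≡ z ^ 3 * (b ^ i * x ^ 3)
      rearrange z x = trans (cong (b ^ i *_) (^-distrib-* z x 3)) (solve 3 (λ b z x → b :* (z :* x) := z :* (b :* x)) refl (b ^ i) (z ^ 3) (x ^ 3))
      -- At x = 0 the substitution degenerates: the inner sum is q in place of s_i, whence the
      -- correction s_i - q.
      term : ∀ x (d : Dec (x ≡ 0#)) → A i x ℤ.* s i ≡ ∑ fs (λ z → A i x ℤ.* A i (z * x)) ℤ.+ 𝟙 d ℤ.* (s i ℤ.- + q)
      term x (yes refl) = begin
        A i 0# ℤ.* s i                     ≡⟨ cong (ℤ._* s i) (A-0 i) ⟩
        1ℤ ℤ.* s i                         ≡⟨ lem (s i) (+ q) ⟩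
        + q ℤ.+ 1ℤ ℤ.* (s i ℤ.- + q)       ≡⟨ cong (ℤ._+ 1ℤ ℤ.* (s i ℤ.- + q)) (trans (sym ∑-q) (∑-cong fs (λ z → sym (cong₂ ℤ._*_ (A-0 i) (trans (cong (A i) (zeroʳ z)) (A-0 i)))))) ⟩
        ∑ fs (λ z → A i 0# ℤ.* A i (z * 0#)) ℤ.+ 1ℤ ℤ.* (s i ℤ.- + q) ∎
        where
        lem : ∀ s q → 1ℤ ℤ.* s ≡ q ℤ.+ 1ℤ ℤ.* (s ℤ.- q)
        lem = solve-∀
      term x (no x≢0) = begin
        A i x ℤ.* s i                            ≡⟨ cong (A i x ℤ.*_) (trans (sym (∑-affine 0# x≢0 (A i))) (∑-cong fs (λ z → cong (A i) (trans (+-identityˡ (x * z)) (*-comm x z))))) ⟩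
        A i x ℤ.* ∑ fs (λ z → A i (z * x))       ≡⟨ ∑-*ˡ (A i x) fs (λ z → A i (z * x)) ⟨
        ∑ fs (λ z → A i x ℤ.* A i (z * x))       ≡⟨ ℤ.+-identityʳ _ ⟨
        ∑ fs (λ z → A i x ℤ.* A i (z * x)) ℤ.+ 0ℤ ℤ.* (s i ℤ.- + q) ∎

    -- The threefold cover gives 3 · 3q, and the corrections s_i - q remove 3q, their first parts
    -- cancelling by the first moment.
    second-moment : ∑ (upTo 3) (λ i → s i ℤ.* s i) ≡ + 6 ℤ.* + q
    second-moment = begin
      ∑ (upTo 3) (λ i → s i ℤ.* s i)
        ≡⟨ ∑-cong (upTo 3) s-square ⟩
      ∑ (upTo 3) (λ i → ∑ fs (λ z → ∑ fs (λ x → φ z (b ^ i * x ^ 3))) ℤ.+ (s i ℤ.- + q))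
        ≡⟨ trans (∑-+ (upTo 3) (λ i → ∑ fs (λ z → ∑ fs (λ x → φ z (b ^ i * x ^ 3)))) (λ i → s i ℤ.- + q)) (cong (λ w → ∑ (upTo 3) (λ i → ∑ fs (λ z → ∑ fs (λ x → φ z (b ^ i * x ^ 3)))) ℤ.+ w) (∑-- (upTo 3) s (λ _ → + q))) ⟩
      ∑ (upTo 3) (λ i → ∑ fs (λ z → ∑ fs (λ x → φ z (b ^ i * x ^ 3)))) ℤ.+ (∑ (upTo 3) s ℤ.- ∑ (upTo 3) (λ _ → + q))
        ≡⟨ cong₂ (λ u v → u ℤ.+ (v ℤ.- ∑ (upTo 3) (λ _ → + q))) (trans (∑-swap (upTo 3) fs (λ i z → ∑ fs (λ x → φ z (b ^ i * x ^ 3)))) (trans (∑-cong fs (λ z → Cu.cover-sum (φ z))) (trans (∑-*ˡ (+ 3) fs (λ z → Q (z ^ 3))) (cong (+ 3 ℤ.*_) sum-Q)))) first-moment ⟩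
      + 3 ℤ.* (+ 3 ℤ.* + q) ℤ.+ (0ℤ ℤ.- (+ q ℤ.+ (+ q ℤ.+ (+ q ℤ.+ 0ℤ))))
        ≡⟨ lem (+ q) ⟩
      + 6 ℤ.* + q ∎
      where
      open ≡-Reasoning
      φ : Fin q → Fin q → ℤ
      φ z w = χ₂ (w + 1#) ℤ.* χ₂ (z ^ 3 * w + 1#)
      lem : ∀ q → + 3 ℤ.* (+ 3 ℤ.* q) ℤ.+ (0ℤ ℤ.- (q ℤ.+ (q ℤ.+ (q ℤ.+ 0ℤ)))) ≡ + 6 ℤ.* q
      lem = solve-∀

  ∑-∣ : {A : Set} {d : ℤ} (xs : List A) {f : A → ℤ} → (∀ x → d ∣ f x) → d ∣ ∑ xs f
  ∑-∣ []       h = divides 0ℤ refl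
  ∑-∣ (x ∷ xs) h = ∣m∣n⇒∣m+n (h x) (∑-∣ xs h)

  module CurveCount (F : FiniteField) where
    open Transport F
    open FieldTheory q field-on using (fs; affinePoints) renaming (_+_ to _⊕_; _*_ to _⊛_; 1# to 𝟏; _≟_ to _≟ᴷ_)

    OnCurve : F.Carrier × F.Carrier → Set
    OnCurve (x , y) = (y F.* y) F.≈ ((x F.* x F.* x) F.+ F.1#)

    onCurve? : Decidable OnCurve
    onCurve? (x , y) = (y F.* y) F.≟ ((x F.* x F.* x) F.+ F.1#)

    ∑-elements : (f : F.Carrier → ℤ) → ∑ F.elements f ≡ ∑ fs (λ i → f (e i))
    ∑-elements f = trans (cong (λ xs → ∑ xs f) (trans (sym (tabulate-lookup F.elements)) (sym (map-tabulate (λ i → i) e)))) (∑-map e fs f)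

    e-cube : ∀ i → e (i ⊛ i ⊛ i ⊕ 𝟏) F.≈ e i F.* e i F.* e i F.+ F.1#
    e-cube i = F.trans (e-idx _) (F.+-cong (F.trans (e-idx _) (F.*-congʳ (e-idx _))) (e-idx _))

    count : + #E F ≡ 1ℤ ℤ.+ affinePoints
    count = cong (λ w → 1ℤ ℤ.+ w) (begin
      + length (filter onCurve? (cartesianProduct F.elements F.elements))
        ≡⟨ length-filter onCurve? (cartesianProduct F.elements F.elements) ⟩
      ∑ (cartesianProduct F.elements F.elements) (λ xy → 𝟙 (onCurve? xy))
        ≡⟨ ∑-× F.elements F.elements (λ xy → 𝟙 (onCurve? xy)) ⟩
      ∑ F.elements (λ x → ∑ F.elements (λ y → 𝟙 (onCurve? (x , y))))
        ≡⟨ ∑-elements (λ x → ∑ F.elements (λ y → 𝟙 (onCurve? (x , y)))) ⟩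
      ∑ fs (λ i → ∑ F.elements (λ y → 𝟙 (onCurve? (e i , y))))
        ≡⟨ ∑-cong fs (λ i → trans (∑-elements (λ y → 𝟙 (onCurve? (e i , y)))) (∑-cong fs (λ j → 𝟙-cong
             (λ eq → e-injective (F.trans (e-idx _) (F.trans eq (F.sym (e-cube i)))))
             (λ eq → F.trans (F.sym (e-idx _)) (F.trans (F.reflexive (cong e eq)) (e-cube i)))
             (onCurve? (e i , e j)) (j ⊛ j ≟ᴷ i ⊛ i ⊛ i ⊕ 𝟏)))) ⟩
      affinePoints ∎)
      where open ≡-Reasoning

  3∣x²⇒3∣x : ∀ x → + 3 ∣ x ℤ.* x → + 3 ∣ x
  3∣x²⇒3∣x x d with residue 3 x
  ... | zero , r = subst (+ 3 ∣_) (ℤ.+-identityʳ x) r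
  ... | suc zero , r = contradiction (subst (+ 3 ∣_) (lem x) (∣m∣n⇒∣m-n d (∣m⇒∣m*n (x ℤ.+ 1ℤ) r))) (from-no (+ 3 ∣? 1ℤ))
    where
    lem : ∀ x → x ℤ.* x ℤ.- (x ℤ.- 1ℤ) ℤ.* (x ℤ.+ 1ℤ) ≡ 1ℤ
    lem = solve-∀
  ... | suc (suc zero) , r = contradiction (subst (+ 3 ∣_) (lem x) (∣m∣n⇒∣m-n d (∣m⇒∣m*n (x ℤ.+ + 2) r))) (from-no (+ 3 ∣? + 4))
    where
    lem : ∀ x → x ℤ.* x ℤ.- (x ℤ.- + 2) ℤ.* (x ℤ.+ + 2) ≡ + 4
    lem = solve-∀

  2∣3x²⇒2∣x : ∀ x → + 2 ∣ + 3 ℤ.* (x ℤ.* x) → + 2 ∣ x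
  2∣3x²⇒2∣x x d with parity x
  ... | inj₁ e = e
  ... | inj₂ o = contradiction (subst (+ 2 ∣_) (lem x) (∣m∣n⇒∣m-n d (∣n⇒∣m*n (+ 3) (∣m⇒∣m*n (x ℤ.+ 1ℤ) o)))) (from-no (+ 2 ∣? + 3))
    where
    lem : ∀ x → + 3 ℤ.* (x ℤ.* x) ℤ.- + 3 ℤ.* ((x ℤ.- 1ℤ) ℤ.* (x ℤ.+ 1ℤ)) ≡ + 3
    lem = solve-∀

  module _ (q j s₀ s₁ s₂ : ℤ) (q≡6j+1 : q ≡ + 6 ℤ.* j ℤ.+ 1ℤ) (first : s₀ ℤ.+ (s₁ ℤ.+ s₂) ≡ 0ℤ)
    (second : s₀ ℤ.* s₀ ℤ.+ (s₁ ℤ.* s₁ ℤ.+ s₂ ℤ.* s₂) ≡ + 6 ℤ.* q)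
    (even : + 2 ∣ q ℤ.+ s₀ ℤ.- + 3) (mod3 : + 3 ∣ q ℤ.+ s₀ ℤ.- + 2) where

    -- With s₀ = -2T the moments give (s₁ - s₂)² = 12q - 3s₀² = 12(q - T²), so s₁ - s₂ is a multiple
    -- 6W of 6 and T² + 3W² = q. That s₀ is even and T ≡ 1 (mod 3) comes from the congruences on the
    -- point count.
    norm-from-moments : ∃ λ T → ∃ λ W → T ℤ.* T ℤ.+ + 3 ℤ.* (W ℤ.* W) ≡ q × + 3 ∣ T ℤ.- 1ℤ × s₀ ≡ ℤ.- (+ 2 ℤ.* T)
    norm-from-moments = T , W , norm , T≡1 , s₀≡
      where
      open ≡-Reasoning
      s-even : + 2 ∣ ℤ.- s₀
      s-even = subst (+ 2 ∣_) (trans (cong (λ r → ℤ.- (r ℤ.+ s₀ ℤ.- + 3) ℤ.+ + 2 ℤ.* (+ 3 ℤ.* j ℤ.- 1ℤ)) q≡6j+1) (lem j s₀))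
        (∣m∣n⇒∣m+n (∣m⇒∣-m even) (∣m⇒∣m*n (+ 3 ℤ.* j ℤ.- 1ℤ) (∣-refl {+ 2})))
        where
        lem : ∀ j s → ℤ.- (+ 6 ℤ.* j ℤ.+ 1ℤ ℤ.+ s ℤ.- + 3) ℤ.+ + 2 ℤ.* (+ 3 ℤ.* j ℤ.- 1ℤ) ≡ ℤ.- s
        lem = solve-∀
      T : ℤ
      T = _∣_.quotient s-even
      s₀≡ : s₀ ≡ ℤ.- (+ 2 ℤ.* T)
      s₀≡ = trans (sym (ℤ.neg-involutive s₀)) (cong ℤ.-_ (trans (_∣_.equality s-even) (ℤ.*-comm T (+ 2))))
      T≡1 : + 3 ∣ T ℤ.- 1ℤ
      T≡1 = subst (+ 3 ∣_) (trans (cong₂ (λ r s → r ℤ.+ s ℤ.- + 2 ℤ.+ + 3 ℤ.* (T ℤ.- + 2 ℤ.* j)) q≡6j+1 s₀≡) (lem j T))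
        (∣m∣n⇒∣m+n mod3 (∣m⇒∣m*n (T ℤ.- + 2 ℤ.* j) (∣-refl {+ 3})))
        where
        lem : ∀ j T → + 6 ℤ.* j ℤ.+ 1ℤ ℤ.+ ℤ.- (+ 2 ℤ.* T) ℤ.- + 2 ℤ.+ + 3 ℤ.* (T ℤ.- + 2 ℤ.* j) ≡ T ℤ.- 1ℤ
        lem = solve-∀
      D : ℤ
      D = s₁ ℤ.- s₂
      D² : D ℤ.* D ≡ + 12 ℤ.* q ℤ.- + 12 ℤ.* (T ℤ.* T)
      D² = begin
        D ℤ.* D
          ≡⟨ lem s₀ s₁ s₂ ⟩
        + 2 ℤ.* (s₀ ℤ.* s₀ ℤ.+ (s₁ ℤ.* s₁ ℤ.+ s₂ ℤ.* s₂)) ℤ.- (s₀ ℤ.+ (s₁ ℤ.+ s₂)) ℤ.* (s₁ ℤ.+ s₂ ℤ.- s₀) ℤ.- + 3 ℤ.* (s₀ ℤ.* s₀)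
          ≡⟨ cong₂ (λ u v → + 2 ℤ.* u ℤ.- v ℤ.* (s₁ ℤ.+ s₂ ℤ.- s₀) ℤ.- + 3 ℤ.* (s₀ ℤ.* s₀)) second first ⟩
        + 2 ℤ.* (+ 6 ℤ.* q) ℤ.- 0ℤ ℤ.* (s₁ ℤ.+ s₂ ℤ.- s₀) ℤ.- + 3 ℤ.* (s₀ ℤ.* s₀)
          ≡⟨ cong₂ (λ u v → + 2 ℤ.* (+ 6 ℤ.* q) ℤ.- u ℤ.- + 3 ℤ.* (v ℤ.* v)) (ℤ.*-zeroˡ (s₁ ℤ.+ s₂ ℤ.- s₀)) s₀≡ ⟩
        + 2 ℤ.* (+ 6 ℤ.* q) ℤ.- 0ℤ ℤ.- + 3 ℤ.* (ℤ.- (+ 2 ℤ.* T) ℤ.* ℤ.- (+ 2 ℤ.* T))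
          ≡⟨ lem′ q T ⟩
        + 12 ℤ.* q ℤ.- + 12 ℤ.* (T ℤ.* T) ∎
        where
        lem : ∀ a b c → (b ℤ.- c) ℤ.* (b ℤ.- c) ≡ + 2 ℤ.* (a ℤ.* a ℤ.+ (b ℤ.* b ℤ.+ c ℤ.* c)) ℤ.- (a ℤ.+ (b ℤ.+ c)) ℤ.* (b ℤ.+ c ℤ.- a) ℤ.- + 3 ℤ.* (a ℤ.* a)
        lem = solve-∀
        lem′ : ∀ q T → + 2 ℤ.* (+ 6 ℤ.* q) ℤ.- 0ℤ ℤ.- + 3 ℤ.* (ℤ.- (+ 2 ℤ.* T) ℤ.* ℤ.- (+ 2 ℤ.* T)) ≡ + 12 ℤ.* q ℤ.- + 12 ℤ.* (T ℤ.* T)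
        lem′ = solve-∀
      3∣D : + 3 ∣ D
      3∣D = 3∣x²⇒3∣x D (divides (+ 4 ℤ.* (q ℤ.- T ℤ.* T)) (trans D² (lem (q) T)))
        where
        lem : ∀ q T → + 12 ℤ.* q ℤ.- + 12 ℤ.* (T ℤ.* T) ≡ + 4 ℤ.* (q ℤ.- T ℤ.* T) ℤ.* + 3
        lem = solve-∀
      w : ℤ
      w = _∣_.quotient 3∣D
      3w² : + 3 ℤ.* (w ℤ.* w) ≡ + 4 ℤ.* (q ℤ.- T ℤ.* T)
      3w² = ℤ.*-cancelˡ-≡ (+ 3) (+ 3 ℤ.* (w ℤ.* w)) (+ 4 ℤ.* (q ℤ.- T ℤ.* T)) (trans (lem w) (trans (cong (λ d → d ℤ.* d) (sym (_∣_.equality 3∣D))) (trans D² (lem′ (q) T))))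
        where
        lem : ∀ w → + 3 ℤ.* (+ 3 ℤ.* (w ℤ.* w)) ≡ w ℤ.* + 3 ℤ.* (w ℤ.* + 3)
        lem = solve-∀
        lem′ : ∀ q T → + 12 ℤ.* q ℤ.- + 12 ℤ.* (T ℤ.* T) ≡ + 3 ℤ.* (+ 4 ℤ.* (q ℤ.- T ℤ.* T))
        lem′ = solve-∀
      2∣w : + 2 ∣ w
      2∣w = 2∣3x²⇒2∣x w (subst (+ 2 ∣_) (sym 3w²) (∣m⇒∣m*n (q ℤ.- T ℤ.* T) (divides (+ 2) refl)))
      W : ℤ
      W = _∣_.quotient 2∣w
      norm : T ℤ.* T ℤ.+ + 3 ℤ.* (W ℤ.* W) ≡ q
      norm = ℤ.*-cancelˡ-≡ (+ 4) (T ℤ.* T ℤ.+ + 3 ℤ.* (W ℤ.* W)) q (begin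
        + 4 ℤ.* (T ℤ.* T ℤ.+ + 3 ℤ.* (W ℤ.* W))                    ≡⟨ lem T W ⟩
        + 4 ℤ.* (T ℤ.* T) ℤ.+ + 3 ℤ.* (W ℤ.* + 2 ℤ.* (W ℤ.* + 2))  ≡⟨ cong (λ v → + 4 ℤ.* (T ℤ.* T) ℤ.+ + 3 ℤ.* (v ℤ.* v)) (_∣_.equality 2∣w) ⟨
        + 4 ℤ.* (T ℤ.* T) ℤ.+ + 3 ℤ.* (w ℤ.* w)                    ≡⟨ cong (λ v → + 4 ℤ.* (T ℤ.* T) ℤ.+ v) 3w² ⟩
        + 4 ℤ.* (T ℤ.* T) ℤ.+ + 4 ℤ.* (q ℤ.- T ℤ.* T)            ≡⟨ lem′ (q) (T ℤ.* T) ⟩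
        + 4 ℤ.* q                                                ∎)
        where
        lem : ∀ T W → + 4 ℤ.* (T ℤ.* T ℤ.+ + 3 ℤ.* (W ℤ.* W)) ≡ + 4 ℤ.* (T ℤ.* T) ℤ.+ + 3 ℤ.* (W ℤ.* + 2 ℤ.* (W ℤ.* + 2))
        lem = solve-∀
        lem′ : ∀ q t → + 4 ℤ.* t ℤ.+ + 4 ℤ.* (q ℤ.- t) ≡ + 4 ℤ.* q
        lem′ = solve-∀

  -- The trace modulo 2, modulo 3 and in the field.

  module Trace (q : ℕ) (K : FieldOn (Fin q)) (j : ℕ) (6j≡m : 6 ℕ.* j ≡ FieldTheory.m q K) where
    open FieldTheory q K
    open Moments q K j 6j≡m

    s₀ : ℤ
    s₀ = s 0

    affine≡ : affinePoints ≡ + q ℤ.+ s₀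
    affine≡ = begin
      ∑ fs (λ x → r₂ (x * x * x + 1#))           ≡⟨ ∑-cong fs (λ x → lem (r₂ (x * x * x + 1#))) ⟩
      ∑ fs (λ x → 1ℤ ℤ.+ χ₂ (x * x * x + 1#))    ≡⟨ ∑-+ fs (λ _ → 1ℤ) (λ x → χ₂ (x * x * x + 1#)) ⟩
      ∑ fs (λ _ → 1ℤ) ℤ.+ ∑ fs (λ x → χ₂ (x * x * x + 1#)) ≡⟨ cong₂ ℤ._+_ ∑-q (∑-cong fs (λ x → cong (λ w → χ₂ (w + 1#)) (sym (cube x)))) ⟩
      + q ℤ.+ s₀                                 ∎
      where
      open ≡-Reasoning
      lem : ∀ r → r ≡ 1ℤ ℤ.+ (r ℤ.- 1ℤ)
      lem = solve-∀

    r₂-parity : ∀ z → + 2 ∣ r₂ z ℤ.- 𝟙 (z ≟ 0#)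
    r₂-parity z with kind z
    ... | is-zero = divides 0ℤ (ℤ.i≡j⇒i-j≡0 (trans (r₂≡ 0#) (trans (Sq.N-zero 0) (sym (𝟙-yes (0# ≟ 0#) refl)))))
    ... | is-square y y≢0 = divides 1ℤ (cong₂ ℤ._-_ (trans (r₂≡ (y * y)) (Sq.N-full {0} {y * y} (*-nonzero y≢0 y≢0) (s≤s z≤n) (y , square y))) (𝟙-no (y * y ≟ 0#) (*-nonzero y≢0 y≢0)))
    ... | is-other y y≢0 = divides 0ℤ (cong₂ ℤ._-_ (minus-cancelʳ {r₂ (a * (y * y))} {0ℤ} 1ℤ (χ₂-other y≢0)) (𝟙-no (a * (y * y) ≟ 0#) (*-nonzero a≢0 (*-nonzero y≢0 y≢0))))

    r₃-mod-3 : ∀ z → + 3 ∣ r₃ z ℤ.- 𝟙 (z ≟ 0#)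
    r₃-mod-3 z = go (z ≟ 0#) (Cu.hits? 0 z)
      where
      go : (d : Dec (z ≡ 0#)) → Dec (Cu.Hits 0 z) → + 3 ∣ r₃ z ℤ.- 𝟙 d
      go (yes refl) _       = divides 0ℤ (ℤ.i≡j⇒i-j≡0 (trans (r₃≡ 0#) (Cu.N-zero 0)))
      go (no z≢0) (yes h)   = divides 1ℤ (cong (ℤ._- 0ℤ) (trans (r₃≡ z) (Cu.N-full {0} {z} z≢0 (s≤s z≤n) h)))
      go (no z≢0) (no none) = divides 0ℤ (cong (ℤ._- 0ℤ) (trans (r₃≡ z) (Cu.N-none {0} {z} none)))

    -- Points come in pairs (x, y), (x, -y), except for the three with y = 0, one for each cube root
    -- of -1.
    affine-odd : + 2 ∣ affinePoints ℤ.- + 3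
    affine-odd = subst (+ 2 ∣_) (trans (∑-- fs _ _) (cong (λ w → affinePoints ℤ.- w) three)) (∑-∣ fs (λ x → r₂-parity (x * x * x + 1#)))
      where
      -1≢0 : - 1# ≢ 0#
      -1≢0 eq = 1≢0 (trans (sym (-‿involutive 1#)) (trans (cong -_ eq) (trans (sym (+-identityˡ (- 0#))) (-‿inverseʳ 0#))))
      three : ∑ fs (λ x → 𝟙 (x * x * x + 1# ≟ 0#)) ≡ + 3
      three = trans (∑-cong fs (λ x → 𝟙-cong (λ eq → trans (solve 2 (λ c o → c := (c :+ o) :- o) refl (x * x * x) 1#) (trans (cong (_- 1#) eq) (trans (+-identityˡ (- 1#)) (sym minus))))
                                              (λ eq → trans (cong (_+ 1#) (trans eq minus)) (-‿inverseˡ 1#)) (x * x * x + 1# ≟ 0#) (x * x * x ≟ - 1# * - 1# * - 1#)))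
                (trans (r₃≡ (- 1# * - 1# * - 1#)) (r₃-full -1≢0))
        where
        minus : - 1# * - 1# * - 1# ≡ - 1#
        minus = trans (solve 1 (λ o → (:- o) :* (:- o) :* (:- o) := :- (o :* o :* o)) refl 1#) (cong -_ (trans (cong (_* 1#) (*-identityˡ 1#)) (*-identityˡ 1#)))

    -- The cube roots of unity act on x and group the points into triples, except for the two with x
    -- = 0.
    affine-mod-3 : + 3 ∣ affinePoints ℤ.- + 2
    affine-mod-3 = subst (+ 3 ∣_) (trans (∑-- fs _ _) (cong₂ ℤ._-_ (sym by-y) two)) (∑-∣ fs (λ y → r₃-mod-3 (y * y - 1#)))
      where
      by-y : affinePoints ≡ ∑ fs (λ y → r₃ (y * y - 1#))
      by-y = trans (∑-swap fs fs _) (∑-cong fs (λ y → ∑-cong fs (λ x → 𝟙-cong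
        (λ eq → trans (solve 2 (λ c o → c := (c :+ o) :- o) refl (x * x * x) 1#) (cong (_- 1#) (sym eq)))
        (λ eq → trans (solve 2 (λ c o → c := (c :- o) :+ o) refl (y * y) 1#) (cong (_+ 1#) (sym eq)))
        (y * y ≟ x * x * x + 1#) (x * x * x ≟ y * y - 1#))))
      two : ∑ fs (λ y → 𝟙 (y * y - 1# ≟ 0#)) ≡ + 2
      two = trans (∑-cong fs (λ y → 𝟙-cong x-y≡0⇒x≡y (λ eq → trans (cong (_- 1#) eq) (-‿inverseʳ 1#)) (y * y - 1# ≟ 0#) (y * y ≟ 1#)))
              (trans (lem (r₂ 1#)) (cong (ℤ._+ 1ℤ) χ₂-1))
        where
        lem : ∀ r → r ≡ r ℤ.- 1ℤ ℤ.+ 1ℤ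
        lem = solve-∀

    q≡6j+1 : + q ≡ + 6 ℤ.* + j ℤ.+ 1ℤ
    q≡6j+1 = trans (cong +_ (trans (sym suc-m) (trans (cong suc (sym 6j≡m)) (ℕ.+-comm 1 (6 ℕ.* j))))) (trans (ℤ.pos-+ (6 ℕ.* j) 1) (cong (ℤ._+ 1ℤ) (ℤ.pos-* 6 j)))

    abstract

      trace : ∃ λ T → ∃ λ W → T ℤ.* T ℤ.+ + 3 ℤ.* (W ℤ.* W) ≡ + q × + 3 ∣ T ℤ.- 1ℤ × s₀ ≡ ℤ.- (+ 2 ℤ.* T)
      trace = norm-from-moments (+ q) (+ j) s₀ (s 1) (s 2) q≡6j+1
        (trans (cong (λ w → s₀ ℤ.+ (s 1 ℤ.+ w)) (sym (ℤ.+-identityʳ (s 2)))) first-moment)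
        (trans (cong (λ w → s₀ ℤ.* s₀ ℤ.+ (s 1 ℤ.* s 1 ℤ.+ w)) (sym (ℤ.+-identityʳ (s 2 ℤ.* s 2)))) second-moment)
        (subst (λ w → + 2 ∣ w ℤ.- + 3) affine≡ affine-odd) (subst (λ w → + 3 ∣ w ℤ.- + 2) affine≡ affine-mod-3)

    ι-∑ : {X : Set} (xs : List X) (f : X → ℤ) → ι (∑ xs f) ≡ ∑ᴷ xs (λ x → ι (f x))
    ι-∑ []       f = refl
    ι-∑ (x ∷ xs) f = trans (ι-+ (f x) (∑ xs f)) (cong (λ w → ι (f x) + w) (ι-∑ xs f))

    -- Interpolates between power sums at n = 0 and the sum of (x³ + 1)^M at i = 0; its step is
    -- Pascal's rule, so binomial coefficients appear by induction.
    S : ℕ → ℕ → Fin q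
    S n i = ∑ᴷ fs (λ x → (x ^ 3) ^ i * (x ^ 3 + 1#) ^ n)

    S-step : ∀ n i → S (suc n) i ≡ S n (suc i) + S n i
    S-step n i = trans (∑ᴷ-cong fs (λ x → trans (solve 4 (λ c u v o → u :* ((c :+ o) :* v) := (c :* u) :* v :+ o :* (u :* v)) refl (x ^ 3) ((x ^ 3) ^ i) ((x ^ 3 + 1#) ^ n) 1#)
        (cong (λ w → x ^ 3 * (x ^ 3) ^ i * (x ^ 3 + 1#) ^ n + w) (*-identityˡ _)))) (∑ᴷ-+ fs _ _)

    S-zero : ∀ i → S 0 i ≡ powerSum (3 ℕ.* i)
    S-zero i = ∑ᴷ-cong fs (λ x → trans (*-identityʳ ((x ^ 3) ^ i)) (^-assocʳ x 3 i))

    nC0≡1 : ∀ n → n C 0 ≡ 1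
    nC0≡1 n = trans (nCk≡nC[n∸k] {0} {n} z≤n) (nCn≡1 n)

    neg-zero : - 0# ≡ 0#
    neg-zero = trans (sym (+-identityˡ (- 0#))) (-‿inverseʳ 0#)

    -- Only exponents 3i with c < i ≤ M occur; they lie strictly between m and 2m, where power sums
    -- vanish.
    S-high : ∀ n i → c ℕ.< i → i ℕ.+ n ℕ.≤ M → S n i ≡ 0#
    S-high zero i c<i i≤M = begin
      S 0 i                          ≡⟨ S-zero i ⟩
      powerSum (3 ℕ.* i)             ≡⟨ cong powerSum (ℕ.m∸n+n≡m (ℕ.<⇒≤ m<3i)) ⟨
      powerSum (3 ℕ.* i ℕ.∸ m ℕ.+ m) ≡⟨ powerSum-periodic (3 ℕ.* i ℕ.∸ m) (ℕ.m<n⇒0<n∸m m<3i) ⟩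
      powerSum (3 ℕ.* i ℕ.∸ m)       ≡⟨ powerSum-small (3 ℕ.* i ℕ.∸ m) (ℕ.m<n⇒0<n∸m m<3i) small ⟩
      0#                             ∎
      where
      open ≡-Reasoning
      m<3i : m ℕ.< 3 ℕ.* i
      m<3i = subst (ℕ._< 3 ℕ.* i) 3c≡m (ℕ.*-monoʳ-< 3 c<i)
      3M≡M+m : 3 ℕ.* M ≡ M ℕ.+ m
      3M≡M+m = cong (M ℕ.+_) 2M≡m
      M<m : M ℕ.< m
      M<m = subst (M ℕ.<_) 2M≡m (ℕ.m<m+n M (ℕ.≤-trans (ℕ.≤-trans 0<j (ℕ.m≤n*m j 3)) (ℕ.m≤m+n M 0)))
      small : 3 ℕ.* i ℕ.∸ m ℕ.< m
      small = ℕ.≤-<-trans (ℕ.∸-monoˡ-≤ m (ℕ.*-monoʳ-≤ 3 (subst (ℕ._≤ M) (ℕ.+-identityʳ i) i≤M))) (subst (ℕ._< m) (sym (trans (cong (ℕ._∸ m) 3M≡M+m) (ℕ.m+n∸n≡m M m))) M<m)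
    S-high (suc n) i c<i le = trans (S-step n i) (trans (cong₂ _+_ (S-high n (suc i) (ℕ.m≤n⇒m≤1+n c<i) (subst (ℕ._≤ M) (ℕ.+-suc i n) le)) (S-high n i c<i (ℕ.≤-trans (ℕ.+-monoʳ-≤ i (ℕ.n≤1+n n)) le))) (+-identityˡ 0#))

    -- Of all exponents occurring, only 3c = m has a nonzero power sum, namely -1, and it appears
    -- with coefficient C(n, c - i).
    S-binomial : ∀ n i d → i ℕ.+ d ≡ c → i ℕ.+ n ℕ.≤ M → S n i ≡ - ι (+ (n C d))
    S-binomial zero i zero i≡c le = begin
      S 0 i              ≡⟨ S-zero i ⟩
      powerSum (3 ℕ.* i) ≡⟨ cong (λ i → powerSum (3 ℕ.* i)) (trans (sym (ℕ.+-identityʳ i)) i≡c) ⟩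
      powerSum (3 ℕ.* c) ≡⟨ cong powerSum 3c≡m ⟩
      powerSum m         ≡⟨ powerSum-m ⟩
      - 1#               ≡⟨ cong -_ (+-identityʳ 1#) ⟨
      - ι (+ (0 C 0))    ∎
      where open ≡-Reasoning
    S-binomial zero i (suc d) i+d≡c le = trans (S-zero i) (trans (vanish i i+d≡c) (sym neg-zero))
      where
      vanish : ∀ i → i ℕ.+ suc d ≡ c → powerSum (3 ℕ.* i) ≡ 0#
      vanish zero    _  = powerSum-zero
      vanish (suc i) eq = powerSum-small (3 ℕ.* suc i) (s≤s z≤n) (subst (3 ℕ.* suc i ℕ.<_) 3c≡m (ℕ.*-monoʳ-< 3 (subst (suc i ℕ.<_) eq (ℕ.m<m+n (suc i) (s≤s z≤n)))))
    S-binomial (suc n) i zero i≡c le = begin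
      S (suc n) i                  ≡⟨ S-step n i ⟩
      S n (suc i) + S n i          ≡⟨ cong₂ _+_ (S-high n (suc i) (s≤s (ℕ.≤-reflexive (trans (sym i≡c) (ℕ.+-identityʳ i)))) (subst (ℕ._≤ M) (ℕ.+-suc i n) le))
                                         (S-binomial n i zero i≡c (ℕ.≤-trans (ℕ.+-monoʳ-≤ i (ℕ.n≤1+n n)) le)) ⟩
      0# + - ι (+ (n C 0))         ≡⟨ +-identityˡ _ ⟩
      - ι (+ (n C 0))              ≡⟨ cong (λ k → - ι (+ k)) (trans (nC0≡1 n) (sym (nC0≡1 (suc n)))) ⟩
      - ι (+ (suc n C 0))          ∎
      where open ≡-Reasoning
    S-binomial (suc n) i (suc d) i+d≡c le = begin
      S (suc n) i                  ≡⟨ S-step n i ⟩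
      S n (suc i) + S n i          ≡⟨ cong₂ _+_ (S-binomial n (suc i) d (trans (sym (ℕ.+-suc i d)) i+d≡c) (subst (ℕ._≤ M) (ℕ.+-suc i n) le))
                                         (S-binomial n i (suc d) i+d≡c (ℕ.≤-trans (ℕ.+-monoʳ-≤ i (ℕ.n≤1+n n)) le)) ⟩
      - ι (+ (n C d)) + - ι (+ (n C suc d)) ≡⟨ solve 2 (λ u v → (:- u) :+ (:- v) := :- (u :+ v)) refl (ι (+ (n C d))) (ι (+ (n C suc d))) ⟩
      - (ι (+ (n C d)) + ι (+ (n C suc d))) ≡⟨ cong -_ (ι-+ (+ (n C d)) (+ (n C suc d))) ⟨
      - ι (+ (n C d ℕ.+ n C suc d)) ≡⟨ cong (λ k → - ι (+ k)) (nCk+nC[k+1]≡[n+1]C[k+1] n d) ⟩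
      - ι (+ (suc n C suc d))      ∎
      where open ≡-Reasoning

    -- The Hasse invariant of the curve.
    ι-trace : ι s₀ ≡ - ι (+ (M C c))
    ι-trace = begin
      ι s₀                                       ≡⟨ ι-∑ fs (A 0) ⟩
      ∑ᴷ fs (λ x → ι (A 0 x))                    ≡⟨ ∑ᴷ-cong fs (λ x → trans (euler (b ^ 0 * x ^ 3 + 1#)) (trans (cong (λ w → (w + 1#) ^ M) (*-identityˡ (x ^ 3))) (sym (*-identityˡ _)))) ⟩
      S M 0                                      ≡⟨ S-binomial M 0 c refl ℕ.≤-refl ⟩
      - ι (+ (M C c))                            ∎
      where open ≡-Reasoning

open import Defs
open LatticeSums
open FieldTransport
open CurveOverFiniteField
open import Data.Fin using (Fin)
open import Data.Integer as ℤ using (ℤ; +_; -[1+_]; 0ℤ; 1ℤ; ∣_∣; +<+; +≤+)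
import Data.Integer.Properties as ℤ
open import Data.Integer.Divisibility.Signed as Signed using (divides; ∣ᵤ⇒∣; ∣⇒∣ᵤ) renaming (_∣_ to _∣ℤ_)
open import Data.Integer.Tactic.RingSolver using (solve-∀)
open import Data.List using (List; []; _∷_; map; upTo; applyUpTo)
open import Data.List.Properties using (upTo-∷ʳ; map-upTo; map-applyUpTo)
open import Data.List.Membership.Propositional using (_∈_)
open import Data.List.Membership.Propositional.Properties using (∈-upTo⁺; ∈-upTo⁻; ∈-cartesianProduct⁺)
open import Data.List.Relation.Unary.All using ([]; _∷_)
open import Data.List.Relation.Unary.AllPairs using ([]; _∷_)
open import Data.List.Relation.Unary.Any using (here; there)
open import Data.List.Relation.Unary.Unique.Propositional using (Unique)
import Data.List.Relation.Unary.Unique.Propositional.Properties as Unique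
open import Data.Nat using (ℕ; zero; suc; _+_; _*_; _^_; _∸_; _≤_; _<_; _%_; _/_; _!; z≤n; s≤s; NonZero; nonTrivial⇒n>1)
open import Data.Nat.Combinatorics using (_C_; nCk≡n!/k![n-k]!; k![n∸k]!∣n!)
open import Data.Nat.Coprimality using (Coprime; coprime-Bézout)
open import Data.Nat.Divisibility using (_∣_; divides; ∣⇒≤; ∣m⇒∣m*n; ∣-refl; ∣1⇒≡1; ∣m+n∣m⇒∣n; _∣?_)
open import Data.Nat.DivMod using (m≡m%n+[m/n]*n; m%n<n; m/n*n≡m)
open import Data.Nat.GCD using (module Bézout)
open import Data.Nat.ListAction using (sum)
open import Data.Nat.Primality using (Prime; euclidsLemma; prime⇒irreducible; prime⇒nonZero; prime⇒nonTrivial)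
open import Data.Nat.Properties
import Data.Nat.Tactic.RingSolver as ℕSolver
open import Data.Product using (_×_; _,_; proj₁; proj₂; ∃)
open import Data.Sum using (_⊎_; inj₁; inj₂; [_,_]′)
open import Function using (_∘_)
open import Relation.Nullary using (¬_; Dec; yes; no; contradiction)
open import Relation.Nullary.Decidable using (_×-dec_)
open import Relation.Binary.Definitions using (tri<; tri≈; tri>)
open import Relation.Binary.PropositionalEquality using (_≡_; _≢_; refl; sym; trans; cong; cong₂; subst; subst₂; module ≡-Reasoning)

-- Arithmetic of the prime: binomial coefficients, divisor sums, and -3 as a non-residue.

C-factorial : ∀ k l → ((k + l) C k) * (k ! * l !) ≡ (k + l) !
C-factorial k l = begin
  ((k + l) C k) * (k ! * l !)             ≡⟨ cong (λ n → ((k + l) C k) * (k ! * n !)) (m+n∸m≡n k l) ⟨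
  ((k + l) C k) * (k ! * (k + l ∸ k) !)   ≡⟨ cong (_* (k ! * (k + l ∸ k) !)) (nCk≡n!/k![n-k]! (m≤m+n k l)) ⟩
  ((k + l) ! / (k ! * (k + l ∸ k) !)) * (k ! * (k + l ∸ k) !) ≡⟨ m/n*n≡m (k![n∸k]!∣n! (m≤m+n k l)) ⟩
  (k + l) !                             ∎
  where
  open ≡-Reasoning
  instance _ = k !* (k + l ∸ k) !≢0

module PrimeArithmetic (p : ℕ) (pr : Prime p) where

  instance
    p≢0 : NonZero p
    p≢0 = prime⇒nonZero pr

  1<p : 1 < p
  1<p = nonTrivial⇒n>1 p {{prime⇒nonTrivial pr}}

  p∤1 : ¬ (p ∣ 1)
  p∤1 d = <-irrefl (sym (∣1⇒≡1 d)) 1<p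

  ∤-* : ∀ {m n} → ¬ (p ∣ m) → ¬ (p ∣ n) → ¬ (p ∣ m * n)
  ∤-* {m} {n} m∤ n∤ d = [ m∤ , n∤ ]′ (euclidsLemma m n pr d)

  -- For r < p the multiples of p up to pa + r contribute p^a a! to the factorial; the remaining
  -- factors form a part prime to p.
  Unital : ℕ → ℕ → Set
  Unital a r = ∃ λ u → ¬ (p ∣ u) × (p * a + r) ! ≡ p ^ a * a ! * u

  unital-step : ∀ a r → suc r < p → Unital a r → Unital a (suc r)
  unital-step a r r<p (u , p∤u , eq) = suc (p * a + r) * u , ∤-* not-divisible p∤u , (begin
    (p * a + suc r) !                       ≡⟨ cong _! (+-suc (p * a) r) ⟩
    suc (p * a + r) * (p * a + r) !         ≡⟨ cong (suc (p * a + r) *_) eq ⟩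
    suc (p * a + r) * (p ^ a * a ! * u)     ≡⟨ lem (suc (p * a + r)) (p ^ a * a !) u ⟩
    p ^ a * a ! * (suc (p * a + r) * u)     ∎)
    where
    open ≡-Reasoning
    lem : ∀ s f u → s * (f * u) ≡ f * (s * u)
    lem = ℕSolver.solve-∀
    not-divisible : ¬ (p ∣ suc (p * a + r))
    not-divisible d = <⇒≱ r<p (∣⇒≤ (∣m+n∣m⇒∣n (subst (p ∣_) (sym (+-suc (p * a) r)) d) (∣m⇒∣m*n a ∣-refl)))

  unital : ∀ a r → r < p → Unital a r
  unital zero    zero    _   = 1 , p∤1 , cong _! (trans (+-identityʳ (p * 0)) (*-zeroʳ p))
  unital (suc a) zero    _   with unital a (p ∸ 1) (≤-reflexive (m+[n∸m]≡n (<⇒≤ 1<p)))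
  ... | u , p∤u , eq = u , p∤u , (begin
    (p * suc a + 0) !                              ≡⟨ cong _! top ⟩
    suc (p * a + (p ∸ 1)) * (p * a + (p ∸ 1)) !    ≡⟨ cong₂ _*_ (trans (sym top) (+-identityʳ (p * suc a))) eq ⟩
    p * suc a * (p ^ a * a ! * u)                  ≡⟨ lem p (suc a) (p ^ a) (a !) u ⟩
    p ^ suc a * (suc a) ! * u                      ∎)
    where
    open ≡-Reasoning
    top : p * suc a + 0 ≡ suc (p * a + (p ∸ 1))
    top = begin
      p * suc a + 0           ≡⟨ +-identityʳ (p * suc a) ⟩
      p * suc a               ≡⟨ *-suc p a ⟩
      p + p * a               ≡⟨ cong (_+ p * a) (m+[n∸m]≡n (<⇒≤ 1<p)) ⟨
      1 + (p ∸ 1) + p * a     ≡⟨ cong suc (+-comm (p ∸ 1) (p * a)) ⟩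
      suc (p * a + (p ∸ 1))   ∎
    lem : ∀ p s q f u → p * s * (q * f * u) ≡ p * q * (s * f) * u
    lem = ℕSolver.solve-∀
  unital a (suc r) r<p = unital-step a r r<p (unital a r (<⇒≤ r<p))

  -- The special case of Lucas' theorem without carries.
  C-lift : ∀ b a s r → s + r < p → ¬ (p ∣ (b + a) C b) → ¬ (p ∣ ((p * b + s) + (p * a + r)) C (p * b + s))
  C-lift b a s r s+r<p p∤C d
    with u₁ , p∤u₁ , e₁ ← unital b s (≤-<-trans (m≤m+n s r) s+r<p)
    with u₂ , p∤u₂ , e₂ ← unital a r (≤-<-trans (m≤n+m r s) s+r<p)
    with u₃ , p∤u₃ , e₃ ← unital (b + a) (s + r) s+r<p =
    ∤-* p∤C p∤u₃ (subst (p ∣_) (*-cancelˡ-≡ _ _ (p ^ (b + a) * (b ! * a !)) {{m*n≢0 (p ^ (b + a)) (b ! * a !) {{m^n≢0 p (b + a)}} {{m*n≢0 (b !) (a !) {{b !≢0}} {{a !≢0}}}}}} key) (∣m⇒∣m*n (u₁ * u₂) d))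
    where
    open ≡-Reasoning
    X : ℕ
    X = ((p * b + s) + (p * a + r)) C (p * b + s)
    key : p ^ (b + a) * (b ! * a !) * (X * (u₁ * u₂)) ≡ p ^ (b + a) * (b ! * a !) * (((b + a) C b) * u₃)
    key = begin
      p ^ (b + a) * (b ! * a !) * (X * (u₁ * u₂))              ≡⟨ cong (λ q → q * (b ! * a !) * (X * (u₁ * u₂))) (^-distribˡ-+-* p b a) ⟩
      p ^ b * p ^ a * (b ! * a !) * (X * (u₁ * u₂))            ≡⟨ lem₁ (p ^ b) (p ^ a) (b !) (a !) X u₁ u₂ ⟩
      X * ((p ^ b * b ! * u₁) * (p ^ a * a ! * u₂))            ≡⟨ cong (X *_) (cong₂ _*_ e₁ e₂) ⟨
      X * ((p * b + s) ! * (p * a + r) !)                      ≡⟨ C-factorial (p * b + s) (p * a + r) ⟩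
      ((p * b + s) + (p * a + r)) !                            ≡⟨ cong _! (lem₂ p b a s r) ⟩
      (p * (b + a) + (s + r)) !                                ≡⟨ e₃ ⟩
      p ^ (b + a) * (b + a) ! * u₃                             ≡⟨ cong (λ f → p ^ (b + a) * f * u₃) (C-factorial b a) ⟨
      p ^ (b + a) * (((b + a) C b) * (b ! * a !)) * u₃           ≡⟨ lem₃ (p ^ (b + a)) ((b + a) C b) (b ! * a !) u₃ ⟩
      p ^ (b + a) * (b ! * a !) * (((b + a) C b) * u₃)           ∎
      where
      lem₁ : ∀ x y f g c u v → x * y * (f * g) * (c * (u * v)) ≡ c * ((x * f * u) * (y * g * v))
      lem₁ = ℕSolver.solve-∀
      lem₂ : ∀ p b a s r → (p * b + s) + (p * a + r) ≡ p * (b + a) + (s + r)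
      lem₂ = ℕSolver.solve-∀
      lem₃ : ∀ q c f u → q * (c * f) * u ≡ q * f * (c * u)
      lem₃ = ℕSolver.solve-∀

  -- (p^(k+1) - 1)/6 = p (p^k - 1)/6 + h, so each step appends the base-p digits 3h and 2h to 3j and
  -- 2j. Since 2h + h < p, nothing is carried.
  p∤C : ∀ h → 6 * h + 1 ≡ p → ∀ k → ∃ λ j → 6 * j + 1 ≡ p ^ k × ¬ (p ∣ (3 * j) C (2 * j))
  p∤C h hp zero = 0 , refl , p∤1
  p∤C h hp (suc k) with j , jp , ∤ ← p∤C h hp k =
    p * j + h , trans (lem₁ p j h) (trans (cong (λ x → p * (6 * j) + x) hp) (trans (lem₂ p (6 * j)) (cong (p *_) jp))) ,
    subst₂ (λ m n → ¬ (p ∣ m C n)) (lem₃ p j h) (lem₄ p j h)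
      (C-lift (2 * j) j (2 * h) h (subst (λ x → 2 * h + h < x) hp (lt h)) (subst (λ m → ¬ (p ∣ m C (2 * j))) (lem₅ j) ∤))
    where
    lem₁ : ∀ p j h → 6 * (p * j + h) + 1 ≡ p * (6 * j) + (6 * h + 1)
    lem₁ = ℕSolver.solve-∀
    lem₂ : ∀ p x → p * x + p ≡ p * (x + 1)
    lem₂ = ℕSolver.solve-∀
    lem₃ : ∀ p j h → p * (2 * j) + 2 * h + (p * j + h) ≡ 3 * (p * j + h)
    lem₃ = ℕSolver.solve-∀
    lem₄ : ∀ p j h → p * (2 * j) + 2 * h ≡ 2 * (p * j + h)
    lem₄ = ℕSolver.solve-∀
    lem₅ : ∀ j → 3 * j ≡ 2 * j + j
    lem₅ = ℕSolver.solve-∀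
    lt : ∀ h → 2 * h + h < 6 * h + 1
    lt h = subst (suc (2 * h + h) ≤_) (lem h) (s≤s (m≤m+n (2 * h + h) (3 * h)))
      where
      lem : ∀ h → suc (2 * h + h + 3 * h) ≡ 6 * h + 1
      lem = ℕSolver.solve-∀

  coprime : ∀ {n} → ¬ (p ∣ n) → Coprime p n
  coprime p∤n (d∣p , d∣n) with prime⇒irreducible pr d∣p
  ... | inj₁ d≡1  = d≡1
  ... | inj₂ refl = contradiction d∣n p∤n

  module Characteristic (k : ℕ) (q : ℕ) (q≡p^k : q ≡ p ^ k) (K : FieldOn (Fin q)) where
    open FieldTheory q K using (0#; 1#; 1≢0; ι; ι-q; ι-*; zeroʳ; *-cancelˡ) renaming (_*_ to _⊛_; _+_ to _⊕_)
    module K = FieldTheory q K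

    -- p^k is zero in the field, and a field has no zero divisors.
    ι-p : ι (+ p) ≡ 0#
    ι-p = go k (trans (cong (λ n → ι (+ n)) (sym q≡p^k)) ι-q)
      where
      go : ∀ k → ι (+ (p ^ k)) ≡ 0# → ι (+ p) ≡ 0#
      go zero    eq = contradiction (trans (sym (K.+-identityʳ 1#)) eq) 1≢0
      go (suc k) eq with ι (+ p) K.≟ 0#
      ... | yes z = z
      ... | no nz = go k (*-cancelˡ nz (trans (sym (trans (cong ι (ℤ.pos-* p (p ^ k))) (ι-* (+ p) (+ (p ^ k))))) (trans eq (sym (zeroʳ (ι (+ p)))))))

    ∣⇒ι≡0 : ∀ {z} → + p Signed.∣ z → ι z ≡ 0#
    ∣⇒ι≡0 (Signed.divides c refl) = trans (ι-* c (+ p)) (trans (cong (ι c ⊛_) ι-p) (zeroʳ (ι c)))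

    bezout : ∀ a b c d → ι (+ a) ⊛ ι (+ b) ≡ 0# → ι (+ c) ⊛ ι (+ d) ≡ 0# → 1 + a * b ≡ c * d → 1# ≡ 0#
    bezout a b c d z₁ z₂ e = trans (sym (K.+-identityʳ 1#)) (trans (cong (λ w → 1# ⊕ w) (trans (sym z₁) (trans (sym (ι-* (+ a) (+ b))) (cong ι (sym (ℤ.pos-* a b))))))
      (trans (cong ι (cong +_ e)) (trans (cong ι (ℤ.pos-* c d)) (trans (ι-* (+ c) (+ d)) z₂))))

    -- Otherwise n and p are coprime, and a Bézout relation would give 1 = 0.
    ι≡0⇒∣ : ∀ n → ι (+ n) ≡ 0# → p ∣ n
    ι≡0⇒∣ n eq with p ∣? n
    ... | yes d  = d
    ... | no p∤n with coprime-Bézout (coprime p∤n)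
    ...   | Bézout.+- x y e = contradiction (bezout y n x p (trans (cong (ι (+ y) ⊛_) eq) (zeroʳ _)) (trans (cong (ι (+ x) ⊛_) ι-p) (zeroʳ _)) e) 1≢0
    ...   | Bézout.-+ x y e = contradiction (bezout x p y n (trans (cong (ι (+ x) ⊛_) ι-p) (zeroʳ _)) (trans (cong (ι (+ y) ⊛_) eq) (zeroʳ _)) e) 1≢0

module PrimeIntegers (p : ℕ) (pr : Prime p) (3<p : 3 < p) where
  open PrimeArithmetic p pr public

  P : ℤ
  P = + p

  euclid : ∀ x y → P ∣ℤ x ℤ.* y → P ∣ℤ x ⊎ P ∣ℤ y
  euclid x y d with euclidsLemma ∣ x ∣ ∣ y ∣ pr (subst (p ∣_) (ℤ.abs-* x y) (∣⇒∣ᵤ d))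
  ... | inj₁ e = inj₁ (∣ᵤ⇒∣ e)
  ... | inj₂ e = inj₂ (∣ᵤ⇒∣ e)

  small : ∀ n → NonZero n → n < p → ¬ (P ∣ℤ + n)
  small n nz n<p d = <⇒≱ n<p (∣⇒≤ {{nz}} (∣⇒∣ᵤ d))

  P∤2 : ¬ (P ∣ℤ + 2)
  P∤2 = small 2 _ (<-trans (s≤s (s≤s (s≤s z≤n))) 3<p)

  P∤3 : ¬ (P ∣ℤ + 3)
  P∤3 = small 3 _ 3<p

  ∣-square : ∀ {x} → P ∣ℤ x ℤ.* x → P ∣ℤ x
  ∣-square {x} d with euclid x x d
  ... | inj₁ e = e
  ... | inj₂ e = e

  ∣-3square : ∀ {y} → P ∣ℤ + 3 ℤ.* (y ℤ.* y) → P ∣ℤ y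
  ∣-3square {y} d with euclid (+ 3) (y ℤ.* y) d
  ... | inj₁ e = contradiction e P∤3
  ... | inj₂ e = ∣-square e

  divisors : ∀ k y z → y * z ≡ p ^ k → ∃ λ i → i ≤ k × y ≡ p ^ i × z ≡ p ^ (k ∸ i)
  divisors zero    y z eq = 0 , z≤n , m*n≡1⇒m≡1 y z eq , m*n≡1⇒n≡1 y z eq
  divisors (suc k) y z eq with euclidsLemma y z pr (subst (p ∣_) (sym eq) (∣m⇒∣m*n (p ^ k) ∣-refl))
  ... | inj₁ (divides y′ refl) with i , i≤k , y≡ , z≡ ← divisors k y′ z (*-cancelˡ-≡ _ _ p (trans (sym (*-assoc p y′ z)) (trans (cong (_* z) (*-comm p y′)) eq))) =
    suc i , s≤s i≤k , trans (*-comm y′ p) (cong (p *_) y≡) , z≡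
  ... | inj₂ (divides z′ refl) with i , i≤k , y≡ , z≡ ← divisors k y z′ (*-cancelˡ-≡ _ _ p (trans (*-comm p (y * z′)) (trans (*-assoc y z′ p) eq))) =
    i , m≤n⇒m≤1+n i≤k , y≡ , trans (*-comm z′ p) (trans (cong (p *_) z≡) (cong (p ^_) (sym (+-∸-assoc 1 i≤k))))

  -- The only factorisations of p^k are p^i · p^(k - i); summing over i instead of pairs gives the
  -- geometric sum.
  σ-prime-power : ∀ B k → p ^ k ≤ B → σ B (+ 4 ℤ.* + (p ^ k)) ≡ ∑ (upTo (suc k)) (λ i → + (p ^ i))
  σ-prime-power B k le = sym (begin
    ∑ (upTo (suc k)) (λ i → + (p ^ i))      ≡⟨ ∑-cong∈ (upTo (suc k)) (λ {i} i∈ → sym (trans (cong (ℤ._* + (p ^ i)) (𝟙-yes (div? (f i)) (hit (≤-pred (∈-upTo⁻ i∈))))) (ℤ.*-identityˡ (+ (p ^ i))))) ⟩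
    ∑ (upTo (suc k)) (λ i → w (f i))        ≡⟨ ∑-reindex (ℤ._≟ 0ℤ) f (Unique.upTo⁺ (suc k)) (Z²-unique B) w
                                                 (λ {i} i∈ _ → ∈-cartesianProduct⁺ (Z⁺ (≤-trans (^-monoʳ-≤ p (≤-pred (∈-upTo⁻ i∈))) le)) (Z⁺ (≤-trans (^-monoʳ-≤ p (m∸n≤m k i)) le)))
                                                 (λ eq → power-injective (ℤ.+-injective (cong proj₁ eq)))
                                                 (λ {yz} _ nz → surj yz (𝟙≢0 (div? yz) (*≢0ˡ _ _ nz))) ⟩
    ∑ (Z² B) w      ≡⟨ ∑-× (Z B) (Z B) w ⟩
    σ B (+ 4 ℤ.* + (p ^ k))                 ∎)
    where
    open ≡-Reasoning
    n : ℤ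
    n = + 4 ℤ.* + (p ^ k)
    Div : ℤ × ℤ → Set
    Div (y , z) = 0ℤ ℤ.< y × 0ℤ ℤ.< z × + 4 ℤ.* (y ℤ.* z) ≡ n
    div? : ∀ yz → Dec (Div yz)
    div? (y , z) = 0ℤ ℤ.<? y ×-dec 0ℤ ℤ.<? z ×-dec + 4 ℤ.* (y ℤ.* z) ℤ.≟ n
    w : ℤ × ℤ → ℤ
    w (y , z) = 𝟙 (div? (y , z)) ℤ.* y
    f : ℕ → ℤ × ℤ
    f i = + (p ^ i) , + (p ^ (k ∸ i))
    power>0 : ∀ i → 0 < p ^ i
    power>0 i = m^n>0 p i
    hit : ∀ {i} → i ≤ k → Div (f i)
    hit {i} i≤k = +<+ (power>0 i) , +<+ (power>0 (k ∸ i)) , cong (+ 4 ℤ.*_) (trans (sym (ℤ.pos-* (p ^ i) (p ^ (k ∸ i)))) (cong +_ (trans (sym (^-distribˡ-+-* p i (k ∸ i))) (cong (p ^_) (m+[n∸m]≡n i≤k)))))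
    power-injective : ∀ {i l} → p ^ i ≡ p ^ l → i ≡ l
    power-injective {i} {l} eq with <-cmp i l
    ... | tri< i<l _ _ = contradiction eq (<⇒≢ (^-monoʳ-< p 1<p i<l))
    ... | tri≈ _ i≡l _ = i≡l
    ... | tri> _ _ l<i = contradiction (sym eq) (<⇒≢ (^-monoʳ-< p 1<p l<i))
    surj : ∀ yz → Div yz → ∃ λ i → i ∈ upTo (suc k) × f i ≡ yz
    surj (+ y , + z) (_ , _ , eq) with i , i≤k , y≡ , z≡ ← divisors k y z (ℤ.+-injective (trans (ℤ.pos-* y z) (ℤ.*-cancelˡ-≡ (+ 4) (+ y ℤ.* + z) (+ (p ^ k)) eq))) =
      i , ∈-upTo⁺ (s≤s i≤k) , cong₂ _,_ (cong +_ (sym y≡)) (cong +_ (sym z≡))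
    surj (-[1+ _ ] , _) (() , _)
    surj (+ _ , -[1+ _ ]) (_ , () , _)

  -- `G (suc k)` is the divisor sum of p^k; the argument counts the terms.
  G : ℕ → ℤ
  G n = ∑ (upTo n) (λ i → + (p ^ i))

  G-suc : ∀ n → G (suc n) ≡ 1ℤ ℤ.+ P ℤ.* G n
  G-suc n = cong (λ w → 1ℤ ℤ.+ w) (begin
    ∑ (applyUpTo suc n) (λ i → + (p ^ i))       ≡⟨ cong (λ xs → ∑ xs (λ i → + (p ^ i))) (map-upTo suc n) ⟨
    ∑ (map suc (upTo n)) (λ i → + (p ^ i))      ≡⟨ ∑-map suc (upTo n) (λ i → + (p ^ i)) ⟩
    ∑ (upTo n) (λ i → + (p * p ^ i))                      ≡⟨ ∑-cong (upTo n) (λ i → ℤ.pos-* p (p ^ i)) ⟩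
    ∑ (upTo n) (λ i → P ℤ.* + (p ^ i))                    ≡⟨ ∑-*ˡ P (upTo n) (λ i → + (p ^ i)) ⟩
    P ℤ.* G n                                             ∎)
    where open ≡-Reasoning

  G-snoc : ∀ n → G (suc n) ≡ G n ℤ.+ + (p ^ n)
  G-snoc n = trans (cong (λ xs → ∑ xs (λ i → + (p ^ i))) (sym (upTo-∷ʳ n))) (trans (∑-++ (upTo n) (n ∷ []) (λ i → + (p ^ i))) (cong (λ w → G n ℤ.+ w) (ℤ.+-identityʳ (+ (p ^ n)))))

  -- Multiplication by p shifts the shorter geometric sum by one, so that only the lowest and the
  -- highest term of the longer one survive.
  G-three-term : ∀ k → G (3 + k) ℤ.- P ℤ.* G (1 + k) ≡ 1ℤ ℤ.+ + (p ^ (2 + k))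
  G-three-term k = trans (cong (λ w → w ℤ.- P ℤ.* G (1 + k)) (trans (G-suc (2 + k)) (trans (cong (λ w → 1ℤ ℤ.+ P ℤ.* w) (G-snoc (1 + k)))
      (cong (λ w → 1ℤ ℤ.+ w) (trans (ℤ.*-distribˡ-+ P (G (1 + k)) (+ (p ^ (1 + k)))) (cong (λ w → P ℤ.* G (1 + k) ℤ.+ w) (sym (ℤ.pos-* p (p ^ (1 + k))))))))))
    (lem (P ℤ.* G (1 + k)) (+ (p ^ (2 + k))))
    where
    lem : ∀ g x → 1ℤ ℤ.+ (g ℤ.+ x) ℤ.- g ≡ 1ℤ ℤ.+ x
    lem = solve-∀

  -- If -3 were a square modulo p, the field would contain a primitive cube root of unity.
  module NonResidue (h : ℕ) (p≡ : 6 * h + 5 ≡ p) (K : FieldOn (Fin p)) where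
    private module K = FieldTheory p K
    open K using (0#; 1#; 1≢0; inverse; ι; ι-*; ι-+; fermat; solve; con; _:=_; _:+_; _:*_; _:-_; zeroʳ; ^-homo-*; ^-assocʳ; 1^n; x-y≡0⇒x≡y) renaming (_+_ to _⊕_; _*_ to _⊛_; _-_ to _⊖_; _^_ to _⋆_)
    open Characteristic 1 p (sym (*-identityʳ p)) K using (∣⇒ι≡0; ι≡0⇒∣)

    ι≡0⇒∣ℤ : ∀ z → ι z ≡ 0# → P ∣ℤ z
    ι≡0⇒∣ℤ (+ n) eq = ∣ᵤ⇒∣ (ι≡0⇒∣ n eq)
    ι≡0⇒∣ℤ -[1+ n ] eq = ∣ᵤ⇒∣ (ι≡0⇒∣ (suc n) (trans (sym (K.-‿involutive (ι (+ suc n)))) (trans (cong K.-_ eq) (trans (sym (K.+-identityˡ (K.- 0#))) (K.-‿inverseʳ 0#)))))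

    one : ι 1ℤ ≡ 1#
    one = K.+-identityʳ 1#

    -- w³ = 1, and p - 1 = 3(2h + 1) + 1, so w = w^(p-1) = 1; then w² + w + 1 is 3.
    root-impossible : ∀ w → w ⊛ w ⊕ w ⊕ 1# ≡ 0# → P ∣ℤ + 3
    root-impossible w eq = ι≡0⇒∣ℤ (+ 3) (begin
      ι (+ 3)                 ≡⟨ subst (λ o → ι (+ 3) ≡ o ⊛ o ⊕ o ⊕ o) one (solve 0 (con (+ 3) := con 1ℤ :* con 1ℤ :+ con 1ℤ :+ con 1ℤ) refl) ⟩
      1# ⊛ 1# ⊕ 1# ⊕ 1#       ≡⟨ cong (λ v → v ⊛ v ⊕ v ⊕ 1#) w≡1 ⟨
      w ⊛ w ⊕ w ⊕ 1#          ≡⟨ eq ⟩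
      0#                      ∎)
      where
      open ≡-Reasoning
      w≢0 : w ≢ 0#
      w≢0 refl = 1≢0 (trans (sym (trans (cong (λ v → v ⊕ 0# ⊕ 1#) (zeroʳ 0#)) (trans (cong (_⊕ 1#) (K.+-identityˡ 0#)) (K.+-identityˡ 1#)))) eq)
      w³≡1 : w ⋆ 3 ≡ 1#
      w³≡1 = begin
        w ⊛ (w ⊛ (w ⊛ 1#))                                ≡⟨ cong (λ v → w ⊛ (w ⊛ v)) (K.*-identityʳ w) ⟩
        w ⊛ (w ⊛ w)                                       ≡⟨ subst (λ o → w ⊛ (w ⊛ w) ≡ o ⊕ (w ⊖ o) ⊛ (w ⊛ w ⊕ w ⊕ o)) one
                                                               (solve 1 (λ w → w :* (w :* w) := con 1ℤ :+ (w :- con 1ℤ) :* (w :* w :+ w :+ con 1ℤ)) refl w) ⟩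
        1# ⊕ (w ⊖ 1#) ⊛ (w ⊛ w ⊕ w ⊕ 1#)                  ≡⟨ cong (λ v → 1# ⊕ (w ⊖ 1#) ⊛ v) eq ⟩
        1# ⊕ (w ⊖ 1#) ⊛ 0#                                ≡⟨ cong (1# ⊕_) (zeroʳ (w ⊖ 1#)) ⟩
        1# ⊕ 0#                                           ≡⟨ K.+-identityʳ 1# ⟩
        1#                                                ∎
      exponent : K.m ≡ 3 * (2 * h + 1) + 1
      exponent = suc-injective (trans K.suc-m (trans (sym p≡) (lem h)))
        where
        lem : ∀ h → 6 * h + 5 ≡ suc (3 * (2 * h + 1) + 1)
        lem = ℕSolver.solve-∀
      w≡1 : w ≡ 1#
      w≡1 = begin
        w                                         ≡⟨ trans (sym (K.*-identityʳ w)) (sym (K.*-identityˡ (w ⊛ 1#))) ⟩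
        1# ⊛ (w ⊛ 1#)                             ≡⟨ cong (_⊛ (w ⊛ 1#)) (trans (sym (1^n (2 * h + 1))) (trans (cong (_⋆ (2 * h + 1)) (sym w³≡1)) (^-assocʳ w 3 (2 * h + 1)))) ⟩
        w ⋆ (3 * (2 * h + 1)) ⊛ w ⋆ 1             ≡⟨ ^-homo-* w (3 * (2 * h + 1)) 1 ⟨
        w ⋆ (3 * (2 * h + 1) + 1)                 ≡⟨ cong (w ⋆_) exponent ⟨
        w ⋆ K.m                                   ≡⟨ fermat w≢0 ⟩
        1#                                        ∎

    -- If y were invertible, x / y would be a square root of -3 and (x / y - 1) / 2 a root of w² + w
    -- + 1.
    anisotropic : ∀ X Y → P ∣ℤ X ℤ.* X ℤ.+ + 3 ℤ.* (Y ℤ.* Y) → P ∣ℤ Y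
    anisotropic X Y d = go (ι Y K.≟ 0#)
      where
      open ≡-Reasoning
      x y : Fin p
      x = ι X
      y = ι Y
      norm : x ⊛ x ⊕ ι (+ 3) ⊛ (y ⊛ y) ≡ 0#
      norm = trans (sym (trans (ι-+ (X ℤ.* X) (+ 3 ℤ.* (Y ℤ.* Y))) (cong₂ _⊕_ (ι-* X X) (trans (ι-* (+ 3) (Y ℤ.* Y)) (cong (ι (+ 3) ⊛_) (ι-* Y Y)))))) (∣⇒ι≡0 d)
      go : Dec (ι Y ≡ 0#) → P ∣ℤ Y
      go (yes z) = ι≡0⇒∣ℤ Y z
      go (no nz) with v , yv ← inverse y nz | t , 2t ← inverse (ι (+ 2)) (λ z → P∤2 (ι≡0⇒∣ℤ (+ 2) z)) =
        contradiction (root-impossible w root) P∤3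
        where
        w : Fin p
        w = t ⊛ (x ⊛ v ⊖ 1#)
        -- 4(w² + w + 1) = z² + 3 for z = 2w + 1 = x / y.
        root : w ⊛ w ⊕ w ⊕ 1# ≡ 0#
        root = begin
          w ⊛ w ⊕ w ⊕ 1#
            ≡⟨ cong (w ⊛ w ⊕ w ⊕_) (trans (sym (K.*-identityˡ 1#)) (cong₂ _⊛_ (sym 2t) (sym 2t))) ⟩
          w ⊛ w ⊕ w ⊕ (ι (+ 2) ⊛ t) ⊛ (ι (+ 2) ⊛ t)
            ≡⟨ cong (λ r → w ⊛ w ⊕ r ⊕ (ι (+ 2) ⊛ t) ⊛ (ι (+ 2) ⊛ t)) (trans (sym (K.*-identityˡ w)) (cong (_⊛ w) (sym 2t))) ⟩
          w ⊛ w ⊕ (ι (+ 2) ⊛ t) ⊛ w ⊕ (ι (+ 2) ⊛ t) ⊛ (ι (+ 2) ⊛ t)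
            ≡⟨ subst (λ o → let w = t ⊛ (x ⊛ v ⊖ o) in w ⊛ w ⊕ (ι (+ 2) ⊛ t) ⊛ w ⊕ (ι (+ 2) ⊛ t) ⊛ (ι (+ 2) ⊛ t) ≡ (t ⊛ t) ⊛ ((x ⊛ x) ⊛ (v ⊛ v) ⊕ ι (+ 3) ⊛ (o ⊛ o))) one
                 (solve 3 (λ t x v → let w = t :* (x :* v :- con 1ℤ) in w :* w :+ (con (+ 2) :* t) :* w :+ (con (+ 2) :* t) :* (con (+ 2) :* t) := (t :* t) :* ((x :* x) :* (v :* v) :+ con (+ 3) :* (con 1ℤ :* con 1ℤ))) refl t x v) ⟩
          (t ⊛ t) ⊛ ((x ⊛ x) ⊛ (v ⊛ v) ⊕ ι (+ 3) ⊛ (1# ⊛ 1#))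
            ≡⟨ cong (λ r → (t ⊛ t) ⊛ ((x ⊛ x) ⊛ (v ⊛ v) ⊕ ι (+ 3) ⊛ r)) (cong₂ _⊛_ (sym yv) (sym yv)) ⟩
          (t ⊛ t) ⊛ ((x ⊛ x) ⊛ (v ⊛ v) ⊕ ι (+ 3) ⊛ ((y ⊛ v) ⊛ (y ⊛ v)))
            ≡⟨ solve 4 (λ t x y v → (t :* t) :* ((x :* x) :* (v :* v) :+ con (+ 3) :* ((y :* v) :* (y :* v))) := (t :* t) :* (v :* v) :* (x :* x :+ con (+ 3) :* (y :* y))) refl t x y v ⟩
          (t ⊛ t) ⊛ (v ⊛ v) ⊛ (x ⊛ x ⊕ ι (+ 3) ⊛ (y ⊛ y))
            ≡⟨ trans (cong ((t ⊛ t) ⊛ (v ⊛ v) ⊛_) norm) (zeroʳ _) ⟩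
          0# ∎

-- Representations of prime powers by t² + 3w².

square-abs : ∀ x → x ℤ.* x ≡ + (∣ x ∣ * ∣ x ∣)
square-abs (+ n)    = sym (ℤ.pos-* n n)
square-abs -[1+ n ] = refl

square-≡ : ∀ {x y} → x ℤ.* x ≡ y ℤ.* y → x ≡ y ⊎ x ≡ ℤ.- y
square-≡ {x} {y} eq with ℤ.i*j≡0⇒i≡0∨j≡0 (x ℤ.- y) {x ℤ.+ y} (trans (lem x y) (ℤ.i≡j⇒i-j≡0 eq))
  where
  lem : ∀ x y → (x ℤ.- y) ℤ.* (x ℤ.+ y) ≡ x ℤ.* x ℤ.- y ℤ.* y
  lem = solve-∀
... | inj₁ z = inj₁ (ℤ.i-j≡0⇒i≡j x y z)
... | inj₂ z = inj₂ (ℤ.i-j≡0⇒i≡j x (ℤ.- y) (trans (cong (λ w → x ℤ.+ w) (ℤ.neg-involutive y)) z))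

-- For u ≠ 0 the second summand alone, 3u²n², would exceed n².
no-large-multiple : ∀ n u v → n ≢ 0ℤ → v ℤ.* v ℤ.+ + 3 ℤ.* ((u ℤ.* n) ℤ.* (u ℤ.* n)) ≡ n ℤ.* n → u ≡ 0ℤ
no-large-multiple n u v n≢0 eq = ℤ.∣i∣≡0⇒i≡0 (zero-square (∣ u ∣) (go (∣ u ∣ * ∣ u ∣) (∣ n ∣ * ∣ n ∣) (∣ v ∣ * ∣ v ∣) n²>0 (ℤ.+-injective nat)))
  where
  zero-square : ∀ k → k * k ≡ 0 → k ≡ 0
  zero-square zero _ = refl
  n²>0 : 0 < ∣ n ∣ * ∣ n ∣
  n²>0 = positive n n≢0
    where
    positive : ∀ n → n ≢ 0ℤ → 0 < ∣ n ∣ * ∣ n ∣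
    positive (+ zero)   n≢0 = contradiction refl n≢0
    positive (+ suc k)  _   = s≤s z≤n
    positive -[1+ k ]   _   = s≤s z≤n
  lem : ∀ u n → (u ℤ.* n) ℤ.* (u ℤ.* n) ≡ (u ℤ.* u) ℤ.* (n ℤ.* n)
  lem = solve-∀
  nat : + (∣ v ∣ * ∣ v ∣ + 3 * ((∣ u ∣ * ∣ u ∣) * (∣ n ∣ * ∣ n ∣))) ≡ + (∣ n ∣ * ∣ n ∣)
  nat = begin
    + (∣ v ∣ * ∣ v ∣ + 3 * (U * M))                  ≡⟨ ℤ.pos-+ (∣ v ∣ * ∣ v ∣) (3 * (U * M)) ⟩
    + (∣ v ∣ * ∣ v ∣) ℤ.+ + (3 * (U * M))            ≡⟨ cong₂ ℤ._+_ (sym (square-abs v)) (trans (ℤ.pos-* 3 (U * M)) (cong (+ 3 ℤ.*_) (trans (ℤ.pos-* U M) (trans (cong₂ ℤ._*_ (sym (square-abs u)) (sym (square-abs n))) (sym (lem u n)))))) ⟩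
    v ℤ.* v ℤ.+ + 3 ℤ.* ((u ℤ.* n) ℤ.* (u ℤ.* n))    ≡⟨ eq ⟩
    n ℤ.* n                                          ≡⟨ square-abs n ⟩
    + (∣ n ∣ * ∣ n ∣)                                ∎
    where
    open ≡-Reasoning
    U M : ℕ
    U = ∣ u ∣ * ∣ u ∣
    M = ∣ n ∣ * ∣ n ∣
  go : ∀ c b a → 0 < b → a + 3 * (c * b) ≡ b → c ≡ 0
  go zero    b a _   _ = refl
  go (suc c) b a 0<b e = contradiction e (>⇒≢ (<-≤-trans (m<m+n b 0<b) (≤-trans (+-mono-≤ (m≤m+n b (c * b)) (≤-trans (m≤m+n b (c * b)) (m≤m+n (b + c * b) _))) (m≤n+m (3 * (suc c * b)) a))))

χ-one : ∀ {x} → + 3 ∣ℤ x ℤ.- 1ℤ → χ x ≡ 1ℤ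
χ-one {x} d = trans (χ-shift {x} {1ℤ} d) χ1

χx*x-neg : ∀ x → χ (ℤ.- x) ℤ.* ℤ.- x ≡ χ x ℤ.* x
χx*x-neg x = trans (cong (ℤ._* (ℤ.- x)) (χ-neg x)) (lem (χ x) x)
  where
  lem : ∀ c x → ℤ.- c ℤ.* ℤ.- x ≡ c ℤ.* x
  lem = solve-∀

module CuspCoefficients (p : ℕ) (pr : Prime p) (3<p : 3 < p) where
  open PrimeIntegers p pr 3<p public

  N : ℕ → ℤ
  N k = + (p ^ k)

  N-suc : ∀ k → N (suc k) ≡ P ℤ.* N k
  N-suc k = ℤ.pos-* p (p ^ k)

  N≢0 : ∀ k → N k ≢ 0ℤ
  N≢0 k eq = <⇒≢ (m^n>0 p k) (sym (ℤ.+-injective eq))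

  P≢0 : P ≢ 0ℤ
  P≢0 eq = <⇒≢ (<-trans (s≤s z≤n) 1<p) (sym (ℤ.+-injective eq))

  instance
    P-nonZero : ℤ.NonZero P
    P-nonZero = ℤ.≢-nonZero P≢0

  x≢-x : ∀ {x} → x ≢ 0ℤ → x ≢ ℤ.- x
  x≢-x {x} x≢0 eq = x≢0 (x≡-x⇒x≡0 x eq)

  power-divides : ∀ k {a b} → ¬ (P ∣ℤ a) → N k ∣ℤ a ℤ.* b → N k ∣ℤ b
  power-divides zero    {a} {b} _   _ = divides b (sym (ℤ.*-identityʳ b))
  power-divides (suc k) {a} {b} P∤a (divides c eq) with euclid a b (divides (c ℤ.* N k) (trans eq (trans (cong (c ℤ.*_) (N-suc k)) (lem c P (N k)))))
    where
    lem : ∀ c p n → c ℤ.* (p ℤ.* n) ≡ c ℤ.* n ℤ.* p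
    lem = solve-∀
  ... | inj₁ d = contradiction d P∤a
  ... | inj₂ (divides b′ refl) with power-divides k {a} {b′} P∤a (divides c (ℤ.*-cancelʳ-≡ (a ℤ.* b′) (c ℤ.* N k) P (trans (ℤ.*-assoc a b′ P) (trans eq (trans (cong (c ℤ.*_) (N-suc k)) (lem c P (N k)))))))
    where
    lem : ∀ c p n → c ℤ.* (p ℤ.* n) ≡ c ℤ.* n ℤ.* p
    lem = solve-∀
  ...   | divides d refl = divides d (trans (ℤ.*-assoc d (N k) P) (cong (d ℤ.*_) (trans (ℤ.*-comm (N k) P) (sym (N-suc k)))))

  norm-∣ : ∀ {t w n} → P ∣ℤ n → P ∣ℤ t → t ℤ.* t ℤ.+ + 3 ℤ.* (w ℤ.* w) ≡ n → P ∣ℤ w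
  norm-∣ {t} {w} {n} P∣n P∣t eq = ∣-3square (subst (P ∣ℤ_) (trans (cong (ℤ._- t ℤ.* t) (sym eq)) (lem (t ℤ.* t) (+ 3 ℤ.* (w ℤ.* w)))) (Signed.∣m∣n⇒∣m-n P∣n (Signed.∣m⇒∣m*n t P∣t)))
    where
    lem : ∀ a b → a ℤ.+ b ℤ.- a ≡ b
    lem = solve-∀

  P∣N : ∀ k → P ∣ℤ N (suc k)
  P∣N k = divides (N k) (trans (N-suc k) (ℤ.*-comm P (N k)))

  -- The solutions with p | t and those with p ∤ t. If p | n, the former have p | w as well and are
  -- scaled solutions for n / p²; the latter will form a single orbit under changes of sign.
  αdiv αprim : ℕ → ℤ → ℤ
  αdiv  B n = ∑ (Z² B) (λ (t , w) → 𝟙 (eis? n (t , w)) ℤ.* (δ P t ℤ.* (χ t ℤ.* t)))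
  αprim B n = ∑ (Z² B) (λ (t , w) → 𝟙 (eis? n (t , w)) ℤ.* ((1ℤ ℤ.- δ P t) ℤ.* (χ t ℤ.* t)))

  α-split : ∀ B n → α B n ≡ αdiv B n ℤ.+ αprim B n
  α-split B n = trans (∑-cong (Z² B) (λ (t , w) → lem (𝟙 (eis? n (t , w))) (δ P t) (χ t ℤ.* t))) (∑-+ (Z² B) _ _)
    where
    lem : ∀ a d x → a ℤ.* x ≡ a ℤ.* (d ℤ.* x) ℤ.+ a ℤ.* ((1ℤ ℤ.- d) ℤ.* x)
    lem = solve-∀

  module _ (P≡1 : + 3 ∣ℤ P ℤ.- 1ℤ) where

    χ-P* : ∀ x → χ (P ℤ.* x) ≡ χ x
    χ-P* x = χ-shift (subst (+ 3 ∣ℤ_) (lem P x) (Signed.∣m⇒∣m*n x P≡1))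
      where
      lem : ∀ P x → (P ℤ.- 1ℤ) ℤ.* x ≡ P ℤ.* x ℤ.- x
      lem = solve-∀

    -- Along (t, w) → (pt, pw) the character is unchanged because p ≡ 1 (mod 3), and the weight χ(t)
    -- t gains one factor p.
    αdiv-scale : ∀ B k → p ^ k ≤ B → p ^ (2 + k) ≤ B → αdiv B (N (2 + k)) ≡ P ℤ.* α B (N k)
    αdiv-scale B k le le₂ = sym (begin
      P ℤ.* α B (N k)             ≡⟨ ∑-*ˡ P (Z² B) _ ⟨
      ∑ (Z² B) (λ (t , w) → P ℤ.* (𝟙 (eis? (N k) (t , w)) ℤ.* (χ t ℤ.* t))) ≡⟨ ∑-cong (Z² B) term ⟩
      ∑ (Z² B) (W ∘ f)            ≡⟨ ∑-reindex (ℤ._≟ 0ℤ) f (Z²-unique B) (Z²-unique B) W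
                                       (λ {tw} _ nz → in-box {f tw} (𝟙≢0 (eis? (N (2 + k)) (f tw)) (*≢0ˡ _ _ nz)))
                                       inj (λ {tw} _ nz → surj tw nz) ⟩
      ∑ (Z² B) W                  ∎)
      where
      open ≡-Reasoning
      f : ℤ × ℤ → ℤ × ℤ
      f (t , w) = P ℤ.* t , P ℤ.* w
      W : ℤ × ℤ → ℤ
      W (t , w) = 𝟙 (eis? (N (2 + k)) (t , w)) ℤ.* (δ P t ℤ.* (χ t ℤ.* t))
      in-box : ∀ {tw} → proj₁ tw ℤ.* proj₁ tw ℤ.+ + 3 ℤ.* (proj₂ tw ℤ.* proj₂ tw) ≡ N (2 + k) → tw ∈ Z² B
      in-box {t , w} e = Z²⁺ (subst (ℤ._≤ + B) (sym e) (+≤+ le₂))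
      N≡ : N (2 + k) ≡ P ℤ.* P ℤ.* N k
      N≡ = trans (N-suc (1 + k)) (trans (cong (P ℤ.*_) (N-suc k)) (sym (ℤ.*-assoc P P (N k))))
      norm-f : ∀ P t w → P ℤ.* t ℤ.* (P ℤ.* t) ℤ.+ + 3 ℤ.* (P ℤ.* w ℤ.* (P ℤ.* w)) ≡ P ℤ.* P ℤ.* (t ℤ.* t ℤ.+ + 3 ℤ.* (w ℤ.* w))
      norm-f = solve-∀
      down : ∀ t w → P ℤ.* t ℤ.* (P ℤ.* t) ℤ.+ + 3 ℤ.* (P ℤ.* w ℤ.* (P ℤ.* w)) ≡ N (2 + k) → t ℤ.* t ℤ.+ + 3 ℤ.* (w ℤ.* w) ≡ N k
      down t w e = ℤ.*-cancelˡ-≡ (P ℤ.* P) _ (N k) {{ℤ.i*j≢0 P P}} (trans (sym (norm-f P t w)) (trans e N≡))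
      term : ∀ ((t , w) : ℤ × ℤ) → P ℤ.* (𝟙 (eis? (N k) (t , w)) ℤ.* (χ t ℤ.* t)) ≡ W (f (t , w))
      term (t , w) = trans (lem P (𝟙 (eis? (N k) (t , w))) (χ t) t) (cong₂ ℤ._*_
          (𝟙-cong (λ e → trans (norm-f P t w) (trans (cong (P ℤ.* P ℤ.*_) e) (sym N≡))) (down t w) (eis? (N k) (t , w)) (eis? (N (2 + k)) (f (t , w))))
          (cong₂ (λ d c → d ℤ.* (c ℤ.* (P ℤ.* t))) (sym (δ-yes (divides t (ℤ.*-comm P t)))) (sym (χ-P* t))))
        where
        lem : ∀ P a c t → P ℤ.* (a ℤ.* (c ℤ.* t)) ≡ a ℤ.* (1ℤ ℤ.* (c ℤ.* (P ℤ.* t)))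
        lem = solve-∀
      inj : ∀ {s t} → f s ≡ f t → s ≡ t
      inj {a , b} {c , d} eq = cong₂ _,_ (ℤ.*-cancelˡ-≡ P a c (cong proj₁ eq)) (ℤ.*-cancelˡ-≡ P b d (cong proj₂ eq))
      surj : ∀ tw → W tw ≢ 0ℤ → ∃ λ s → s ∈ Z² B × f s ≡ tw
      surj (t , w) nz = go P∣t (norm-∣ {t} {w} (P∣N (1 + k)) P∣t e)
        where
        P∣t : P ∣ℤ t
        P∣t = δ≢0 {P} {t} (*≢0ˡ _ _ (*≢0ʳ (𝟙 (eis? (N (2 + k)) (t , w))) _ nz))
        e : t ℤ.* t ℤ.+ + 3 ℤ.* (w ℤ.* w) ≡ N (2 + k)
        e = 𝟙≢0 (eis? (N (2 + k)) (t , w)) (*≢0ˡ _ _ nz)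
        go : P ∣ℤ t → P ∣ℤ w → ∃ λ s → s ∈ Z² B × f s ≡ (t , w)
        go (divides t′ t≡) (divides w′ w≡) = (t′ , w′) , Z²⁺ (subst (ℤ._≤ + B) (sym (down t′ w′ (trans (cong₂ (λ x y → x ℤ.* x ℤ.+ + 3 ℤ.* (y ℤ.* y)) (sym t≡′) (sym w≡′)) e))) (+≤+ le)) , cong₂ _,_ (sym t≡′) (sym w≡′)
          where
          t≡′ : t ≡ P ℤ.* t′
          t≡′ = trans t≡ (ℤ.*-comm t′ P)
          w≡′ : w ≡ P ℤ.* w′
          w≡′ = trans w≡ (ℤ.*-comm w′ P)

  -- p | t forces p | w, and then p² would divide p.
  αdiv-prime : ∀ B → αdiv B (N 1) ≡ 0ℤ
  αdiv-prime B = ∑-0 (Z² B) term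
    where
    impossible : ∀ {t w} → P ∣ℤ t → t ℤ.* t ℤ.+ + 3 ℤ.* (w ℤ.* w) ≡ N 1 → P ∣ℤ 1ℤ
    impossible {t} {w} P∣t e = go P∣t (norm-∣ {t} {w} (P∣N 0) P∣t e)
      where
      go : P ∣ℤ t → P ∣ℤ w → P ∣ℤ 1ℤ
      go (divides t′ t≡) (divides w′ w≡) = divides (t′ ℤ.* t′ ℤ.+ + 3 ℤ.* (w′ ℤ.* w′)) (ℤ.*-cancelʳ-≡ 1ℤ ((t′ ℤ.* t′ ℤ.+ + 3 ℤ.* (w′ ℤ.* w′)) ℤ.* P) P
        (trans (ℤ.*-identityˡ P) (trans (cong +_ (sym (*-identityʳ p))) (trans (sym e) (trans (cong₂ (λ x y → x ℤ.* x ℤ.+ + 3 ℤ.* (y ℤ.* y)) t≡ w≡) (lem t′ w′ P))))))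
        where
        lem : ∀ t w P → t ℤ.* P ℤ.* (t ℤ.* P) ℤ.+ + 3 ℤ.* (w ℤ.* P ℤ.* (w ℤ.* P)) ≡ (t ℤ.* t ℤ.+ + 3 ℤ.* (w ℤ.* w)) ℤ.* P ℤ.* P
        lem = solve-∀
    term : ∀ ((t , w) : ℤ × ℤ) → 𝟙 (eis? (N 1) (t , w)) ℤ.* (δ P t ℤ.* (χ t ℤ.* t)) ≡ 0ℤ
    term (t , w) with 𝟙 (eis? (N 1) (t , w)) ℤ.* (δ P t ℤ.* (χ t ℤ.* t)) ℤ.≟ 0ℤ
    ... | yes z = z
    ... | no nz = contradiction (impossible {t} {w} (δ≢0 (*≢0ˡ _ _ (*≢0ʳ (𝟙 (eis? (N 1) (t , w))) _ nz))) (𝟙≢0 (eis? (N 1) (t , w)) (*≢0ˡ _ _ nz)))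
                    (λ d → p∤1 (∣⇒∣ᵤ d))

  -- (TY - XW)(TY + XW) = n(Y² - W²), so n divides one of the factors, and Brahmagupta's identity makes that factor zero.
  primitive-unique : ∀ k {T W X Y} → T ℤ.* T ℤ.+ + 3 ℤ.* (W ℤ.* W) ≡ N (suc k) → X ℤ.* X ℤ.+ + 3 ℤ.* (Y ℤ.* Y) ≡ N (suc k) →
    ¬ (P ∣ℤ T) → ¬ (P ∣ℤ X) → X ℤ.* X ≡ T ℤ.* T × Y ℤ.* Y ≡ W ℤ.* W
  primitive-unique k {T} {W} {X} {Y} eT eX P∤T P∤X = X²≡T² , Y²≡W²
    where
    open ≡-Reasoning
    n : ℤ
    n = N (suc k)
    P∤Y : ¬ (P ∣ℤ Y)
    P∤Y d = P∤X (∣-square (subst (P ∣ℤ_) (trans (cong (ℤ._- + 3 ℤ.* (Y ℤ.* Y)) (sym eX)) (lem (X ℤ.* X) (+ 3 ℤ.* (Y ℤ.* Y))))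
              (Signed.∣m∣n⇒∣m-n (P∣N k) (Signed.∣n⇒∣m*n (+ 3) (Signed.∣m⇒∣m*n Y d)))))
      where
      lem : ∀ a b → a ℤ.+ b ℤ.- b ≡ a
      lem = solve-∀
    U U′ : ℤ
    U  = T ℤ.* Y ℤ.- X ℤ.* W
    U′ = T ℤ.* Y ℤ.+ X ℤ.* W
    product : U ℤ.* U′ ≡ n ℤ.* (Y ℤ.* Y ℤ.- W ℤ.* W)
    product = begin
      U ℤ.* U′ ≡⟨ lem₁ T W X Y ⟩
      (T ℤ.* T ℤ.+ + 3 ℤ.* (W ℤ.* W)) ℤ.* (Y ℤ.* Y) ℤ.- (X ℤ.* X ℤ.+ + 3 ℤ.* (Y ℤ.* Y)) ℤ.* (W ℤ.* W) ≡⟨ cong₂ (λ a b → a ℤ.* (Y ℤ.* Y) ℤ.- b ℤ.* (W ℤ.* W)) eT eX ⟩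
      n ℤ.* (Y ℤ.* Y) ℤ.- n ℤ.* (W ℤ.* W) ≡⟨ lem₂ n (Y ℤ.* Y) (W ℤ.* W) ⟩
      n ℤ.* (Y ℤ.* Y ℤ.- W ℤ.* W) ∎
      where
      lem₁ : ∀ T W X Y → (T ℤ.* Y ℤ.- X ℤ.* W) ℤ.* (T ℤ.* Y ℤ.+ X ℤ.* W) ≡ (T ℤ.* T ℤ.+ + 3 ℤ.* (W ℤ.* W)) ℤ.* (Y ℤ.* Y) ℤ.- (X ℤ.* X ℤ.+ + 3 ℤ.* (Y ℤ.* Y)) ℤ.* (W ℤ.* W)
      lem₁ = solve-∀
      lem₂ : ∀ n a b → n ℤ.* a ℤ.- n ℤ.* b ≡ n ℤ.* (a ℤ.- b)
      lem₂ = solve-∀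
    brahmagupta : (T ℤ.* X ℤ.+ + 3 ℤ.* (W ℤ.* Y)) ℤ.* (T ℤ.* X ℤ.+ + 3 ℤ.* (W ℤ.* Y)) ℤ.+ + 3 ℤ.* (U ℤ.* U) ≡ n ℤ.* n
    brahmagupta = trans (lem T W X Y) (cong₂ ℤ._*_ eT eX)
      where
      lem : ∀ T W X Y → (T ℤ.* X ℤ.+ + 3 ℤ.* (W ℤ.* Y)) ℤ.* (T ℤ.* X ℤ.+ + 3 ℤ.* (W ℤ.* Y)) ℤ.+ + 3 ℤ.* ((T ℤ.* Y ℤ.- X ℤ.* W) ℤ.* (T ℤ.* Y ℤ.- X ℤ.* W)) ≡ (T ℤ.* T ℤ.+ + 3 ℤ.* (W ℤ.* W)) ℤ.* (X ℤ.* X ℤ.+ + 3 ℤ.* (Y ℤ.* Y))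
      lem = solve-∀
    brahmagupta′ : (T ℤ.* X ℤ.- + 3 ℤ.* (W ℤ.* Y)) ℤ.* (T ℤ.* X ℤ.- + 3 ℤ.* (W ℤ.* Y)) ℤ.+ + 3 ℤ.* (U′ ℤ.* U′) ≡ n ℤ.* n
    brahmagupta′ = trans (lem T W X Y) (cong₂ ℤ._*_ eT eX)
      where
      lem : ∀ T W X Y → (T ℤ.* X ℤ.- + 3 ℤ.* (W ℤ.* Y)) ℤ.* (T ℤ.* X ℤ.- + 3 ℤ.* (W ℤ.* Y)) ℤ.+ + 3 ℤ.* ((T ℤ.* Y ℤ.+ X ℤ.* W) ℤ.* (T ℤ.* Y ℤ.+ X ℤ.* W)) ≡ (T ℤ.* T ℤ.+ + 3 ℤ.* (W ℤ.* W)) ℤ.* (X ℤ.* X ℤ.+ + 3 ℤ.* (Y ℤ.* Y))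
      lem = solve-∀
    vanishing : ∀ {u v} → n ∣ℤ u → v ℤ.* v ℤ.+ + 3 ℤ.* (u ℤ.* u) ≡ n ℤ.* n → u ≡ 0ℤ
    vanishing {v = v} (divides c refl) e = trans (cong (ℤ._* n) (no-large-multiple n c v (N≢0 (suc k)) e)) (ℤ.*-zeroˡ n)
    -- The two factors add up to 2TY, which is prime to p, so p divides at most one of them and the
    -- full power p^(k+1) must divide the other.
    both : ¬ (P ∣ℤ U × P ∣ℤ U′)
    both (d , d′) = [ P∤2 , (λ e → [ P∤T , P∤Y ]′ (euclid T Y e)) ]′ (euclid (+ 2) (T ℤ.* Y) (subst (P ∣ℤ_) (lem T W X Y) (Signed.∣m∣n⇒∣m+n d d′)))
      where
      lem : ∀ T W X Y → T ℤ.* Y ℤ.- X ℤ.* W ℤ.+ (T ℤ.* Y ℤ.+ X ℤ.* W) ≡ + 2 ℤ.* (T ℤ.* Y)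
      lem = solve-∀
    UU′≡0 : U ℤ.* U′ ≡ 0ℤ
    UU′≡0 = go (P Signed.∣? U)
      where
      go : Dec (P ∣ℤ U) → U ℤ.* U′ ≡ 0ℤ
      go (no P∤U) = trans (cong (U ℤ.*_) (vanishing {U′} {T ℤ.* X ℤ.- + 3 ℤ.* (W ℤ.* Y)} (power-divides (suc k) {U} {U′} P∤U (divides (Y ℤ.* Y ℤ.- W ℤ.* W) (trans product (ℤ.*-comm n (Y ℤ.* Y ℤ.- W ℤ.* W))))) brahmagupta′)) (ℤ.*-zeroʳ U)
      go (yes P∣U) = trans (cong (ℤ._* U′) (vanishing {U} {T ℤ.* X ℤ.+ + 3 ℤ.* (W ℤ.* Y)} (power-divides (suc k) {U′} {U} (λ d → both (P∣U , d)) (divides (Y ℤ.* Y ℤ.- W ℤ.* W) (trans (ℤ.*-comm U′ U) (trans product (ℤ.*-comm n (Y ℤ.* Y ℤ.- W ℤ.* W)))))) brahmagupta)) (ℤ.*-zeroˡ U′)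
    Y²≡W² : Y ℤ.* Y ≡ W ℤ.* W
    Y²≡W² = [ (λ z → contradiction z (N≢0 (suc k))) , ℤ.i-j≡0⇒i≡j (Y ℤ.* Y) (W ℤ.* W) ]′ (ℤ.i*j≡0⇒i≡0∨j≡0 n (trans (sym product) UU′≡0))
    X²≡T² : X ℤ.* X ≡ T ℤ.* T
    X²≡T² = begin
      X ℤ.* X                                                   ≡⟨ lem (X ℤ.* X) (Y ℤ.* Y) ⟩
      X ℤ.* X ℤ.+ + 3 ℤ.* (Y ℤ.* Y) ℤ.- + 3 ℤ.* (Y ℤ.* Y)       ≡⟨ cong₂ (λ a b → a ℤ.- + 3 ℤ.* b) (trans eX (sym eT)) Y²≡W² ⟩
      T ℤ.* T ℤ.+ + 3 ℤ.* (W ℤ.* W) ℤ.- + 3 ℤ.* (W ℤ.* W)       ≡⟨ lem (T ℤ.* T) (W ℤ.* W) ⟨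
      T ℤ.* T                                                   ∎
      where
      lem : ∀ a b → a ≡ a ℤ.+ + 3 ℤ.* b ℤ.- + 3 ℤ.* b
      lem = solve-∀

  -- By uniqueness the primitive solutions are (±T, ±W), four distinct ones since T and W are
  -- nonzero, and χ(t) t is even in t.
  αprim-value : ∀ B k T W → p ^ suc k ≤ B → T ℤ.* T ℤ.+ + 3 ℤ.* (W ℤ.* W) ≡ N (suc k) → ¬ (P ∣ℤ T) → + 3 ∣ℤ T ℤ.- 1ℤ → αprim B (N (suc k)) ≡ + 4 ℤ.* T
  αprim-value B k T W le eT P∤T T≡1 = begin
    αprim B n          ≡⟨ ∑-reindex (ℤ._≟ 0ℤ) (λ x → x) xs-unique (Z²-unique B) V (λ {tw} _ nz → in-box {tw} (𝟙≢0 (eis? n tw) (*≢0ˡ _ _ nz))) (λ e → e) (λ {tw} _ nz → tw , surj tw nz , refl) ⟨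
    ∑ xs V             ≡⟨ cong₄ (λ a b c d → a ℤ.+ (b ℤ.+ (c ℤ.+ (d ℤ.+ 0ℤ)))) (value (T , W) eT P∤T) (value (T , ℤ.- W) (trans (lem₀ T W) eT) P∤T) (trans (value (ℤ.- T , W) (trans (lem₁ T W) eT) P∤-T) (χx*x-neg T)) (trans (value (ℤ.- T , ℤ.- W) (trans (lem₂ T W) eT) P∤-T) (χx*x-neg T)) ⟩
    c ℤ.+ (c ℤ.+ (c ℤ.+ (c ℤ.+ 0ℤ)))  ≡⟨ cong (λ c → c ℤ.+ (c ℤ.+ (c ℤ.+ (c ℤ.+ 0ℤ)))) (trans (cong (ℤ._* T) (χ-one T≡1)) (ℤ.*-identityˡ T)) ⟩
    T ℤ.+ (T ℤ.+ (T ℤ.+ (T ℤ.+ 0ℤ)))  ≡⟨ lem₃ T ⟩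
    + 4 ℤ.* T          ∎
    where
    open ≡-Reasoning
    n c : ℤ
    n = N (suc k)
    c = χ T ℤ.* T
    V : ℤ × ℤ → ℤ
    V (t , w) = 𝟙 (eis? n (t , w)) ℤ.* ((1ℤ ℤ.- δ P t) ℤ.* (χ t ℤ.* t))
    lem₀ : ∀ T W → T ℤ.* T ℤ.+ + 3 ℤ.* (ℤ.- W ℤ.* ℤ.- W) ≡ T ℤ.* T ℤ.+ + 3 ℤ.* (W ℤ.* W)
    lem₀ = solve-∀
    lem₁ : ∀ T W → ℤ.- T ℤ.* ℤ.- T ℤ.+ + 3 ℤ.* (W ℤ.* W) ≡ T ℤ.* T ℤ.+ + 3 ℤ.* (W ℤ.* W)
    lem₁ = solve-∀
    lem₂ : ∀ T W → ℤ.- T ℤ.* ℤ.- T ℤ.+ + 3 ℤ.* (ℤ.- W ℤ.* ℤ.- W) ≡ T ℤ.* T ℤ.+ + 3 ℤ.* (W ℤ.* W)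
    lem₂ = solve-∀
    lem₃ : ∀ T → T ℤ.+ (T ℤ.+ (T ℤ.+ (T ℤ.+ 0ℤ))) ≡ + 4 ℤ.* T
    lem₃ = solve-∀
    P∤-T : ¬ (P ∣ℤ ℤ.- T)
    P∤-T d = P∤T (subst (P ∣ℤ_) (ℤ.neg-involutive T) (Signed.∣m⇒∣-m d))
    δ-no : ∀ {t} → ¬ (P ∣ℤ t) → δ P t ≡ 0ℤ
    δ-no {t} P∤t with δ P t ℤ.≟ 0ℤ
    ... | yes z = z
    ... | no nz = contradiction (δ≢0 nz) P∤t
    value : ∀ ((t , w) : ℤ × ℤ) → t ℤ.* t ℤ.+ + 3 ℤ.* (w ℤ.* w) ≡ n → ¬ (P ∣ℤ t) → V (t , w) ≡ χ t ℤ.* t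
    value (t , w) e P∤t = trans (cong₂ (λ a d → a ℤ.* ((1ℤ ℤ.- d) ℤ.* (χ t ℤ.* t))) (𝟙-yes (eis? n (t , w)) e) (δ-no P∤t)) (trans (ℤ.*-identityˡ _) (ℤ.*-identityˡ _))
    in-box : ∀ {tw} → proj₁ tw ℤ.* proj₁ tw ℤ.+ + 3 ℤ.* (proj₂ tw ℤ.* proj₂ tw) ≡ n → tw ∈ Z² B
    in-box {t , w} e = Z²⁺ (subst (ℤ._≤ + B) (sym e) (+≤+ le))
    T≢0 : T ≢ 0ℤ
    T≢0 T≡0 = P∤T (subst (P ∣ℤ_) (sym T≡0) (divides 0ℤ refl))
    W≢0 : W ≢ 0ℤ
    W≢0 W≡0 = P∤T (∣-square (subst (P ∣ℤ_) (trans (sym eT) (trans (cong (λ w → T ℤ.* T ℤ.+ + 3 ℤ.* (w ℤ.* w)) W≡0) (ℤ.+-identityʳ (T ℤ.* T)))) (P∣N k)))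
    xs : List (ℤ × ℤ)
    xs = (T , W) ∷ (T , ℤ.- W) ∷ (ℤ.- T , W) ∷ (ℤ.- T , ℤ.- W) ∷ []
    xs-unique : Unique xs
    xs-unique = (x≢-x W≢0 ∘ cong proj₂ ∷ x≢-x T≢0 ∘ cong proj₁ ∷ x≢-x T≢0 ∘ cong proj₁ ∷ [])
      ∷ (x≢-x T≢0 ∘ cong proj₁ ∷ x≢-x T≢0 ∘ cong proj₁ ∷ []) ∷ (x≢-x W≢0 ∘ cong proj₂ ∷ []) ∷ [] ∷ []
    surj : ∀ tw → V tw ≢ 0ℤ → tw ∈ xs
    surj (t , w) nz = go (square-≡ {t} {T} (proj₁ signs)) (square-≡ {w} {W} (proj₂ signs))
      where
      P∤t : ¬ (P ∣ℤ t)
      P∤t d = *≢0ˡ (1ℤ ℤ.- δ P t) (χ t ℤ.* t) (*≢0ʳ (𝟙 (eis? n (t , w))) _ nz) (cong (λ d → 1ℤ ℤ.- d) (δ-yes d))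
      signs : t ℤ.* t ≡ T ℤ.* T × w ℤ.* w ≡ W ℤ.* W
      signs = primitive-unique k {T} {W} {t} {w} eT (𝟙≢0 (eis? n (t , w)) (*≢0ˡ _ _ nz)) P∤T P∤t
      go : t ≡ T ⊎ t ≡ ℤ.- T → w ≡ W ⊎ w ≡ ℤ.- W → (t , w) ∈ xs
      go (inj₁ e) (inj₁ e′) = here (cong₂ _,_ e e′)
      go (inj₁ e) (inj₂ e′) = there (here (cong₂ _,_ e e′))
      go (inj₂ e) (inj₁ e′) = there (there (here (cong₂ _,_ e e′)))
      go (inj₂ e) (inj₂ e′) = there (there (there (here (cong₂ _,_ e e′))))

  module Inert (P≡2 : + 3 ∣ℤ P ℤ.+ 1ℤ) (anisotropic : ∀ X Y → P ∣ℤ X ℤ.* X ℤ.+ + 3 ℤ.* (Y ℤ.* Y) → P ∣ℤ Y) where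

    χ-P*-inert : ∀ x → χ (P ℤ.* x) ≡ ℤ.- χ x
    χ-P*-inert x = trans (χ-shift {P ℤ.* x} {ℤ.- x} (subst (+ 3 ∣ℤ_) (lem P x) (Signed.∣m⇒∣m*n x P≡2))) (χ-neg x)
      where
      lem : ∀ P x → (P ℤ.+ 1ℤ) ℤ.* x ≡ P ℤ.* x ℤ.- ℤ.- x
      lem = solve-∀

    -- Descent: p divides Y by anisotropy and then X, and dividing both by p lowers m by one.
    only-trivial : ∀ m X Y → X ℤ.* X ℤ.+ + 3 ℤ.* (Y ℤ.* Y) ≡ N m ℤ.* N m → X ℤ.* X ≡ N m ℤ.* N m × Y ≡ 0ℤ
    only-trivial zero X Y e = trans (trans (sym (ℤ.+-identityʳ (X ℤ.* X))) (cong (λ y → X ℤ.* X ℤ.+ + 3 ℤ.* (y ℤ.* y)) (sym Y≡0))) e , Y≡0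
      where
      Y≡0 : Y ≡ 0ℤ
      Y≡0 = no-large-multiple 1ℤ Y X (λ ()) (trans (cong (λ y → X ℤ.* X ℤ.+ + 3 ℤ.* (y ℤ.* y)) (ℤ.*-identityʳ Y)) e)
    only-trivial (suc m) X Y e = go (anisotropic X Y P∣norm)
      where
      P∣norm : P ∣ℤ X ℤ.* X ℤ.+ + 3 ℤ.* (Y ℤ.* Y)
      P∣norm = subst (P ∣ℤ_) (sym e) (Signed.∣m⇒∣m*n (N (suc m)) (P∣N m))
      go : P ∣ℤ Y → X ℤ.* X ≡ N (suc m) ℤ.* N (suc m) × Y ≡ 0ℤ
      go P∣Y@(divides Y′ Y≡) = go′ (∣-square {X} (subst (P ∣ℤ_) (lem (X ℤ.* X) (+ 3 ℤ.* (Y ℤ.* Y))) (Signed.∣m∣n⇒∣m-n P∣norm (Signed.∣n⇒∣m*n (+ 3) (Signed.∣m⇒∣m*n Y P∣Y)))))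
        where
        lem : ∀ a b → a ℤ.+ b ℤ.- b ≡ a
        lem = solve-∀
        go′ : P ∣ℤ X → X ℤ.* X ≡ N (suc m) ℤ.* N (suc m) × Y ≡ 0ℤ
        go′ (divides X′ X≡) = (begin
            X ℤ.* X                                ≡⟨ cong (λ x → x ℤ.* x) X≡ ⟩
            X′ ℤ.* P ℤ.* (X′ ℤ.* P)                ≡⟨ lem₂ X′ P ⟩
            P ℤ.* P ℤ.* (X′ ℤ.* X′)                ≡⟨ cong (P ℤ.* P ℤ.*_) (proj₁ ih) ⟩
            P ℤ.* P ℤ.* (N m ℤ.* N m)              ≡⟨ sym N² ⟩
            N (suc m) ℤ.* N (suc m)                ∎) , trans Y≡ (cong (ℤ._* P) (proj₂ ih))
          where
          open ≡-Reasoning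
          lem₂ : ∀ X P → X ℤ.* P ℤ.* (X ℤ.* P) ≡ P ℤ.* P ℤ.* (X ℤ.* X)
          lem₂ = solve-∀
          lem₃ : ∀ X Y P → X ℤ.* P ℤ.* (X ℤ.* P) ℤ.+ + 3 ℤ.* (Y ℤ.* P ℤ.* (Y ℤ.* P)) ≡ P ℤ.* P ℤ.* (X ℤ.* X ℤ.+ + 3 ℤ.* (Y ℤ.* Y))
          lem₃ = solve-∀
          lem₄ : ∀ P n → P ℤ.* n ℤ.* (P ℤ.* n) ≡ P ℤ.* P ℤ.* (n ℤ.* n)
          lem₄ = solve-∀
          N² : N (suc m) ℤ.* N (suc m) ≡ P ℤ.* P ℤ.* (N m ℤ.* N m)
          N² = trans (cong (λ n → n ℤ.* n) (N-suc m)) (lem₄ P (N m))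
          ih : X′ ℤ.* X′ ≡ N m ℤ.* N m × Y′ ≡ 0ℤ
          ih = only-trivial m X′ Y′ (ℤ.*-cancelˡ-≡ (P ℤ.* P) (X′ ℤ.* X′ ℤ.+ + 3 ℤ.* (Y′ ℤ.* Y′)) (N m ℤ.* N m) {{ℤ.i*j≢0 P P}}
            (trans (sym (lem₃ X′ Y′ P)) (trans (cong₂ (λ x y → x ℤ.* x ℤ.+ + 3 ℤ.* (y ℤ.* y)) (sym X≡) (sym Y≡)) (trans e N²))))

    -- Only (±p^m, 0) contribute, and equally.
    α-value : ∀ B m → N m ℤ.* N m ℤ.≤ + B → α B (N m ℤ.* N m) ≡ + 2 ℤ.* (χ (N m) ℤ.* N m)
    α-value B m le = begin
      α B n     ≡⟨ ∑-reindex (ℤ._≟ 0ℤ) (λ x → x) xs-unique (Z²-unique B) V (λ {tw} _ nz → in-box {tw} (𝟙≢0 (eis? n tw) (*≢0ˡ _ _ nz))) (λ e → e) (λ {tw} _ nz → tw , surj tw nz , refl) ⟨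
      ∑ xs V    ≡⟨ cong₂ (λ a b → a ℤ.+ (b ℤ.+ 0ℤ)) (value (N m , 0ℤ) (ℤ.+-identityʳ n)) (trans (value (ℤ.- N m , 0ℤ) (trans (ℤ.+-identityʳ (ℤ.- N m ℤ.* ℤ.- N m)) (lem₀ (N m)))) (χx*x-neg (N m))) ⟩
      χ (N m) ℤ.* N m ℤ.+ (χ (N m) ℤ.* N m ℤ.+ 0ℤ) ≡⟨ lem₁ (χ (N m) ℤ.* N m) ⟩
      + 2 ℤ.* (χ (N m) ℤ.* N m) ∎
      where
      open ≡-Reasoning
      n : ℤ
      n = N m ℤ.* N m
      V : ℤ × ℤ → ℤ
      V (t , w) = 𝟙 (eis? n (t , w)) ℤ.* (χ t ℤ.* t)
      xs : List (ℤ × ℤ)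
      xs = (N m , 0ℤ) ∷ (ℤ.- N m , 0ℤ) ∷ []
      xs-unique : Unique xs
      xs-unique = (x≢-x (N≢0 m) ∘ cong proj₁ ∷ []) ∷ [] ∷ []
      lem₀ : ∀ x → ℤ.- x ℤ.* ℤ.- x ≡ x ℤ.* x
      lem₀ = solve-∀
      lem₁ : ∀ x → x ℤ.+ (x ℤ.+ 0ℤ) ≡ + 2 ℤ.* x
      lem₁ = solve-∀
      in-box : ∀ {tw} → proj₁ tw ℤ.* proj₁ tw ℤ.+ + 3 ℤ.* (proj₂ tw ℤ.* proj₂ tw) ≡ n → tw ∈ Z² B
      in-box {t , w} e = Z²⁺ (subst (ℤ._≤ + B) (sym e) le)
      value : ∀ ((t , w) : ℤ × ℤ) → t ℤ.* t ℤ.+ + 3 ℤ.* (w ℤ.* w) ≡ n → V (t , w) ≡ χ t ℤ.* t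
      value (t , w) e = trans (cong (ℤ._* (χ t ℤ.* t)) (𝟙-yes (eis? n (t , w)) e)) (ℤ.*-identityˡ _)
      surj : ∀ tw → V tw ≢ 0ℤ → tw ∈ xs
      surj (t , w) nz with only-trivial m t w (𝟙≢0 (eis? n (t , w)) (*≢0ˡ _ _ nz))
      ... | e , refl with square-≡ {t} {N m} e
      ...   | inj₁ refl = here refl
      ...   | inj₂ refl = there (here refl)

-- Assembly of the relations along the powers of p.

sumTo-suc : ∀ k (f : ℕ → ℕ) → sumTo (suc k) f ≡ f 0 + sumTo k (λ j → f (suc j))
sumTo-suc k f = cong (λ xs → f 0 + sum xs) (trans (map-applyUpTo suc f (suc k)) (sym (map-upTo (λ j → f (suc j)) (suc k))))

sumTo-cong : ∀ k {f g : ℕ → ℕ} → (∀ j → f j ≡ g j) → sumTo k f ≡ sumTo k g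
sumTo-cong k {f} {g} eq = go (upTo (suc k))
  where
  go : ∀ xs → sum (map f xs) ≡ sum (map g xs)
  go []       = refl
  go (x ∷ xs) = cong₂ _+_ (eq x) (go xs)

sumTo-* : ∀ k c (f : ℕ → ℕ) → sumTo k (λ j → c * f j) ≡ c * sumTo k f
sumTo-* k c f = go (upTo (suc k))
  where
  go : ∀ xs → sum (map (λ j → c * f j) xs) ≡ c * sum (map f xs)
  go []       = sym (*-zeroʳ c)
  go (x ∷ xs) = trans (cong (λ w → c * f x + w) (go xs)) (sym (*-distribˡ-+ c (f x) (sum (map f xs))))

residue-mod-6 : ∀ p → Prime p → 3 < p → p % 6 ≡ 1 ⊎ p % 6 ≡ 5
residue-mod-6 p pr 3<p = go (p % 6) refl (m%n<n p 6)
  where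
  composite : ∀ d c r → 1 < d → d < p → p % 6 ≡ r → r + p / 6 * 6 ≡ c * d → ∀ {A : Set} → A
  composite d c r 1<d d<p e eq = contradiction (prime⇒irreducible pr (divides c (trans (m≡m%n+[m/n]*n p 6) (trans (cong (_+ p / 6 * 6) e) eq))))
    [ (λ d≡1 → <⇒≢ 1<d (sym d≡1)) , <⇒≢ d<p ]′
  2<p : 2 < p
  2<p = <-trans (s≤s (s≤s (s≤s z≤n))) 3<p
  go : ∀ r → p % 6 ≡ r → r < 6 → p % 6 ≡ 1 ⊎ p % 6 ≡ 5
  go 0 e _ = composite 2 (p / 6 * 3) 0 (s≤s (s≤s z≤n)) 2<p e (lem (p / 6))
    where
    lem : ∀ x → 0 + x * 6 ≡ x * 3 * 2
    lem = ℕSolver.solve-∀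
  go 1 e _ = inj₁ e
  go 2 e _ = composite 2 (1 + p / 6 * 3) 2 (s≤s (s≤s z≤n)) 2<p e (lem (p / 6))
    where
    lem : ∀ x → 2 + x * 6 ≡ (1 + x * 3) * 2
    lem = ℕSolver.solve-∀
  go 3 e _ = composite 3 (1 + p / 6 * 2) 3 (s≤s (s≤s z≤n)) 3<p e (lem (p / 6))
    where
    lem : ∀ x → 3 + x * 6 ≡ (1 + x * 2) * 3
    lem = ℕSolver.solve-∀
  go 4 e _ = composite 2 (2 + p / 6 * 3) 4 (s≤s (s≤s z≤n)) 2<p e (lem (p / 6))
    where
    lem : ∀ x → 4 + x * 6 ≡ (2 + x * 3) * 2
    lem = ℕSolver.solve-∀
  go 5 e _ = inj₂ e
  go (suc (suc (suc (suc (suc (suc _)))))) _ (s≤s (s≤s (s≤s (s≤s (s≤s (s≤s ()))))))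

module Assembly (p : ℕ) (pr : Prime p) (3<p : 3 < p) (F : ℕ → FiniteField) (cardF : ∀ k → card (F (suc k)) ≡ p ^ suc k) where
  open CuspCoefficients p pr 3<p

  divide : ∀ {r} → p % 6 ≡ r → 6 * (p / 6) + r ≡ p
  divide {r} e = trans (+-comm (6 * (p / 6)) r) (trans (cong₂ _+_ (sym e) (*-comm 6 (p / 6))) (sym (m≡m%n+[m/n]*n p 6)))

  -- p^k ≡ 1 (mod 6) serves twice: for the formula for `r13`, and for the quadratic and cubic
  -- residue classes in the field with p^k elements.
  Good : ℕ → Set
  Good k = ∃ λ j → 6 * j + 1 ≡ p ^ k

  module _ (k : ℕ) (good : Good k) where

    private
      N-1 : N k ℤ.- 1ℤ ≡ + 6 ℤ.* + (proj₁ good)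
      N-1 = trans (cong (λ n → + n ℤ.- 1ℤ) (sym (proj₂ good))) (trans (cong (ℤ._- 1ℤ) (trans (ℤ.pos-+ (6 * proj₁ good) 1) (cong (ℤ._+ 1ℤ) (ℤ.pos-* 6 (proj₁ good))))) (lem (+ (proj₁ good))))
        where
        lem : ∀ j → + 6 ℤ.* j ℤ.+ 1ℤ ℤ.- 1ℤ ≡ + 6 ℤ.* j
        lem = solve-∀

    N-odd : + 2 ∣ℤ N k ℤ.- 1ℤ
    N-odd = subst (+ 2 ∣ℤ_) (sym N-1) (Signed.∣m⇒∣m*n (+ (proj₁ good)) (Signed.divides (+ 3) refl))

    N≡1mod3 : + 3 ∣ℤ N k ℤ.- 1ℤ
    N≡1mod3 = subst (+ 3 ∣ℤ_) (sym N-1) (Signed.∣m⇒∣m*n (+ (proj₁ good)) (Signed.divides (+ 2) refl))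

    -- B is left free so that the values at p^k and at p^(k+2) can be taken over the same box.
    six : ∀ B → 4 * p ^ k + 1 ≤ B → + 6 ℤ.* + (r13 (p ^ k)) ≡ + 2 ℤ.* G (suc k) ℤ.- α B (N k)
    six B le = trans (Hadamard.6r13 B (≤-trans (m≤n+m 1 (4 * p ^ k)) le) (p ^ k) N-odd N≡1mod3 bound)
      (cong (λ s → + 2 ℤ.* s ℤ.- α B (N k)) (σ-prime-power B k (≤-trans (m≤n*m (p ^ k) 4) (≤-trans (m≤m+n (4 * p ^ k) 1) le))))
      where
      bound : + 4 ℤ.* + (p ^ k) ℤ.+ 1ℤ ℤ.≤ + B
      bound = subst (ℤ._≤ + B) (trans (ℤ.pos-+ (4 * p ^ k) 1) (cong (ℤ._+ 1ℤ) (ℤ.pos-* 4 (p ^ k)))) (+≤+ le)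

  -- The trace of Frobenius over F (suc k) is 2T.
  Frobenius : ℕ → ℤ → ℤ → Set
  Frobenius k T W = T ℤ.* T ℤ.+ + 3 ℤ.* (W ℤ.* W) ≡ N (suc k) × + 3 ∣ℤ T ℤ.- 1ℤ × + (#E (F (suc k))) ≡ 1ℤ ℤ.+ (N (suc k) ℤ.- + 2 ℤ.* T)

  module Points (k j : ℕ) (6j+1≡ : 6 * j + 1 ≡ p ^ suc k) where
    open Transport (F (suc k)) using (q; field-on)

    q≡ : q ≡ p ^ suc k
    q≡ = cardF k

    6j≡m : 6 * j ≡ FieldTheory.m q field-on
    6j≡m = suc-injective (trans (+-comm 1 (6 * j)) (trans 6j+1≡ (trans (sym q≡) (sym (FieldTheory.suc-m q field-on)))))

    open Trace q field-on j 6j≡m using (affine≡; s₀; trace; ι-trace)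

    T W : ℤ
    T = proj₁ trace
    W = proj₁ (proj₂ trace)

    s₀≡ : s₀ ≡ ℤ.- (+ 2 ℤ.* T)
    s₀≡ = proj₂ (proj₂ (proj₂ (proj₂ trace)))

    frobenius : Frobenius k T W
    frobenius = trans (proj₁ (proj₂ (proj₂ trace))) (cong +_ q≡) , proj₁ (proj₂ (proj₂ (proj₂ trace))) ,
      trans (CurveCount.count (F (suc k))) (cong (λ w → 1ℤ ℤ.+ w) (trans affine≡ (cong₂ (λ n s → + n ℤ.+ s) q≡ s₀≡)))

    -- If p divided T, the trace would vanish in the field, and with it, by `ι-trace`, the binomial
    -- coefficient.
    ordinary : ¬ (p ∣ (3 * j) C (2 * j)) → ¬ (P ∣ℤ T)
    ordinary p∤C P∣T = p∤C (ι≡0⇒∣ _ (begin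
      ι (+ ((3 * j) C (2 * j)))          ≡⟨ -‿involutive _ ⟨
      - (- ι (+ ((3 * j) C (2 * j))))    ≡⟨ cong -_ (sym ι-trace) ⟩
      - ι s₀                               ≡⟨ cong -_ (∣⇒ι≡0 (subst (P ∣ℤ_) (sym s₀≡) (Signed.∣m⇒∣-m (Signed.∣n⇒∣m*n (+ 2) P∣T)))) ⟩
      - 0#                                 ≡⟨ trans (sym (K+-identityˡ (- 0#))) (-‿inverseʳ 0#) ⟩
      0#                                   ∎))
      where
      open ≡-Reasoning
      open FieldTheory q field-on using (ι; 0#; -_; -‿involutive; -‿inverseʳ) renaming (+-identityˡ to K+-identityˡ)
      open Characteristic (suc k) q q≡ field-on using (ι≡0⇒∣; ∣⇒ι≡0)

  -- The split and the inert case enter only through the recursion for `α`; the remainder compares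
  -- 2σ - α at p^(k+2) and at p^k.
  combine : ∀ k T W → Good k → Good (2 + k) → Frobenius (suc k) T W →
    (∀ B → p ^ k ≤ B → p ^ (2 + k) ≤ B → α B (N (2 + k)) ≡ P ℤ.* α B (N k) ℤ.+ + 4 ℤ.* T) →
    3 * r13 (p ^ (2 + k)) ≡ #E (F (2 + k)) + 3 * p * r13 (p ^ k)
  combine k T W g g₂ (_ , _ , count) α-rec = ℤ.+-injective (ℤ.*-cancelˡ-≡ (+ 2) (+ (3 * r)) (+ (E + 3 * p * r′)) (begin
      + 2 ℤ.* + (3 * r)
        ≡⟨ cong (+ 2 ℤ.*_) (ℤ.pos-* 3 r) ⟩
      + 2 ℤ.* (+ 3 ℤ.* + r)
        ≡⟨ lem₀ (+ r) ⟩
      + 6 ℤ.* + r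
        ≡⟨ six (2 + k) g₂ B ≤-refl ⟩
      + 2 ℤ.* G (3 + k) ℤ.- α B (N (2 + k))
        ≡⟨ cong₂ (λ x y → + 2 ℤ.* x ℤ.- y) G≡ (α-rec B p^k≤B p^[2+k]≤B) ⟩
      + 2 ℤ.* (P ℤ.* G (1 + k) ℤ.+ (1ℤ ℤ.+ N (2 + k))) ℤ.- (P ℤ.* α B (N k) ℤ.+ + 4 ℤ.* T)
        ≡⟨ lem₁ P (G (1 + k)) (N (2 + k)) (α B (N k)) T ⟩
      + 2 ℤ.* (1ℤ ℤ.+ (N (2 + k) ℤ.- + 2 ℤ.* T)) ℤ.+ P ℤ.* (+ 2 ℤ.* G (1 + k) ℤ.- α B (N k))
        ≡⟨ cong₂ (λ x y → + 2 ℤ.* x ℤ.+ P ℤ.* y) count (six k g B bounded) ⟨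
      + 2 ℤ.* + E ℤ.+ P ℤ.* (+ 6 ℤ.* + r′)
        ≡⟨ lem₂ (+ E) P (+ r′) ⟩
      + 2 ℤ.* (+ E ℤ.+ + 3 ℤ.* P ℤ.* + r′)
        ≡⟨ cong (+ 2 ℤ.*_) (trans (ℤ.pos-+ E (3 * p * r′)) (cong (λ w → + E ℤ.+ w) (trans (ℤ.pos-* (3 * p) r′) (cong (ℤ._* + r′) (ℤ.pos-* 3 p))))) ⟨
      + 2 ℤ.* + (E + 3 * p * r′) ∎))
    where
    open ≡-Reasoning
    r r′ E B : ℕ
    r  = r13 (p ^ (2 + k))
    r′ = r13 (p ^ k)
    E  = #E (F (2 + k))
    B  = 4 * p ^ (2 + k) + 1
    p^k≤p^[2+k] : p ^ k ≤ p ^ (2 + k)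
    p^k≤p^[2+k] = ^-monoʳ-≤ p (m≤n+m k 2)
    p^[2+k]≤B : p ^ (2 + k) ≤ B
    p^[2+k]≤B = ≤-trans (m≤n*m (p ^ (2 + k)) 4) (m≤m+n (4 * p ^ (2 + k)) 1)
    p^k≤B : p ^ k ≤ B
    p^k≤B = ≤-trans p^k≤p^[2+k] p^[2+k]≤B
    bounded : 4 * p ^ k + 1 ≤ B
    bounded = +-monoˡ-≤ 1 (*-monoʳ-≤ 4 p^k≤p^[2+k])
    G≡ : G (3 + k) ≡ P ℤ.* G (1 + k) ℤ.+ (1ℤ ℤ.+ N (2 + k))
    G≡ = trans (lem (G (3 + k)) (P ℤ.* G (1 + k))) (cong (λ w → P ℤ.* G (1 + k) ℤ.+ w) (G-three-term k))
      where
      lem : ∀ a b → a ≡ b ℤ.+ (a ℤ.- b)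
      lem = solve-∀
    lem₀ : ∀ r → + 2 ℤ.* (+ 3 ℤ.* r) ≡ + 6 ℤ.* r
    lem₀ = solve-∀
    lem₁ : ∀ P g n a T → + 2 ℤ.* (P ℤ.* g ℤ.+ (1ℤ ℤ.+ n)) ℤ.- (P ℤ.* a ℤ.+ + 4 ℤ.* T) ≡ + 2 ℤ.* (1ℤ ℤ.+ (n ℤ.- + 2 ℤ.* T)) ℤ.+ P ℤ.* (+ 2 ℤ.* g ℤ.- a)
    lem₁ = solve-∀
    lem₂ : ∀ e P r → + 2 ℤ.* e ℤ.+ P ℤ.* (+ 6 ℤ.* r) ≡ + 2 ℤ.* (e ℤ.+ + 3 ℤ.* P ℤ.* r)
    lem₂ = solve-∀

  module Split (h : ℕ) (p≡ : 6 * h + 1 ≡ p) where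

    good : ∀ k → Good k
    good k = proj₁ (p∤C h p≡ k) , proj₁ (proj₂ (p∤C h p≡ k))

    module At (k : ℕ) = Points k (proj₁ (p∤C h p≡ (suc k))) (proj₁ (proj₂ (p∤C h p≡ (suc k))))

    P∤T : ∀ k → ¬ (P ∣ℤ At.T k)
    P∤T k = At.ordinary k (proj₂ (proj₂ (p∤C h p≡ (suc k))))

    P≡1 : + 3 ∣ℤ P ℤ.- 1ℤ
    P≡1 = subst (λ n → + 3 ∣ℤ + n ℤ.- 1ℤ) (*-identityʳ p) (N≡1mod3 1 (good 1))

    αprim≡ : ∀ B k → p ^ suc k ≤ B → αprim B (N (suc k)) ≡ + 4 ℤ.* At.T k
    αprim≡ B k le = αprim-value B k (At.T k) (At.W k) le (proj₁ (At.frobenius k)) (P∤T k) (proj₁ (proj₂ (At.frobenius k)))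

    three-term : ∀ k → 3 * r13 (p ^ (2 + k)) ≡ #E (F (2 + k)) + 3 * p * r13 (p ^ k)
    three-term k = combine k (At.T (suc k)) (At.W (suc k)) (good k) (good (2 + k)) (At.frobenius (suc k))
      (λ B le le₂ → trans (α-split B (N (2 + k))) (cong₂ ℤ._+_ (αdiv-scale P≡1 B k le le₂) (αprim≡ B (suc k) le₂)))

    -- Here `α` has no part divisible by p, and the divisor sum is already 1 + p.
    first : 3 * r13 (p ^ 1) ≡ #E (F 1)
    first = ℤ.+-injective (ℤ.*-cancelˡ-≡ (+ 2) (+ (3 * r)) (+ (#E (F 1))) (begin
      + 2 ℤ.* + (3 * r)                    ≡⟨ trans (cong (+ 2 ℤ.*_) (ℤ.pos-* 3 r)) (lem₀ (+ r)) ⟩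
      + 6 ℤ.* + r                          ≡⟨ six 1 (good 1) B ≤-refl ⟩
      + 2 ℤ.* G 2 ℤ.- α B (N 1)              ≡⟨ cong (λ w → + 2 ℤ.* G 2 ℤ.- w) (trans (α-split B (N 1)) (cong₂ ℤ._+_ (αdiv-prime B) (αprim≡ B 0 (≤-trans (m≤n*m (p ^ 1) 4) (m≤m+n (4 * p ^ 1) 1))))) ⟩
      + 2 ℤ.* G 2 ℤ.- (0ℤ ℤ.+ + 4 ℤ.* T)   ≡⟨ lem (N 1) T ⟩
      + 2 ℤ.* (1ℤ ℤ.+ (N 1 ℤ.- + 2 ℤ.* T)) ≡⟨ cong (+ 2 ℤ.*_) (proj₂ (proj₂ (At.frobenius 0))) ⟨
      + 2 ℤ.* + (#E (F 1))                 ∎))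
      where
      open ≡-Reasoning
      r B : ℕ
      r = r13 (p ^ 1)
      B = 4 * p ^ 1 + 1
      T : ℤ
      T = At.T 0
      lem₀ : ∀ r → + 2 ℤ.* (+ 3 ℤ.* r) ≡ + 6 ℤ.* r
      lem₀ = solve-∀
      lem : ∀ n T → + 2 ℤ.* (1ℤ ℤ.+ (n ℤ.+ 0ℤ)) ℤ.- (0ℤ ℤ.+ + 4 ℤ.* T) ≡ + 2 ℤ.* (1ℤ ℤ.+ (n ℤ.- + 2 ℤ.* T))
      lem = solve-∀

  module NonSplit (h : ℕ) (p≡ : 6 * h + 5 ≡ p) where

    good : ∀ m → Good (2 * m)
    good zero    = 0 , refl
    -- The witness is ((6h + 5)² (6j + 1) - 1) / 6, multiplied out.
    good (suc m) with j , eq ← good m = 6 * h * h * (6 * j + 1) + 10 * h * (6 * j + 1) + 25 * j + 4 ,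
      trans (lem h j) (trans (cong₂ (λ p n → p * (p * n)) p≡ eq) (cong (p ^_) (sym (*-suc 2 m))))
      where
      lem : ∀ h j → 6 * (6 * h * h * (6 * j + 1) + 10 * h * (6 * j + 1) + 25 * j + 4) + 1 ≡ (6 * h + 5) * ((6 * h + 5) * (6 * j + 1))
      lem = ℕSolver.solve-∀

    good₂ : ∀ m → Good (2 + 2 * m)
    good₂ m = subst Good (*-suc 2 m) (good (suc m))

    module At (m : ℕ) = Points (suc (2 * m)) (proj₁ (good₂ m)) (proj₂ (good₂ m))

    P≡2 : + 3 ∣ℤ P ℤ.+ 1ℤ
    P≡2 = subst (λ n → + 3 ∣ℤ + n ℤ.+ 1ℤ) p≡ (subst (+ 3 ∣ℤ_) (sym (trans (cong (ℤ._+ 1ℤ) (trans (ℤ.pos-+ (6 * h) 5) (cong (ℤ._+ + 5) (ℤ.pos-* 6 h)))) (lem (+ h))))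
      (Signed.∣m⇒∣m*n (+ 2 ℤ.* (+ h ℤ.+ 1ℤ)) (Signed.∣-refl {+ 3})))
      where
      lem : ∀ h → + 6 ℤ.* h ℤ.+ + 5 ℤ.+ 1ℤ ≡ + 3 ℤ.* (+ 2 ℤ.* (h ℤ.+ 1ℤ))
      lem = solve-∀

    anisotropic : ∀ X Y → P ∣ℤ X ℤ.* X ℤ.+ + 3 ℤ.* (Y ℤ.* Y) → P ∣ℤ Y
    anisotropic = transported (Transport.q (F 1)) (trans (cardF 0) (*-identityʳ p)) (Transport.field-on (F 1))
      where
      transported : ∀ q → q ≡ p → FieldOn (Fin q) → ∀ X Y → P ∣ℤ X ℤ.* X ℤ.+ + 3 ℤ.* (Y ℤ.* Y) → P ∣ℤ Y
      transported q refl K = NonResidue.anisotropic h p≡ K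

    open Inert P≡2 anisotropic

    N-square : ∀ m → N (2 * m) ≡ N m ℤ.* N m
    N-square m = trans (cong +_ (trans (cong (λ e → p ^ (m + e)) (+-identityʳ m)) (^-distribˡ-+-* p m m))) (ℤ.pos-* (p ^ m) (p ^ m))

    N-square₂ : ∀ m → N (2 + 2 * m) ≡ N (suc m) ℤ.* N (suc m)
    N-square₂ m = trans (cong (λ e → N e) (sym (*-suc 2 m))) (N-square (suc m))

    -- T is p^(m+1) up to sign, and T ≡ 1 (mod 3) fixes the sign. As χ(x) x does not see the sign of
    -- x, it may be evaluated at T.
    χN≡T : ∀ m → χ (N (suc m)) ℤ.* N (suc m) ≡ At.T m
    χN≡T m = go (square-≡ {At.T m} {N (suc m)} (proj₁ (only-trivial (suc m) (At.T m) (At.W m) (trans (proj₁ (At.frobenius m)) (N-square₂ m)))))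
      where
      open ≡-Reasoning
      T : ℤ
      T = At.T m
      χT : χ T ℤ.* T ≡ T
      χT = trans (cong (ℤ._* T) (χ-one (proj₁ (proj₂ (At.frobenius m))))) (ℤ.*-identityˡ T)
      go : T ≡ N (suc m) ⊎ T ≡ ℤ.- N (suc m) → χ (N (suc m)) ℤ.* N (suc m) ≡ T
      go (inj₁ e) = trans (cong (λ x → χ x ℤ.* x) (sym e)) χT
      go (inj₂ e) = trans (sym (χx*x-neg (N (suc m)))) (trans (cong (λ x → χ x ℤ.* x) (sym e)) χT)

    three-term : ∀ m → 3 * r13 (p ^ (2 + 2 * m)) ≡ #E (F (2 + 2 * m)) + 3 * p * r13 (p ^ (2 * m))
    three-term m = combine (2 * m) (At.T m) (At.W m) (good m) (good₂ m) (At.frobenius m) α-rec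
      where
      open ≡-Reasoning
      α-rec : ∀ B → p ^ (2 * m) ≤ B → p ^ (2 + 2 * m) ≤ B → α B (N (2 + 2 * m)) ≡ P ℤ.* α B (N (2 * m)) ℤ.+ + 4 ℤ.* At.T m
      α-rec B le le₂ = begin
        α B (N (2 + 2 * m))                     ≡⟨ cong (α B) (N-square₂ m) ⟩
        α B (N (suc m) ℤ.* N (suc m))           ≡⟨ α-value B (suc m) (subst (ℤ._≤ + B) (N-square₂ m) (+≤+ le₂)) ⟩
        -- The value is 2T, written as -2T + 4T to match the split recursion: -2T is p times the
        -- previous value because χ(p) = -1.
        + 2 ℤ.* (χ (N (suc m)) ℤ.* N (suc m)) ≡⟨ lem (χ (N (suc m)) ℤ.* N (suc m)) ⟩
        ℤ.- (+ 2 ℤ.* (χ (N (suc m)) ℤ.* N (suc m))) ℤ.+ + 4 ℤ.* (χ (N (suc m)) ℤ.* N (suc m))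
          ≡⟨ cong₂ ℤ._+_ scaled (cong (+ 4 ℤ.*_) (χN≡T m)) ⟩
        P ℤ.* α B (N (2 * m)) ℤ.+ + 4 ℤ.* At.T m ∎
        where
        lem : ∀ x → + 2 ℤ.* x ≡ ℤ.- (+ 2 ℤ.* x) ℤ.+ + 4 ℤ.* x
        lem = solve-∀
        scaled : ℤ.- (+ 2 ℤ.* (χ (N (suc m)) ℤ.* N (suc m))) ≡ P ℤ.* α B (N (2 * m))
        scaled = begin
          ℤ.- (+ 2 ℤ.* (χ (N (suc m)) ℤ.* N (suc m)))    ≡⟨ cong₂ (λ c n → ℤ.- (+ 2 ℤ.* (c ℤ.* n))) (trans (cong χ (N-suc m)) (χ-P*-inert (N m))) (N-suc m) ⟩
          ℤ.- (+ 2 ℤ.* (ℤ.- χ (N m) ℤ.* (P ℤ.* N m)))    ≡⟨ lem′ (χ (N m)) P (N m) ⟩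
          P ℤ.* (+ 2 ℤ.* (χ (N m) ℤ.* N m))              ≡⟨ cong (P ℤ.*_) (α-value B m (subst (ℤ._≤ + B) (N-square m) (+≤+ le))) ⟨
          P ℤ.* α B (N m ℤ.* N m)                          ≡⟨ cong (λ n → P ℤ.* α B n) (N-square m) ⟨
          P ℤ.* α B (N (2 * m))                            ∎
          where
          lem′ : ∀ c P n → ℤ.- (+ 2 ℤ.* (ℤ.- c ℤ.* (P ℤ.* n))) ≡ P ℤ.* (+ 2 ℤ.* (c ℤ.* n))
          lem′ = solve-∀

  even-three-term : ∀ m → 3 * r13 (p ^ (2 + 2 * m)) ≡ #E (F (2 + 2 * m)) + 3 * p * r13 (p ^ (2 * m))
  even-three-term m = [ (λ e → Split.three-term (p / 6) (divide e) (2 * m)) , (λ e → NonSplit.three-term (p / 6) (divide e) m) ]′ (residue-mod-6 p pr 3<p)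

  second : 3 * r13 (p ^ 2) ≡ #E (F 2)
  -- At exponent 0, `r13 1` evaluates to 0, since 1 is not a sum of four nonzero squares; the
  -- three-term relation shrinks to two terms.
  second = trans (even-three-term 0) (trans (cong (λ w → #E (F 2) + w) (*-zeroʳ (3 * p))) (+-identityʳ (#E (F 2))))

  -- The offset c treats both parities at once: 1 for odd exponents, 2 for even ones. Each step
  -- multiplies the earlier sum by p and puts one new term in front.
  telescope : ∀ c → 3 * r13 (p ^ c) ≡ #E (F c) →
    (∀ k → 3 * r13 (p ^ (2 + (2 * k + c))) ≡ #E (F (2 + (2 * k + c))) + 3 * p * r13 (p ^ (2 * k + c))) →
    ∀ k → 3 * r13 (p ^ (2 * k + c)) ≡ sumTo k (λ j → p ^ j * #E (F (2 * k + c ∸ 2 * j)))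
  telescope c base step zero    = trans base (sym (trans (+-identityʳ (1 * #E (F c))) (*-identityˡ (#E (F c)))))
  telescope c base step (suc k) = begin
    3 * r13 (p ^ (2 * suc k + c))
      ≡⟨ cong (λ e → 3 * r13 (p ^ (e + c))) (*-suc 2 k) ⟩
    3 * r13 (p ^ (2 + (2 * k + c)))
      ≡⟨ step k ⟩
    #E (F (2 + (2 * k + c))) + 3 * p * r13 (p ^ (2 * k + c))
      ≡⟨ cong₂ _+_ (trans (sym (*-identityˡ _)) (cong (λ e → 1 * #E (F (e + c))) (sym (*-suc 2 k))))
           (trans (lem p (r13 (p ^ (2 * k + c)))) (trans (cong (p *_) (telescope c base step k)) (sym (sumTo-* k p _)))) ⟩
    1 * #E (F (2 * suc k + c)) + sumTo k (λ j → p * (p ^ j * #E (F (2 * k + c ∸ 2 * j))))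
      ≡⟨ cong (λ w → 1 * #E (F (2 * suc k + c)) + w) (sumTo-cong k (λ j → trans (sym (*-assoc p (p ^ j) _)) (cong (λ e → p * p ^ j * #E (F e)) (shift j)))) ⟩
    1 * #E (F (2 * suc k + c)) + sumTo k (λ j → p ^ suc j * #E (F (2 * suc k + c ∸ 2 * suc j)))
      ≡⟨ sumTo-suc k (λ j → p ^ j * #E (F (2 * suc k + c ∸ 2 * j))) ⟨
    sumTo (suc k) (λ j → p ^ j * #E (F (2 * suc k + c ∸ 2 * j))) ∎
    where
    open ≡-Reasoning
    lem : ∀ p r → 3 * p * r ≡ p * (3 * r)
    lem = ℕSolver.solve-∀
    shift : ∀ j → 2 * k + c ∸ 2 * j ≡ 2 * suc k + c ∸ 2 * suc j
    shift j = sym (cong₂ (λ a b → a + c ∸ b) (*-suc 2 k) (*-suc 2 j))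

theorem7 : (p : ℕ) → Prime p → 3 < p →
    (F : ℕ → FiniteField) → (∀ k → card (F (suc k)) ≡ p ^ suc k) →
    (p % 6 ≡ 1 → 3 * r13 p ≡ #E (F 1))
    × (p % 6 ≡ 1 → ∀ k → 1 ≤ k →
    (3 ≤ k → 3 * r13 (p ^ k) ≡ #E (F k) + 3 * p * r13 (p ^ (k ∸ 2)))
    × (k ≤ 2 → 3 * r13 (p ^ k) ≡ #E (F k)))
    × (∀ m →
    (3 ≤ 2 * suc m → 3 * r13 (p ^ (2 * suc m)) ≡ #E (F (2 * suc m)) + 3 * p * r13 (p ^ (2 * suc m ∸ 2)))
    × (2 * suc m ≤ 2 → 3 * r13 (p ^ (2 * suc m)) ≡ #E (F (2 * suc m))))
    × (p % 6 ≡ 1 → ∀ k →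
    3 * r13 (p ^ (2 * k + 1)) ≡ sumTo k (λ j → p ^ j * #E (F (2 * k + 1 ∸ 2 * j))))
    × (∀ k →
    3 * r13 (p ^ (2 * k + 2)) ≡ sumTo k (λ j → p ^ j * #E (F (2 * k + 2 ∸ 2 * j))))
theorem7 p pr 3<p F cardF =
    (λ e → subst (λ n → 3 * r13 n ≡ #E (F 1)) (*-identityʳ p) (Split.first (p / 6) (divide e)))
  , (λ e k 1≤k → odd-or-even e k 1≤k)
  , (λ m → (λ _ → even m) , λ le → even-base m le)
  , (λ e → telescope 1 (Split.first (p / 6) (divide e)) (λ k → Split.three-term (p / 6) (divide e) (2 * k + 1)))
  -- The even sequence starts at exponent 2, so step k of the telescope is the even relation with
  -- index k + 1.
  , telescope 2 second (λ k → subst (λ n → 3 * r13 (p ^ (2 + n)) ≡ #E (F (2 + n)) + 3 * p * r13 (p ^ n)) (trans (*-suc 2 k) (+-comm 2 (2 * k))) (even-three-term (suc k)))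
  where
  open Assembly p pr 3<p F cardF

  odd-or-even : p % 6 ≡ 1 → ∀ k → 1 ≤ k →
    (3 ≤ k → 3 * r13 (p ^ k) ≡ #E (F k) + 3 * p * r13 (p ^ (k ∸ 2))) × (k ≤ 2 → 3 * r13 (p ^ k) ≡ #E (F k))
  odd-or-even e 1 _ = (λ { (s≤s ()) }) , (λ _ → Split.first (p / 6) (divide e))
  odd-or-even e 2 _ = (λ { (s≤s (s≤s ())) }) , (λ _ → second)
  odd-or-even e (suc (suc (suc k))) _ = (λ _ → Split.three-term (p / 6) (divide e) (suc k)) , (λ { (s≤s (s≤s ())) })

  even : ∀ m → 3 * r13 (p ^ (2 * suc m)) ≡ #E (F (2 * suc m)) + 3 * p * r13 (p ^ (2 * suc m ∸ 2))
  even m = subst (λ n → 3 * r13 (p ^ n) ≡ #E (F n) + 3 * p * r13 (p ^ (n ∸ 2))) (sym (*-suc 2 m)) (even-three-term m)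

  even-base : ∀ m → 2 * suc m ≤ 2 → 3 * r13 (p ^ (2 * suc m)) ≡ #E (F (2 * suc m))
  even-base zero    _  = second
  even-base (suc m) le = contradiction le (<⇒≱ (subst (2 <_) (sym (*-suc 2 (suc m))) (s≤s (s≤s (s≤s z≤n)))))
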